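{- Let $\lambda\subseteq\nu$ and $\mu$ be partitions. Write the skew reverse plane partition generating function $g_{\nu/\lambda}$ in the basis $\{g_\eta\}$ as $g_{\nu/\lambda}=\sum_{\eta} a^{\nu}_{\lambda\eta}\, g_\eta$. Then $a^{\nu}_{\lambda\mu}$ equals $(-1)^{|\nu|-|\lambda|-|\mu|}$ times the number of column $\lambda$-Yamanouchi set-valued tableaux of shape $\mu$ and weight $\nu-\lambda$.
   Context: Diagrams are drawn in French notation (row 1 at the bottom). A reverse plane partition of skew shape $\nu/\lambda$ is a filling of the cells of $\nu/\lambda$ with positive integers weakly increasing along rows (left to right) and up columns; its weight $\mathrm{wt}(R)$ is the vector whose $i$-th entry is the number of columns of $R$ containing the letter $i$. Set $g_{\nu/\lambda}=\sum_{R} x^{\mathrm{wt}(R)}$ summed over all reverse plane partitions of shape $\nu/\lambda$, and $g_\mu=g_{\mu/\emptyset}$; the $g_\mu$ (over all partitions $\mu$) form a basis in which $g_{\nu/\lambda}$ has a unique finite expansion. A set-valued tableau of shape $\mu$ is a filling of each cell of $\mu$ with a nonempty finite set of positive integers such that every choice of one element from each cell yields a semistandard tableau (rows weakly increasing left to right, columns strictly increasing bottom to top). Its weight counts the total number of occurrences of each $i$. Its column word is obtained by reading columns from left to right, each column from top to bottom, and the letters within a cell from smallest to largest. A word $w$ is $\lambda$-Yamanouchi if for every factorization $w=uv$ and every $i\ge1$, $\mathrm{wt}_i(v)+\lambda_i\ge \mathrm{wt}_{i+1}(v)+\lambda_{i+1}$, where $\mathrm{wt}_i(v)$ is the number of occurrences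 of $i$ in $v$. A set-valued tableau is column $\lambda$-Yamanouchi if its column word is $\lambda$-Yamanouchi. The weight $\nu-\lambda$ is the componentwise difference. -}

module Defs where

open import Data.Nat using (ℕ; zero; suc; _+_; _∸_; _≤_; _<_; _⊔_; _≤ᵇ_; _<ᵇ_; _≡ᵇ_)
open import Data.Bool using (Bool; true; false; _∧_; _∨_; not)
open import Data.List using (List; []; _∷_; [_]; _++_; map; concatMap; length; foldr; upTo; reverse; filterᵇ; tails)
open import Data.Nat.ListAction using (sum)
open import Data.Bool.ListAction using (all; any)
open import Data.List.Relation.Unary.Linked using (Linked)
open import Data.List.Relation.Unary.All using (All)
open import Data.Product using (_×_; _,_; proj₁; proj₂)
open import Data.Integer as ℤ using (ℤ; +_; -[1+_]; ∣_∣)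
open import Data.List.Properties using (≡-dec)
open import Relation.Nullary.Decidable using (⌊_⌋)
open import Relation.Binary.PropositionalEquality using (_≡_)

IsPartition : List ℕ → Set
IsPartition p = Linked (λ a b → b ≤ a) p × All (λ a → 0 < a) p

-- i-th part (1-indexed), 0 beyond the length (and for i = 0)
part : List ℕ → ℕ → ℕ
part []       _             = 0
part (x ∷ xs) zero          = 0
part (x ∷ xs) (suc zero)    = x
part (x ∷ xs) (suc (suc i)) = part xs (suc i)

_⊆ᵖ_ : List ℕ → List ℕ → Set
la ⊆ᵖ nu = ∀ i → part la i ≤ part nu i

size : List ℕ → ℕ
size = sum

range1 : ℕ → List ℕ
range1 n = map suc (upTo n)

countᵇ : {A : Set} → (A → Bool) → List A → ℕ
countᵇ p xs = length (filterᵇ p xs)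

eqListᵇ : List ℕ → List ℕ → Bool
eqListᵇ xs ys = ⌊ ≡-dec Data.Nat._≟_ xs ys ⌋
  where import Data.Nat

-- Cells (row , column), French notation: row 1 at the bottom.

Cell : Set
Cell = ℕ × ℕ

skewCells : List ℕ → List ℕ → List Cell
skewCells nu la =
  concatMap (λ r → map (λ k → (r , part la r + k)) (range1 (part nu r ∸ part la r)))
            (range1 (length nu))

assignments : {A : Set} → List Cell → List A → List (List (Cell × A))
assignments []       vs = [ [] ]
assignments (c ∷ cs) vs = concatMap (λ v → map ((c , v) ∷_) (assignments cs vs)) vs

isRPP : List (Cell × ℕ) → Bool
isRPP F = all (λ p → all (λ q → ok p q) F) F
  where
  ok : Cell × ℕ → Cell × ℕ → Bool
  ok ((r , c) , a) ((r' , c') , b) =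
    (not ((r ≡ᵇ r') ∧ (c ≤ᵇ c')) ∨ (a ≤ᵇ b)) ∧
    (not ((c ≡ᵇ c') ∧ (r ≤ᵇ r')) ∨ (a ≤ᵇ b))

rppWt : ℕ → List (Cell × ℕ) → List ℕ
rppWt n F = map (λ i → countᵇ (λ c → any (λ e → (proj₂ (proj₁ e) ≡ᵇ c) ∧ (proj₂ e ≡ᵇ i)) F) cols)
                (range1 n)
  where
  cols : List ℕ
  cols = range1 (foldr (λ e m → proj₂ (proj₁ e) ⊔ m) 0 F)

-- coefficient of the monomial x^α = x₁^α₁ ⋯ x_n^α_n (n = length α) in
-- g_{ν/λ}: number of reverse plane partitions R of shape ν/λ with
-- wt(R) = α (such R only use letters 1..n).
gCoeff : List ℕ → List ℕ → List ℕ → ℕ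
gCoeff nu la α =
  countᵇ (λ F → isRPP F ∧ eqListᵇ (rppWt (length α) F) α)
         (assignments (skewCells nu la) (range1 (length α)))

-- Expansions Σ_η c_η g_η (finite, given as a list of (η , c_η); repeated
-- keys are added together)

sumℤ : List ℤ → ℤ
sumℤ = foldr ℤ._+_ (+ 0)

IsExpansion : List ℕ → List ℕ → List (List ℕ × ℤ) → Set
IsExpansion nu la E =
  ∀ (α : List ℕ) → + gCoeff nu la α ≡ sumℤ (map (λ e → proj₂ e ℤ.* + gCoeff (proj₁ e) [] α) E)

coeffOf : List (List ℕ × ℤ) → List ℕ → ℤ
coeffOf E mu = sumℤ (map proj₂ (filterᵇ (λ e → eqListᵇ (proj₁ e) mu) E))

sublists : List ℕ → List (List ℕ)
sublists []       = [ [] ]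
sublists (x ∷ xs) = map (x ∷_) (sublists xs) ++ sublists xs

nonEmpty : List ℕ → Bool
nonEmpty []      = false
nonEmpty (_ ∷ _) = true

-- nonempty subsets of {1..n}, each listed in increasing order
nonemptySubsets : ℕ → List (List ℕ)
nonemptySubsets n = filterᵇ nonEmpty (sublists (range1 n))

choices : List (Cell × List ℕ) → List (List (Cell × ℕ))
choices []             = [ [] ]
choices ((c , S) ∷ ss) = concatMap (λ x → map ((c , x) ∷_) (choices ss)) S

isSSYT : List (Cell × ℕ) → Bool
isSSYT T = all (λ p → all (λ q → ok p q) T) T
  where
  ok : Cell × ℕ → Cell × ℕ → Bool
  ok ((r , c) , a) ((r' , c') , b) =
    (not ((r ≡ᵇ r') ∧ (c ≤ᵇ c')) ∨ (a ≤ᵇ b)) ∧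
    (not ((c ≡ᵇ c') ∧ (r <ᵇ r')) ∨ (a <ᵇ b))

isSetValued : List (Cell × List ℕ) → Bool
isSetValued S = all isSSYT (choices S)

svtWt : ℕ → List (Cell × List ℕ) → List ℕ
svtWt n S = map (λ i → sum (map (λ e → countᵇ (λ x → x ≡ᵇ i) (proj₂ e)) S)) (range1 n)

entry : List (Cell × List ℕ) → Cell → List ℕ
entry []                  _         = []
entry (((r , c) , s) ∷ S) (r' , c') with (r ≡ᵇ r') ∧ (c ≡ᵇ c')
... | true  = s
... | false = entry S (r' , c')

-- column word of a set-valued tableau of shape μ: columns left to right,
-- each column top to bottom, letters in a cell from smallest to largest
colWord : List ℕ → List (Cell × List ℕ) → List ℕ
colWord mu S =
  concatMap (λ c → concatMap (λ r → entry S (r , c)) (reverse (range1 (length mu))))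
            (range1 (part mu 1))

occ : ℕ → List ℕ → ℕ
occ i v = countᵇ (λ x → x ≡ᵇ i) v

-- λ-Yamanouchi: for every suffix v of w and every i ≥ 1,
-- wt_i(v) + λ_i ≥ wt_{i+1}(v) + λ_{i+1}.  For i > max(w) + length λ both
-- sides are 0, so checking i ≤ max(w) + length λ checks all i ≥ 1.
isYamanouchi : List ℕ → List ℕ → Bool
isYamanouchi la w =
  all (λ v → all (λ i → (occ (suc i) v + part la (suc i)) ≤ᵇ (occ i v + part la i))
                 (range1 (foldr _⊔_ 0 w + length la)))
      (tails w)

-- number of column λ-Yamanouchi set-valued tableaux of shape μ and
-- weight ν - λ.  (Letters are at most n = length ν, since the weight
-- ν - λ vanishes beyond n.)
countSVT : List ℕ → List ℕ → List ℕ → ℕ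
countSVT la nu mu =
  countᵇ (λ S → isSetValued S
                ∧ eqListᵇ (svtWt n S) (map (λ i → part nu i ∸ part la i) (range1 n))
                ∧ isYamanouchi la (colWord mu S))
         (assignments (skewCells mu []) (nonemptySubsets n))
  where
  n : ℕ
  n = length nu

signPow : ℤ → ℤ
signPow e = -[1+ 0 ] ℤ.^ ∣ e ∣

-- Think of a functional L on ℤ[x₁,…,x_N] as given by its values on monomials x^β; let it be
-- K-antisymmetric, i.e. kill xᵢ₊₁(1-xᵢ)f whenever f is symmetric in xᵢ, xᵢ₊₁.  This is the
-- straightening law of the bialternants det(xᵢ^(βⱼ+N-j) (1-xᵢ)^(j-1)) that define G_β, and a
-- determinant gives such functionals L_ν dual to partitions.  For K-antisymmetric L:
--   * L(h_k x^λ) is the sum of L(x^ρ) over ρ ⊇ λ with k columns in ρ/λ.  Applied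
--     repeatedly to L_ν it counts chains of partitions, that is, reverse plane
--     partitions: L_ν(h_α x^λ) is the coefficient of x^α in g_{ν/λ}.
--   * Let G_μ be the signed generating polynomial of set-valued tableaux.  Multiplication
--     by G_μ preserves K-antisymmetry, and in L(G_μ x^λ) the tableaux that are not column
--     λ-Yamanouchi cancel in pairs which differ by a letter i in the cell of an i+1.
--     In particular L(G_λ) = L(x^λ).
-- If g_{ν/λ} = Σ c_η g_η, then Σ c_η L_η - L_ν(G_λ ·) kills every h_α, hence, by a
-- lexicographic triangularity, all x^μ; so c_μ = L_ν(G_λ x^μ) = L_ν(G_λ G_μ) = L_ν(G_μ x^λ),
-- which is the signed number of column λ-Yamanouchi tableaux of shape μ and weight ν-λ.

module Submission where

open import Defs
open import Data.Nat using (ℕ; zero; suc; _+_; _∸_; _≤_; _<_; _⊔_; _≤ᵇ_; _<ᵇ_; _≡ᵇ_; z≤n; s≤s)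
open import Data.Nat.Properties
open import Algebra.Properties.CommutativeSemigroup +-commutativeSemigroup using (interchange; x∙yz≈y∙xz)
open import Data.Nat.ListAction using (sum)
open import Data.Nat.ListAction.Properties using (sum-++)
open import Data.Bool using (Bool; true; false; _∧_; _∨_; not; T; if_then_else_)
open import Data.Bool.ListAction using (all; any)
open import Data.Unit using (⊤; tt)
open import Data.Empty using (⊥; ⊥-elim)
open import Data.List using (List; []; _∷_; _++_; length; replicate; map; concat; concatMap; zipWith; foldr; filterᵇ; upTo; applyUpTo; reverse; tails)
import Data.List.Properties as Lₚ
open import Data.List.Membership.Propositional using (_∈_)
import Data.List.Membership.Propositional.Properties as ∈ₚ
open import Data.List.Membership.Propositional.Properties.WithK using (unique∧set⇒bag)
open import Data.List.Relation.Binary.BagAndSetEquality using (∼bag⇒↭)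
open import Data.List.Relation.Binary.Disjoint.Propositional using (Disjoint)
open import Data.List.Relation.Binary.Permutation.Propositional.Properties using (↭-length)
open import Data.List.Relation.Unary.All using (All; []; _∷_)
import Data.List.Relation.Unary.All as All
import Data.List.Relation.Unary.All.Properties as Allₚ
open import Data.List.Relation.Unary.AllPairs using (AllPairs; []; _∷_)
import Data.List.Relation.Unary.AllPairs.Properties as APₚ
open import Data.List.Relation.Unary.Any using (here; there)
open import Data.List.Relation.Unary.Linked using (Linked; []; [-]; _∷_)
open import Data.List.Relation.Unary.Unique.Propositional using (Unique)
import Data.List.Relation.Unary.Unique.Propositional.Properties as Uₚ
open import Data.Maybe using (Maybe; just; nothing)
open import Data.Product using (_×_; _,_; proj₁; proj₂; ∃)
open import Data.Sum using (_⊎_; inj₁; inj₂)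
open import Data.Integer using (ℤ; +_; _-_; _*_; -_; -[1+_]; 0ℤ; 1ℤ) renaming (_+_ to _+ᶻ_)
import Data.Integer as ℤ
import Data.Integer.Properties as ℤₚ
open import Data.Integer.Tactic.RingSolver using (solve-∀)
open import Relation.Nullary using (¬_; yes; no)
open import Relation.Nullary.Decidable using (toWitness; fromWitness)
open import Relation.Binary.PropositionalEquality
open import Function using (_∘_; id)
open import Function.Bundles using (mk⇔)
open import Relation.Binary.Definitions using (tri<; tri≈; tri>)

-- The antisymmetry of `G` cannot be carried from column to column on its own. If the bounds of a
-- column contain i without i+1 right after it, the letters i and i+1 are treated differently, and
-- the resulting functional need not be K-antisymmetric in x_i, x_{i+1}. Two statements therefore
-- travel together along the columns: antisymmetry for bounds in which each i is followed by i+1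
-- (`Good`), and skewness of the difference of two functionals whose bounds differ only by i+1 in
-- place of i. Both are needed at the next column. Columns are placed from right to left because the
-- columns already placed then form a suffix of the column word: the weight carried along is the one
-- that the Yamanouchi condition tests. The same two statements, at equal exponents, make the two
-- terms of a cancelling pair equal. The Pieri rule uses no involution. The series of the h_k is
-- inverted by the product of the factors 1 - t x_i, and the sum over partitions undoes that product
-- by telescoping.

Fun : Set
Fun = List ℕ → ℤ

-- Linear relations and K-antisymmetry

when : Bool → ℤ → ℤ
when true  z = z
when false _ = 0ℤ

double-zero : ∀ z → z +ᶻ z ≡ 0ℤ → z ≡ 0ℤ
double-zero (+ zero) _ = refl
double-zero (+ suc n) ()
double-zero -[1+ n ] ()

-- For f in y(1-x)·ℤ[x,y]^sym, the sum of the f_ab M(a,b) vanishes.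
record Anti (M : ℕ → ℕ → ℤ) : Set where
  constructor mkAnti
  field
    anti : ∀ x y → (M x (suc y) - M (suc x) (suc y)) +ᶻ (M y (suc x) - M (suc y) (suc x)) ≡ 0ℤ

record Skew (M : ℕ → ℕ → ℤ) : Set where
  constructor mkSkew
  field
    skew : ∀ x y → M x y +ᶻ M y x ≡ 0ℤ

open Anti
open Skew

-- A linear relation between the values of a family of functionals indexed by `I`. The operators
-- below are assembled from values by zeros, sums and differences, so one lifting lemma per operator
-- transports antisymmetry, skewness, equality and differences alike.
record Linear {I : Set} (R : (I → ℤ) → Set) : Set where
  field
    R0 : R (λ _ → 0ℤ)
    R+ : ∀ {f g} → R f → R g → R (λ i → f i +ᶻ g i)
    R- : ∀ {f g} → R f → R g → R (λ i → f i - g i)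

  Rwhen : ∀ b {f} → R f → R (λ i → when b (f i))
  Rwhen true  r = r
  Rwhen false _ = R0

Anti′ Skew′ : (ℕ × ℕ → ℤ) → Set
Anti′ f = Anti (λ x y → f (x , y))
Skew′ f = Skew (λ x y → f (x , y))

private
  zz+ : ∀ a b c d a' b' c' d' → ((a +ᶻ a') - (b +ᶻ b')) +ᶻ ((c +ᶻ c') - (d +ᶻ d'))
      ≡ ((a - b) +ᶻ (c - d)) +ᶻ ((a' - b') +ᶻ (c' - d'))
  zz+ = solve-∀
  zz- : ∀ a b c d a' b' c' d' → ((a - a') - (b - b')) +ᶻ ((c - c') - (d - d'))
      ≡ ((a - b) +ᶻ (c - d)) - ((a' - b') +ᶻ (c' - d'))
  zz- = solve-∀
  ss+ : ∀ a b a' b' → (a +ᶻ a') +ᶻ (b +ᶻ b') ≡ (a +ᶻ b) +ᶻ (a' +ᶻ b')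
  ss+ = solve-∀
  ss- : ∀ a b a' b' → (a - a') +ᶻ (b - b') ≡ (a +ᶻ b) - (a' +ᶻ b')
  ss- = solve-∀

linearAnti : Linear Anti′
linearAnti = record
  { R0 = mkAnti λ x y → refl
  ; R+ = λ {f} {g} r s → mkAnti λ x y → trans
      (zz+ (f (x , suc y)) (f (suc x , suc y)) (f (y , suc x)) (f (suc y , suc x))
           (g (x , suc y)) (g (suc x , suc y)) (g (y , suc x)) (g (suc y , suc x)))
      (cong₂ _+ᶻ_ (anti r x y) (anti s x y))
  ; R- = λ {f} {g} r s → mkAnti λ x y → trans
      (zz- (f (x , suc y)) (f (suc x , suc y)) (f (y , suc x)) (f (suc y , suc x))
           (g (x , suc y)) (g (suc x , suc y)) (g (y , suc x)) (g (suc y , suc x)))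
      (cong₂ _-_ (anti r x y) (anti s x y)) }

linearSkew : Linear Skew′
linearSkew = record
  { R0 = mkSkew λ x y → refl
  ; R+ = λ {f} {g} r s → mkSkew λ x y → trans
      (ss+ (f (x , y)) (f (y , x)) (g (x , y)) (g (y , x))) (cong₂ _+ᶻ_ (skew r x y) (skew s x y))
  ; R- = λ {f} {g} r s → mkSkew λ x y → trans
      (ss- (f (x , y)) (f (y , x)) (g (x , y)) (g (y , x))) (cong₂ _-_ (skew r x y) (skew s x y)) }

module LA = Linear linearAnti
module LS = Linear linearSkew

anti-ext : ∀ {M N : ℕ → ℕ → ℤ} → (∀ x y → M x y ≡ N x y) → Anti N → Anti M
anti-ext e a = mkAnti λ x y → trans (cong₂ _+ᶻ_ (cong₂ _-_ (e _ _) (e _ _)) (cong₂ _-_ (e _ _) (e _ _))) (anti a x y)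

skew-ext : ∀ {M N : ℕ → ℕ → ℤ} → (∀ x y → M x y ≡ N x y) → Skew N → Skew M
skew-ext e a = mkSkew λ x y → trans (cong₂ _+ᶻ_ (e _ _) (e _ _)) (skew a x y)

-- Multiplication by xy; `anti-sum` is multiplication by x + y. Symmetric factors preserve
-- K-antisymmetry, and these two generate them.
anti-shift : ∀ {M} → Anti M → Anti (λ x y → M (suc x) (suc y))
anti-shift a = mkAnti λ x y → anti a (suc x) (suc y)

anti-sum : ∀ {M} → Anti M → Anti (λ x y → M x (suc y) +ᶻ M (suc x) y)
anti-sum {M} a = mkAnti λ x y → trans
  (lem (M x (suc (suc y))) (M (suc x) (suc y)) (M (suc x) (suc (suc y))) (M (suc (suc x)) (suc y))
       (M y (suc (suc x))) (M (suc y) (suc x)) (M (suc y) (suc (suc x))) (M (suc (suc y)) (suc x)))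
  (cong₂ _+ᶻ_ (anti a x (suc y)) (anti a (suc x) y))
  where
  lem : ∀ a b c d e f g h →
    ((a +ᶻ b) - (c +ᶻ d)) +ᶻ ((e +ᶻ f) - (g +ᶻ h)) ≡
    ((a - c) +ᶻ (f - h)) +ᶻ ((b - d) +ᶻ (e - g))
  lem = solve-∀

-- As operators: x(1-y) maps skew functionals to K-antisymmetric ones.
skew⇒anti : ∀ {Z} → Skew Z → Anti (λ x y → Z (suc x) y - Z (suc x) (suc y))
skew⇒anti {Z} s = mkAnti λ x y → trans
  (lem (Z (suc x) (suc y)) (Z (suc x) (suc (suc y))) (Z (suc (suc x)) (suc y)) (Z (suc (suc x)) (suc (suc y)))
       (Z (suc y) (suc x)) (Z (suc y) (suc (suc x))) (Z (suc (suc y)) (suc x)) (Z (suc (suc y)) (suc (suc x))))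
  (trans (cong₂ _+ᶻ_ (cong₂ _-_ (skew s (suc x) (suc y)) (skew s (suc x) (suc (suc y))))
                     (cong₂ _-_ (skew s (suc (suc x)) (suc (suc y))) (skew s (suc (suc x)) (suc y)))) refl)
  where
  lem : ∀ a b c d e f g h →
    ((a - b) - (c - d)) +ᶻ ((e - f) - (g - h)) ≡
    ((a +ᶻ e) - (b +ᶻ g)) +ᶻ ((d +ᶻ h) - (c +ᶻ f))
  lem = solve-∀

anti⇒skew : ∀ {M} → Anti M → Skew (λ x y → M x (suc y) - M (suc x) (suc y))
anti⇒skew a = mkSkew (anti a)

-- For equal exponents the two brackets coincide, and ℤ has no 2-torsion. This case drives both the
-- cancellation of columns and the Pieri rule.
anti-diag : ∀ {M} → Anti M → ∀ x → M x (suc x) ≡ M (suc x) (suc x)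
anti-diag {M} a x = ℤₚ.i-j≡0⇒i≡j _ _ (double-zero _ (anti a x x))

-- Positions count from 0: the pair tested consists of the letters p+1 and p+2.
AntiAt : ℕ → Fun → Set
AntiAt p L = ∀ pre rest → length pre ≡ p → Anti (λ x y → L (pre ++ x ∷ y ∷ rest))

AntiBelow : ℕ → Fun → Set
AntiBelow n L = ∀ p → suc p < n → AntiAt p L

antiAt-tail : ∀ {p L} a → AntiAt (suc p) L → AntiAt p (L ∘ (a ∷_))
antiAt-tail a h pre rest e = h (a ∷ pre) rest (cong suc e)

-- Column transfer

-- A column of a set-valued tableau is scanned through its letters ℓ = 1, 2, …: each
-- letter is absent, joins the current cell, or starts the next cell.  `prev b p`
-- records the part b of the starting weight at the previous letter and whether
-- that letter is present; `free` drops the Yamanouchi condition.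

data Prev : Set where
  free : Prev
  prev : ℕ → Bool → Prev

nxt : Bool → ℕ → Bool → Prev
nxt false _ _ = free
nxt true  b p = prev b p

-- For a decreasing weight, the Yamanouchi condition can fail at a letter only if its weight equals
-- that of the letter before it. Joining then violates it, since a cell is read from its smallest
-- letter and the suffix misses the smaller one; starting a cell is allowed if the smaller letter is
-- present, since it then lies in a cell below.
okJ okS : Prev → ℕ → Bool
okJ free       _ = true
okJ (prev a p) b = not (a ≡ᵇ b)
okS free       _ = true
okS (prev a p) b = not (a ≡ᵇ b) ∨ p

starting : List ℕ → (ℕ → List ℕ → ℤ) → ℤ
starting []       f = 0ℤ
starting (t ∷ bs) f = f t bs

stop : List ℕ → ℤ → ℤ
stop []      z = z
stop (_ ∷ _) _ = 0ℤ

-- C y K ℓ pv c bs β: signed sum over the ways to continue a column from letter ℓ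
-- on, where c bounds the current cell, bs bounds the cells still to be started, β is
-- the part of the weight from ℓ on, and K receives the minima of the cells started
-- and the new weight.
C : Bool → (List ℕ → Fun) → ℕ → Prev → ℕ → List ℕ → Fun
C y K ℓ pv c bs []      = stop bs (K [] [])
C y K ℓ pv c bs (b ∷ β) =
  (C y (λ ms → K ms ∘ (b ∷_)) (suc ℓ) (nxt y b false) c bs β
   - when (okJ pv b ∧ (ℓ ≤ᵇ c)) (C y (λ ms → K ms ∘ (suc b ∷_)) (suc ℓ) (nxt y b true) c bs β))
  +ᶻ starting bs (λ t bs' →
       when (okS pv b ∧ (ℓ ≤ᵇ t)) (C y (λ ms → K (ℓ ∷ ms) ∘ (suc b ∷_)) (suc ℓ) (nxt y b true) t bs' β))

-- Columns of heights hs are placed from right to left; b are the minima of the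
-- column to the right, and cells without right neighbour get the vacuous bound N.
Φ : Bool → ℕ → List ℕ → Fun → List ℕ → Fun
Φ y N []       L b β = L β
Φ y N (h ∷ hs) L b β = C y (Φ y N hs L) 1 free 0 (b ++ replicate (h ∸ length b) N) β

-- `C` is additive in its continuation. Only minima that are at least `ℓ` can occur, so a relation
-- need be known only for the minima started after the letters under study.
C-lift : ∀ {I : Set} {R : (I → ℤ) → Set} → Linear R → ∀ y (K : I → List ℕ → Fun) ℓ pv c bs β →
  (∀ ms → All (ℓ ≤_) ms → ∀ β' → R (λ i → K i ms β')) → R (λ i → C y (K i) ℓ pv c bs β)
C-lift lin y K ℓ pv c []       []      h = h [] [] []
C-lift lin y K ℓ pv c (_ ∷ _)  []      h = Linear.R0 lin
C-lift {I} {R} lin y K ℓ pv c bs (b ∷ β) h =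
  Linear.R+ lin
    (Linear.R- lin (C-lift lin y _ (suc ℓ) _ c bs β (λ ms a β' → h ms (weak a) _))
      (Linear.Rwhen lin (okJ pv b ∧ (ℓ ≤ᵇ c)) (C-lift lin y _ (suc ℓ) _ c bs β (λ ms a β' → h ms (weak a) _))))
    (st bs)
  where
  weak : ∀ {ms} → All (suc ℓ ≤_) ms → All (ℓ ≤_) ms
  weak = All.map (≤-trans (n≤1+n ℓ))
  st : ∀ bs → R (λ i → starting bs (λ t bs' →
       when (okS pv b ∧ (ℓ ≤ᵇ t)) (C y (λ ms → K i (ℓ ∷ ms) ∘ (suc b ∷_)) (suc ℓ) (nxt y b true) t bs' β)))
  st []       = Linear.R0 lin
  st (t ∷ bs) = Linear.Rwhen lin (okS pv b ∧ (ℓ ≤ᵇ t))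
    (C-lift lin y _ (suc ℓ) _ t bs β (λ ms a β' → h (ℓ ∷ ms) (≤-refl ∷ weak a) _))

-- Index set that turns "is the difference of" into a relation between three values, so that
-- additivity of an operator becomes another instance of lifting.
data Three : Set where one two three : Three

Rel3 : (Three → ℤ) → Set
Rel3 f = f one ≡ f two - f three

linear3 : Linear Rel3
linear3 = record
  { R0 = refl
  ; R+ = λ {f} {g} r s → trans (cong₂ _+ᶻ_ r s) (l₁ (f two) (f three) (g two) (g three))
  ; R- = λ {f} {g} r s → trans (cong₂ _-_ r s) (l₂ (f two) (f three) (g two) (g three)) }
  where
  l₁ : ∀ a b c d → (a - b) +ᶻ (c - d) ≡ (a +ᶻ c) - (b +ᶻ d)
  l₁ = solve-∀
  l₂ : ∀ a b c d → (a - b) - (c - d) ≡ (a - c) - (b - d)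
  l₂ = solve-∀

C-sub : ∀ y (K K' : List ℕ → Fun) ℓ pv c bs β →
  C y (λ ms β → K ms β - K' ms β) ℓ pv c bs β ≡ C y K ℓ pv c bs β - C y K' ℓ pv c bs β
C-sub y K K' ℓ pv c bs β = C-lift linear3 y fam ℓ pv c bs β (λ _ _ _ → refl)
  where
  fam : Three → List ℕ → Fun
  fam one   ms β = K ms β - K' ms β
  fam two   = K
  fam three = K'

Rel2 : (Bool → ℤ) → Set
Rel2 f = f true ≡ f false

linear2 : Linear Rel2
linear2 = record { R0 = refl ; R+ = λ r s → cong₂ _+ᶻ_ r s ; R- = λ r s → cong₂ _-_ r s }

-- Two consecutive letters in one column

≤ᵇ-true : ∀ {m n} → m ≤ n → (m ≤ᵇ n) ≡ true
≤ᵇ-true {m} {n} p with m ≤ᵇ n in eq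
... | true  = refl
... | false = ⊥-elim (subst T eq (≤⇒≤ᵇ p))

≤ᵇ-false : ∀ {m n} → n < m → (m ≤ᵇ n) ≡ false
≤ᵇ-false {m} {n} p with m ≤ᵇ n in eq
... | false = refl
... | true  = ⊥-elim (<⇒≱ p (≤ᵇ⇒≤ m n (subst T (sym eq) tt)))

≡ᵇ-≢ : ∀ {a b} → a ≢ b → (a ≡ᵇ b) ≡ false
≡ᵇ-≢ {a} {b} ne with a ≡ᵇ b in eq
... | false = refl
... | true  = ⊥-elim (ne (≡ᵇ⇒≡ a b (subst T (sym eq) tt)))

≡ᵇ-≡ : ∀ b → (b ≡ᵇ b) ≡ true
≡ᵇ-≡ zero    = refl
≡ᵇ-≡ (suc b) = ≡ᵇ-≡ b

-- Only a bound equal to i can separate the letters i and i+1.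
≤ᵇ-suc : ∀ {i c} → c ≢ i → (i ≤ᵇ c) ≡ (suc i ≤ᵇ c)
≤ᵇ-suc {i} {c} ne with <-cmp i c
... | tri< lt _ _ = trans (≤ᵇ-true (<⇒≤ lt)) (sym (≤ᵇ-true lt))
... | tri≈ _ e _ = ⊥-elim (ne (sym e))
... | tri> _ _ gt = trans (≤ᵇ-false gt) (sym (≤ᵇ-false (<-trans gt (n<1+n i))))

-- The contribution of two consecutive letters i, i+1 to a column: e, e' (resp.
-- f, f') say whether i, i+1 may join the current cell (resp. start the next one);
-- W, S, F, G are the sums over the later letters when the cells started by i, i+1
-- are none, that of i+1, that of i, and both.  The signs come from joining letters.
mid : (e e' f f' : Bool) (W S F G : ℕ → ℕ → ℤ) → ℕ → ℕ → ℤ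
mid e e' f f' W S F G x y =
  (((W x y - when e' (W x (suc y))) +ᶻ when f' (S x (suc y)))
   - when e ((W (suc x) y - when e' (W (suc x) (suc y))) +ᶻ when f' (S (suc x) (suc y))))
  +ᶻ when f ((F (suc x) y - when f' (F (suc x) (suc y))) +ᶻ G x y)

anti+ : ∀ {M N : ℕ → ℕ → ℤ} → Anti M → Anti N → Anti (λ x y → M x y +ᶻ N x y)
anti+ {M} {N} = LA.R+ {λ p → M (proj₁ p) (proj₂ p)} {λ p → N (proj₁ p) (proj₂ p)}

anti- : ∀ {M N : ℕ → ℕ → ℤ} → Anti M → Anti N → Anti (λ x y → M x y - N x y)
anti- {M} {N} = LA.R- {λ p → M (proj₁ p) (proj₂ p)} {λ p → N (proj₁ p) (proj₂ p)}

skew+ : ∀ {M N : ℕ → ℕ → ℤ} → Skew M → Skew N → Skew (λ x y → M x y +ᶻ N x y)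
skew+ {M} {N} = LS.R+ {λ p → M (proj₁ p) (proj₂ p)} {λ p → N (proj₁ p) (proj₂ p)}

skew- : ∀ {M N : ℕ → ℕ → ℤ} → Skew M → Skew N → Skew (λ x y → M x y - N x y)
skew- {M} {N} = LS.R- {λ p → M (proj₁ p) (proj₂ p)} {λ p → N (proj₁ p) (proj₂ p)}

anti-when : ∀ b {M} → Anti M → Anti (λ x y → when b (M x y))
anti-when true  a = a
anti-when false a = mkAnti λ x y → refl

skew-when : ∀ b {M} → Skew M → Skew (λ x y → when b (M x y))
skew-when true  a = a
skew-when false a = mkSkew λ x y → refl

-- The factor is (1-x)(1-y) if both letters may join and 1 if neither may; both are symmetric.
joins : ∀ e {W} → Anti W → Anti (λ x y →
  (W x y - when e (W x (suc y))) - when e (W (suc x) y - when e (W (suc x) (suc y))))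
joins false {W} a = anti-ext (λ x y → lem (W x y)) a
  where
  lem : ∀ a → (a - 0ℤ) - 0ℤ ≡ a
  lem = solve-∀
joins true {W} a = anti-ext (λ x y → lem (W x y) (W x (suc y)) (W (suc x) y) (W (suc x) (suc y)))
  (anti+ (anti- a (anti-sum a)) (anti-shift a))
  where
  lem : ∀ a b c d → (a - b) - (c - d) ≡ (a - (b +ᶻ c)) +ᶻ d
  lem = solve-∀

-- With `S` in place of `F` the factor is x + y - xy, reduced by a further xy if `e` holds, hence
-- symmetric. The error is x(1-y) applied to `S` - `F`, which `skew⇒anti` covers.
starts : ∀ e {S F : ℕ → ℕ → ℤ} → Anti S → Skew (λ x y → S x y - F x y) → Anti (λ x y →
  (S x (suc y) - when e (S (suc x) (suc y))) +ᶻ (F (suc x) y - F (suc x) (suc y)))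
starts e {S} {F} a z = anti-ext
  (λ x y → lem (S x (suc y)) (S (suc x) y) (when e (S (suc x) (suc y))) (S (suc x) (suc y))
               (F (suc x) y) (F (suc x) (suc y)))
  (anti- (anti- (anti- (anti-sum a) (anti-shift a)) (anti-when e (anti-shift a)))
         (skew⇒anti z))
  where
  lem : ∀ s t w u f h → (s - w) +ᶻ (f - h) ≡ (((s +ᶻ t) - u) - w) - ((t - f) - (u - h))
  lem = solve-∀

-- No bound separates the two letters, so the sum splits into antisymmetric pieces by the number of
-- cells that they start: none (`joins`), one (`starts`), or two (`G`).
mid-anti : ∀ e f {W S F G : ℕ → ℕ → ℤ} → Anti W → Anti S → Anti G → Skew (λ x y → S x y - F x y) →
  Anti (mid e e f f W S F G)
mid-anti e false {W} aW aS aG z = anti-ext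
  (λ x y → trans (lem (W x y - when e (W x (suc y))) _)
     (cong (λ u → (W x y - when e (W x (suc y))) - u) (wh e (W (suc x) y - when e (W (suc x) (suc y))))))
  (joins e aW)
  where
  lem : ∀ a b → ((a +ᶻ 0ℤ) - b) +ᶻ 0ℤ ≡ a - b
  lem = solve-∀
  wh : ∀ e b → when e (b +ᶻ 0ℤ) ≡ when e b
  wh true  b = ℤₚ.+-identityʳ b
  wh false b = refl
mid-anti e true {W} {S} {F} {G} aW aS aG z = anti-ext
  (λ x y → lem e (W x y - when e (W x (suc y))) (W (suc x) y - when e (W (suc x) (suc y)))
               (S x (suc y)) (S (suc x) (suc y)) (F (suc x) y) (F (suc x) (suc y))
               (G x y))
  (anti+ (anti+ (joins e aW) (starts e {S} {F} aS z)) aG)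
  where
  lem : ∀ e w v s u f h k →
    ((w +ᶻ s) - when e (v +ᶻ u)) +ᶻ ((f - h) +ᶻ k) ≡
    ((w - when e v) +ᶻ ((s - when e u) +ᶻ (f - h))) +ᶻ k
  lem true = l where
    l : ∀ w v s u f h k → ((w +ᶻ s) - (v +ᶻ u)) +ᶻ ((f - h) +ᶻ k) ≡
      ((w - v) +ᶻ ((s - u) +ᶻ (f - h))) +ᶻ k
    l = solve-∀
  lem false = l where
    l : ∀ w v s u f h k → ((w +ᶻ s) - 0ℤ) +ᶻ ((f - h) +ᶻ k) ≡
      ((w - 0ℤ) +ᶻ ((s - 0ℤ) +ᶻ (f - h))) +ᶻ k
    l = solve-∀

-- The bound of the current cell is i and that of the next one is i+1.
mid-anti-cap : ∀ {W S F G : ℕ → ℕ → ℤ} → (∀ x y → W x y ≡ 0ℤ) → Anti S → Anti G → Skew (λ x y → S x y - F x y) →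
  Anti (mid true false true true W S F G)
mid-anti-cap {W} {S} {F} {G} w0 aS aG z = anti-ext
  (λ x y → trans (cong₂ (λ u v → (((u - 0ℤ) +ᶻ S x (suc y)) - ((v - 0ℤ) +ᶻ S (suc x) (suc y)))
                     +ᶻ ((F (suc x) y - F (suc x) (suc y)) +ᶻ G x y))
                   (w0 x y) (w0 (suc x) y))
                 (lem (S x (suc y)) (S (suc x) (suc y)) (F (suc x) y) (F (suc x) (suc y))
                      (G x y)))
  (anti+ (starts true {S} {F} aS z) aG)
  where
  lem : ∀ s u f h k → (((0ℤ - 0ℤ) +ᶻ s) - ((0ℤ - 0ℤ) +ᶻ u)) +ᶻ ((f - h) +ᶻ k) ≡
    ((s - u) +ᶻ (f - h)) +ᶻ k
  lem = solve-∀

-- The bounds of the next two cells are i and i+1.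
mid-anti-two : ∀ e e' {W S F G : ℕ → ℕ → ℤ} → (∀ x y → W x y ≡ 0ℤ) → (∀ x y → F x y ≡ 0ℤ) → Anti G →
  Anti (mid e e' true false W S F G)
mid-anti-two e e' {W} {S} {F} {G} w0 f0 aG = anti-ext
  (λ x y → lem e e' (w0 x y) (w0 x (suc y)) (w0 (suc x) y) (w0 (suc x) (suc y)) (f0 (suc x) y) _)
  aG
  where
  lem : ∀ e e' {a b c d f} → a ≡ 0ℤ → b ≡ 0ℤ → c ≡ 0ℤ → d ≡ 0ℤ → f ≡ 0ℤ → ∀ k →
    (((a - when e' b) +ᶻ 0ℤ) - when e ((c - when e' d) +ᶻ 0ℤ)) +ᶻ ((f - 0ℤ) +ᶻ k) ≡ k
  lem true  true  refl refl refl refl refl k = trans (ℤₚ.+-identityˡ _) (ℤₚ.+-identityˡ _)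
  lem true  false refl refl refl refl refl k = trans (ℤₚ.+-identityˡ _) (ℤₚ.+-identityˡ _)
  lem false true  refl refl refl refl refl k = trans (ℤₚ.+-identityˡ _) (ℤₚ.+-identityˡ _)
  lem false false refl refl refl refl refl k = trans (ℤₚ.+-identityˡ _) (ℤₚ.+-identityˡ _)

-- Letters only increase, so a cell whose bound has been passed can never be started.
C-zero : ∀ y (K : List ℕ → Fun) ℓ pv c t bs β → t < ℓ → C y K ℓ pv c (t ∷ bs) β ≡ 0ℤ
C-zero y K ℓ pv c t bs []      lt = refl
C-zero y K ℓ pv c t bs (b ∷ β) lt = trans
  (cong₂ _+ᶻ_
    (cong₂ _-_ (C-zero y _ (suc ℓ) _ c t bs β lt')
       (trans (cong (when (okJ pv b ∧ (ℓ ≤ᵇ c))) (C-zero y _ (suc ℓ) _ c t bs β lt')) (when0 (okJ pv b ∧ (ℓ ≤ᵇ c)))))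
    (cong (λ q → when q (C y (λ ms → K (ℓ ∷ ms) ∘ (suc b ∷_)) (suc ℓ) (nxt y b true) t bs β))
      (trans (cong (okS pv b ∧_) (≤ᵇ-false lt)) (∧f (okS pv b)))))
  refl
  where
  lt' = <-trans lt (n<1+n ℓ)
  when0 : ∀ b → when b 0ℤ ≡ 0ℤ
  when0 true  = refl
  when0 false = refl
  ∧f : ∀ b → (b ∧ false) ≡ false
  ∧f true  = refl
  ∧f false = refl

-- Bounds that have been passed exclude all remaining letters alike.
C-cap : ∀ y (K : List ℕ → Fun) ℓ pv c c' bs β → c < ℓ → c' < ℓ → C y K ℓ pv c bs β ≡ C y K ℓ pv c' bs β
C-cap y K ℓ pv c c' bs []      lt lt' = refl
C-cap y K ℓ pv c c' bs (b ∷ β) lt lt' =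
  cong (_+ᶻ starting bs (λ t bs' →
       when (okS pv b ∧ (ℓ ≤ᵇ t)) (C y (λ ms → K (ℓ ∷ ms) ∘ (suc b ∷_)) (suc ℓ) (nxt y b true) t bs' β)))
   (trans (cong (λ z → z - when (okJ pv b ∧ (ℓ ≤ᵇ c)) (C y (λ ms → K ms ∘ (suc b ∷_)) (suc ℓ) (nxt y b true) c bs β))
             (C-cap y _ (suc ℓ) _ c c' bs β (up lt) (up lt')))
          (cong (λ z → C y (λ ms → K ms ∘ (b ∷_)) (suc ℓ) (nxt y b false) c' bs β - z)
             (trans (cong (λ q → when (okJ pv b ∧ q) (C y (λ ms → K ms ∘ (suc b ∷_)) (suc ℓ) (nxt y b true) c bs β)) (≤ᵇ-false lt))
             (trans (f0 (okJ pv b))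
             (sym (trans (cong (λ q → when (okJ pv b ∧ q) (C y (λ ms → K ms ∘ (suc b ∷_)) (suc ℓ) (nxt y b true) c' bs β)) (≤ᵇ-false lt'))
                  (f0 (okJ pv b))))))))
  where
  up : ∀ {c} → c < ℓ → c < suc ℓ
  up q = <-trans q (n<1+n ℓ)
  f0 : ∀ b {z} → when (b ∧ false) z ≡ 0ℤ
  f0 true  = refl
  f0 false = refl

-- A bound i matters for the symmetry in i, i+1 unless the next bound is i+1.

HeadIs : ℕ → List ℕ → Set
HeadIs a []      = ⊥
HeadIs a (b ∷ _) = b ≡ a

Good : ℕ → List ℕ → Set
Good i []       = ⊤
Good i (t ∷ ts) = (t ≡ i → HeadIs (suc i) ts) × Good i ts

good-avoid : ∀ {i ts} → All (_≢ i) ts → Good i ts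
good-avoid []       = tt
good-avoid (n ∷ ns) = (λ e → ⊥-elim (n e)) , good-avoid ns

good-++ˡ : ∀ {i u v} → All (_≢ i) u → Good i v → Good i (u ++ v)
good-++ˡ []       g = g
good-++ˡ (n ∷ ns) g = (λ e → ⊥-elim (n e)) , good-++ˡ ns g

headIs-++ : ∀ {a} u {v} → HeadIs a u → HeadIs a (u ++ v)
headIs-++ (x ∷ u) h = h

good-++ʳ : ∀ {i} u {v} → Good i u → All (_≢ i) v → Good i (u ++ v)
good-++ʳ []       g       a = good-avoid a
good-++ʳ (x ∷ u) (h , g) a = (λ e → headIs-++ u (h e)) , good-++ʳ u g a

-- What is required of the columns further left, sorted by which of i, i+1 are minima of cells
-- started here. There is no antisymmetry for i alone, because it becomes a bound i with no i+1
-- after it; only its difference from the case of i+1 is controlled.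
record Hyps (i : ℕ) (K : List ℕ → ℕ → ℕ → Fun) : Set where
  field
    hW  : ∀ post → All (suc (suc i) ≤_) post → ∀ rest → Anti (λ x y → K post x y rest)
    hS  : ∀ post → All (suc (suc i) ≤_) post → ∀ rest → Anti (λ x y → K (suc i ∷ post) x y rest)
    hSS : ∀ post → All (suc (suc i) ≤_) post → ∀ rest → Anti (λ x y → K (i ∷ suc i ∷ post) x y rest)
    hD  : ∀ post → All (suc (suc i) ≤_) post → ∀ rest →
          Skew (λ x y → K (suc i ∷ post) x y rest - K (i ∷ post) x y rest)

module Mid (y? : Bool) (i : ℕ) (K : List ℕ → Fun) (hyps : Hyps i (λ ms x y rest → K ms (x ∷ y ∷ rest)))
           (rest : List ℕ) where
  open Hyps hyps

  cont : List ℕ → Prev → ℕ → List ℕ → ℕ → ℕ → ℤ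
  cont pre pv c bs x y = C y? (λ ms β → K (pre ++ ms) (x ∷ y ∷ β)) (suc (suc i)) pv c bs rest

  W S F SS : Prev → ℕ → List ℕ → ℕ → ℕ → ℤ
  W = cont []
  S = cont (suc i ∷ [])
  F = cont (i ∷ [])
  SS = cont (i ∷ suc i ∷ [])

  aW : ∀ pv c bs → Anti (W pv c bs)
  aW pv c bs = C-lift linearAnti y? (λ p ms β → K ms (proj₁ p ∷ proj₂ p ∷ β)) (suc (suc i)) pv c bs rest
    (λ post a β → hW post a β)

  aS : ∀ pv c bs → Anti (S pv c bs)
  aS pv c bs = C-lift linearAnti y? (λ p ms β → K (suc i ∷ ms) (proj₁ p ∷ proj₂ p ∷ β)) (suc (suc i)) pv c bs rest
    (λ post a β → hS post a β)

  aSS : ∀ pv c bs → Anti (SS pv c bs)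
  aSS pv c bs = C-lift linearAnti y? (λ p ms β → K (i ∷ suc i ∷ ms) (proj₁ p ∷ proj₂ p ∷ β))
    (suc (suc i)) pv c bs rest (λ post a β → hSS post a β)

  zSF : ∀ pv c bs → Skew (λ x y → S pv c bs x y - F pv c bs x y)
  zSF pv c bs = skew-ext
    (λ x y → sym (C-sub y? (λ ms β → K (suc i ∷ ms) (x ∷ y ∷ β)) (λ ms β → K (i ∷ ms) (x ∷ y ∷ β))
                           (suc (suc i)) pv c bs rest))
    (C-lift linearSkew y?
      (λ p ms β → K (suc i ∷ ms) (proj₁ p ∷ proj₂ p ∷ β) - K (i ∷ ms) (proj₁ p ∷ proj₂ p ∷ β))
      (suc (suc i)) pv c bs rest (λ post a β → hD post a β))

module MidFalse (i : ℕ) (K : List ℕ → Fun) (hyps : Hyps i (λ ms x y rest → K ms (x ∷ y ∷ rest)))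
                (rest : List ℕ) where
  open Mid false i K hyps rest

  both : List ℕ → ℕ → ℕ → ℤ
  both bs x y = starting bs (λ t bs' → when (suc i ≤ᵇ t) (SS free t bs' (suc x) (suc y)))

  both-anti : ∀ bs → Anti (both bs)
  both-anti []       = mkAnti λ x y → refl
  both-anti (t ∷ bs) = anti-when (suc i ≤ᵇ t) (anti-shift (aSS free t bs))

  go : ℕ → List ℕ → ℕ → ℕ → ℤ
  go c bs x y = C false K i free c bs (x ∷ y ∷ rest)

  M : (e e' : Bool) (c t : ℕ) (bs : List ℕ) (f f' : Bool) → ℕ → ℕ → ℤ
  M e e' c t bs f f' = mid e e' f f' (W free c (t ∷ bs)) (S free t bs) (F free t bs) (both bs)

  go-anti : ∀ c bs → Good i (c ∷ bs) → Anti (go c bs)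
  go-anti c [] (h , _) = subst (λ e → Anti (mid e (suc i ≤ᵇ c) false false (W free c []) (S free c [])
                                       (F free c []) (both [])))
    (sym (≤ᵇ-suc h))
    (mid-anti (suc i ≤ᵇ c) false (aW free c []) (aS free c []) (both-anti []) (zSF free c []))
  go-anti c (t ∷ bs) (h , h' , g) with c ≟ i
  -- The current bound is i, so goodness makes the next one i+1. Letter i+1 cannot join the current
  -- cell, and the terms in which neither letter starts a cell vanish, the next bound having been
  -- passed.
  ... | yes refl rewrite h refl = subst₂ (λ e e' → Anti (M e e' i (suc i) bs (i ≤ᵇ suc i) e'' ))
          (sym (≤ᵇ-true (≤-refl {i}))) (sym (≤ᵇ-false (n<1+n i)))
          (subst₂ (λ f f' → Anti (M true false i (suc i) bs f f'))
            (sym (≤ᵇ-true (n≤1+n i))) (sym (≤ᵇ-true (≤-refl {suc i})))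
            (mid-anti-cap (λ x y → C-zero false _ (suc (suc i)) free i (suc i) bs rest (n<1+n _))
              (aS free _ bs) (both-anti bs) (zSF free _ bs)))
    where e'' = suc i ≤ᵇ suc i
  ... | no c≢i with t ≟ i
  ...   | no t≢i = subst₂ (λ e f → Anti (M e (suc i ≤ᵇ c) c t bs f (suc i ≤ᵇ t)))
            (sym (≤ᵇ-suc c≢i)) (sym (≤ᵇ-suc t≢i))
            (mid-anti (suc i ≤ᵇ c) (suc i ≤ᵇ t) (aW free c (t ∷ bs)) (aS free t bs) (both-anti bs) (zSF free t bs))
  -- The next bounds are i and i+1. Only these very letters can still start the two cells in time,
  -- so `both` alone survives.
  ...   | yes refl = subst₂ (λ f f' → Anti (M (i ≤ᵇ c) (suc i ≤ᵇ c) c i bs f f'))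
            (sym (≤ᵇ-true (≤-refl {i}))) (sym (≤ᵇ-false (n<1+n i)))
            (mid-anti-two (i ≤ᵇ c) (suc i ≤ᵇ c) {S = S free i bs}
              (λ x y → C-zero false _ (suc (suc i)) free c i bs rest (<-trans (n<1+n i) (n<1+n _)))
              (fz (h' refl)) (both-anti bs))
    where
    fz : ∀ {bs} → HeadIs (suc i) bs → ∀ x y → F free i bs x y ≡ 0ℤ
    fz {_ ∷ bs} refl x y = C-zero false _ (suc (suc i)) free i (suc i) bs rest (n<1+n _)

  -- Replacing the bound i+1 of the current cell, or of the next one, by i.
  skew-cur : ∀ bs → Skew (λ x y → go (suc i) bs x y - go i bs x y)
  skew-cur bs = skew-ext (λ x y → eq x y)
    (skew-neg (anti⇒skew (aW free i bs)))
    where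
    skew-neg : ∀ {M} → Skew M → Skew (λ x y → 0ℤ - M x y)
    skew-neg s = skew- {M = λ _ _ → 0ℤ} (mkSkew λ x y → refl) s
    cap : ∀ x y → W free (suc i) bs x y ≡ W free i bs x y
    cap x y = C-cap false _ (suc (suc i)) free (suc i) i bs rest (n<1+n _) (<-trans (n<1+n i) (n<1+n _))
    St : ℕ → ℕ → ℤ
    St x y = starting bs (λ t bs' → when (suc i ≤ᵇ t) (S free t bs' x y))
    Ft : ℕ → ℕ → ℤ
    Ft x y = starting bs (λ t bs' → when (i ≤ᵇ t) ((F free t bs' (suc x) y - when (suc i ≤ᵇ t) (F free t bs' (suc x) (suc y))) +ᶻ both bs' x y))
    ex : Bool → Bool → ℕ → ℕ → ℕ → ℤ
    ex e e' c x y = (((W free c bs x y - when e' (W free c bs x (suc y))) +ᶻ St x (suc y))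
       - when e ((W free c bs (suc x) y - when e' (W free c bs (suc x) (suc y))) +ᶻ St (suc x) (suc y)))
      +ᶻ Ft x y
    -- The two sums differ only in whether i+1 may join the current cell, which leaves -y(1-x)
    -- applied to `W`.
    eq : ∀ x y → go (suc i) bs x y - go i bs x y ≡ 0ℤ - (W free i bs x (suc y) - W free i bs (suc x) (suc y))
    eq x y = trans (cong₂ _-_
        (cong₂ (λ e e' → ex e e' (suc i) x y) (≤ᵇ-true (n≤1+n i)) (≤ᵇ-true (≤-refl {suc i})))
        (cong₂ (λ e e' → ex e e' i x y) (≤ᵇ-true (≤-refl {i})) (≤ᵇ-false (n<1+n i))))
      (trans (l (cap x y) (cap x (suc y)) (cap (suc x) y) (cap (suc x) (suc y)) (St x (suc y)) (St (suc x) (suc y)) (Ft x y)) refl)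
      where
      l₀ : ∀ a b c d s t f →
        ((((a - b) +ᶻ s) - ((c - d) +ᶻ t)) +ᶻ f) - ((((a - 0ℤ) +ᶻ s) - ((c - 0ℤ) +ᶻ t)) +ᶻ f) ≡ 0ℤ - (b - d)
      l₀ = solve-∀
      l : ∀ {a b c d a' b' c' d'} → a' ≡ a → b' ≡ b → c' ≡ c → d' ≡ d → ∀ s t f →
        ((((a' - b') +ᶻ s) - ((c' - d') +ᶻ t)) +ᶻ f) - ((((a - 0ℤ) +ᶻ s) - ((c - 0ℤ) +ᶻ t)) +ᶻ f) ≡ 0ℤ - (b - d)
      l {a} {b} {c} {d} refl refl refl refl s t f = l₀ a b c d s t f

  skew-next : ∀ c v → c < i → Skew (λ x y → go c (suc i ∷ v) x y - go c (i ∷ v) x y)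
  skew-next c v c<i = skew-ext eq
    (skew+ (anti⇒skew (aS free (suc i) v))
      (mkSkew λ x y → skew (zSF free (suc i) v) (suc x) (suc y)))
    where
    lt₂ : i < suc (suc i)
    lt₂ = <-trans (n<1+n i) (n<1+n _)
    -- The larger bound additionally lets i+1 start the next cell, or join it after i has started
    -- it. The difference is yS - xyF, rewritten as y(1-x)S + xy(S - F).
    eq : ∀ x y → go c (suc i ∷ v) x y - go c (i ∷ v) x y ≡
      (S free (suc i) v x (suc y) - S free (suc i) v (suc x) (suc y)) +ᶻ
      (S free (suc i) v (suc x) (suc y) - F free (suc i) v (suc x) (suc y))
    eq x y = trans (cong₂ _-_ e₁ e₂)
      (l (C-cap false (λ ms β → K (i ∷ ms) (suc x ∷ y ∷ β)) (suc (suc i)) free (suc i) i v rest (n<1+n _) lt₂)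
         (S free (suc i) v x (suc y)) (S free (suc i) v (suc x) (suc y)) (F free (suc i) v (suc x) (suc y)) (both v x y))
      where
      z₁ : ∀ x y → W free c (suc i ∷ v) x y ≡ 0ℤ
      z₁ x y = C-zero false _ (suc (suc i)) free c (suc i) v rest (n<1+n _)
      z₂ : ∀ x y → W free c (i ∷ v) x y ≡ 0ℤ
      z₂ x y = C-zero false _ (suc (suc i)) free c i v rest lt₂
      e₁ : go c (suc i ∷ v) x y ≡ ((((0ℤ - 0ℤ) +ᶻ S free (suc i) v x (suc y)) - 0ℤ)
             +ᶻ ((F free (suc i) v (suc x) y - F free (suc i) v (suc x) (suc y)) +ᶻ both v x y))
      e₁ rewrite ≤ᵇ-false c<i | ≤ᵇ-false (<-trans c<i (n<1+n i))
               | ≤ᵇ-true (n≤1+n i) | ≤ᵇ-true (≤-refl {suc i}) | z₁ x y = refl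
      e₂ : go c (i ∷ v) x y ≡ ((((0ℤ - 0ℤ) +ᶻ 0ℤ) - 0ℤ)
             +ᶻ ((F free i v (suc x) y - 0ℤ) +ᶻ both v x y))
      e₂ rewrite ≤ᵇ-false c<i | ≤ᵇ-false (<-trans c<i (n<1+n i))
               | ≤ᵇ-true (≤-refl {i}) | ≤ᵇ-false (n<1+n i) | z₂ x y = refl
      l₀ : ∀ g s u f t →
        ((((0ℤ - 0ℤ) +ᶻ s) - 0ℤ) +ᶻ ((g - f) +ᶻ t)) - ((((0ℤ - 0ℤ) +ᶻ 0ℤ) - 0ℤ) +ᶻ ((g - 0ℤ) +ᶻ t))
        ≡ (s - u) +ᶻ (u - f)
      l₀ = solve-∀
      l : ∀ {g g'} → g' ≡ g → ∀ s u f t →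
        ((((0ℤ - 0ℤ) +ᶻ s) - 0ℤ) +ᶻ ((g' - f) +ᶻ t)) - ((((0ℤ - 0ℤ) +ᶻ 0ℤ) - 0ℤ) +ᶻ ((g - 0ℤ) +ᶻ t))
        ≡ (s - u) +ᶻ (u - f)
      l {g} refl s u f t = l₀ g s u f t

  go-stuck : ∀ c t bs x y → t < i → go c (t ∷ bs) x y ≡ 0ℤ
  go-stuck c t bs x y lt = C-zero false K i free c t bs (x ∷ y ∷ rest) lt

-- Antisymmetry along a column and from column to column

HypsP : ℕ → ℕ → (List ℕ → Fun) → Set
HypsP p i K = ∀ ms₀ → All (_< i) ms₀ → ∀ pre → length pre ≡ p →
  Hyps i (λ ms x y rest → K (ms₀ ++ ms) (pre ++ x ∷ y ∷ rest))

hypsP-tail : ∀ {p i} K b → HypsP (suc p) i K → HypsP p i (λ ms → K ms ∘ (b ∷_))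
hypsP-tail K b H ms₀ a pre e = H ms₀ a (b ∷ pre) (cong suc e)

hypsP-start : ∀ {p i} K ℓ b → ℓ < i → HypsP (suc p) i K → HypsP p i (λ ms → K (ℓ ∷ ms) ∘ (b ∷_))
hypsP-start K ℓ b lt H ms₀ a pre e = H (ℓ ∷ ms₀) (lt ∷ a) (b ∷ pre) (cong suc e)

private
  pos< : ∀ {ℓ p i} → ℓ + suc p ≡ i → ℓ < i
  pos< {ℓ} {p} refl = ≤-trans (s≤s (m≤m+n ℓ p)) (≤-reflexive (sym (+-suc ℓ p)))

  next-pos : ∀ {ℓ p i} → ℓ + suc p ≡ i → suc ℓ + p ≡ i
  next-pos {ℓ} {p} e = trans (sym (+-suc ℓ p)) e

  start-pos : ∀ {ℓ i} → ℓ + 0 ≡ i → ℓ ≡ i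
  start-pos {ℓ} e = trans (sym (+-identityʳ ℓ)) e

  split : ∀ a j s a' j' s' → ((a - j) +ᶻ s) - ((a' - j') +ᶻ s') ≡ ((a - a') - (j - j')) +ᶻ (s - s')
  split = solve-∀

  skew-self : ∀ {z : ℕ → ℕ → ℤ} → Skew (λ x y → z x y - z x y)
  skew-self {z} = skew-ext (λ x y → ℤₚ.+-inverseʳ (z x y)) (mkSkew λ x y → refl)

  when- : ∀ b z z' → when b z - when b z' ≡ when b (z - z')
  when- true  z z' = refl
  when- false z z' = refl

-- The letters before i leave the exponents of i and i+1 alone, and goodness survives when the next
-- bound becomes that of the current cell.
prefix-anti : ∀ {i} pre ℓ → ℓ + length pre ≡ i → ∀ K → HypsP (length pre) i K → ∀ c bs → Good i (c ∷ bs) →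
  ∀ rest → Anti (λ x y → C false K ℓ free c bs (pre ++ x ∷ y ∷ rest))
prefix-anti [] ℓ e K H c bs g rest with start-pos {ℓ} e
... | refl = MidFalse.go-anti ℓ K (H [] [] [] refl) rest c bs g
prefix-anti {i} (b ∷ pre) ℓ e K H c bs g rest =
  anti+ (anti- (prefix-anti pre (suc ℓ) (next-pos e) _ (hypsP-tail K b H) c bs g rest)
               (anti-when (ℓ ≤ᵇ c) (prefix-anti pre (suc ℓ) (next-pos e) _ (hypsP-tail K (suc b) H) c bs g rest)))
        (st bs g)
  where
  st : ∀ bs → Good i (c ∷ bs) → Anti (λ x y → starting bs (λ t bs' → when (ℓ ≤ᵇ t)
         (C false (λ ms → K (ℓ ∷ ms) ∘ (suc b ∷_)) (suc ℓ) free t bs' (pre ++ x ∷ y ∷ rest))))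
  st []       g       = mkAnti λ x y → refl
  st (t ∷ bs) (_ , g) = anti-when (ℓ ≤ᵇ t)
    (prefix-anti pre (suc ℓ) (next-pos e) _ (hypsP-start K ℓ (suc b) (pos< e) H) t bs g rest)

prefix-skew-cur : ∀ {i} pre ℓ → ℓ + length pre ≡ i → ∀ K → HypsP (length pre) i K → ∀ bs rest →
  Skew (λ x y → C false K ℓ free (suc i) bs (pre ++ x ∷ y ∷ rest) - C false K ℓ free i bs (pre ++ x ∷ y ∷ rest))
prefix-skew-cur [] ℓ e K H bs rest with start-pos {ℓ} e
... | refl = MidFalse.skew-cur ℓ K (H [] [] [] refl) rest bs
prefix-skew-cur {i} (b ∷ pre) ℓ e K H bs rest
  rewrite ≤ᵇ-true (<⇒≤ (pos< {ℓ} e)) | ≤ᵇ-true (<⇒≤ (<-trans (pos< {ℓ} e) (n<1+n i))) =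
  skew-ext (λ x y → split (c₁ (suc i) x y) (c₂ (suc i) x y) (st x y) (c₁ i x y) (c₂ i x y) (st x y))
    (skew+ (skew- (prefix-skew-cur pre (suc ℓ) (next-pos e) _ (hypsP-tail K b H) bs rest)
                  (prefix-skew-cur pre (suc ℓ) (next-pos e) _ (hypsP-tail K (suc b) H) bs rest))
           (skew-self {st}))
  where
  c₁ c₂ : ℕ → ℕ → ℕ → ℤ
  c₁ c x y = C false (λ ms → K ms ∘ (b ∷_)) (suc ℓ) free c bs (pre ++ x ∷ y ∷ rest)
  c₂ c x y = C false (λ ms → K ms ∘ (suc b ∷_)) (suc ℓ) free c bs (pre ++ x ∷ y ∷ rest)
  st : ℕ → ℕ → ℤ
  st x y = starting bs (λ t bs' → when (ℓ ≤ᵇ t)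
         (C false (λ ms → K (ℓ ∷ ms) ∘ (suc b ∷_)) (suc ℓ) free t bs' (pre ++ x ∷ y ∷ rest)))

-- The differing bound waits until the cells bounded by `u` have been started. Starting its cell
-- makes it the current bound, where `prefix-skew-cur` takes over. If letter i arrives while a bound
-- below i is left, both sums vanish.
prefix-skew-next : ∀ {i} pre ℓ → ℓ + length pre ≡ i → ∀ K → HypsP (length pre) i K →
  ∀ c u v rest → c < i → All (_< i) u →
  Skew (λ x y → C false K ℓ free c (u ++ suc i ∷ v) (pre ++ x ∷ y ∷ rest)
              - C false K ℓ free c (u ++ i ∷ v) (pre ++ x ∷ y ∷ rest))
prefix-skew-next [] ℓ e K H c [] v rest c<i [] with start-pos {ℓ} e
... | refl = MidFalse.skew-next ℓ K (H [] [] [] refl) rest c v c<i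
prefix-skew-next [] ℓ e K H c (t ∷ u) v rest c<i (t<i ∷ _) with start-pos {ℓ} e
... | refl = skew-ext (λ x y → cong₂ _-_ (MidFalse.go-stuck ℓ K (H [] [] [] refl) rest c t (u ++ suc ℓ ∷ v) x y t<i)
                                         (MidFalse.go-stuck ℓ K (H [] [] [] refl) rest c t (u ++ ℓ ∷ v) x y t<i))
                      (mkSkew λ x y → refl)
prefix-skew-next {i} (b ∷ pre) ℓ e K H c u v rest c<i u<i =
  skew-ext (λ x y → trans (split (c₁ (suc i) x y) (when (ℓ ≤ᵇ c) (c₂ (suc i) x y)) (st u (suc i) x y)
                                 (c₁ i x y) (when (ℓ ≤ᵇ c) (c₂ i x y)) (st u i x y))
                     (cong (λ q → ((c₁ (suc i) x y - c₁ i x y) - q) +ᶻ (st u (suc i) x y - st u i x y))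
                           (when- (ℓ ≤ᵇ c) _ _)))
    (skew+ (skew- (prefix-skew-next pre (suc ℓ) (next-pos e) _ (hypsP-tail K b H) c u v rest c<i u<i)
                  (skew-when (ℓ ≤ᵇ c)
                    (prefix-skew-next pre (suc ℓ) (next-pos e) _ (hypsP-tail K (suc b) H) c u v rest c<i u<i)))
           (stSkew u u<i))
  where
  c₁ c₂ : ℕ → ℕ → ℕ → ℤ
  c₁ t x y = C false (λ ms → K ms ∘ (b ∷_)) (suc ℓ) free c (u ++ t ∷ v) (pre ++ x ∷ y ∷ rest)
  c₂ t x y = C false (λ ms → K ms ∘ (suc b ∷_)) (suc ℓ) free c (u ++ t ∷ v) (pre ++ x ∷ y ∷ rest)
  st : List ℕ → ℕ → ℕ → ℕ → ℤ
  st u t x y = starting (u ++ t ∷ v) (λ t bs' → when (ℓ ≤ᵇ t)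
         (C false (λ ms → K (ℓ ∷ ms) ∘ (suc b ∷_)) (suc ℓ) free t bs' (pre ++ x ∷ y ∷ rest)))
  stSkew : ∀ u → All (_< i) u → Skew (λ x y → st u (suc i) x y - st u i x y)
  stSkew [] [] rewrite ≤ᵇ-true (<⇒≤ (pos< {ℓ} e)) | ≤ᵇ-true (<⇒≤ (<-trans (pos< {ℓ} e) (n<1+n i))) =
    prefix-skew-cur pre (suc ℓ) (next-pos e) _ (hypsP-start K ℓ (suc b) (pos< e) H) v rest
  stSkew (t ∷ u) (t<i ∷ u<i) = skew-ext (λ x y → when- (ℓ ≤ᵇ t) _ _)
    (skew-when (ℓ ≤ᵇ t)
      (prefix-skew-next pre (suc ℓ) (next-pos e) _ (hypsP-start K ℓ (suc b) (pos< e) H) t u v rest t<i u<i))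

private
  bounds : ∀ (h N : ℕ) u x v → (u ++ x ∷ v) ++ replicate (h ∸ length (u ++ x ∷ v)) N ≡
           u ++ x ∷ (v ++ replicate (h ∸ (length u + suc (length v))) N)
  bounds h N u x v rewrite Lₚ.length-++ u {x ∷ v} = Lₚ.++-assoc u (x ∷ v) _

module _ (N : ℕ) (L : Fun) (aL : AntiBelow N L) where

  AntiΦ SkewΦ : List ℕ → ℕ → Set
  AntiΦ hs p = ∀ b → Good (suc p) b → AntiAt p (Φ false N hs L b)
  SkewΦ hs p = ∀ u v → All (_< suc p) u → ∀ pre rest → length pre ≡ p →
    Skew (λ x y → Φ false N hs L (u ++ suc (suc p) ∷ v) (pre ++ x ∷ y ∷ rest)
                - Φ false N hs L (u ++ suc p ∷ v) (pre ++ x ∷ y ∷ rest))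

  -- The other minima are below i or at least i+2, so goodness of the bounds passed on can fail only
  -- at i itself. With i+1 right after it, as in `hSS`, it holds; i alone is left to `SkewΦ`.
  hypsΦ : ∀ hs p → AntiΦ hs p → SkewΦ hs p → HypsP p (suc p) (Φ false N hs L)
  hypsΦ hs p A S ms₀ a pre e = record
    { hW  = λ post q rest → A (ms₀ ++ post) (good-avoid (Allₚ.++⁺ a≢ (q≢ q))) pre rest e
    ; hS  = λ post q rest → A _ (good-avoid (Allₚ.++⁺ a≢ ((λ ()) ∷ q≢ q))) pre rest e
    ; hSS = λ post q rest → A _ (good-++ˡ a≢ ((λ _ → refl) , good-avoid ((λ ()) ∷ q≢ q))) pre rest e
    ; hD  = λ post q rest → S ms₀ post a pre rest e }
    where
    a≢ : All (_≢ suc p) ms₀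
    a≢ = All.map (λ lt e → <⇒≢ lt e) a
    q≢ : ∀ {post} → All (suc (suc (suc p)) ≤_) post → All (_≢ suc p) post
    q≢ = All.map (λ le e → <⇒≢ (≤-trans (n≤1+n _) le) (sym e))

  Φ-props : ∀ hs p → suc p < N → AntiΦ hs p × SkewΦ hs p
  -- With no column left the bounds are ignored, so the difference is zero.
  Φ-props [] p lt = (λ b _ → aL p lt) , λ u v _ pre rest _ → skew-self {λ x y → L (pre ++ x ∷ y ∷ rest)}
  Φ-props (h ∷ hs) p lt with Φ-props hs p lt
  ... | A , S = anti′ , skew′
    where
    H : HypsP p (suc p) (Φ false N hs L)
    H = hypsΦ hs p A S
    anti′ : AntiΦ (h ∷ hs) p
    anti′ b g pre rest refl = prefix-anti pre 1 refl (Φ false N hs L) H 0 _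
      -- The initial bound 0 and the padding bound `N` both differ from i = p+1, the latter because
      -- p+1 < `N`.
      ((λ ()) , good-++ʳ b g (Allₚ.replicate⁺ (h ∸ length b) (λ e → <⇒≢ lt (sym e)))) rest
    skew′ : SkewΦ (h ∷ hs) p
    skew′ u v u< pre rest refl = subst₂
      (λ w w' → Skew (λ x y → C false (Φ false N hs L) 1 free 0 w (pre ++ x ∷ y ∷ rest)
                            - C false (Φ false N hs L) 1 free 0 w' (pre ++ x ∷ y ∷ rest)))
      (sym (bounds h N u (suc (suc (length pre))) v)) (sym (bounds h N u (suc (length pre)) v))
      (prefix-skew-next pre 1 refl (Φ false N hs L) H 0 u _ rest (s≤s z≤n) u<)

  Φ-anti : ∀ hs → AntiBelow N (Φ false N hs L [])
  Φ-anti hs p lt = proj₁ (Φ-props hs p lt) [] tt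

  Φ-hyps : ∀ hs p → suc p < N → HypsP p (suc p) (Φ false N hs L)
  Φ-hyps hs p lt = hypsΦ hs p (proj₁ (Φ-props hs p lt)) (proj₂ (Φ-props hs p lt))

-- Cancellation of the columns that are not Yamanouchi

HypsFrom : ℕ → ℕ → (List ℕ → Fun) → Set
HypsFrom ℓ m K = ∀ p → suc p < m → HypsP p (ℓ + p) K

hypsFrom-tail : ∀ {ℓ m} K b → HypsFrom ℓ (suc m) K → HypsFrom (suc ℓ) m (λ ms → K ms ∘ (b ∷_))
hypsFrom-tail {ℓ} K b H p lt = subst (λ i → HypsP p i (λ ms → K ms ∘ (b ∷_))) (+-suc ℓ p)
  (hypsP-tail K b (H (suc p) (s≤s lt)))

hypsFrom-start : ∀ {ℓ m} K b → HypsFrom ℓ (suc m) K → HypsFrom (suc ℓ) m (λ ms → K (ℓ ∷ ms) ∘ (b ∷_))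
hypsFrom-start {ℓ} K b H p lt = subst (λ i → HypsP p i (λ ms → K (ℓ ∷ ms) ∘ (b ∷_))) (+-suc ℓ p)
  (hypsP-start K ℓ b (≤-trans (s≤s (m≤m+n ℓ p)) (≤-reflexive (sym (+-suc ℓ p)))) (H (suc p) (s≤s lt)))

private
  -- The pair in which ℓ+1 joins the current cell: ℓ is absent, or joins as well. The signs are
  -- opposite, and a cell that admits ℓ+1 admits ℓ.
  cancel-joins : ∀ e e' → (e' ≡ true → e ≡ true) → ∀ wa wp va vp s u → wp ≡ vp →
    ((wa - when e' wp) +ᶻ s) - when e ((va - when e' vp) +ᶻ u) ≡
    ((wa - 0ℤ) +ᶻ s) - when e ((va - 0ℤ) +ᶻ u)
  cancel-joins e     false h wa wp va vp s u _    = refl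
  cancel-joins false true  h with h refl
  ... | ()
  cancel-joins true  true  h wa wp va vp s u refl = l wa wp va s u
    where
    l : ∀ wa wp va s u → ((wa - wp) +ᶻ s) - ((va - wp) +ᶻ u) ≡ ((wa - 0ℤ) +ᶻ s) - ((va - 0ℤ) +ᶻ u)
    l = solve-∀

  -- The pair in which ℓ+1 lies in the next cell: ℓ+1 starts it, or ℓ starts it and ℓ+1 joins. The
  -- two cells have different minima, which is where the skewness of the difference enters.
  cancel-starts : ∀ f f' → (f' ≡ true → f ≡ true) → ∀ w s v fa fp k → s ≡ fp →
    ((w +ᶻ when f' s) - v) +ᶻ when f ((fa - when f' fp) +ᶻ k) ≡
    ((w +ᶻ 0ℤ) - v) +ᶻ when f ((fa - 0ℤ) +ᶻ k)
  cancel-starts f     false h w s v fa fp k _    = refl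
  cancel-starts false true  h with h refl
  ... | ()
  cancel-starts true  true  h w s v fa fp k refl = l w s v fa k
    where
    l : ∀ w s v fa k → ((w +ᶻ s) - v) +ᶻ ((fa - s) +ᶻ k) ≡ ((w +ᶻ 0ℤ) - v) +ᶻ ((fa - 0ℤ) +ᶻ k)
    l = solve-∀

  ≤ᵇ-pred : ∀ i c → (suc i ≤ᵇ c) ≡ true → (i ≤ᵇ c) ≡ true
  ≤ᵇ-pred i c e = ≤ᵇ-true (<⇒≤ (≤ᵇ⇒≤ (suc i) c (subst T (sym e) tt)))

prev-irrelevant : ∀ K ℓ b p c bs b₂ β → (b ≡ᵇ b₂) ≡ false →
  C true K ℓ free c bs (b₂ ∷ β) ≡ C true K ℓ (prev b p) c bs (b₂ ∷ β)
prev-irrelevant K ℓ b p c bs b₂ β e rewrite e = refl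

firstStep : (List ℕ → Fun) → ℕ → ℕ → List ℕ → ℕ → List ℕ → Bool → Prev → Prev → ℤ
firstStep K ℓ c bs b β y q₁ q₂ =
  (C y (λ ms → K ms ∘ (b ∷_)) (suc ℓ) q₁ c bs β
   - when (ℓ ≤ᵇ c) (C y (λ ms → K ms ∘ (suc b ∷_)) (suc ℓ) q₂ c bs β))
  +ᶻ starting bs (λ t bs' →
       when (ℓ ≤ᵇ t) (C y (λ ms → K (ℓ ∷ ms) ∘ (suc b ∷_)) (suc ℓ) q₂ t bs' β))

firstStep-cong : ∀ K ℓ c bs b β {y y' q₁ q₂ q₁' q₂'} →
  (∀ c bs → C y (λ ms → K ms ∘ (b ∷_)) (suc ℓ) q₁ c bs β ≡ C y' (λ ms → K ms ∘ (b ∷_)) (suc ℓ) q₁' c bs β) →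
  (∀ c bs → C y (λ ms → K ms ∘ (suc b ∷_)) (suc ℓ) q₂ c bs β ≡ C y' (λ ms → K ms ∘ (suc b ∷_)) (suc ℓ) q₂' c bs β) →
  (∀ c bs → C y (λ ms → K (ℓ ∷ ms) ∘ (suc b ∷_)) (suc ℓ) q₂ c bs β ≡ C y' (λ ms → K (ℓ ∷ ms) ∘ (suc b ∷_)) (suc ℓ) q₂' c bs β) →
  firstStep K ℓ c bs b β y q₁ q₂ ≡ firstStep K ℓ c bs b β y' q₁' q₂'
firstStep-cong K ℓ c []       b β h₁ h₂ h₃ = cong₂ _+ᶻ_ (cong₂ _-_ (h₁ c []) (cong (when (ℓ ≤ᵇ c)) (h₂ c []))) refl
firstStep-cong K ℓ c (t ∷ bs) b β h₁ h₂ h₃ =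
  cong₂ _+ᶻ_ (cong₂ _-_ (h₁ c (t ∷ bs)) (cong (when (ℓ ≤ᵇ c)) (h₂ c (t ∷ bs)))) (cong (when (ℓ ≤ᵇ t)) (h₃ t bs))

module _ (K : List ℕ → Fun) (ℓ b : ℕ) (rest : List ℕ) (H : Hyps ℓ (λ ms x y rest → K ms (x ∷ y ∷ rest))) where
  open Mid true ℓ K H rest

  private
    pv : Prev
    pv = prev b true

    W-diag : ∀ c bs → W pv c bs b (suc b) ≡ W pv c bs (suc b) (suc b)
    W-diag c bs = anti-diag (aW pv c bs) b

    SF-diag : ∀ c bs → S pv c bs b (suc b) ≡ F pv c bs (suc b) (suc b)
    SF-diag c bs = trans (anti-diag (aS pv c bs) b)
      (ℤₚ.i-j≡0⇒i≡j _ _ (double-zero _ (skew (zSF pv c bs) (suc b) (suc b))))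

  -- A column that is not Yamanouchi at the letters ℓ, ℓ+1 cancels against the
  -- one with ℓ added to, or removed from, the cell of ℓ+1.
  cancel : ∀ c bs → firstStep K ℓ c bs b (b ∷ rest) true free free ≡
                    firstStep K ℓ c bs b (b ∷ rest) true (prev b false) (prev b true)
  cancel c [] rewrite ≡ᵇ-≡ b = cong (_+ᶻ 0ℤ)
    (cancel-joins (ℓ ≤ᵇ c) (suc ℓ ≤ᵇ c) (≤ᵇ-pred ℓ c) (W (prev b false) c [] b b) _
       (W (prev b false) c [] (suc b) b) _ 0ℤ 0ℤ (W-diag c []))
  cancel c (t ∷ bs) rewrite ≡ᵇ-≡ b = trans
    (cong (_+ᶻ when (ℓ ≤ᵇ t) ((F (prev b false) t bs (suc b) b - when (suc ℓ ≤ᵇ t) (F pv t bs (suc b) (suc b)))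
             +ᶻ starting bs (λ t bs' → when (suc ℓ ≤ᵇ t) (SS pv t bs' (suc b) (suc b)))))
      (cancel-joins (ℓ ≤ᵇ c) (suc ℓ ≤ᵇ c) (≤ᵇ-pred ℓ c) (W (prev b false) c (t ∷ bs) b b) _
         (W (prev b false) c (t ∷ bs) (suc b) b) _
         (when (suc ℓ ≤ᵇ t) (S pv t bs b (suc b))) (when (suc ℓ ≤ᵇ t) (S pv t bs (suc b) (suc b)))
         (W-diag c (t ∷ bs))))
    (cancel-starts (ℓ ≤ᵇ t) (suc ℓ ≤ᵇ t) (≤ᵇ-pred ℓ t)
       (W (prev b false) c (t ∷ bs) b b - 0ℤ) (S pv t bs b (suc b))
       (when (ℓ ≤ᵇ c) ((W (prev b false) c (t ∷ bs) (suc b) b - 0ℤ)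
          +ᶻ when (suc ℓ ≤ᵇ t) (S pv t bs (suc b) (suc b))))
       (F (prev b false) t bs (suc b) b) (F pv t bs (suc b) (suc b))
       (starting bs (λ t bs' → when (suc ℓ ≤ᵇ t) (SS pv t bs' (suc b) (suc b))))
       (SF-diag t bs))

-- The induction hypothesis imposes the tests from the second letter on, with no memory of the
-- first. The test between the first two letters is then supplied by `cancel` if their weights
-- agree, and is void otherwise.
column-LR : ∀ β ℓ K → HypsFrom ℓ (length β) K → ∀ c bs → C false K ℓ free c bs β ≡ C true K ℓ free c bs β
column-LR []             ℓ K H c bs = refl
column-LR (b ∷ [])       ℓ K H c bs = refl
column-LR (b ∷ b₂ ∷ β) ℓ K H c bs = trans
  (firstStep-cong K ℓ c bs b (b₂ ∷ β)
    {q₁ = free} {q₂ = free} {q₁' = free} {q₂' = free}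
    (column-LR (b₂ ∷ β) (suc ℓ) (λ ms → K ms ∘ (b ∷_)) (hypsFrom-tail K b H))
    (column-LR (b₂ ∷ β) (suc ℓ) (λ ms → K ms ∘ (suc b ∷_)) (hypsFrom-tail K (suc b) H))
    (column-LR (b₂ ∷ β) (suc ℓ) (λ ms → K (ℓ ∷ ms) ∘ (suc b ∷_)) (hypsFrom-start K (suc b) H)))
  last
  where
  H₀ : Hyps ℓ (λ ms x y rest → K ms (x ∷ y ∷ rest))
  H₀ = subst (λ i → Hyps i (λ ms x y rest → K ms (x ∷ y ∷ rest))) (+-identityʳ ℓ)
    (H 0 (s≤s (s≤s z≤n)) [] [] [] refl)
  last : firstStep K ℓ c bs b (b₂ ∷ β) true free free ≡
         firstStep K ℓ c bs b (b₂ ∷ β) true (prev b false) (prev b true)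
  last with b ≟ b₂
  ... | yes refl = cancel K ℓ b β H₀ c bs
  ... | no ne = firstStep-cong K ℓ c bs b (b₂ ∷ β)
    {q₁ = free} {q₂ = free} {q₁' = prev b false} {q₂' = prev b true}
    (λ c bs → prev-irrelevant (λ ms → K ms ∘ (b ∷_)) (suc ℓ) b false c bs b₂ β (≡ᵇ-≢ ne))
    (λ c bs → prev-irrelevant (λ ms → K ms ∘ (suc b ∷_)) (suc ℓ) b true c bs b₂ β (≡ᵇ-≢ ne))
    (λ c bs → prev-irrelevant (λ ms → K (ℓ ∷ ms) ∘ (suc b ∷_)) (suc ℓ) b true c bs b₂ β (≡ᵇ-≢ ne))

-- Antisymmetry is available for the unrestricted sum, so the current column is restricted while
-- those further left are still free; only then does the recursion restrict them.
Φ-LR : ∀ L N → AntiBelow N L → ∀ hs b β → length β ≡ N → Φ false N hs L b β ≡ Φ true N hs L b β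
Φ-LR L N a []       b β e = refl
Φ-LR L N a (h ∷ hs) b β refl = trans
  (column-LR β 1 (Φ false N hs L) (λ p lt → Φ-hyps N L a hs p lt) 0 _)
  (C-ext-len true 1 free 0 _ β (λ ms β' e → Φ-LR L N a hs ms β' e))
  where
  C-ext-len : ∀ y {K K' : List ℕ → Fun} ℓ pv c bs β → (∀ ms β' → length β' ≡ length β → K ms β' ≡ K' ms β') →
    C y K ℓ pv c bs β ≡ C y K' ℓ pv c bs β
  C-ext-len y ℓ pv c []      []      h = h [] [] refl
  C-ext-len y ℓ pv c (_ ∷ _) []      h = refl
  C-ext-len y {K} {K'} ℓ pv c bs (b ∷ β) h = cong₂ _+ᶻ_
    (cong₂ _-_ (C-ext-len y (suc ℓ) _ c bs β (λ ms β' e → h ms (b ∷ β') (cong suc e)))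
               (cong (when (okJ pv b ∧ (ℓ ≤ᵇ c)))
                 (C-ext-len y (suc ℓ) _ c bs β (λ ms β' e → h ms (suc b ∷ β') (cong suc e)))))
    (st bs)
    where
    st : ∀ bs → starting bs (λ t bs' → when (okS pv b ∧ (ℓ ≤ᵇ t)) (C y (λ ms → K (ℓ ∷ ms) ∘ (suc b ∷_)) (suc ℓ) (nxt y b true) t bs' β))
       ≡ starting bs (λ t bs' → when (okS pv b ∧ (ℓ ≤ᵇ t)) (C y (λ ms → K' (ℓ ∷ ms) ∘ (suc b ∷_)) (suc ℓ) (nxt y b true) t bs' β))
    st []       = refl
    st (t ∷ bs) = cong (when (okS pv b ∧ (ℓ ≤ᵇ t)))
      (C-ext-len y (suc ℓ) _ t bs β (λ ms β' e → h (ℓ ∷ ms) (suc b ∷ β') (cong suc e)))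

-- Complete homogeneous operators and the Pieri rule

Graded : Set
Graded = List ℕ → ℕ → ℤ

-- Multiplication by 1/(1-tx) in one exponent; the last argument is the degree in t still to be
-- distributed.
up : (ℕ → ℕ → ℤ) → ℕ → ℕ → ℤ
up F m zero    = F m zero
up F m (suc k) = F m (suc k) +ᶻ up F (suc m) k

atZero : Fun → Graded
atZero L β zero    = L β
atZero L β (suc k) = 0ℤ

-- The value of L at h_k x^β. Distributing the degree must end with nothing left, which is what
-- `atZero` enforces.
H : Fun → Graded
H L []      k = atZero L [] k
H L (b ∷ β) k = up (λ a → H (L ∘ (a ∷_)) β) b k

module _ {I : Set} {R : (I → ℤ) → Set} (lin : Linear R) where
  open Linear lin

  up-lift : ∀ (F : I → ℕ → ℕ → ℤ) → (∀ a k → R (λ i → F i a k)) → ∀ m k → R (λ i → up (F i) m k)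
  up-lift F h m zero    = h m zero
  up-lift F h m (suc k) = R+ (h m (suc k)) (up-lift F h (suc m) k)

  H-lift : ∀ (L : I → Fun) β → (∀ β' → length β' ≡ length β → R (λ i → L i β')) → ∀ k → R (λ i → H (L i) β k)
  H-lift L []      h zero    = h [] refl
  H-lift L []      h (suc k) = R0
  H-lift L (b ∷ β) h k =
    up-lift (λ i a → H (L i ∘ (a ∷_)) β) (λ a → H-lift (λ i → L i ∘ (a ∷_)) β (λ β' e → h (a ∷ β') (cong suc e))) b k

H-ext : ∀ {L L'} β → (∀ β' → length β' ≡ length β → L β' ≡ L' β') → ∀ k → H L β k ≡ H L' β k
H-ext {L} {L'} β h k = H-lift linear2 (λ b → if b then L else L') β h k

up-ext : ∀ {F G} → (∀ a k → F a k ≡ G a k) → ∀ m k → up F m k ≡ up G m k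
up-ext {F} {G} h m k = up-lift linear2 (λ b → if b then F else G) h m k

-- With T(x,y) multiplied by 1/(1-tx)(1-ty), the symmetric recurrence shows
-- that antisymmetry passes to every coefficient of t.
up-up-anti : ∀ (T : ℕ → ℕ → ℕ → ℤ) → (∀ k → Anti (λ x y → T x y k)) → ∀ k → Anti (λ x y → up (λ a → up (T a) y) x k)
up-up-anti T h k = proj₁ (both k)
  where
  U : ℕ → ℕ → ℕ → ℤ
  U k x y = up (λ a → up (T a) y) x k
  -- The recurrence U(k+2) = T(k+2) + (x+y)U(k+1) - xyU(k) has order two, hence the pair.
  both : ∀ k → Anti (U k) × Anti (U (suc k))
  both zero = h 0 , anti-ext (λ x y → ℤₚ.+-assoc (T x y 1) (T x (suc y) 0) (T (suc x) y 0)) (anti+ (h 1) (anti-sum (h 0)))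
  both (suc k) with both k
  ... | a₀ , a₁ = a₁ , anti-ext
    (λ x y → l (T x y (suc (suc k))) (up (T x) (suc y) (suc k)) (U (suc k) (suc x) y) (U k (suc x) (suc y)))
    (anti- (anti+ (h (suc (suc k))) (anti-sum a₁)) (anti-shift a₀))
    where
    l : ∀ t r u v → (t +ᶻ r) +ᶻ u ≡ (t +ᶻ ((r +ᶻ v) +ᶻ u)) - v
    l = solve-∀

H-antiAt : ∀ p L → AntiAt p L → ∀ k → AntiAt p (λ β → H L β k)
H-antiAt p L a k [] rest e = up-up-anti (λ x y → H (λ β → L (x ∷ y ∷ β)) rest)
  (λ k → H-lift linearAnti (λ p β → L (proj₁ p ∷ proj₂ p ∷ β)) rest (λ β' _ → a [] β' e) k) k
H-antiAt (suc p) L a k (b ∷ pre) rest e =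
  up-lift linearAnti (λ i a → H (L ∘ (a ∷_)) (pre ++ proj₁ i ∷ proj₂ i ∷ rest))
    (λ c k → H-antiAt p (L ∘ (c ∷_)) (antiAt-tail {L = L} c a) k pre rest (suc-injective e)) b k

H-anti : ∀ {n L} → AntiBelow n L → ∀ k → AntiBelow n (λ β → H L β k)
H-anti {L = L} a k p lt = H-antiAt p L (a p lt) k

-- Inverting the complete homogeneous series

sh : (ℕ → ℤ) → ℕ → ℤ
sh f zero    = 0ℤ
sh f (suc k) = f k

-- Multiplication by (1-tx₁)(1-tx₂)⋯, whose inverse is the generating series H.
E : Graded → Graded
E F []      k = F [] k
E F (b ∷ β) k = E (F ∘ (b ∷_)) β k - sh (E (F ∘ (suc b ∷_)) β) k

sh-lift : ∀ {I : Set} {R : (I → ℤ) → Set} (lin : Linear R) (f : I → ℕ → ℤ) →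
  (∀ k → R (λ i → f i k)) → ∀ k → R (λ i → sh (f i) k)
sh-lift lin f h zero    = Linear.R0 lin
sh-lift lin f h (suc k) = h k

E-lift : ∀ {I : Set} {R : (I → ℤ) → Set} (lin : Linear R) (F : I → Graded) →
  (∀ β k → R (λ i → F i β k)) → ∀ β k → R (λ i → E (F i) β k)
E-lift lin F h []      k = h [] k
E-lift lin F h (b ∷ β) k = Linear.R- lin
  (E-lift lin (λ i → F i ∘ (b ∷_)) (λ β → h (b ∷ β)) β k)
  (sh-lift lin (λ i → E (F i ∘ (suc b ∷_)) β) (E-lift lin (λ i → F i ∘ (suc b ∷_)) (λ β → h (suc b ∷ β)) β) k)

E-ext : ∀ {F G : Graded} → (∀ β k → F β k ≡ G β k) → ∀ β k → E F β k ≡ E G β k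
E-ext {F} {G} h = E-lift linear2 (λ b → if b then F else G) h

E-sub : ∀ (F G : Graded) β k → E (λ β k → F β k - G β k) β k ≡ E F β k - E G β k
E-sub F G = E-lift linear3 fam (λ _ _ → refl)
  where
  fam : Three → Graded
  fam one   β k = F β k - G β k
  fam two   = F
  fam three = G

E-sh : ∀ (F : Graded) β k → E (λ β → sh (F β)) β k ≡ sh (E F β) k
E-sh F []      k = refl
E-sh F (b ∷ β) zero = cong (_- 0ℤ) (E-sh (F ∘ (b ∷_)) β zero)
E-sh F (b ∷ β) (suc k) = cong₂ _-_ (E-sh (F ∘ (b ∷_)) β (suc k)) (E-sh (F ∘ (suc b ∷_)) β k)

up-step : ∀ F m k → F m k ≡ up F m k - sh (up F (suc m)) k
up-step F m zero    = sym (ℤₚ.+-identityʳ _)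
up-step F m (suc k) = l (F m (suc k)) (up F (suc m) k)
  where
  l : ∀ a b → a ≡ (a +ᶻ b) - b
  l = solve-∀

-- The factors 1 - tx and 1/(1-tx) cancel one exponent at a time.
E-H : ∀ L β k → E (H L) β k ≡ atZero L β k
E-H L []      k = refl
E-H L (b ∷ β) k = begin
  E (H L ∘ (b ∷_)) β k - sh (E (H L ∘ (suc b ∷_)) β) k
    ≡⟨ cong (λ z → E (H L ∘ (b ∷_)) β k - z) (sym (E-sh (H L ∘ (suc b ∷_)) β k)) ⟩
  E (H L ∘ (b ∷_)) β k - E (λ β → sh (H L (suc b ∷ β))) β k
    ≡⟨ sym (E-sub (H L ∘ (b ∷_)) (λ β → sh (H L (suc b ∷ β))) β k) ⟩
  E (λ β k → H L (b ∷ β) k - sh (H L (suc b ∷ β)) k) β k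
    ≡⟨ E-ext (λ β k → sym (up-step (λ a → H (L ∘ (a ∷_)) β) b k)) β k ⟩
  E (H (L ∘ (b ∷_))) β k
    ≡⟨ E-H (L ∘ (b ∷_)) β k ⟩
  atZero (L ∘ (b ∷_)) β k
    ≡⟨ az k ⟩
  atZero L (b ∷ β) k ∎
  where
  open ≡-Reasoning
  az : ∀ k → atZero (L ∘ (b ∷_)) β k ≡ atZero L (b ∷ β) k
  az zero    = refl
  az (suc k) = refl

-- The sum over partitions and the Pieri rule

head₀ : List ℕ → ℕ
head₀ []      = 0
head₀ (a ∷ _) = a

-- The new first part starts at the larger of l and the next part, and only columns beyond that are
-- charged to t: for a partition λ, a column between l and the next part already meets the next row
-- of the skew shape.
inner : ℕ → Graded → Graded
inner l F ρ k = up (λ a → F (a ∷ ρ)) (l ⊔ head₀ ρ) k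

-- Sum over the partitions ρ ⊇ λ, where t records the columns of ρ/λ.
Q : Graded → Graded
Q F []      k = F [] k
Q F (l ∷ λ') k = Q (inner l F) λ' k

Q-ext : ∀ {F G : Graded} λ' → (∀ β → length β ≡ length λ' → ∀ k → F β k ≡ G β k) → ∀ k → Q F λ' k ≡ Q G λ' k
Q-ext []      h k = h [] refl k
Q-ext (l ∷ λ') h k = Q-ext λ' (λ β e k → up-ext (λ a k → h (a ∷ β) (cong suc e) k) (l ⊔ head₀ β) k) k

-- `up` divides by the factor 1 - tx that the difference contains, so consecutive terms cancel and
-- the first one remains.
telescope : ∀ (G : ℕ → ℕ → ℤ) m k → up (λ a k → G a k - sh (G (suc a)) k) m k ≡ G m k
telescope G m zero    = ℤₚ.+-identityʳ _
telescope G m (suc k) = trans (cong ((G m (suc k) - G (suc m) k) +ᶻ_) (telescope G (suc m) k)) (l (G m (suc k)) (G (suc m) k))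
  where
  l : ∀ a b → (a - b) +ᶻ b ≡ a
  l = solve-∀

-- The trace of K-antisymmetry on equal exponents, which is all that the telescoping uses.
Diag : ℕ → Graded → Set
Diag n F = ∀ pre c rest k → suc (length pre) < n → F (pre ++ c ∷ suc c ∷ rest) k ≡ F (pre ++ suc c ∷ suc c ∷ rest) k

lead : ℕ → Graded → Graded
lead l F ρ = F (l ⊔ head₀ ρ ∷ ρ)

lead-diag : ∀ {n} l F → Diag (suc n) F → Diag n (lead l F)
lead-diag l F d [] c rest k lt = trans (d (l ⊔ c ∷ []) c rest k (s≤s lt)) step
  where
  step : F (l ⊔ c ∷ suc c ∷ suc c ∷ rest) k ≡ F (l ⊔ suc c ∷ suc c ∷ suc c ∷ rest) k
  step with l ≤? c
  ... | yes l≤c rewrite m≤n⇒m⊔n≡n l≤c | m≤n⇒m⊔n≡n (m≤n⇒m≤1+n l≤c) = d [] c (suc c ∷ rest) k (<-trans lt (n<1+n _))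
  ... | no l≰c rewrite m≥n⇒m⊔n≡m (<⇒≤ (≰⇒> l≰c)) | m≥n⇒m⊔n≡m (≰⇒> l≰c) = refl
lead-diag l F d (x ∷ pre) c rest k lt = d (l ⊔ x ∷ x ∷ pre) c rest k (s≤s lt)

inner-E : ∀ {n} l F → Diag (suc n) F → ∀ ρ → length ρ ≡ n → ∀ k → inner l (E F) ρ k ≡ E (lead l F) ρ k
inner-E l F d [] e k = telescope (λ a k → E (F ∘ (a ∷_)) [] k) (l ⊔ 0) k
inner-E l F d (c ∷ ρ) refl k = trans
  (telescope (λ a k → E (F ∘ (a ∷_)) (c ∷ ρ) k) (l ⊔ c) k)
  (cong (λ z → E (λ ρ → F (l ⊔ c ∷ c ∷ ρ)) ρ k - z) (sh-lift linear2 (λ b → E (if b then f else g) ρ) (E-ext same ρ) k))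
  where
  f g : Graded
  f ρ = F (l ⊔ c ∷ suc c ∷ ρ)
  g ρ = F (l ⊔ suc c ∷ suc c ∷ ρ)
  -- Raising the exponent c to c+1 may also raise the maximum in front of it, namely if l ≤ c;
  -- `Diag` absorbs exactly this change.
  same : ∀ ρ k → f ρ k ≡ g ρ k
  same ρ k with l ≤? c
  ... | yes l≤c rewrite m≤n⇒m⊔n≡n l≤c | m≤n⇒m⊔n≡n (m≤n⇒m≤1+n l≤c) = d [] c ρ k (s≤s (s≤s z≤n))
  ... | no l≰c rewrite m≥n⇒m⊔n≡m (<⇒≤ (≰⇒> l≰c)) | m≥n⇒m⊔n≡m (≰⇒> l≰c) = refl

Decr : List ℕ → Set
Decr []       = ⊤
Decr (l ∷ λ') = head₀ λ' ≤ l × Decr λ'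

-- In each row the sum telescopes against its factor 1 - tx and leaves the least admissible part.
-- For a decreasing λ these least parts assemble to λ itself.
Q-E : ∀ λ' F → Decr λ' → Diag (length λ') F → ∀ k → Q (E F) λ' k ≡ F λ' k
Q-E []      F dec d k = refl
Q-E (l ∷ λ') F (h≤l , dec) d k = trans (Q-ext λ' (inner-E l F d) k)
  (trans (Q-E λ' (lead l F) dec (lead-diag l F d) k)
         (cong (λ m → F (m ∷ λ') k) (m≥n⇒m⊔n≡m h≤l)))

pieri : ∀ L λ' → Decr λ' → AntiBelow (length λ') L → ∀ k → H L λ' k ≡ Q (atZero L) λ' k
pieri L λ' dec a k = trans (sym (Q-E λ' (H L) dec diag k)) (Q-ext λ' (λ β _ k → E-H L β k) k)
  where
  diag : Diag (length λ') (H L)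
  diag pre c rest k lt = anti-diag (H-antiAt (length pre) L (a (length pre) lt) k pre rest refl) c

-- Determinants

-- Laplace expansion of a row: the columns passed over are collected in the argument of `f`, and
-- each of them changes the sign.
expand : {A : Set} → (A → ℤ) → (List A → ℤ) → List A → ℤ
expand ℓ f []      = 0ℤ
expand ℓ f (v ∷ V) = ℓ v * f V - expand ℓ (f ∘ (v ∷_)) V

det : {A : Set} → List (A → ℤ) → List A → ℤ
det []      []      = 1ℤ
det []      (_ ∷ _) = 0ℤ
det (ℓ ∷ R) V       = expand ℓ (det R) V

module _ {A : Set} where

  Alternating : (List A → ℤ) → Set
  Alternating f = ∀ pre u w post → f (pre ++ u ∷ w ∷ post) +ᶻ f (pre ++ w ∷ u ∷ post) ≡ 0ℤ

  expand-opposite : ∀ ℓ (f g : List A → ℤ) → (∀ W → f W +ᶻ g W ≡ 0ℤ) → ∀ V → expand ℓ f V +ᶻ expand ℓ g V ≡ 0ℤ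
  expand-opposite ℓ f g h []      = refl
  expand-opposite ℓ f g h (v ∷ V) = trans
    (l (ℓ v) (f V) (g V) (expand ℓ (f ∘ (v ∷_)) V) (expand ℓ (g ∘ (v ∷_)) V))
    (trans (cong₂ (λ a b → ℓ v * a - b) (h V) (expand-opposite ℓ _ _ (h ∘ (v ∷_)) V)) (z (ℓ v)))
    where
    l : ∀ a f g x y → (a * f - x) +ᶻ (a * g - y) ≡ a * (f +ᶻ g) - (x +ᶻ y)
    l = solve-∀
    z : ∀ a → a * 0ℤ - 0ℤ ≡ 0ℤ
    z = solve-∀

  expand-alternating : ∀ ℓ f → Alternating f → Alternating (expand ℓ f)
  expand-alternating ℓ f a [] u w V = trans
    (l (ℓ u) (ℓ w) (f (w ∷ V)) (f (u ∷ V)) (expand ℓ (λ W → f (u ∷ w ∷ W)) V) (expand ℓ (λ W → f (w ∷ u ∷ W)) V))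
    (expand-opposite ℓ _ _ (a [] u w) V)
    where
    l : ∀ a b f g x y → (a * f - (b * g - x)) +ᶻ (b * g - (a * f - y)) ≡ x +ᶻ y
    l = solve-∀
  expand-alternating ℓ f a (p ∷ pre) u w V = trans
    (l (ℓ p) (f (pre ++ u ∷ w ∷ V)) (f (pre ++ w ∷ u ∷ V)) _ _)
    (trans (cong₂ (λ a b → ℓ p * a - b) (a pre u w V) (expand-alternating ℓ (f ∘ (p ∷_)) (λ pre → a (p ∷ pre)) pre u w V)) (z (ℓ p)))
    where
    l : ∀ a f g x y → (a * f - x) +ᶻ (a * g - y) ≡ a * (f +ᶻ g) - (x +ᶻ y)
    l = solve-∀
    z : ∀ a → a * 0ℤ - 0ℤ ≡ 0ℤ
    z = solve-∀

  det-alternating : ∀ (R : List (A → ℤ)) → Alternating (det R)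
  det-alternating [] []      u w V = refl
  det-alternating [] (_ ∷ _) u w V = refl
  det-alternating (ℓ ∷ R) = expand-alternating ℓ (det R) (det-alternating R)

  module _ (w u v : A) where

    Splits : (List A → ℤ) → Set
    Splits f = ∀ pre post → f (pre ++ w ∷ post) ≡ f (pre ++ u ∷ post) - f (pre ++ v ∷ post)

    expand-sub : ∀ ℓ (f g h : List A → ℤ) → (∀ W → f W ≡ g W - h W) → ∀ V → expand ℓ f V ≡ expand ℓ g V - expand ℓ h V
    expand-sub ℓ f g h e []      = refl
    expand-sub ℓ f g h e (x ∷ V) = trans
      (cong₂ (λ a b → ℓ x * a - b) (e V) (expand-sub ℓ _ _ _ (e ∘ (x ∷_)) V))
      (l (ℓ x) (g V) (h V) _ _)
      where
      l : ∀ a g h x y → a * (g - h) - (x - y) ≡ (a * g - x) - (a * h - y)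
      l = solve-∀

    expand-splits : ∀ ℓ f → ℓ w ≡ ℓ u - ℓ v → Splits f → Splits (expand ℓ f)
    expand-splits ℓ f e s [] V = trans
      (cong₂ (λ a b → a * f V - b) e (expand-sub ℓ _ _ _ (s []) V))
      (l (ℓ u) (ℓ v) (f V) _ _)
      where
      l : ∀ a b f x y → (a - b) * f - (x - y) ≡ (a * f - x) - (b * f - y)
      l = solve-∀
    expand-splits ℓ f e s (p ∷ pre) V = trans
      (cong₂ (λ a b → ℓ p * a - b) (s pre V) (expand-splits ℓ (f ∘ (p ∷_)) e (λ pre → s (p ∷ pre)) pre V))
      (l (ℓ p) (f (pre ++ u ∷ V)) (f (pre ++ v ∷ V)) _ _)
      where
      l : ∀ a g h x y → a * (g - h) - (x - y) ≡ (a * g - x) - (a * h - y)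
      l = solve-∀

    det-splits : ∀ R → All (λ ℓ → ℓ w ≡ ℓ u - ℓ v) R → Splits (det R)
    det-splits [] [] []      post = refl
    det-splits [] [] (_ ∷ _) post = refl
    det-splits (ℓ ∷ R) (e ∷ es) = expand-splits ℓ (det R) e (det-splits R es)

  expand-zeroˡ : ∀ ℓ (f : List A → ℤ) V → All (λ v → ℓ v ≡ 0ℤ) V → expand ℓ f V ≡ 0ℤ
  expand-zeroˡ ℓ f []      []       = refl
  expand-zeroˡ ℓ f (v ∷ V) (e ∷ es) = cong₂ (λ a b → a * f V - b) e (expand-zeroˡ ℓ _ V es)

  expand-zeroʳ : ∀ ℓ (f : List A → ℤ) → (∀ W → f W ≡ 0ℤ) → ∀ V → expand ℓ f V ≡ 0ℤ
  expand-zeroʳ ℓ f h []      = refl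
  expand-zeroʳ ℓ f h (v ∷ V) = trans (cong₂ (λ a b → ℓ v * a - b) (h V) (expand-zeroʳ ℓ _ (h ∘ (v ∷_)) V))
    (trans (ℤₚ.+-identityʳ _) (ℤₚ.*-zeroʳ (ℓ v)))

  det-zero : ∀ (R : List (A → ℤ)) v → All (λ ℓ → ℓ v ≡ 0ℤ) R → ∀ W → det R (v ∷ W) ≡ 0ℤ
  det-zero []      v []       W = refl
  det-zero (ℓ ∷ R) v (e ∷ es) W = cong₂ (λ a b → a * det R W - b) e (expand-zeroʳ ℓ _ (det-zero R v es) W)

-- sums i a b is the coefficient of t^(a-b) in (t/(1-t))^i, and entry i j a b
-- its j-th forward difference in a; both only depend on a-b.

sums : ℕ → ℕ → ℕ → ℤ
sums zero    a       b = if a ≡ᵇ b then 1ℤ else 0ℤ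
sums (suc i) zero    b = 0ℤ
sums (suc i) (suc a) b = sums (suc i) a b +ᶻ sums i a b

entry′ : ℕ → ℕ → ℕ → ℕ → ℤ
entry′ i zero    a b = sums i a b
entry′ i (suc j) a b = entry′ i j (suc a) b - entry′ i j a b

sums-0-suc : ∀ i b → sums i 0 (suc b) ≡ 0ℤ
sums-0-suc zero    b = refl
sums-0-suc (suc i) b = refl

sums-shift : ∀ i a b → sums i (suc a) (suc b) ≡ sums i a b
sums-shift zero    a       b = refl
sums-shift (suc i) zero    b = cong (0ℤ +ᶻ_) (sums-0-suc i b)
sums-shift (suc i) (suc a) b = cong₂ _+ᶻ_ (sums-shift (suc i) a b) (sums-shift i a b)

entry-shift : ∀ i j a b → entry′ i j (suc a) (suc b) ≡ entry′ i j a b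
entry-shift i zero    a b = sums-shift i a b
entry-shift i (suc j) a b = cong₂ _-_ (entry-shift i j (suc a) b) (entry-shift i j a b)

-- A column at position j+1 is a difference of two columns at position j. This identity reduces
-- K-antisymmetry to the alternation of a determinant.
entry-suc : ∀ i j a b → entry′ i (suc j) a (suc b) ≡ entry′ i j a b - entry′ i j a (suc b)
entry-suc i j a b = cong (_- entry′ i j a (suc b)) (entry-shift i j a b)

-- A difference undoes a summation, so entries depend on i - j only: they are the coefficients of
-- t^(a-b) in (t/(1-t))^(i-j).
entry-diag : ∀ i j a b → entry′ (suc i) (suc j) a b ≡ entry′ i j a b
entry-diag i zero    a b = l (sums (suc i) a b) (sums i a b)
  where
  l : ∀ x y → (x +ᶻ y) - x ≡ y
  l = solve-∀
entry-diag i (suc j) a b = cong₂ _-_ (entry-diag i j (suc a) b) (entry-diag i j a b)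

entry-diag+ : ∀ k i j a b → entry′ (k + i) (k + j) a b ≡ entry′ i j a b
entry-diag+ zero    i j a b = refl
entry-diag+ (suc k) i j a b = trans (entry-diag (k + i) (k + j) a b) (entry-diag+ k i j a b)

sums-< : ∀ i {a b} → a < b → sums i a b ≡ 0ℤ
sums-< zero lt rewrite ≡ᵇ-≢ (<⇒≢ lt) = refl
sums-< (suc i) {zero} lt = refl
sums-< (suc i) {suc a} lt = cong₂ _+ᶻ_ (sums-< (suc i) lt′) (sums-< i lt′)
  where lt′ = <-trans (n<1+n a) lt

sums-≤ : ∀ i {a b} → a ≤ b → sums (suc i) a b ≡ 0ℤ
sums-≤ i {zero} le = refl
sums-≤ i {suc a} le = cong₂ _+ᶻ_ (sums-≤ i (<⇒≤ le)) (sums-< i le)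

entry-> : ∀ j {a b} → b < a → entry′ 0 j a b ≡ 0ℤ
entry-> zero    lt rewrite ≡ᵇ-≢ (λ e → <⇒≢ lt (sym e)) = refl
entry-> (suc j) lt = cong₂ _-_ (entry-> j (<-trans lt (n<1+n _))) (entry-> j lt)

row : ℕ → ℕ → ℕ × ℕ → ℤ
row i a (j , b) = entry′ i j a b

rows : ℕ → List ℕ → List (ℕ × ℕ → ℤ)
rows k []      = []
rows k (a ∷ ν) = row k a ∷ rows (suc k) ν

cols : ℕ → List ℕ → List (ℕ × ℕ)
cols k []      = []
cols k (b ∷ β) = (k , b) ∷ cols (suc k) β

dual : List ℕ → Fun
dual ν β = det (rows 0 ν) (cols 0 β)

cols-++ : ∀ k pre post → cols k (pre ++ post) ≡ cols k pre ++ cols (k + length pre) post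
cols-++ k []        post = cong (λ k → cols k post) (sym (+-identityʳ k))
cols-++ k (b ∷ pre) post = cong ((k , b) ∷_) (trans (cols-++ (suc k) pre post)
  (cong (λ m → cols (suc k) pre ++ cols m post) (sym (+-suc k (length pre)))))

dual-anti : ∀ ν p → AntiAt p (dual ν)
dual-anti ν p pre rest refl = mkAnti λ x y → trans
  (cong₂ _+ᶻ_ (cong₂ _-_ (e x y) (e (suc x) y)) (cong₂ _-_ (e y x) (e (suc y) x)))
  (trans (l (B x y) (B x (suc y)) (B (suc x) y) (B (suc x) (suc y)) (B y x) (B y (suc x)) (B (suc y) x) (B (suc y) (suc x)))
    (cong₂ _+ᶻ_ (cong₂ _-_ (alt x y) (alt x (suc y))) (cong₂ _-_ (alt (suc x) (suc y)) (alt (suc x) y))))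
  where
  j = length pre
  R = rows 0 ν
  u = cols 0 pre
  v = cols (suc (suc j)) rest
  B : ℕ → ℕ → ℤ
  B x y = det R (u ++ (j , x) ∷ (j , y) ∷ v)
  alt : ∀ x y → B x y +ᶻ B y x ≡ 0ℤ
  alt x y = det-alternating R u (j , x) (j , y) v
  rowsSplit : ∀ k ν y → All (λ ℓ → ℓ (suc j , suc y) ≡ ℓ (j , y) - ℓ (j , suc y)) (rows k ν)
  rowsSplit k []      y = []
  rowsSplit k (a ∷ ν) y = entry-suc k j a y ∷ rowsSplit (suc k) ν y
  -- Moves both columns to position j, where exchanging x and y only changes the sign.
  e : ∀ x y → dual ν (pre ++ x ∷ suc y ∷ rest) ≡ B x y - B x (suc y)
  e x y = trans (cong (det R) (cols-++ 0 pre (x ∷ suc y ∷ rest)))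
    (trans (cong (det R) (sym (Lₚ.++-assoc u ((j , x) ∷ []) _)))
    (trans (det-splits (suc j , suc y) (j , y) (j , suc y) R (rowsSplit 0 ν y) (u ++ (j , x) ∷ []) v)
      (cong₂ (λ a b → det R a - det R b) (Lₚ.++-assoc u ((j , x) ∷ []) _) (Lₚ.++-assoc u ((j , x) ∷ []) _))))
  l : ∀ a b c d a' b' c' d' → ((a - b) - (c - d)) +ᶻ ((a' - b') - (c' - d')) ≡
    ((a +ᶻ a') - (b +ᶻ c')) +ᶻ ((d +ᶻ d') - (c +ᶻ b'))
  l = solve-∀

decr-≤ : ∀ {a ν} → Decr (a ∷ ν) → All (_≤ a) ν
decr-≤ {a} {[]}    _            = []
decr-≤ {a} {b ∷ ν} (le , h , d) = le ∷ All.map (λ q → ≤-trans q le) (decr-≤ {b} {ν} (h , d))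

rows-low : ∀ k m b ν → All (_≤ b) ν → All (λ ℓ → ℓ (k , b) ≡ 0ℤ) (rows (k + suc m) ν)
rows-low k m b []      []       = []
rows-low k m b (a ∷ ν) (p ∷ ps) =
  trans (cong (λ z → entry′ (k + suc m) z a b) (sym (+-identityʳ k)))
    (trans (entry-diag+ k (suc m) 0 a b) (sums-≤ m p))
  ∷ subst (λ z → All (λ ℓ → ℓ (k , b) ≡ 0ℤ) (rows z ν)) (+-suc k (suc m)) (rows-low k (suc m) b ν ps)

cols-low : ∀ k m a ρ → All (_< a) ρ → All (λ v → row k a v ≡ 0ℤ) (cols (k + m) ρ)
cols-low k m a []      []       = []
cols-low k m a (b ∷ ρ) (p ∷ ps) =
  trans (cong (λ z → entry′ z (k + m) a b) (sym (+-identityʳ k)))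
    (trans (entry-diag+ k 0 m a b) (entry-> m p))
  ∷ subst (λ z → All (λ v → row k a v ≡ 0ℤ) (cols z ρ)) (+-suc k m) (cols-low k (suc m) a ρ ps)

private
  -- If a ≤ b the first column vanishes below its first entry, and if a > b the first row vanishes
  -- after it. Either way the determinant factors.
  det-step : ∀ k a b ν ρ → Decr (a ∷ ν) → Decr (b ∷ ρ) →
    det (rows k (a ∷ ν)) (cols k (b ∷ ρ)) ≡ (if a ≡ᵇ b then 1ℤ else 0ℤ) * det (rows (suc k) ν) (cols (suc k) ρ)
  det-step k a b ν ρ dν dρ = trans (cong₂ (λ e z → e * det (rows (suc k) ν) (cols (suc k) ρ) - z) diag rest)
    (ℤₚ.+-identityʳ _)
    where
    diag : entry′ k k a b ≡ (if a ≡ᵇ b then 1ℤ else 0ℤ)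
    diag = trans (cong₂ (λ i j → entry′ i j a b) (sym (+-identityʳ k)) (sym (+-identityʳ k))) (entry-diag+ k 0 0 a b)
    rest : expand (row k a) (det (rows (suc k) ν) ∘ ((k , b) ∷_)) (cols (suc k) ρ) ≡ 0ℤ
    rest with a ≤? b
    ... | yes a≤b = expand-zeroʳ (row k a) (det (rows (suc k) ν) ∘ ((k , b) ∷_)) (det-zero (rows (suc k) ν) (k , b)
            (subst (λ z → All (λ ℓ → ℓ (k , b) ≡ 0ℤ) (rows z ν)) (trans (+-suc k 0) (cong suc (+-identityʳ k)))
              (rows-low k 0 b ν (All.map (λ q → ≤-trans q a≤b) (decr-≤ dν))))) (cols (suc k) ρ)
    ... | no a≰b = expand-zeroˡ (row k a) _ _
            (subst (λ z → All (λ v → row k a v ≡ 0ℤ) (cols z ρ)) (trans (+-suc k 0) (cong suc (+-identityʳ k)))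
              (cols-low k 1 a ρ (All.map (λ q → ≤-<-trans q (≰⇒> a≰b)) (decr-≤ dρ))))

  det-same : ∀ k ν → Decr ν → det (rows k ν) (cols k ν) ≡ 1ℤ
  det-same k []      _ = refl
  det-same k (a ∷ ν) d rewrite det-step k a a ν ν d d | ≡ᵇ-≡ a | det-same (suc k) ν (proj₂ d) = refl

  det-other : ∀ k ν ρ → Decr ν → Decr ρ → ν ≢ ρ → det (rows k ν) (cols k ρ) ≡ 0ℤ
  det-other k []      []      _ _ ne = ⊥-elim (ne refl)
  det-other k []      (b ∷ ρ) _ _ ne = refl
  det-other k (a ∷ ν) []      _ _ ne = refl
  det-other k (a ∷ ν) (b ∷ ρ) dν dρ ne with a ≟ b
  ... | yes refl = trans (det-step k a a ν ρ dν dρ)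
        (trans (cong ((if a ≡ᵇ a then 1ℤ else 0ℤ) *_) (det-other (suc k) ν ρ (proj₂ dν) (proj₂ dρ) (λ e → ne (cong (a ∷_) e))))
          (ℤₚ.*-zeroʳ (if a ≡ᵇ a then 1ℤ else 0ℤ)))
  ... | no a≢b = trans (det-step k a b ν ρ dν dρ)
        (cong (λ q → (if q then 1ℤ else 0ℤ) * det (rows (suc k) ν) (cols (suc k) ρ)) (≡ᵇ-≢ a≢b))

dual-same : ∀ ν → Decr ν → dual ν ν ≡ 1ℤ
dual-same = det-same 0

dual-other : ∀ ν ρ → Decr ν → Decr ρ → ν ≢ ρ → dual ν ρ ≡ 0ℤ
dual-other = det-other 0

-- The first column is zero. This yields the bound that a descending lexicographic induction needs.
dual-large : ∀ ν b β → All (_< b) ν → dual ν (b ∷ β) ≡ 0ℤ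
dual-large ν b β lt = det-zero (rows 0 ν) (0 , b) (go 0 ν lt) (cols 1 β)
  where
  go : ∀ k ν → All (_< b) ν → All (λ ℓ → ℓ (0 , b) ≡ 0ℤ) (rows k ν)
  go k []      []       = []
  go k (a ∷ ν) (p ∷ ps) = sums-< k p ∷ go (suc k) ν ps

-- Finite sums

∑ : {A : Set} → List A → (A → ℤ) → ℤ
∑ xs f = sumℤ (map f xs)

module _ {A : Set} where

  ∑-ext : ∀ (xs : List A) {f g : A → ℤ} → (∀ x → f x ≡ g x) → ∑ xs f ≡ ∑ xs g
  ∑-ext []       h = refl
  ∑-ext (x ∷ xs) h = cong₂ _+ᶻ_ (h x) (∑-ext xs h)

  ∑-++ : ∀ (xs ys : List A) f → ∑ (xs ++ ys) f ≡ ∑ xs f +ᶻ ∑ ys f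
  ∑-++ []       ys f = sym (ℤₚ.+-identityˡ _)
  ∑-++ (x ∷ xs) ys f = trans (cong (f x +ᶻ_) (∑-++ xs ys f)) (sym (ℤₚ.+-assoc (f x) _ _))

  ∑-zero : ∀ (xs : List A) {f} → (∀ x → f x ≡ 0ℤ) → ∑ xs f ≡ 0ℤ
  ∑-zero []       h = refl
  ∑-zero (x ∷ xs) h = cong₂ _+ᶻ_ (h x) (∑-zero xs h)

  ∑-+ : ∀ (xs : List A) f g → ∑ xs (λ x → f x +ᶻ g x) ≡ ∑ xs f +ᶻ ∑ xs g
  ∑-+ []       f g = refl
  ∑-+ (x ∷ xs) f g = trans (cong ((f x +ᶻ g x) +ᶻ_) (∑-+ xs f g)) (l (f x) (g x) (∑ xs f) (∑ xs g))
    where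
    l : ∀ a b c d → (a +ᶻ b) +ᶻ (c +ᶻ d) ≡ (a +ᶻ c) +ᶻ (b +ᶻ d)
    l = solve-∀

  ∑-- : ∀ (xs : List A) f g → ∑ xs (λ x → f x - g x) ≡ ∑ xs f - ∑ xs g
  ∑-- []       f g = refl
  ∑-- (x ∷ xs) f g = trans (cong ((f x - g x) +ᶻ_) (∑-- xs f g)) (l (f x) (g x) (∑ xs f) (∑ xs g))
    where
    l : ∀ a b c d → (a - b) +ᶻ (c - d) ≡ (a +ᶻ c) - (b +ᶻ d)
    l = solve-∀

  ∑-scale : ∀ (xs : List A) a f → ∑ xs (λ x → a * f x) ≡ a * ∑ xs f
  ∑-scale []       a f = sym (ℤₚ.*-zeroʳ a)
  ∑-scale (x ∷ xs) a f = trans (cong (a * f x +ᶻ_) (∑-scale xs a f)) (sym (ℤₚ.*-distribˡ-+ a (f x) (∑ xs f)))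

  -- `nothing` indexes the combination and `just x` its terms; lifting this relation shows that an
  -- operator commutes with finite linear combinations.
  ∑-linear : ∀ (xs : List A) (a : A → ℤ) → Linear (λ (f : Maybe A → ℤ) → f nothing ≡ ∑ xs (λ x → a x * f (just x)))
  ∑-linear xs a = record
    { R0 = sym (∑-zero xs (λ x → ℤₚ.*-zeroʳ (a x)))
    ; R+ = λ {f} {g} r s → trans (cong₂ _+ᶻ_ r s) (trans (sym (∑-+ xs _ _))
             (∑-ext xs (λ x → sym (ℤₚ.*-distribˡ-+ (a x) (f (just x)) (g (just x))))))
    ; R- = λ {f} {g} r s → trans (cong₂ _-_ r s) (trans (sym (∑-- xs _ _))
             (∑-ext xs (λ x → l (a x) (f (just x)) (g (just x))))) }
    where
    l : ∀ a b c → a * b - a * c ≡ a * (b - c)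
    l = solve-∀

module _ {A B : Set} where

  ∑-map : ∀ (h : A → B) (xs : List A) f → ∑ (map h xs) f ≡ ∑ xs (λ x → f (h x))
  ∑-map h []       f = refl
  ∑-map h (x ∷ xs) f = cong (f (h x) +ᶻ_) (∑-map h xs f)

  ∑-concatMap : ∀ (h : A → List B) (xs : List A) f → ∑ (concatMap h xs) f ≡ ∑ xs (λ x → ∑ (h x) f)
  ∑-concatMap h []       f = refl
  ∑-concatMap h (x ∷ xs) f = trans (∑-++ (h x) (concatMap h xs) f) (cong (∑ (h x) f +ᶻ_) (∑-concatMap h xs f))

  ∑-swap : ∀ (xs : List A) (ys : List B) (f : A → B → ℤ) →
    ∑ xs (λ x → ∑ ys (f x)) ≡ ∑ ys (λ y → ∑ xs (λ x → f x y))
  ∑-swap []       ys f = sym (∑-zero ys (λ _ → refl))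
  ∑-swap (x ∷ xs) ys f = trans (cong (∑ ys (f x) +ᶻ_) (∑-swap xs ys f)) (sym (∑-+ ys (f x) _))

-- Explicit form of the column transfer

data Status : Set where
  absent join start : Status

words : ℕ → List (List Status)
words zero    = [] ∷ []
words (suc n) = map (absent ∷_) (words n) ++ (map (join ∷_) (words n) ++ map (start ∷_) (words n))

infixl 6 _⊕_
_⊕_ : List ℕ → List ℕ → List ℕ
_⊕_ = zipWith (λ b g → g + b)

weight : Status → ℕ
weight absent = 0
weight join   = 1
weight start  = 1

sign : Status → ℤ
sign absent = 1ℤ
sign join   = -[1+ 0 ]
sign start  = 1ℤ

wtCol : List Status → List ℕ
wtCol = map weight

sgCol : List Status → ℤ
sgCol []      = 1ℤ
sgCol (x ∷ s) = sign x * sgCol s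

mins : ℕ → List Status → List ℕ
mins ℓ []           = []
mins ℓ (absent ∷ s) = mins (suc ℓ) s
mins ℓ (join ∷ s)   = mins (suc ℓ) s
mins ℓ (start ∷ s)  = ℓ ∷ mins (suc ℓ) s

noneLeft : List ℕ → Bool
noneLeft []      = true
noneLeft (_ ∷ _) = false

okCol : Bool → ℕ → Prev → ℕ → List ℕ → List ℕ → List Status → Bool
okCol y ℓ pv c bs       (b ∷ β) (absent ∷ s) = okCol y (suc ℓ) (nxt y b false) c bs β s
okCol y ℓ pv c bs       (b ∷ β) (join ∷ s)   = (okJ pv b ∧ (ℓ ≤ᵇ c)) ∧ okCol y (suc ℓ) (nxt y b true) c bs β s
okCol y ℓ pv c []       (b ∷ β) (start ∷ s)  = false
okCol y ℓ pv c (t ∷ bs) (b ∷ β) (start ∷ s)  = (okS pv b ∧ (ℓ ≤ᵇ t)) ∧ okCol y (suc ℓ) (nxt y b true) t bs β s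
okCol y ℓ pv c bs       []      []           = noneLeft bs
okCol y ℓ pv c bs       (_ ∷ _) []           = false
okCol y ℓ pv c bs       []      (_ ∷ _)      = false

C-sum : ∀ y K ℓ pv c bs β →
  C y K ℓ pv c bs β ≡ ∑ (words (length β)) (λ s → when (okCol y ℓ pv c bs β s) (sgCol s) * K (mins ℓ s) (β ⊕ wtCol s))
C-sum y K ℓ pv c []       [] = sym (trans (ℤₚ.+-identityʳ _) (ℤₚ.*-identityˡ _))
C-sum y K ℓ pv c (_ ∷ _)  [] = sym (ℤₚ.+-identityʳ _)
C-sum y K ℓ pv c bs (b ∷ β) = trans
  (trans (cong₂ _+ᶻ_ (cong₂ _-_ partA partJ) (partS bs))
    (trans (cong (_+ᶻ tS bs) (cong (tA +ᶻ_) refl)) (ℤₚ.+-assoc tA (- ∑ W fJ) (tS bs))))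
  (sym (trans (∑-++ (map (absent ∷_) W) _ _)
    (cong₂ _+ᶻ_ (∑-map (absent ∷_) W _)
      (trans (∑-++ (map (join ∷_) W) _ _)
        (cong₂ _+ᶻ_ (trans (∑-map (join ∷_) W _) jj) (trans (∑-map (start ∷_) W _) (ss bs)))))))
  where
  W = words (length β)
  KA KJ KS : List ℕ → Fun
  KA ms = K ms ∘ (b ∷_)
  KJ ms = K ms ∘ (suc b ∷_)
  KS ms = K (ℓ ∷ ms) ∘ (suc b ∷_)
  fA fJ : List Status → ℤ
  fA s = when (okCol y (suc ℓ) (nxt y b false) c bs β s) (1ℤ * sgCol s) * KA (mins (suc ℓ) s) (β ⊕ wtCol s)
  fJ s = when ((okJ pv b ∧ (ℓ ≤ᵇ c)) ∧ okCol y (suc ℓ) (nxt y b true) c bs β s) (sgCol s) * KJ (mins (suc ℓ) s) (β ⊕ wtCol s)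
  fS : ℕ → List ℕ → List Status → ℤ
  fS t bs s = when ((okS pv b ∧ (ℓ ≤ᵇ t)) ∧ okCol y (suc ℓ) (nxt y b true) t bs β s) (1ℤ * sgCol s) * KS (mins (suc ℓ) s) (β ⊕ wtCol s)
  tA : ℤ
  tA = ∑ W fA
  tS : List ℕ → ℤ
  tS []       = 0ℤ
  tS (t ∷ bs) = ∑ W (fS t bs)
  wh∧ : ∀ p q z w → when (p ∧ q) z * w ≡ when p (when q z * w)
  wh∧ true  q z w = refl
  wh∧ false q z w = refl
  wh∑ : ∀ p (f : List Status → ℤ) → when p (∑ W f) ≡ ∑ W (λ s → when p (f s))
  wh∑ true  f = refl
  wh∑ false f = sym (∑-zero W (λ _ → refl))
  one* : ∀ p z → when p (1ℤ * z) ≡ when p z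
  one* p z = cong (when p) (ℤₚ.*-identityˡ z)
  partA : C y KA (suc ℓ) (nxt y b false) c bs β ≡ tA
  partA = trans (C-sum y KA (suc ℓ) (nxt y b false) c bs β)
    (∑-ext W (λ s → cong (_* KA (mins (suc ℓ) s) (β ⊕ wtCol s)) (sym (one* (okCol y (suc ℓ) (nxt y b false) c bs β s) (sgCol s)))))
  partJ : when (okJ pv b ∧ (ℓ ≤ᵇ c)) (C y KJ (suc ℓ) (nxt y b true) c bs β) ≡ ∑ W fJ
  partJ = trans (cong (when (okJ pv b ∧ (ℓ ≤ᵇ c))) (C-sum y KJ (suc ℓ) (nxt y b true) c bs β))
    (trans (wh∑ (okJ pv b ∧ (ℓ ≤ᵇ c)) _) (∑-ext W (λ s → sym (wh∧ (okJ pv b ∧ (ℓ ≤ᵇ c)) _ (sgCol s) _))))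
  partS : ∀ bs → starting bs (λ t bs' → when (okS pv b ∧ (ℓ ≤ᵇ t)) (C y KS (suc ℓ) (nxt y b true) t bs' β)) ≡ tS bs
  partS []       = refl
  partS (t ∷ bs) = trans (cong (when (okS pv b ∧ (ℓ ≤ᵇ t))) (C-sum y KS (suc ℓ) (nxt y b true) t bs β))
    (trans (wh∑ (okS pv b ∧ (ℓ ≤ᵇ t)) _) (∑-ext W (λ s → trans
      (cong (when (okS pv b ∧ (ℓ ≤ᵇ t))) (cong (_* KS (mins (suc ℓ) s) (β ⊕ wtCol s)) (sym (one* (okCol y (suc ℓ) (nxt y b true) t bs β s) (sgCol s)))))
      (sym (wh∧ (okS pv b ∧ (ℓ ≤ᵇ t)) _ (1ℤ * sgCol s) _)))))
  whneg : ∀ p z → when p (-[1+ 0 ] * z) ≡ - when p z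
  whneg true  z = l z
    where
    l : ∀ z → -[1+ 0 ] * z ≡ - z
    l = solve-∀
  whneg false z = refl
  jj : ∑ W (λ s → when ((okJ pv b ∧ (ℓ ≤ᵇ c)) ∧ okCol y (suc ℓ) (nxt y b true) c bs β s) (-[1+ 0 ] * sgCol s) * KJ (mins (suc ℓ) s) (β ⊕ wtCol s))
       ≡ - ∑ W fJ
  jj = trans (∑-ext W (λ s → trans (cong (_* KJ (mins (suc ℓ) s) (β ⊕ wtCol s)) (whneg ((okJ pv b ∧ (ℓ ≤ᵇ c)) ∧ okCol y (suc ℓ) (nxt y b true) c bs β s) (sgCol s)))
                                (sym (ℤₚ.neg-distribˡ-* (when ((okJ pv b ∧ (ℓ ≤ᵇ c)) ∧ okCol y (suc ℓ) (nxt y b true) c bs β s) (sgCol s)) _))))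
             (neg W)
    where
    neg : ∀ W → ∑ W (λ s → - fJ s) ≡ - ∑ W fJ
    neg []      = refl
    neg (s ∷ W) = trans (cong (- fJ s +ᶻ_) (neg W)) (sym (ℤₚ.neg-distrib-+ (fJ s) (∑ W fJ)))
  ss : ∀ bs → ∑ W (λ s → when (okCol y ℓ pv c bs (b ∷ β) (start ∷ s)) (1ℤ * sgCol s) * KS (mins (suc ℓ) s) (β ⊕ wtCol s)) ≡ tS bs
  ss []       = ∑-zero W (λ _ → refl)
  ss (t ∷ bs) = refl

-- A tableau lists its columns from right to left.

tabs : List ℕ → ℕ → List (List (List Status))
tabs []       n = [] ∷ []
tabs (h ∷ hs) n = concatMap (λ s → map (s ∷_) (tabs hs n)) (words n)

extend : ℕ → ℕ → List ℕ → List ℕ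
extend N h b = b ++ replicate (h ∸ length b) N

okTab : Bool → ℕ → List ℕ → List ℕ → List ℕ → List (List Status) → Bool
okTab y N []       b β []      = true
okTab y N []       b β (_ ∷ _) = false
okTab y N (h ∷ hs) b β []      = false
okTab y N (h ∷ hs) b β (s ∷ T) = okCol y 1 free 0 (extend N h b) β s ∧ okTab y N hs (mins 1 s) (β ⊕ wtCol s) T

sgTab : List (List Status) → ℤ
sgTab []      = 1ℤ
sgTab (s ∷ T) = sgCol s * sgTab T

addTab : List ℕ → List (List Status) → List ℕ
addTab β []      = β
addTab β (s ∷ T) = addTab (β ⊕ wtCol s) T

words-length : ∀ n → All (λ s → length s ≡ n) (words n)
words-length zero    = refl ∷ []
words-length (suc n) = Allₚ.++⁺ (m absent) (Allₚ.++⁺ (m join) (m start))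
  where
  m : ∀ x → All (λ s → length s ≡ suc n) (map (x ∷_) (words n))
  m x = Allₚ.map⁺ (All.map (cong suc) (words-length n))

∑-ext-All : ∀ {A : Set} {P : A → Set} {xs : List A} {f g : A → ℤ} → All P xs → (∀ x → P x → f x ≡ g x) → ∑ xs f ≡ ∑ xs g
∑-ext-All []       h = refl
∑-ext-All (p ∷ ps) h = cong₂ _+ᶻ_ (h _ p) (∑-ext-All ps h)

⊕-length : ∀ β γ → length γ ≡ length β → length (β ⊕ γ) ≡ length β
⊕-length []      []      e = refl
⊕-length (b ∷ β) (g ∷ γ) e = cong suc (⊕-length β γ (suc-injective e))

wtCol-length : ∀ {n} s → length s ≡ n → length (wtCol s) ≡ n
wtCol-length s e = trans (Lₚ.length-map weight s) e

Φ-sum : ∀ y N hs L b β → Φ y N hs L b β ≡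
  ∑ (tabs hs (length β)) (λ T → when (okTab y N hs b β T) (sgTab T) * L (addTab β T))
Φ-sum y N []       L b β = sym (trans (ℤₚ.+-identityʳ _) (ℤₚ.*-identityˡ _))
Φ-sum y N (h ∷ hs) L b β = trans (C-sum y (Φ y N hs L) 1 free 0 (extend N h b) β)
  (trans (∑-ext-All (words-length (length β)) step)
         (sym (∑-concatMap (λ s → map (s ∷_) (tabs hs (length β))) (words (length β)) _)))
  where
  n = length β
  step : ∀ s → length s ≡ n →
    when (okCol y 1 free 0 (extend N h b) β s) (sgCol s) * Φ y N hs L (mins 1 s) (β ⊕ wtCol s) ≡
    ∑ (map (s ∷_) (tabs hs n)) (λ T → when (okTab y N (h ∷ hs) b β T) (sgTab T) * L (addTab β T))
  step s e = trans (cong (o *_) (trans (Φ-sum y N hs L (mins 1 s) (β ⊕ wtCol s))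
      (cong (λ m → ∑ (tabs hs m) (λ T → when (okTab y N hs (mins 1 s) (β ⊕ wtCol s) T) (sgTab T) * L (addTab (β ⊕ wtCol s) T)))
        (⊕-length β (wtCol s) (wtCol-length s e)))))
    (trans (sym (∑-scale (tabs hs n) o _))
    (trans (∑-ext (tabs hs n) (λ T → l (okCol y 1 free 0 (extend N h b) β s) (okTab y N hs (mins 1 s) (β ⊕ wtCol s) T) (sgCol s) (sgTab T) _))
      (sym (∑-map (s ∷_) (tabs hs n) _))))
    where
    o = when (okCol y 1 free 0 (extend N h b) β s) (sgCol s)
    l : ∀ p q a b z → when p a * (when q b * z) ≡ when (p ∧ q) (a * b) * z
    l true  true  a b z = sym (ℤₚ.*-assoc a b z)
    l true  false a b z = ℤₚ.*-zeroʳ a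
    l false q     a b z = refl

-- Without the Yamanouchi tests only the bounds matter, and these ignore the weight. Hence `G` is
-- multiplication by a fixed polynomial and commutes with `H` and with every other `G`.
okCol-free : ∀ ℓ c bs β β' s → length β ≡ length β' → okCol false ℓ free c bs β s ≡ okCol false ℓ free c bs β' s
okCol-free ℓ c bs       []      []        []           e = refl
okCol-free ℓ c bs       []      []        (_ ∷ _)      e = refl
okCol-free ℓ c bs       (_ ∷ _) (_ ∷ _)   []           e = refl
okCol-free ℓ c bs       (_ ∷ β) (_ ∷ β')  (absent ∷ s) e = okCol-free (suc ℓ) c bs β β' s (suc-injective e)
okCol-free ℓ c bs       (_ ∷ β) (_ ∷ β')  (join ∷ s)   e = cong ((ℓ ≤ᵇ c) ∧_) (okCol-free (suc ℓ) c bs β β' s (suc-injective e))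
okCol-free ℓ c []       (_ ∷ β) (_ ∷ β')  (start ∷ s)  e = refl
okCol-free ℓ c (t ∷ bs) (_ ∷ β) (_ ∷ β')  (start ∷ s)  e = cong ((ℓ ≤ᵇ t) ∧_) (okCol-free (suc ℓ) t bs β β' s (suc-injective e))

okTab-free : ∀ N hs b β β' T → length β ≡ length β' → okTab false N hs b β T ≡ okTab false N hs b β' T
okTab-free N []       b β β' []      e = refl
okTab-free N []       b β β' (_ ∷ _) e = refl
okTab-free N (h ∷ hs) b β β' []      e = refl
okTab-free N (h ∷ hs) b β β' (s ∷ T) e =
  cong₂ _∧_ (okCol-free 1 0 (extend N h b) β β' s e) (okTab-free N hs (mins 1 s) _ _ T (zl β β' (wtCol s) e))
  where
  zl : ∀ β β' γ → length β ≡ length β' → length (β ⊕ γ) ≡ length (β' ⊕ γ)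
  zl []      []       γ       e = refl
  zl (_ ∷ β) (_ ∷ β') []      e = refl
  zl (_ ∷ β) (_ ∷ β') (_ ∷ γ) e = cong suc (zl β β' γ (suc-injective e))

⊕-comm : ∀ β γ δ → β ⊕ γ ⊕ δ ≡ β ⊕ δ ⊕ γ
⊕-comm []      γ       δ       = refl
⊕-comm (b ∷ β) []      []      = refl
⊕-comm (b ∷ β) []      (d ∷ δ) = refl
⊕-comm (b ∷ β) (g ∷ γ) []      = refl
⊕-comm (b ∷ β) (g ∷ γ) (d ∷ δ) = cong₂ _∷_
  (trans (sym (+-assoc d g b)) (trans (cong (_+ b) (+-comm d g)) (+-assoc g d b))) (⊕-comm β γ δ)

addTab-⊕ : ∀ β γ T → addTab (β ⊕ γ) T ≡ addTab β T ⊕ γ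
addTab-⊕ β γ []      = refl
addTab-⊕ β γ (s ∷ T) = trans (cong (λ z → addTab z T) (⊕-comm β γ (wtCol s))) (addTab-⊕ (β ⊕ wtCol s) γ T)

addTab-comm : ∀ β T T' → addTab (addTab β T) T' ≡ addTab (addTab β T') T
addTab-comm β []      T' = refl
addTab-comm β (s ∷ T) T' = trans (addTab-comm (β ⊕ wtCol s) T T') (cong (λ z → addTab z T) (addTab-⊕ β (wtCol s) T'))

tabs-length : ∀ hs n → All (All (λ s → length s ≡ n)) (tabs hs n)
tabs-length []       n = [] ∷ []
tabs-length (h ∷ hs) n = Allₚ.concat⁺ (Allₚ.map⁺ (All.map (λ e → Allₚ.map⁺ (All.map (e ∷_) (tabs-length hs n))) (words-length n)))

addTab-length : ∀ β T → All (λ s → length s ≡ length β) T → length (addTab β T) ≡ length β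
addTab-length β []      []       = refl
addTab-length β (s ∷ T) (e ∷ es) = trans (addTab-length (β ⊕ wtCol s) T (All.map (λ q → trans q (sym le)) es)) le
  where le = ⊕-length β (wtCol s) (wtCol-length s e)

-- Multiplication by the signed polynomial of set-valued tableaux

G : ℕ → List ℕ → Fun → Fun
G N hs L = Φ false N hs L []

coef : ℕ → List ℕ → List ℕ → List (List Status) → ℤ
coef N hs β T = when (okTab false N hs [] β T) (sgTab T)

G-sum : ∀ N hs L β β' → length β' ≡ length β →
  G N hs L β' ≡ ∑ (tabs hs (length β)) (λ T → coef N hs β T * L (addTab β' T))
G-sum N hs L β β' e = trans (Φ-sum false N hs L [] β')
  (trans (cong (λ m → ∑ (tabs hs m) (λ T → coef N hs β' T * L (addTab β' T))) e)
    (∑-ext (tabs hs (length β)) (λ T → cong (λ o → when o (sgTab T) * L (addTab β' T)) (okTab-free N hs [] β' β T e))))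

private
  same-length : ∀ hs β → All (λ T → length (addTab β T) ≡ length β) (tabs hs (length β))
  same-length hs β = All.map (λ {T} → addTab-length β T) (tabs-length hs (length β))

  G-G-sum : ∀ N hs hs' L β → G N hs (G N hs' L) β ≡
    ∑ (tabs hs (length β)) (λ T → ∑ (tabs hs' (length β)) (λ T' → coef N hs β T * (coef N hs' β T' * L (addTab (addTab β T) T'))))
  G-G-sum N hs hs' L β = trans (G-sum N hs (G N hs' L) β β refl)
    (∑-ext-All (same-length hs β) (λ T e → trans
      (cong (coef N hs β T *_) (G-sum N hs' L β (addTab β T) e))
      (sym (∑-scale (tabs hs' (length β)) (coef N hs β T) _))))

G-comm : ∀ N hs hs' L β → G N hs (G N hs' L) β ≡ G N hs' (G N hs L) β
G-comm N hs hs' L β = trans (G-G-sum N hs hs' L β)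
  (trans (∑-swap (tabs hs (length β)) (tabs hs' (length β)) _)
  (trans (∑-ext (tabs hs' (length β)) (λ T' → ∑-ext (tabs hs (length β)) (λ T → trans
      (l (coef N hs β T) (coef N hs' β T') (L (addTab (addTab β T) T')))
      (cong (λ z → coef N hs' β T' * (coef N hs β T * L z)) (addTab-comm β T T')))))
    (sym (G-G-sum N hs' hs L β))))
  where
  l : ∀ a b z → a * (b * z) ≡ b * (a * z)
  l = solve-∀

up-+ : ∀ F g m k → up (λ a → F (g + a)) m k ≡ up F (g + m) k
up-+ F g m zero    = refl
up-+ F g m (suc k) = cong (F (g + m) (suc k) +ᶻ_)
  (trans (up-+ F g (suc m) k) (cong (λ z → up F z k) (+-suc g m)))

H-⊕ : ∀ L β γ k → length γ ≡ length β → H (λ β' → L (β' ⊕ γ)) β k ≡ H L (β ⊕ γ) k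
H-⊕ L []      []      zero    e = refl
H-⊕ L []      []      (suc k) e = refl
H-⊕ L (b ∷ β) (g ∷ γ) k e = trans
  (up-ext (λ a k → H-⊕ (λ β' → L (g + a ∷ β')) β γ k (suc-injective e)) b k)
  (up-+ (λ a → H (λ β' → L (a ∷ β')) (β ⊕ γ)) g b k)

H-addTab : ∀ L β T k → All (λ s → length s ≡ length β) T → H (λ β' → L (addTab β' T)) β k ≡ H L (addTab β T) k
H-addTab L β []      k []       = refl
H-addTab L β (s ∷ T) k (e ∷ es) = trans
  (H-⊕ (λ β' → L (addTab β' T)) β (wtCol s) k e')
  (H-addTab L (β ⊕ wtCol s) T k (All.map (λ q → trans q (sym (⊕-length β (wtCol s) e'))) es))
  where e' = wtCol-length s e

H-G-comm : ∀ N hs L β k → H (G N hs L) β k ≡ G N hs (λ β' → H L β' k) β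
H-G-comm N hs L β k = trans (H-ext β (λ β' e → G-sum N hs L β β' e) k)
  (trans (H-lift (∑-linear (tabs hs (length β)) (coef N hs β)) fam β (λ _ _ → refl) k)
  (trans (∑-ext-All (tabs-length hs (length β)) (λ T es → cong (coef N hs β T *_) (H-addTab L β T k es)))
    (sym (G-sum N hs (λ β' → H L β' k) β β refl))))
  where
  fam : Maybe (List (List Status)) → Fun
  fam nothing  β' = ∑ (tabs hs (length β)) (λ T → coef N hs β T * L (addTab β' T))
  fam (just T) β' = L (addTab β' T)

-- The unique Yamanouchi tableau starting from the empty partition

iota : ℕ → ℕ → List ℕ
iota ℓ zero    = []
iota ℓ (suc r) = ℓ ∷ iota (suc ℓ) r

-- The exponents of x_1 ⋯ x_e in m variables, for e ≤ m.
block : ℕ → ℕ → List ℕ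
block zero    m       = replicate m 0
block (suc e) zero    = []
block (suc e) (suc m) = 1 ∷ block e m

private
  z--+ : ∀ z → (z - 0ℤ) +ᶻ 0ℤ ≡ z
  z--+ = solve-∀

  starting-0 : ∀ bs {f : ℕ → List ℕ → ℤ} → (∀ t bs' → f t bs' ≡ 0ℤ) → starting bs f ≡ 0ℤ
  starting-0 []       h = refl
  starting-0 (t ∷ bs) h = h t bs

-- Among zero weights, no letter is allowed once its predecessor is absent.
dead : ∀ K ℓ c bs m → C true K ℓ (prev 0 false) c bs (replicate m 0) ≡ stop bs (K [] (replicate m 0))
dead K ℓ c bs zero    = refl
dead K ℓ c bs (suc m) = trans
  (cong₂ (λ a b → (a - 0ℤ) +ᶻ b) (dead (λ ms → K ms ∘ (0 ∷_)) (suc ℓ) c bs m) (starting-0 bs (λ _ _ → refl)))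
  (z--+ _)

-- All weights are 0, so no letter may be skipped before the last one, and after a present letter
-- equality of weights forbids joining. What remains is a run of consecutive letters, one per cell.
grow : ∀ N e m K ℓ pv c → e ≤ m → ℓ + m ≤ suc N → (okJ pv 0 ∧ (ℓ ≤ᵇ c)) ≡ false → okS pv 0 ≡ true →
  C true K ℓ pv c (replicate e N) (replicate m 0) ≡ K (iota ℓ e) (block e m)
grow N zero zero    K ℓ pv c le lt nj ns = refl
grow N zero (suc m) K ℓ pv c le lt nj ns rewrite nj = trans (z--+ _) (dead (λ ms → K ms ∘ (0 ∷_)) (suc ℓ) c [] m)
grow N (suc e) (suc m) K ℓ pv c (s≤s le) lt nj ns rewrite nj | ns | ≤ᵇ-true {ℓ} {N} (≤-trans (m≤m+n ℓ m) (≤-pred (≤-trans (≤-reflexive (sym (+-suc ℓ m))) lt))) = trans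
  (cong₂ (λ a b → (a - 0ℤ) +ᶻ b) (dead (λ ms → K ms ∘ (0 ∷_)) (suc ℓ) c (N ∷ replicate e N) m)
    (grow N e m (λ ms → K (ℓ ∷ ms) ∘ (1 ∷_)) (suc ℓ) (prev 0 true) N le (≤-trans (≤-reflexive (sym (+-suc ℓ m))) lt) refl refl))
  (ℤₚ.+-identityˡ _)

okS-true : ∀ b b' → okS (prev b true) b' ≡ true
okS-true b b' with b ≡ᵇ b'
... | true  = refl
... | false = refl

-- The bounds ℓ, ℓ+1, ... leave no choice: an absent letter would let its own bound pass, and the
-- current bound already excludes joining.
fill : ∀ N β₀ e m K ℓ pv c → e ≤ m → ℓ + (length β₀ + m) ≤ suc N → c < ℓ → (∀ b → okS pv b ≡ true) →
  C true K ℓ pv c (iota ℓ (length β₀) ++ replicate e N) (β₀ ++ replicate m 0) ≡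
  K (iota ℓ (length β₀ + e)) (map suc β₀ ++ block e m)
fill N [] e m K ℓ pv c le lt c<ℓ ns = grow N e m K ℓ pv c le lt (trans (cong (okJ pv 0 ∧_) (≤ᵇ-false c<ℓ)) (∧f (okJ pv 0))) (ns 0)
  where
  ∧f : ∀ b → (b ∧ false) ≡ false
  ∧f true  = refl
  ∧f false = refl
fill N (b ∷ β₀) e m K ℓ pv c le lt c<ℓ ns rewrite ns b | ≤ᵇ-true (≤-refl {ℓ}) | ≤ᵇ-false c<ℓ = trans
  (cong₂ _+ᶻ_
    (cong₂ _-_ (C-zero true (λ ms → K ms ∘ (b ∷_)) (suc ℓ) (prev b false) c ℓ (iota (suc ℓ) (length β₀) ++ replicate e N) (β₀ ++ replicate m 0) (n<1+n ℓ))
      (wf (okJ pv b)))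
    (fill N β₀ e m (λ ms → K (ℓ ∷ ms) ∘ (suc b ∷_)) (suc ℓ) (prev b true) ℓ le
      (≤-trans (≤-reflexive (sym (+-suc ℓ (length β₀ + m)))) lt) (n<1+n ℓ) (okS-true b)))
  (ℤₚ.+-identityˡ _)
  where
  wf : ∀ p {z} → when (p ∧ false) z ≡ 0ℤ
  wf true  = refl
  wf false = refl

-- The column heights from right to left, that is, the conjugate partition in increasing order.
heights : List ℕ → List ℕ
heights []       = []
heights (a ∷ λ') = replicate (a ∸ head₀ λ') 1 ++ map suc (heights λ')

stack : ℕ → List ℕ → List ℕ → List ℕ
stack N []       β = β
stack N (h ∷ hs) β = stack N hs (β ⊕ block h N)

data Heights (N : ℕ) : ℕ → List ℕ → Set where
  []  : ∀ {r} → Heights N r []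
  _∷_ : ∀ {r h hs} → r ≤ h × h ≤ N → Heights N h hs → Heights N r (h ∷ hs)

iota-length : ∀ ℓ r → length (iota ℓ r) ≡ r
iota-length ℓ zero    = refl
iota-length ℓ (suc r) = cong suc (iota-length (suc ℓ) r)

private
  map-suc-⊕ : ∀ β₀ e m → map suc β₀ ++ block e m ≡ (β₀ ++ replicate m 0) ⊕ block (length β₀ + e) (length β₀ + m)
  map-suc-⊕ []       zero    zero    = refl
  map-suc-⊕ []       zero    (suc m) = cong (0 ∷_) (map-suc-⊕ [] zero m)
  map-suc-⊕ []       (suc e) zero    = refl
  map-suc-⊕ []       (suc e) (suc m) = cong (1 ∷_) (map-suc-⊕ [] e m)
  map-suc-⊕ (b ∷ β₀) e       m       = cong (suc b ∷_) (map-suc-⊕ β₀ e m)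

  block-split : ∀ e m → e ≤ m → ∃ λ β₁ → block e m ≡ β₁ ++ replicate (m ∸ e) 0 × length β₁ ≡ e
  block-split zero    m       le = [] , refl , refl
  block-split (suc e) (suc m) (s≤s le) with block-split e m le
  ... | β₁ , q , r = 1 ∷ β₁ , cong (1 ∷_) q , cong suc r

-- In the surviving tableau a column of height h is 1, 2, ..., h. Its minima are again of the form
-- `iota 1 h`, and as nothing joins, the sign is +1.
Φ-stack : ∀ N hs L r β₀ m → Heights N r hs → length β₀ ≡ r → r + m ≡ N →
  Φ true N hs L (iota 1 r) (β₀ ++ replicate m 0) ≡ L (stack N hs (β₀ ++ replicate m 0))
Φ-stack N []       L r β₀ m []                  refl eN = refl
Φ-stack N (h ∷ hs) L r β₀ m ((r≤h , h≤N) ∷ H) refl refl = trans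
  (cong (λ z → C true (Φ true N hs L) 1 free 0 (iota 1 r ++ replicate (h ∸ z) N) (β₀ ++ replicate m 0)) (iota-length 1 r))
  (trans (fill N β₀ e m (Φ true N hs L) 1 free 0 e≤m ≤-refl (s≤s z≤n) (λ _ → refl))
  (trans (cong₂ (Φ true N hs L) (cong (iota 1) re≡h) splitEq)
  (trans (Φ-stack N hs L h β₁ (m ∸ e) H lenβ₁ hN)
    (cong (λ z → L (stack N hs z)) (trans (sym splitEq) (trans (map-suc-⊕ β₀ e m) (cong (λ z → (β₀ ++ replicate m 0) ⊕ block z N) re≡h)))))))
  where
  e = h ∸ r
  re≡h : r + e ≡ h
  re≡h = m+[n∸m]≡n r≤h
  e≤m : e ≤ m
  e≤m = +-cancelˡ-≤ r e m (≤-trans (≤-reflexive re≡h) h≤N)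
  sp = block-split e m e≤m
  β₁ = map suc β₀ ++ proj₁ sp
  lenβ₁ : length β₁ ≡ h
  lenβ₁ = trans (Lₚ.length-++ (map suc β₀)) (trans (cong₂ _+_ (Lₚ.length-map suc β₀) (proj₂ (proj₂ sp))) re≡h)
  splitEq : map suc β₀ ++ block e m ≡ β₁ ++ replicate (m ∸ e) 0
  splitEq = trans (cong (map suc β₀ ++_) (proj₁ (proj₂ sp))) (sym (Lₚ.++-assoc (map suc β₀) (proj₁ sp) _))
  hN : h + (m ∸ e) ≡ N
  hN = trans (cong (_+ (m ∸ e)) (sym re≡h)) (trans (+-assoc r e (m ∸ e)) (cong (λ z → r + z) (m+[n∸m]≡n e≤m)))

heights-length : ∀ λ' → Decr λ' → length (heights λ') ≡ head₀ λ'
heights-length []       d = refl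
heights-length (a ∷ λ') (h≤a , d) = trans (Lₚ.length-++ (replicate (a ∸ head₀ λ') 1))
  (trans (cong₂ _+_ (Lₚ.length-replicate (a ∸ head₀ λ')) (trans (Lₚ.length-map suc (heights λ')) (heights-length λ' d)))
    (m∸n+n≡m h≤a))

heights-heights : ∀ λ' → Heights (length λ') 0 (heights λ')
heights-heights []       = []
heights-heights (a ∷ λ') = rep (a ∸ head₀ λ') z≤n
  where
  up′ : ∀ {N r hs} → Heights N r hs → Heights (suc N) (suc r) (map suc hs)
  up′ []              = []
  up′ ((p , q) ∷ H) = (s≤s p , s≤s q) ∷ up′ H
  rep : ∀ j {r} → r ≤ 1 → Heights (suc (length λ')) r (replicate j 1 ++ map suc (heights λ'))
  rep zero    z≤n       = weaken (up′ (heights-heights λ'))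
    where
    weaken : ∀ {N hs} → Heights N 1 hs → Heights N 0 hs
    weaken []            = []
    weaken ((p , q) ∷ H) = (z≤n , q) ∷ H
  rep zero    (s≤s z≤n) = up′ (heights-heights λ')
  rep (suc j) r≤1 = (r≤1 , s≤s z≤n) ∷ rep j (s≤s z≤n)

stack-heights : ∀ λ' → Decr λ' → stack (length λ') (heights λ') (replicate (length λ') 0) ≡ λ'
stack-heights []       d = refl
stack-heights (a ∷ λ') (h≤a , d) = trans (rep (a ∸ head₀ λ') 0 (replicate n 0) (Lₚ.length-replicate n))
  (trans (ups (heights λ') (a ∸ head₀ λ' + 0) (replicate n 0))
    (cong₂ _∷_ (trans (cong₂ _+_ (heights-length λ' d) (+-identityʳ _)) (m+[n∸m]≡n h≤a)) (stack-heights λ' d)))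
  where
  n = length λ'
  ⊕-zero : ∀ β m → length β ≡ m → β ⊕ replicate m 0 ≡ β
  ⊕-zero []      zero    e = refl
  ⊕-zero (b ∷ β) (suc m) e = cong (b ∷_) (⊕-zero β m (suc-injective e))
  rep : ∀ j b β → length β ≡ n → stack (suc n) (replicate j 1 ++ map suc (heights λ')) (b ∷ β) ≡
                   stack (suc n) (map suc (heights λ')) (j + b ∷ β)
  rep zero    b β e = refl
  rep (suc j) b β e = trans (cong (λ z → stack (suc n) (replicate j 1 ++ map suc (heights λ')) (suc b ∷ z)) (⊕-zero β n e))
    (trans (rep j (suc b) β e) (cong (λ z → stack (suc n) (map suc (heights λ')) (z ∷ β)) (+-suc j b)))
  ups : ∀ hs b β → stack (suc n) (map suc hs) (b ∷ β) ≡ length hs + b ∷ stack n hs β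
  ups []       b β = refl
  ups (h ∷ hs) b β = trans (ups hs (suc b) (β ⊕ block h n)) (cong (_∷ stack n hs (β ⊕ block h n)) (+-suc (length hs) b))

G-unit : ∀ L λ' → Decr λ' → AntiBelow (length λ') L → G (length λ') (heights λ') L (replicate (length λ') 0) ≡ L λ'
G-unit L λ' d a = trans (Φ-LR L (length λ') a (heights λ') [] (replicate (length λ') 0) (Lₚ.length-replicate (length λ')))
  (trans (Φ-stack (length λ') (heights λ') L 0 [] (length λ') (heights-heights λ') refl refl)
    (cong L (stack-heights λ' d)))

-- Duplicate-free enumerations

∈-concatMap⁻ : ∀ {A B : Set} (h : A → List B) xs {y} → y ∈ concatMap h xs → ∃ λ x → x ∈ xs × y ∈ h x
∈-concatMap⁻ h (x ∷ xs) p with ∈ₚ.∈-++⁻ (h x) p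
... | inj₁ q = x , here refl , q
... | inj₂ q with ∈-concatMap⁻ h xs q
...   | z , r , s = z , there r , s

∈-concatMap⁺ : ∀ {A B : Set} (h : A → List B) {xs x y} → x ∈ xs → y ∈ h x → y ∈ concatMap h xs
∈-concatMap⁺ h {x ∷ xs} (here refl) q = ∈ₚ.∈-++⁺ˡ q
∈-concatMap⁺ h {x ∷ xs} (there p)   q = ∈ₚ.∈-++⁺ʳ (h x) (∈-concatMap⁺ h p q)

-- The retraction `g` reads off the block to which an element belongs, which makes distinct blocks
-- disjoint.
unique-concatMap : ∀ {A B : Set} (h : A → List B) (g : B → A) → (∀ x y → y ∈ h x → g y ≡ x) →
  (∀ x → Unique (h x)) → ∀ {xs} → Unique xs → Unique (concatMap h xs)
unique-concatMap h g e u [] = []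
unique-concatMap h g e u {x ∷ xs} (n ∷ ns) = Uₚ.++⁺ (u x) (unique-concatMap h g e u ns) disj
  where
  disj : Disjoint (h x) (concatMap h xs)
  disj {y} (p , q) with ∈-concatMap⁻ h xs q
  ... | z , r , s = All.lookup n r (trans (sym (e x y p)) (e z y s))

∑-ext-∈ : ∀ {A : Set} (xs : List A) {f g : A → ℤ} → (∀ x → x ∈ xs → f x ≡ g x) → ∑ xs f ≡ ∑ xs g
∑-ext-∈ xs = ∑-ext-All (All.tabulate id)

∑-single : ∀ {A : Set} (xs : List A) (f : A → ℤ) a → Unique xs → a ∈ xs → (∀ x → x ∈ xs → x ≢ a → f x ≡ 0ℤ) → ∑ xs f ≡ f a
∑-single (x ∷ xs) f a (n ∷ ns) (here refl) h = trans
  (cong (f x +ᶻ_) (trans (∑-ext-∈ xs {g = λ _ → 0ℤ} (λ y q → h y (there q) (λ e → All.lookup n q (sym e)))) (∑-zero xs (λ _ → refl))))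
  (ℤₚ.+-identityʳ _)
∑-single (x ∷ xs) f a (n ∷ ns) (there p) h = trans
  (cong₂ _+ᶻ_ (h x (here refl) (All.lookup n p)) (∑-single xs f a ns p (λ y q → h y (there q))))
  (ℤₚ.+-identityˡ _)

∑-filterᵇ : ∀ {A : Set} (p : A → Bool) xs (f : A → ℤ) → ∑ (filterᵇ p xs) f ≡ ∑ xs (λ x → when (p x) (f x))
∑-filterᵇ p []       f = refl
∑-filterᵇ p (x ∷ xs) f with p x
... | true  = cong (f x +ᶻ_) (∑-filterᵇ p xs f)
... | false = trans (∑-filterᵇ p xs f) (sym (ℤₚ.+-identityˡ _))

steps : ℕ → ℕ → List (ℕ × ℕ)
steps m zero    = (m , 0) ∷ []
steps m (suc k) = (m , suc k) ∷ steps (suc m) k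

graded : List ℕ → ℕ → List (List ℕ × ℕ)
graded []       k = ([] , k) ∷ []
graded (l ∷ λ') k = concatMap (λ p → map (λ s → (proj₁ s ∷ proj₁ p , proj₂ s)) (steps (l ⊔ head₀ (proj₁ p)) (proj₂ p))) (graded λ' k)

above : List ℕ → ℕ → List (List ℕ)
above λ' k = map proj₁ (filterᵇ (λ p → proj₂ p ≡ᵇ 0) (graded λ' k))

up-sum : ∀ F m k → up F m k ≡ ∑ (steps m k) (λ s → F (proj₁ s) (proj₂ s))
up-sum F m zero    = sym (ℤₚ.+-identityʳ _)
up-sum F m (suc k) = cong (F m (suc k) +ᶻ_) (up-sum F (suc m) k)

Q-graded : ∀ F λ' k → Q F λ' k ≡ ∑ (graded λ' k) (λ p → F (proj₁ p) (proj₂ p))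
Q-graded F []       k = sym (ℤₚ.+-identityʳ _)
Q-graded F (l ∷ λ') k = trans (Q-graded (inner l F) λ' k)
  (trans (∑-ext (graded λ' k) (λ p → trans (up-sum (λ a → F (a ∷ proj₁ p)) (l ⊔ head₀ (proj₁ p)) (proj₂ p))
      (sym (∑-map (λ s → (proj₁ s ∷ proj₁ p , proj₂ s)) (steps (l ⊔ head₀ (proj₁ p)) (proj₂ p)) _))))
    (sym (∑-concatMap (λ p → map (λ s → (proj₁ s ∷ proj₁ p , proj₂ s)) (steps (l ⊔ head₀ (proj₁ p)) (proj₂ p))) (graded λ' k) _)))

Q-above : ∀ L λ' k → Q (atZero L) λ' k ≡ ∑ (above λ' k) L
Q-above L λ' k = trans (Q-graded (atZero L) λ' k)
  (trans (∑-ext (graded λ' k) (λ { (ρ , zero) → refl ; (ρ , suc j) → refl }))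
    (trans (sym (∑-filterᵇ (λ p → proj₂ p ≡ᵇ 0) (graded λ' k) (λ p → L (proj₁ p))))
      (sym (∑-map proj₁ (filterᵇ (λ p → proj₂ p ≡ᵇ 0) (graded λ' k)) L))))

steps-∈⁻ : ∀ m k {a j} → (a , j) ∈ steps m k → m ≤ a × a + j ≡ m + k
steps-∈⁻ m zero    (here refl) = ≤-refl , refl
steps-∈⁻ m (suc k) (here refl) = ≤-refl , refl
steps-∈⁻ m (suc k) (there p) with steps-∈⁻ (suc m) k p
... | le , e = <⇒≤ le , trans e (sym (+-suc m k))

steps-∈⁺ : ∀ m k {a j} → m ≤ a → a + j ≡ m + k → (a , j) ∈ steps m k
steps-∈⁺ m k {a} {j} le e with m ≟ a
... | yes refl with +-cancelˡ-≡ m j k e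
steps-∈⁺ m zero    le e | yes refl | refl = here refl
steps-∈⁺ m (suc k) le e | yes refl | refl = here refl
steps-∈⁺ m zero    {a} {j} le e | no ne = ⊥-elim (ne (≤-antisym le
  (≤-trans (m≤m+n a j) (≤-reflexive (trans e (+-identityʳ m))))))
steps-∈⁺ m (suc k) le e | no ne = there (steps-∈⁺ (suc m) k (≤∧≢⇒< le ne) (trans e (+-suc m k)))

steps-unique : ∀ m k → Unique (steps m k)
steps-unique m zero    = [] ∷ []
steps-unique m (suc k) = All.tabulate (λ {x} p e → 1+n≰n (subst (λ z → suc m ≤ proj₁ z) (sym e) (proj₁ (steps-∈⁻ (suc m) k p)))) ∷ steps-unique (suc m) k

-- Above λ ρ says that ρ is a partition containing λ, and strip λ ρ counts the columns of ρ/λ.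

Above : List ℕ → List ℕ → Set
Above []       []      = ⊤
Above []       (_ ∷ _) = ⊥
Above (_ ∷ _)  []      = ⊥
Above (l ∷ λ') (r ∷ ρ) = (l ⊔ head₀ ρ ≤ r) × Above λ' ρ

strip : List ℕ → List ℕ → ℕ
strip []       _       = 0
strip (_ ∷ _)  []      = 0
strip (l ∷ λ') (r ∷ ρ) = (r ∸ (l ⊔ head₀ ρ)) + strip λ' ρ

graded-∈⁻ : ∀ λ' k {ρ j} → (ρ , j) ∈ graded λ' k → Above λ' ρ × strip λ' ρ + j ≡ k
graded-∈⁻ []       k (here refl) = tt , refl
graded-∈⁻ (l ∷ λ') k p with ∈-concatMap⁻ _ (graded λ' k) p
... | (ρ , j) , q , r with ∈ₚ.∈-map⁻ _ r
...   | (a , i) , s , refl with steps-∈⁻ (l ⊔ head₀ ρ) j s | graded-∈⁻ λ' k q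
...     | le , e | ab , e' = (le , ab) , (begin
  (a ∸ m + strip λ' ρ) + i   ≡⟨ cong (_+ i) (+-comm (a ∸ m) (strip λ' ρ)) ⟩
  (strip λ' ρ + (a ∸ m)) + i ≡⟨ +-assoc (strip λ' ρ) (a ∸ m) i ⟩
  strip λ' ρ + ((a ∸ m) + i) ≡⟨ cong (λ z → strip λ' ρ + z) ai ⟩
  strip λ' ρ + j             ≡⟨ e' ⟩
  k ∎)
  where
  open ≡-Reasoning
  m = l ⊔ head₀ ρ
  ai : (a ∸ m) + i ≡ j
  ai = +-cancelˡ-≡ m _ _ (trans (sym (+-assoc m (a ∸ m) i)) (trans (cong (_+ i) (m+[n∸m]≡n le)) e))

graded-∈⁺ : ∀ λ' k {ρ} j → Above λ' ρ → strip λ' ρ + j ≡ k → (ρ , j) ∈ graded λ' k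
graded-∈⁺ []       k {[]}    j ab refl = here refl
graded-∈⁺ (l ∷ λ') k {r ∷ ρ} j (le , ab) e = ∈-concatMap⁺ _
  (graded-∈⁺ λ' k ((r ∸ m) + j) ab (trans (sym (+-assoc (strip λ' ρ) (r ∸ m) j)) (trans (cong (_+ j) (+-comm (strip λ' ρ) (r ∸ m))) e)))
  (∈ₚ.∈-map⁺ _ (steps-∈⁺ m ((r ∸ m) + j) le (trans (cong (_+ j) (sym (m+[n∸m]≡n le))) (+-assoc m (r ∸ m) j))))
  where m = l ⊔ head₀ ρ

graded-unique : ∀ λ' k → Unique (graded λ' k)
graded-unique []       k = [] ∷ []
graded-unique (l ∷ λ') k = unique-concatMap _ back back-ok
  (λ p → Uₚ.map⁺ (λ { refl → refl }) (steps-unique (l ⊔ head₀ (proj₁ p)) (proj₂ p))) (graded-unique λ' k)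
  where
  back : List ℕ × ℕ → List ℕ × ℕ
  back ([] , j)    = [] , j
  back (a ∷ ρ , j) = ρ , (a + j) ∸ (l ⊔ head₀ ρ)
  back-ok : ∀ x y → y ∈ map (λ s → (proj₁ s ∷ proj₁ x , proj₂ s)) (steps (l ⊔ head₀ (proj₁ x)) (proj₂ x)) → back y ≡ x
  back-ok (ρ , j) y p with ∈ₚ.∈-map⁻ _ p
  ... | (a , i) , q , refl = cong (ρ ,_) (trans (cong (_∸ (l ⊔ head₀ ρ)) (proj₂ (steps-∈⁻ (l ⊔ head₀ ρ) j q))) (m+n∸m≡n (l ⊔ head₀ ρ) j))

above-∈⁻ : ∀ λ' k {ρ} → ρ ∈ above λ' k → Above λ' ρ × strip λ' ρ ≡ k
above-∈⁻ λ' k p with ∈ₚ.∈-map⁻ proj₁ p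
... | (ρ , j) , q , refl with ∈ₚ.∈-filter⁻ _ {xs = graded λ' k} q
...   | r , t with ≡ᵇ⇒≡ j 0 t
...     | refl with graded-∈⁻ λ' k r
...       | ab , e = ab , trans (sym (+-identityʳ _)) e

above-∈⁺ : ∀ λ' k {ρ} → Above λ' ρ → strip λ' ρ ≡ k → ρ ∈ above λ' k
above-∈⁺ λ' k ab e = ∈ₚ.∈-map⁺ proj₁ (∈ₚ.∈-filter⁺ _ (graded-∈⁺ λ' k 0 ab (trans (+-identityʳ _) e)) tt)

above-unique : ∀ λ' k → Unique (above λ' k)
above-unique λ' k = inj (Uₚ.filter⁺ _ (graded-unique λ' k)) (λ {x} q → ≡ᵇ⇒≡ (proj₂ x) 0 (proj₂ (∈ₚ.∈-filter⁻ _ {xs = graded λ' k} q)))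
  where
  inj : ∀ {xs : List (List ℕ × ℕ)} → Unique xs → (∀ {x} → x ∈ xs → proj₂ x ≡ 0) → Unique (map proj₁ xs)
  inj [] h = []
  inj {x ∷ xs} (n ∷ ns) h = All.tabulate f ∷ inj ns (λ q → h (there q))
    where
    f : ∀ {ρ} → ρ ∈ map proj₁ xs → proj₁ x ≢ ρ
    f p e with ∈ₚ.∈-map⁻ proj₁ p
    ... | y , q , refl = All.lookup n q (cong₂ _,_ e (trans (h (here refl)) (sym (h (there q)))))

above-length : ∀ λ' ρ → Above λ' ρ → length ρ ≡ length λ'
above-length []       []      ab       = refl
above-length (l ∷ λ') (r ∷ ρ) (_ , ab) = cong suc (above-length λ' ρ ab)

above-decr : ∀ λ' ρ → Above λ' ρ → Decr ρ
above-decr []       []      ab        = tt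
above-decr (l ∷ λ') (r ∷ ρ) (le , ab) = ≤-trans (m≤n⊔m l (head₀ ρ)) le , above-decr λ' ρ ab

-- Iterated Pieri rule

Hs : List ℕ → Fun → Fun
Hs []      L    = L
Hs (k ∷ α) L λ' = H (Hs α L) λ' k

Hs-anti : ∀ {n L} α → AntiBelow n L → AntiBelow n (Hs α L)
Hs-anti []      a = a
Hs-anti (k ∷ α) a = H-anti (Hs-anti α a) k

pieri-above : ∀ L λ' → Decr λ' → AntiBelow (length λ') L → ∀ k → H L λ' k ≡ ∑ (above λ' k) L
pieri-above L λ' d a k = trans (pieri L λ' d a k) (Q-above L λ' k)

chains : List ℕ → List ℕ → List (List (List ℕ))
chains []      λ' = [] ∷ []
chains (k ∷ α) λ' = concatMap (λ ρ → map (ρ ∷_) (chains α ρ)) (above λ' k)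

top : List ℕ → List (List ℕ) → List ℕ
top λ' []      = λ'
top λ' (ρ ∷ χ) = top ρ χ

Hs-chains : ∀ α L λ' → Decr λ' → AntiBelow (length λ') L → Hs α L λ' ≡ ∑ (chains α λ') (λ χ → L (top λ' χ))
Hs-chains []      L λ' d a = sym (ℤₚ.+-identityʳ _)
Hs-chains (k ∷ α) L λ' d a = trans (pieri-above (Hs α L) λ' d (Hs-anti α a) k)
  (trans (∑-ext-∈ (above λ' k) (λ ρ p → let ab = proj₁ (above-∈⁻ λ' k p) in
      trans (Hs-chains α L ρ (above-decr λ' ρ ab) (subst (λ n → AntiBelow n L) (sym (above-length λ' ρ ab)) a))
            (sym (∑-map (ρ ∷_) (chains α ρ) _))))
    (sym (∑-concatMap (λ ρ → map (ρ ∷_) (chains α ρ)) (above λ' k) _)))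

Hs-G : ∀ N hs α L β → Hs α (G N hs L) β ≡ G N hs (Hs α L) β
Hs-G N hs []      L β = refl
Hs-G N hs (k ∷ α) L β = trans (H-ext β (λ β' _ → Hs-G N hs α L β') k) (H-G-comm N hs (Hs α L) β k)

-- A factor h_k absorbed into the functional reappears at the end of α; this is how the parts
-- removed in `leading-zero` are collected into one moment.
Hs-snoc : ∀ α k L β → Hs α (λ β → H L β k) β ≡ Hs (α ++ k ∷ []) L β
Hs-snoc []      k L β = refl
Hs-snoc (j ∷ α) k L β = H-ext β (λ β' _ → Hs-snoc α k L β') j

-- Complete homogeneous moments

data _>ˡ_ : List ℕ → List ℕ → Set where
  this : ∀ {a b ρ τ} → b < a → (a ∷ ρ) >ˡ (b ∷ τ)
  next : ∀ {a ρ τ} → ρ >ˡ τ → (a ∷ ρ) >ˡ (a ∷ τ)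

Dominates : List ℕ → List ℕ → Set
Dominates ρ       []       = ⊤
Dominates []      (_ ∷ _)  = ⊥
Dominates (r ∷ ρ) (l ∷ λ') = l ≤ r × Dominates ρ λ'

private
  ∸-⊔ : ∀ r l h → l ⊔ h ≤ r → r ∸ (l ⊔ h) ≡ r ∸ h → l ≤ h
  ∸-⊔ r l h le e = ≤-trans (m≤m⊔n l h) (≤-reflexive (∸-cancelˡ-≡ le (≤-trans (m≤n⊔m l h) le) e))

strip-≤ : ∀ λ' ρ → Above λ' ρ → strip λ' ρ ≤ head₀ ρ
strip-≤ []       []      ab        = z≤n
strip-≤ (l ∷ λ') (r ∷ ρ) (le , ab) = ≤-trans
  (+-mono-≤ (∸-monoʳ-≤ r (m≤n⊔m l (head₀ ρ))) (strip-≤ λ' ρ ab))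
  (≤-reflexive (m∸n+n≡m (≤-trans (m≤n⊔m l (head₀ ρ)) le)))

-- For partitions, if λ_i exceeded ρ_{i+1}, column λ_i would have height i in both diagrams and miss
-- the skew shape. So if every one of the ρ₁ columns is met, then λ_i ≤ ρ_{i+1} for all i, with 0
-- after the last part.
strip-full : ∀ l λ' r ρ → Above (l ∷ λ') (r ∷ ρ) → strip (l ∷ λ') (r ∷ ρ) ≡ r → Dominates (ρ ++ 0 ∷ []) (l ∷ λ')
strip-full l λ' r ρ (le , ab) e = go λ' ρ ab l≤h (≤-antisym (strip-≤ λ' ρ ab) h≤s)
  where
  h = head₀ ρ
  s = strip λ' ρ
  h≤r : h ≤ r
  h≤r = ≤-trans (m≤n⊔m l h) le
  rr : (r ∸ (l ⊔ h)) + s ≡ (r ∸ h) + h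
  rr = trans e (sym (m∸n+n≡m h≤r))
  d≤ : r ∸ (l ⊔ h) ≤ r ∸ h
  d≤ = ∸-monoʳ-≤ r (m≤n⊔m l h)
  h≤s : h ≤ s
  h≤s = +-cancelˡ-≤ (r ∸ h) h s (≤-trans (≤-reflexive (sym rr)) (+-monoˡ-≤ s d≤))
  l≤h : l ≤ h
  l≤h = ∸-⊔ r l h le (+-cancelʳ-≡ h _ _ (trans (cong (λ z → (r ∸ (l ⊔ h)) + z) (≤-antisym h≤s (strip-≤ λ' ρ ab))) rr))
  go : ∀ λ' ρ → Above λ' ρ → l ≤ head₀ ρ → strip λ' ρ ≡ head₀ ρ → Dominates (ρ ++ 0 ∷ []) (l ∷ λ')
  go []       []       ab le e = le , tt
  go (m ∷ λ') (r ∷ ρ)  ab le e = le , strip-full m λ' r ρ ab e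

dominates-> : ∀ ρ λ' τ → length ρ ≡ length λ' → Dominates ρ λ' → λ' >ˡ τ → ρ >ˡ τ
dominates-> (r ∷ ρ) (l ∷ λ') (t ∷ τ) e (le , d) (this lt) = this (<-≤-trans lt le)
dominates-> (r ∷ ρ) (l ∷ λ') (l ∷ τ) e (le , d) (next g) with l ≟ r
... | yes refl = next (dominates-> ρ λ' τ (suc-injective e) d g)
... | no ne    = this (≤∧≢⇒< le ne)

dominates-≥ : ∀ ρ τ → length ρ ≡ length τ → Dominates ρ τ → ρ ≡ τ ⊎ ρ >ˡ τ
dominates-≥ []      []      e d = inj₁ refl
dominates-≥ (r ∷ ρ) (t ∷ τ) e (le , d) with t ≟ r
... | no ne = inj₂ (this (≤∧≢⇒< le ne))
... | yes refl with dominates-≥ ρ τ (suc-injective e) d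
...   | inj₁ refl = inj₁ refl
...   | inj₂ g    = inj₂ (next g)

init-> : ∀ ρ τ → length ρ ≡ length τ → (ρ ++ 0 ∷ []) >ˡ (τ ++ 0 ∷ []) → ρ >ˡ τ
init-> []      []      e (this ())
init-> []      []      e (next ())
init-> (r ∷ ρ) (t ∷ τ) e (this lt) = this lt
init-> (r ∷ ρ) (r ∷ τ) e (next g)  = next (init-> ρ τ (suc-injective e) g)

private
  above-shift : ∀ k ζ → Decr (k ∷ ζ) → Above (ζ ++ 0 ∷ []) (k ∷ ζ) × strip (ζ ++ 0 ∷ []) (k ∷ ζ) ≡ k
  above-shift k []      d = (z≤n , tt) , +-identityʳ k
  above-shift k (z ∷ ζ) (z≤k , d) with above-shift z ζ d
  ... | ab , e rewrite ⊔-idem z = (z≤k , ab) , trans (cong (λ x → (k ∸ z) + x) e) (m∸n+n≡m z≤k)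

  decr-shift : ∀ ζ → Decr ζ → Decr (ζ ++ 0 ∷ [])
  decr-shift []          d        = z≤n , tt
  decr-shift (z ∷ [])    d        = z≤n , z≤n , tt
  decr-shift (z ∷ y ∷ ζ) (le , d) = le , decr-shift (y ∷ ζ) d

  length-shift : ∀ (ζ : List ℕ) → length (ζ ++ 0 ∷ []) ≡ suc (length ζ)
  length-shift ζ = trans (Lₚ.length-++ ζ) (+-comm (length ζ) 1)

VanishesAbove : Fun → List ℕ → Set
VanishesAbove Ξ τ = ∀ ρ → Decr ρ → length ρ ≡ length τ → ρ >ˡ τ → Ξ ρ ≡ 0ℤ

module _ (Ξ : Fun) (k : ℕ) (ζ : List ℕ) (a : AntiBelow (suc (length ζ)) Ξ) (v : VanishesAbove Ξ (k ∷ ζ)) where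

  private
    -- With k columns met, ρ₁ is at least k. If it is larger, ρ lies lexicographically above k, ζ,
    -- where Ξ vanishes; if it equals k, every column is met and `strip-full` applies.
    support : ∀ λ' → length λ' ≡ suc (length ζ) → ∀ {ρ} → ρ ∈ above λ' k →
      Ξ ρ ≡ 0ℤ ⊎ ∃ λ ρ' → ρ ≡ k ∷ ρ' × length ρ' ≡ length ζ × Decr (k ∷ ρ') × Dominates (ρ' ++ 0 ∷ []) λ'
    support (l ∷ λ') e {ρ} p with above-∈⁻ (l ∷ λ') k p
    support (l ∷ λ') e {r ∷ ρ} p | ab , s with k ≟ r
    ... | yes refl = inj₂ (ρ , refl , suc-injective (trans (above-length (l ∷ λ') (r ∷ ρ) ab) e) ,
                          above-decr (l ∷ λ') (r ∷ ρ) ab , strip-full l λ' r ρ ab s)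
    ... | no ne = inj₁ (v (r ∷ ρ) (above-decr (l ∷ λ') (r ∷ ρ) ab) (trans (above-length (l ∷ λ') (r ∷ ρ) ab) e)
                    (this (≤∧≢⇒< (≤-trans (≤-reflexive (sym s)) (strip-≤ (l ∷ λ') (r ∷ ρ) ab)) ne)))

    rule : ∀ λ' → Decr λ' → length λ' ≡ suc (length ζ) → H Ξ λ' k ≡ ∑ (above λ' k) Ξ
    rule λ' d e = pieri-above Ξ λ' d (subst (λ n → AntiBelow n Ξ) (sym e) a) k

  -- Multiplication by h_k strips the leading part k: the leading exponent k, ζ becomes ζ, 0, and by
  -- `H-leading` the value there is kept.
  H-vanishes : VanishesAbove (λ β → H Ξ β k) (ζ ++ 0 ∷ [])
  H-vanishes λ' d e g = trans (rule λ' d e') (trans (∑-ext-∈ (above λ' k) zero′) (∑-zero (above λ' k) (λ _ → refl)))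
    where
    e' = trans e (length-shift ζ)
    zero′ : ∀ ρ → ρ ∈ above λ' k → Ξ ρ ≡ 0ℤ
    zero′ ρ p with support λ' e' p
    ... | inj₁ z = z
    ... | inj₂ (ρ' , refl , l , dρ , dom) = v (k ∷ ρ') dρ (cong suc l)
          (next (init-> ρ' ζ l (dominates-> (ρ' ++ 0 ∷ []) λ' (ζ ++ 0 ∷ []) (trans (length-shift ρ') (trans (cong suc l) (sym e'))) dom g)))

  H-leading : Decr (k ∷ ζ) → H Ξ (ζ ++ 0 ∷ []) k ≡ Ξ (k ∷ ζ)
  H-leading d = trans (rule λ' (decr-shift ζ (proj₂ d)) (length-shift ζ))
    (∑-single (above λ' k) Ξ (k ∷ ζ) (above-unique λ' k) (above-∈⁺ λ' k (proj₁ sh′) (proj₂ sh′)) other)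
    where
    λ' = ζ ++ 0 ∷ []
    sh′ = above-shift k ζ d
    other : ∀ ρ → ρ ∈ above λ' k → ρ ≢ k ∷ ζ → Ξ ρ ≡ 0ℤ
    other ρ p ne with support λ' (length-shift ζ) p
    ... | inj₁ z = z
    ... | inj₂ (ρ' , refl , l , dρ , dom) with dominates-≥ (ρ' ++ 0 ∷ []) λ' (trans (length-shift ρ') (trans (cong suc l) (sym (length-shift ζ)))) dom
    ...   | inj₁ eq = ⊥-elim (ne (cong (k ∷_) (Lₚ.++-cancelʳ (0 ∷ []) ρ' ζ eq)))
    ...   | inj₂ g  = v (k ∷ ρ') dρ (cong suc l) (next (init-> ρ' ζ l g))

NoMoments : ℕ → Fun → Set
NoMoments n Ξ = ∀ α → Hs α Ξ (replicate n 0) ≡ 0ℤ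

-- Stripping the parts of the leading exponent τ one by one gives Ξ(x^τ) = Ξ(h_τ), a moment. `u`
-- holds the parts still to be stripped; each one stripped adds a zero to the `z` zeros at the end.
leading-zero : ∀ u z Ξ → Decr (u ++ replicate z 0) → AntiBelow (length u + z) Ξ →
  VanishesAbove Ξ (u ++ replicate z 0) → NoMoments (length u + z) Ξ → Ξ (u ++ replicate z 0) ≡ 0ℤ
leading-zero []      z Ξ d a v m = m []
leading-zero (k ∷ u) z Ξ d a v m = trans (sym (H-leading Ξ k ζ a' v d))
  (trans (cong (λ β → H Ξ β k) shiftEq) (leading-zero u (suc z) Ξ' d' (subst (λ n → AntiBelow n Ξ') (sym (+-suc (length u) z)) (H-anti a k)) v' m'))
  where
  ζ = u ++ replicate z 0
  Ξ' : Fun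
  Ξ' β = H Ξ β k
  lenζ : length ζ ≡ length u + z
  lenζ = trans (Lₚ.length-++ u) (cong (λ x → length u + x) (Lₚ.length-replicate z))
  a' : AntiBelow (suc (length ζ)) Ξ
  a' = subst (λ n → AntiBelow (suc n) Ξ) (sym lenζ) a
  rep : ∀ z → replicate z 0 ++ 0 ∷ [] ≡ replicate (suc z) 0
  rep zero    = refl
  rep (suc z) = cong (0 ∷_) (rep z)
  shiftEq : ζ ++ 0 ∷ [] ≡ u ++ replicate (suc z) 0
  shiftEq = trans (Lₚ.++-assoc u (replicate z 0) (0 ∷ [])) (cong (u ++_) (rep z))
  d' : Decr (u ++ replicate (suc z) 0)
  d' = subst Decr shiftEq (decr-shift ζ (proj₂ d))
  v' : VanishesAbove Ξ' (u ++ replicate (suc z) 0)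
  v' = subst (VanishesAbove Ξ') shiftEq (H-vanishes Ξ k ζ a' v)
  m' : NoMoments (length u + suc z) Ξ'
  m' α = trans (cong (λ n → Hs α Ξ' (replicate n 0)) (+-suc (length u) z))
    (trans (Hs-snoc α k Ξ _) (m (α ++ k ∷ [])))

-- Lexicographic order has infinite ascending chains, so tuples with an entry above `B` serve as the
-- base of the descending induction.
lex-induction : ∀ B n (P : List ℕ → Set) → (∀ τ → length τ ≡ n → ¬ All (_≤ B) τ → P τ) →
  (∀ τ → length τ ≡ n → (∀ ρ → length ρ ≡ n → ρ >ˡ τ → P ρ) → P τ) → ∀ τ → length τ ≡ n → P τ
lex-induction B zero    P out st [] e = st [] e (λ _ _ ())
lex-induction B (suc n) P out st (a ∷ τ) e = go (suc B) a (m≤n+m (suc B) a) τ (suc-injective e)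
  where
  -- `d` limits how far the first entry can still grow before it exceeds `B`.
  go : ∀ d a → B < a + d → ∀ τ → length τ ≡ n → P (a ∷ τ)
  go zero    a lt τ e = out (a ∷ τ) (cong suc e)
    (λ { (le ∷ _) → <⇒≱ (<-≤-trans lt (≤-reflexive (+-identityʳ a))) le })
  go (suc d) a lt τ e = lex-induction B n (λ τ → P (a ∷ τ))
    (λ τ e ne → out (a ∷ τ) (cong suc e) (λ { (_ ∷ ps) → ne ps }))
    (λ τ e ih → st (a ∷ τ) (cong suc e) (λ
      { (b ∷ ρ) e' (this lt') → go d b (<-≤-trans lt (≤-trans (≤-reflexive (+-suc a d)) (+-monoˡ-≤ d lt'))) ρ (suc-injective e')
      ; (b ∷ ρ) e' (next g)   → ih ρ (suc-injective e') g }))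
    τ e

no-moments⇒zero : ∀ n B Ξ → AntiBelow n Ξ → NoMoments n Ξ →
  (∀ ρ → Decr ρ → length ρ ≡ n → B < head₀ ρ → Ξ ρ ≡ 0ℤ) → ∀ τ → Decr τ → length τ ≡ n → Ξ τ ≡ 0ℤ
no-moments⇒zero n B Ξ a m big τ d e = lex-induction B n (λ τ → Decr τ → Ξ τ ≡ 0ℤ) out st τ e d
  where
  small : ∀ τ → Decr τ → head₀ τ ≤ B → All (_≤ B) τ
  small []      d le = []
  small (x ∷ τ) d le = le ∷ All.map (λ q → ≤-trans q le) (decr-≤ d)
  out : ∀ τ → length τ ≡ n → ¬ All (_≤ B) τ → Decr τ → Ξ τ ≡ 0ℤ
  out τ e nb d = big τ d e (≰⇒> (λ le → nb (small τ d le)))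
  st : ∀ τ → length τ ≡ n → (∀ ρ → length ρ ≡ n → ρ >ˡ τ → Decr ρ → Ξ ρ ≡ 0ℤ) → Decr τ → Ξ τ ≡ 0ℤ
  st τ refl ih d = subst (λ z → Ξ z ≡ 0ℤ) (Lₚ.++-identityʳ τ)
    (leading-zero τ 0 Ξ (subst Decr (sym (Lₚ.++-identityʳ τ)) d)
      (subst (λ n → AntiBelow n Ξ) (sym (+-identityʳ n)) a)
      (subst (VanishesAbove Ξ) (sym (Lₚ.++-identityʳ τ)) (λ ρ dρ l g → ih ρ l g dρ))
      (subst (λ n → NoMoments n Ξ) (sym (+-identityʳ n)) m))

-- Counting

count-bijection : ∀ {A B : Set} (p : A → Bool) (q : B → Bool) (xs : List A) (ys : List B) (f : B → A) →
  Unique xs → Unique ys →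
  (∀ y → y ∈ ys → T (q y) → f y ∈ xs × T (p (f y))) →
  (∀ x → x ∈ xs → T (p x) → ∃ λ y → y ∈ ys × T (q y) × f y ≡ x) →
  (∀ y y' → y ∈ ys → y' ∈ ys → T (q y) → T (q y') → f y ≡ f y' → y ≡ y') →
  countᵇ p xs ≡ countᵇ q ys
count-bijection p q xs ys f ux uy to from inj = trans
  (↭-length (∼bag⇒↭ (unique∧set⇒bag (Uₚ.filter⁺ _ ux) (uniq (Uₚ.filter⁺ _ uy) (λ m → ∈ₚ.∈-filter⁻ _ {xs = ys} m)) (λ {x} → mk⇔ fwd bwd))))
  (Lₚ.length-map f (filterᵇ q ys))
  where
  fwd : ∀ {x} → x ∈ filterᵇ p xs → x ∈ map f (filterᵇ q ys)
  fwd m with ∈ₚ.∈-filter⁻ _ {xs = xs} m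
  ... | i , t with from _ i t
  ...   | y , j , s , refl = ∈ₚ.∈-map⁺ f (∈ₚ.∈-filter⁺ _ j s)
  bwd : ∀ {x} → x ∈ map f (filterᵇ q ys) → x ∈ filterᵇ p xs
  bwd m with ∈ₚ.∈-map⁻ f m
  ... | y , j , refl with ∈ₚ.∈-filter⁻ _ {xs = ys} j
  ...   | k , s = ∈ₚ.∈-filter⁺ _ (proj₁ (to y k s)) (proj₂ (to y k s))
  uniq : ∀ {zs} → Unique zs → (∀ {y} → y ∈ zs → y ∈ ys × T (q y)) → Unique (map f zs)
  uniq [] h = []
  uniq {z ∷ zs} (n ∷ ns) h = All.tabulate ne ∷ uniq ns (λ m → h (there m))
    where
    ne : ∀ {x} → x ∈ map f zs → f z ≢ x
    ne m e with ∈ₚ.∈-map⁻ f m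
    ... | y , j , refl = All.lookup n j (inj z y (proj₁ (h (here refl))) (proj₁ (h (there j))) (proj₂ (h (here refl))) (proj₂ (h (there j))) e)

∑-count : ∀ {A : Set} (p : A → Bool) xs → + countᵇ p xs ≡ ∑ xs (λ x → if p x then 1ℤ else 0ℤ)
∑-count p []       = refl
∑-count p (x ∷ xs) with p x
... | true  = cong (1ℤ +ᶻ_) (∑-count p xs)
... | false = trans (∑-count p xs) (sym (ℤₚ.+-identityˡ _))

-- Boolean tests as propositions

∧-T : ∀ {a b} → T (a ∧ b) → T a × T b
∧-T {true} t = tt , t

T-∧ : ∀ {a b} → T a → T b → T (a ∧ b)
T-∧ {true} _ t = t

imp-T : ∀ {a b} → T (not a ∨ b) → T a → T b
imp-T {true} t _ = t

T-imp : ∀ {a b} → (T a → T b) → T (not a ∨ b)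
T-imp {true}  f = f tt
T-imp {false} f = tt

∨-T : ∀ {a b} → T (a ∨ b) → T a ⊎ T b
∨-T {true}  t = inj₁ tt
∨-T {false} t = inj₂ t

T-∨ˡ : ∀ {a b} → T a → T (a ∨ b)
T-∨ˡ {true} t = tt

T-∨ʳ : ∀ {a b} → T b → T (a ∨ b)
T-∨ʳ {true}  t = tt
T-∨ʳ {false} t = t

T-≡ : ∀ {a b} → (T a → T b) → (T b → T a) → a ≡ b
T-≡ {true}  {true}  f g = refl
T-≡ {false} {false} f g = refl
T-≡ {true}  {false} f g = ⊥-elim (f tt)
T-≡ {false} {true}  f g = ⊥-elim (g tt)

all-T : ∀ {A : Set} (p : A → Bool) {xs x} → T (all p xs) → x ∈ xs → T (p x)
all-T p {y ∷ xs} t (here refl) = proj₁ (∧-T {p y} t)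
all-T p {y ∷ xs} t (there m)   = all-T p (proj₂ (∧-T {p y} t)) m

T-all : ∀ {A : Set} (p : A → Bool) xs → (∀ x → x ∈ xs → T (p x)) → T (all p xs)
T-all p []       h = tt
T-all p (x ∷ xs) h = T-∧ (h x (here refl)) (T-all p xs (λ y m → h y (there m)))

any-T : ∀ {A : Set} (p : A → Bool) xs → T (any p xs) → ∃ λ x → x ∈ xs × T (p x)
any-T p (x ∷ xs) t with ∨-T {p x} t
... | inj₁ s = x , here refl , s
... | inj₂ s with any-T p xs s
...   | y , m , r = y , there m , r

T-any : ∀ {A : Set} (p : A → Bool) {xs x} → x ∈ xs → T (p x) → T (any p xs)
T-any p (here refl) t = T-∨ˡ t
T-any p {y ∷ xs} (there m) t = T-∨ʳ {p y} (T-any p m t)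

eqListᵇ-T : ∀ xs ys → T (eqListᵇ xs ys) → xs ≡ ys
eqListᵇ-T xs ys t = toWitness t

T-eqListᵇ : ∀ {xs ys} → xs ≡ ys → T (eqListᵇ xs ys)
T-eqListᵇ e = fromWitness e

-- Fillings of a set of cells

tabulate′ : {A : Set} → List Cell → (Cell → A) → List (Cell × A)
tabulate′ cs φ = map (λ c → (c , φ c)) cs

eqCell : Cell → Cell → Bool
eqCell (r , c) (r' , c') = (r ≡ᵇ r') ∧ (c ≡ᵇ c')

look : {A : Set} → A → List (Cell × A) → Cell → A
look d []            x = d
look d ((c , a) ∷ F) x = if eqCell c x then a else look d F x

eqCell-T : ∀ c c' → T (eqCell c c') → c ≡ c'
eqCell-T (r , c) (r' , c') t with ∧-T {r ≡ᵇ r'} t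
... | t₁ , t₂ = cong₂ _,_ (≡ᵇ⇒≡ r r' t₁) (≡ᵇ⇒≡ c c' t₂)

eqCell-refl : ∀ c → eqCell c c ≡ true
eqCell-refl (r , c) rewrite ≡ᵇ-≡ r | ≡ᵇ-≡ c = refl

eqCell-≢ : ∀ {c c'} → c ≢ c' → eqCell c c' ≡ false
eqCell-≢ {c} {c'} ne with eqCell c c' in eq
... | false = refl
... | true  = ⊥-elim (ne (eqCell-T c c' (subst T (sym eq) tt)))

look-head : ∀ {A : Set} (d : A) c a F → look d ((c , a) ∷ F) c ≡ a
look-head d c a F rewrite eqCell-refl c = refl

look-tail : ∀ {A : Set} (d : A) {c a F x} → c ≢ x → look d ((c , a) ∷ F) x ≡ look d F x
look-tail d ne rewrite eqCell-≢ ne = refl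

tabulate′-cong : ∀ {A : Set} cs {φ ψ : Cell → A} → (∀ c → c ∈ cs → φ c ≡ ψ c) → tabulate′ cs φ ≡ tabulate′ cs ψ
tabulate′-cong []       h = refl
tabulate′-cong (c ∷ cs) h = cong₂ _∷_ (cong (c ,_) (h c (here refl))) (tabulate′-cong cs (λ x m → h x (there m)))

tabulate′-≡ : ∀ {A : Set} cs {φ ψ : Cell → A} → tabulate′ cs φ ≡ tabulate′ cs ψ → ∀ c → c ∈ cs → φ c ≡ ψ c
tabulate′-≡ (c ∷ cs) e .c (here refl) = cong proj₂ (Lₚ.∷-injectiveˡ e)
tabulate′-≡ (c ∷ cs) e x  (there m)   = tabulate′-≡ cs (Lₚ.∷-injectiveʳ e) x m

look-tabulate : ∀ {A : Set} (d : A) cs φ x → x ∈ cs → look d (tabulate′ cs φ) x ≡ φ x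
look-tabulate d (c ∷ cs) φ x m with eqCell c x in eq
... | true = cong φ (eqCell-T c x (subst T (sym eq) tt))
look-tabulate d (c ∷ cs) φ .c (here refl) | false with trans (sym (eqCell-refl c)) eq
... | ()
look-tabulate d (c ∷ cs) φ x (there m) | false = look-tabulate d cs φ x m

look-∉ : ∀ {A : Set} (d : A) cs φ x → ¬ (x ∈ cs) → look d (tabulate′ cs φ) x ≡ d
look-∉ d []       φ x n = refl
look-∉ d (c ∷ cs) φ x n rewrite eqCell-≢ {c} {x} (λ e → n (here (sym e))) = look-∉ d cs φ x (λ m → n (there m))

module _ {A : Set} where

  assignments-∈⁺ : ∀ cs (vs : List A) φ → (∀ c → c ∈ cs → φ c ∈ vs) → tabulate′ cs φ ∈ assignments cs vs
  assignments-∈⁺ []       vs φ h = here refl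
  assignments-∈⁺ (c ∷ cs) vs φ h = ∈-concatMap⁺ _ (h c (here refl))
    (∈ₚ.∈-map⁺ _ (assignments-∈⁺ cs vs φ (λ x m → h x (there m))))

  assignments-∈⁻ : ∀ (d : A) cs (vs : List A) → Unique cs → ∀ {F} → F ∈ assignments cs vs →
    F ≡ tabulate′ cs (look d F) × (∀ c → c ∈ cs → look d F c ∈ vs)
  assignments-∈⁻ d []       vs u (here refl) = refl , λ _ ()
  assignments-∈⁻ d (c ∷ cs) vs (n ∷ u) m with ∈-concatMap⁻ _ vs m
  ... | v , v∈ , m' with ∈ₚ.∈-map⁻ _ m'
  ...   | F , F∈ , refl with assignments-∈⁻ d cs vs u F∈
  ...     | e , h = cong₂ _∷_ (cong (c ,_) (sym (look-head d c v F)))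
                      (trans e (tabulate′-cong cs (λ x m → sym (look-tail d {c} {v} {F} {x} (All.lookup n m))))) , h'
    where
    h' : ∀ x → x ∈ c ∷ cs → look d ((c , v) ∷ F) x ∈ vs
    h' x (here refl) = subst (_∈ vs) (sym (look-head d c v F)) v∈
    h' x (there m)   = subst (_∈ vs) (sym (look-tail d {c} {v} {F} {x} (All.lookup n m))) (h x m)

  assignments-unique : ∀ cs (vs : List A) → Unique vs → Unique (assignments cs vs)
  assignments-unique []       vs u = [] ∷ []
  assignments-unique (c ∷ cs) []         u = []
  assignments-unique (c ∷ cs) (v₀ ∷ vs) u = unique-concatMap _ back ok
    (λ v → Uₚ.map⁺ (λ { refl → refl }) (assignments-unique cs (v₀ ∷ vs) u)) u
    where
    back : List (Cell × A) → A
    back []            = v₀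
    back ((_ , v) ∷ _) = v
    ok : ∀ v F → F ∈ map ((c , v) ∷_) (assignments cs (v₀ ∷ vs)) → back F ≡ v
    ok v F m with ∈ₚ.∈-map⁻ _ m
    ... | _ , _ , refl = refl

range1-∈⁺ : ∀ {n i} → 1 ≤ i → i ≤ n → i ∈ range1 n
range1-∈⁺ {n} {suc i} _ le = ∈ₚ.∈-map⁺ suc (∈ₚ.∈-upTo⁺ le)

range1-∈⁻ : ∀ {n i} → i ∈ range1 n → 1 ≤ i × i ≤ n
range1-∈⁻ m with ∈ₚ.∈-map⁻ suc m
... | j , q , refl = s≤s z≤n , ∈ₚ.∈-upTo⁻ q

range1-unique : ∀ n → Unique (range1 n)
range1-unique n = Uₚ.map⁺ suc-injective (Uₚ.upTo⁺ n)

part-beyond : ∀ p {i} → length p < i → part p i ≡ 0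
part-beyond []       lt = refl
part-beyond (x ∷ xs) {suc (suc i)} (s≤s lt) = part-beyond xs lt
part-beyond (x ∷ xs) {suc zero}    (s≤s ())

module _ (nu la : List ℕ) where

  skewCells-∈⁻ : ∀ {r c} → (r , c) ∈ skewCells nu la → part la r < c × c ≤ part nu r
  skewCells-∈⁻ m with ∈-concatMap⁻ _ (range1 (length nu)) m
  ... | r , _ , m' with ∈ₚ.∈-map⁻ _ m'
  ...   | k , k∈ , refl with range1-∈⁻ k∈
  ...     | 1≤k , k≤ = ≤-trans (≤-reflexive (+-comm 1 (part la r))) (+-monoʳ-≤ (part la r) 1≤k) ,
              ≤-trans (+-monoʳ-≤ (part la r) k≤) (≤-reflexive (m+[n∸m]≡n (lt 1≤k k≤)))
    where
    lt : 1 ≤ k → k ≤ part nu r ∸ part la r → part la r ≤ part nu r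
    lt p q = <⇒≤ (m∸n≢0⇒n<m (λ e → <⇒≱ (≤-trans p q) (≤-reflexive e)))

  skewCells-∈⁺ : ∀ {r c} → part la r < c → c ≤ part nu r → (r , c) ∈ skewCells nu la
  skewCells-∈⁺ {zero}  {c} lt le = ⊥-elim (<⇒≱ (≤-<-trans z≤n lt) (≤-trans le (≤-reflexive (p0 nu))))
    where
    p0 : ∀ p → part p 0 ≡ 0
    p0 []      = refl
    p0 (_ ∷ _) = refl
  skewCells-∈⁺ {suc i} {c} lt le = ∈-concatMap⁺ (λ r → map (λ k → (r , part la r + k)) (range1 (part nu r ∸ part la r)))
    (range1-∈⁺ (s≤s z≤n) (≮⇒≥ (λ q → <⇒≱ (≤-<-trans z≤n lt) (≤-trans le (≤-reflexive (part-beyond nu q))))))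
    (subst (λ z → (suc i , z) ∈ map (λ k → (suc i , l + k)) (range1 (part nu (suc i) ∸ l))) (m+[n∸m]≡n (<⇒≤ lt))
      (∈ₚ.∈-map⁺ (λ k → (suc i , l + k)) (range1-∈⁺ (m<n⇒0<n∸m lt) (∸-monoˡ-≤ l le))))
    where l = part la (suc i)

  skewCells-unique : Unique (skewCells nu la)
  skewCells-unique = unique-concatMap _ proj₁ ok
    (λ r → Uₚ.map⁺ (λ e → +-cancelˡ-≡ (part la r) _ _ (cong proj₂ e)) (range1-unique (part nu r ∸ part la r)))
    (range1-unique (length nu))
    where
    ok : ∀ r x → x ∈ map (λ k → (r , part la r + k)) (range1 (part nu r ∸ part la r)) → proj₁ x ≡ r
    ok r x m with ∈ₚ.∈-map⁻ _ m
    ... | _ , _ , refl = refl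

-- Reverse plane partitions are chains of partitions

cnt : (ℕ → Bool) → ℕ → ℕ
cnt p zero    = 0
cnt p (suc m) = cnt p m + (if p (suc m) then 1 else 0)

countᵇ-range1 : ∀ p m → countᵇ p (range1 m) ≡ cnt p m
countᵇ-range1 p zero    = refl
countᵇ-range1 p (suc m) = trans (cong (countᵇ p) (trans (cong (map suc) (sym (Lₚ.upTo-∷ʳ m))) (Lₚ.map-++ suc (upTo m) (m ∷ []))))
  (trans (cong length (Lₚ.filter-++ _ (range1 m) (suc m ∷ [])))
  (trans (Lₚ.length-++ (filterᵇ p (range1 m))) (cong₂ _+_ (countᵇ-range1 p m) last)))
  where
  last : length (filterᵇ p (suc m ∷ [])) ≡ (if p (suc m) then 1 else 0)
  last with p (suc m)
  ... | true  = refl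
  ... | false = refl

cnt-cong : ∀ {p q} m → (∀ k → p k ≡ q k) → cnt p m ≡ cnt q m
cnt-cong zero    h = refl
cnt-cong (suc m) h = cong₂ (λ a b → a + (if b then 1 else 0)) (cnt-cong m h) (h (suc m))

cnt-+ : ∀ p q r m → (∀ c → (if p c then 1 else 0) ≡ (if q c then 1 else 0) + (if r c then 1 else 0)) → cnt p m ≡ cnt q m + cnt r m
cnt-+ p q r zero    h = refl
cnt-+ p q r (suc m) h = trans (cong₂ _+_ (cnt-+ p q r m h) (h (suc m)))
  (interchange (cnt q m) (cnt r m) (if q (suc m) then 1 else 0) (if r (suc m) then 1 else 0))

¬T : ∀ {b} → ¬ T b → b ≡ false
¬T {true}  n = ⊥-elim (n tt)
¬T {false} n = refl

T⇒≡ : ∀ {b} → T b → b ≡ true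
T⇒≡ {true} t = refl

cnt-beyond : ∀ p h m → h ≤ m → (∀ c → h < c → ¬ T (p c)) → cnt p m ≡ cnt p h
cnt-beyond p h m le n with h ≟ m
... | yes refl = refl
cnt-beyond p h zero    z≤n n | no ne = ⊥-elim (ne refl)
cnt-beyond p h (suc m) le n | no ne rewrite ¬T (n (suc m) (≤∧≢⇒< le ne)) =
  trans (+-identityʳ _) (cnt-beyond p h m (≤-pred (≤∧≢⇒< le ne)) n)

between : ℕ → ℕ → ℕ → Bool
between l h c = (l <ᵇ c) ∧ (c ≤ᵇ h)

T-between : ∀ {l h c} → l < c → c ≤ h → T (between l h c)
T-between p q = T-∧ (<⇒<ᵇ p) (≤⇒≤ᵇ q)

between-T : ∀ l h c → T (between l h c) → l < c × c ≤ h
between-T l h c t with ∧-T {l <ᵇ c} t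
... | a , b = <ᵇ⇒< l c a , ≤ᵇ⇒≤ c h b

cnt-between : ∀ l h m → h ≤ m → cnt (between l h) m ≡ h ∸ l
cnt-between l h m le = trans (cnt-beyond (between l h) h m le (λ c lt t → <⇒≱ lt (proj₂ (between-T l h c t)))) (low h ≤-refl)
  where
  low : ∀ k → k ≤ h → cnt (between l h) k ≡ k ∸ l
  low zero    le = sym (0∸n≡0 l)
  low (suc k) le with l ≤? k
  ... | yes l≤k rewrite T⇒≡ (T-between (s≤s l≤k) le) = trans (cong (_+ 1) (low k (<⇒≤ le)))
        (trans (+-comm (k ∸ l) 1) (sym (+-∸-assoc 1 l≤k)))
  ... | no l≰k rewrite ¬T {between l h (suc k)} (λ t → l≰k (≤-pred (proj₁ (between-T l h (suc k) t)))) =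
        trans (+-identityʳ _) (trans (low k (<⇒≤ le))
          (trans (m≤n⇒m∸n≡0 (<⇒≤ (≰⇒> l≰k))) (sym (m≤n⇒m∸n≡0 (≰⇒> l≰k)))))

hit : List ℕ → List ℕ → ℕ → Bool
hit []       _        c = false
hit (_ ∷ _)  []       c = false
hit (l ∷ lo) (h ∷ hi) c = between l h c ∨ hit lo hi c

hit-≤ : ∀ lo hi c → Above lo hi → T (hit lo hi c) → c ≤ head₀ hi
hit-≤ (l ∷ lo) (h ∷ hi) c (le , ab) t with ∨-T {between l h c} t
... | inj₁ s = proj₂ (between-T l h c s)
... | inj₂ s = ≤-trans (hit-≤ lo hi c ab s) (≤-trans (m≤n⊔m l (head₀ hi)) le)

-- Let g be the second part of `hi`. A column of the first row up to g also meets the next row,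
-- since `lo` decreases, and no later row reaches beyond g. So the first row contributes exactly the
-- columns beyond the larger of l and g.
strip-count : ∀ lo hi m → Decr lo → Above lo hi → head₀ hi ≤ m → cnt (hit lo hi) m ≡ strip lo hi
strip-count []       []       m d ab hm = zero′ m
  where
  zero′ : ∀ m → cnt (λ _ → false) m ≡ 0
  zero′ zero    = refl
  zero′ (suc m) = trans (+-identityʳ _) (zero′ m)
strip-count (l ∷ lo) (h ∷ hi) m (hl , d) (le , ab) hm = trans
  (cnt-+ (hit (l ∷ lo) (h ∷ hi)) (between (l ⊔ g) h) (hit lo hi) m ind)
  (cong₂ _+_ (cnt-between (l ⊔ g) h m hm) (strip-count lo hi m d ab (≤-trans g≤h hm)))
  where
  g = head₀ hi
  g≤h : g ≤ h
  g≤h = ≤-trans (m≤n⊔m l g) le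
  first : ∀ lo hi {c} → Above lo hi → head₀ lo < c → c ≤ head₀ hi → T (hit lo hi c)
  first []       []       ab lt le = ⊥-elim (<⇒≱ lt le)
  first (l ∷ lo) (h ∷ hi) ab lt le = T-∨ˡ (T-between lt le)
  ind : ∀ c → (if hit (l ∷ lo) (h ∷ hi) c then 1 else 0) ≡ (if between (l ⊔ g) h c then 1 else 0) + (if hit lo hi c then 1 else 0)
  ind c with c ≤? g
  ... | yes c≤g rewrite ¬T {between (l ⊔ g) h c} (λ t → <⇒≱ (proj₁ (between-T (l ⊔ g) h c t)) (≤-trans c≤g (m≤n⊔m l g))) =
        cong (if_then 1 else 0) (T-≡ {between l h c ∨ hit lo hi c}
          (λ t → drop (∨-T {between l h c} t)) (T-∨ʳ {between l h c}))
    where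
    drop : T (between l h c) ⊎ T (hit lo hi c) → T (hit lo hi c)
    drop (inj₁ s) = first lo hi ab (≤-<-trans hl (proj₁ (between-T l h c s))) c≤g
    drop (inj₂ s) = s
  ... | no c≰g rewrite ¬T {hit lo hi c} (λ t → c≰g (hit-≤ lo hi c ab t)) = trans
        (cong (if_then 1 else 0) (T-≡ {between l h c ∨ false} {between (l ⊔ g) h c}
          (λ t → to (∨-T {between l h c} t))
          (λ t → T-∨ˡ (T-between (≤-<-trans (m≤m⊔n l g) (proj₁ (between-T (l ⊔ g) h c t))) (proj₂ (between-T (l ⊔ g) h c t))))))
        (sym (+-identityʳ _))
    where
    to : T (between l h c) ⊎ ⊥ → T (between (l ⊔ g) h c)
    to (inj₁ s) = T-between (⊔-lub (proj₁ (between-T l h c s)) (≰⇒> c≰g)) (proj₂ (between-T l h c s))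

-- Chains of partitions and the values of cells

Mono : List ℕ → List (List ℕ) → Set
Mono λ' []      = ⊤
Mono λ' (ρ ∷ χ) = Above λ' ρ × Mono ρ χ

strips : List ℕ → List (List ℕ) → List ℕ
strips λ' []      = []
strips λ' (ρ ∷ χ) = strip λ' ρ ∷ strips ρ χ

chains-∈⁻ : ∀ α λ' {χ} → χ ∈ chains α λ' → Mono λ' χ × strips λ' χ ≡ α
chains-∈⁻ []      λ' (here refl) = tt , refl
chains-∈⁻ (k ∷ α) λ' m with ∈-concatMap⁻ _ (above λ' k) m
... | ρ , ρ∈ , m' with ∈ₚ.∈-map⁻ _ m'
...   | χ , χ∈ , refl with above-∈⁻ λ' k ρ∈ | chains-∈⁻ α ρ χ∈
...     | ab , e | mo , e' = (ab , mo) , cong₂ _∷_ e e'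

chains-∈⁺ : ∀ λ' χ → Mono λ' χ → χ ∈ chains (strips λ' χ) λ'
chains-∈⁺ λ' []      mo        = here refl
chains-∈⁺ λ' (ρ ∷ χ) (ab , mo) = ∈-concatMap⁺ _ (above-∈⁺ λ' _ ab refl) (∈ₚ.∈-map⁺ _ (chains-∈⁺ ρ χ mo))

chains-unique : ∀ α λ' → Unique (chains α λ')
chains-unique []      λ' = [] ∷ []
chains-unique (k ∷ α) λ' = unique-concatMap _ back ok (λ ρ → Uₚ.map⁺ (λ { refl → refl }) (chains-unique α ρ)) (above-unique λ' k)
  where
  back : List (List ℕ) → List ℕ
  back []      = []
  back (ρ ∷ _) = ρ
  ok : ∀ ρ χ → χ ∈ map (ρ ∷_) (chains α ρ) → back χ ≡ ρ
  ok ρ χ m with ∈ₚ.∈-map⁻ _ m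
  ... | _ , _ , refl = refl

at : List ℕ → List (List ℕ) → ℕ → List ℕ
at λ' χ       zero    = λ'
at λ' []      (suc i) = λ'
at λ' (ρ ∷ χ) (suc i) = at ρ χ i

-- The index of the first partition of the chain that contains the cell; the default 1 gives a cell
-- in none of them the length of the chain plus 1.
valc : List (List ℕ) → Cell → ℕ
valc []      _       = 1
valc (ρ ∷ χ) (r , c) = if c ≤ᵇ part ρ r then 1 else suc (valc χ (r , c))

part-0 : ∀ p → part p 0 ≡ 0
part-0 []      = refl
part-0 (_ ∷ _) = refl

above-part : ∀ λ' ρ → Above λ' ρ → ∀ r → part λ' r ≤ part ρ r
above-part []       []      ab        r             = z≤n
above-part (l ∷ λ') (x ∷ ρ) (le , ab) zero          = z≤n
above-part (l ∷ λ') (x ∷ ρ) (le , ab) (suc zero)    = ≤-trans (m≤m⊔n l _) le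
above-part (l ∷ λ') (x ∷ ρ) (le , ab) (suc (suc r)) = above-part λ' ρ ab (suc r)

decr-part : ∀ ρ → Decr ρ → ∀ i → part ρ (suc (suc i)) ≤ part ρ (suc i)
decr-part []      d        i       = z≤n
decr-part (x ∷ ρ) (le , d) zero    = ≤-trans (≤-reflexive (h ρ)) le
  where
  h : ∀ ρ → part ρ 1 ≡ head₀ ρ
  h []      = refl
  h (_ ∷ _) = refl
decr-part (x ∷ ρ) (le , d) (suc i) = decr-part ρ d i

antitone : ∀ (f : ℕ → ℕ) → (∀ i → f (suc (suc i)) ≤ f (suc i)) → ∀ {r r'} → 1 ≤ r → r ≤ r' → f r' ≤ f r
antitone f h {suc r} {r'} (s≤s z≤n) le = go r' le
  where
  go : ∀ r' → suc r ≤ r' → f r' ≤ f (suc r)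
  go r' le with suc r ≟ r'
  ... | yes refl = ≤-refl
  go (suc zero) (s≤s z≤n) | no ne = ⊥-elim (ne refl)
  go (suc (suc r')) le    | no ne = ≤-trans (h r') (go (suc r') (≤-pred (≤∧≢⇒< le ne)))

mono-at : ∀ λ' χ → Mono λ' χ → ∀ i r → part λ' r ≤ part (at λ' χ i) r
mono-at λ' χ       mo        zero    r = ≤-refl
mono-at λ' []      mo        (suc i) r = ≤-refl
mono-at λ' (ρ ∷ χ) (ab , mo) (suc i) r = ≤-trans (above-part λ' ρ ab r) (mono-at ρ χ mo i r)

at-top : ∀ λ' χ → Mono λ' χ → ∀ i r → part (at λ' χ i) r ≤ part (top λ' χ) r
at-top λ' []      mo        zero    r = ≤-refl
at-top λ' []      mo        (suc i) r = ≤-refl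
at-top λ' (ρ ∷ χ) (ab , mo) zero    r = ≤-trans (above-part λ' ρ ab r) (at-top ρ χ mo zero r)
at-top λ' (ρ ∷ χ) (ab , mo) (suc i) r = at-top ρ χ mo i r

at-above : ∀ λ' χ → Mono λ' χ → ∀ i → i < length χ → Above (at λ' χ i) (at λ' χ (suc i))
at-above λ' (ρ ∷ χ) (ab , mo) zero    lt       = ab
at-above λ' (ρ ∷ χ) (ab , mo) (suc i) (s≤s lt) = at-above ρ χ mo i lt

at-decr : ∀ λ' χ → Decr λ' → Mono λ' χ → ∀ i → Decr (at λ' χ i)
at-decr λ' χ       d mo        zero    = d
at-decr λ' []      d mo        (suc i) = d
at-decr λ' (ρ ∷ χ) d (ab , mo) (suc i) = at-decr ρ χ (above-decr λ' ρ ab) mo i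

valc-≤ : ∀ ρ χ r c → c ≤ part ρ r → valc (ρ ∷ χ) (r , c) ≡ 1
valc-≤ ρ χ r c le rewrite T⇒≡ (≤⇒≤ᵇ le) = refl

valc-> : ∀ ρ χ r c → part ρ r < c → valc (ρ ∷ χ) (r , c) ≡ suc (valc χ (r , c))
valc-> ρ χ r c lt rewrite ¬T {c ≤ᵇ part ρ r} (λ t → <⇒≱ lt (≤ᵇ⇒≤ c _ t)) = refl

1≤valc : ∀ χ x → 1 ≤ valc χ x
1≤valc []      x = s≤s z≤n
1≤valc (ρ ∷ χ) (r , c) with c ≤ᵇ part ρ r
... | true  = s≤s z≤n
... | false = s≤s z≤n

valc-range : ∀ λ' χ r c i → part λ' r < c → i < length χ → valc χ (r , c) ≡ suc i →
  part (at λ' χ i) r < c × c ≤ part (at λ' χ (suc i)) r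
valc-range λ' (ρ ∷ χ) r c i lt il e with c ≤? part ρ r
valc-range λ' (ρ ∷ χ) r c zero lt il e | yes le = lt , le
valc-range λ' (ρ ∷ χ) r c (suc i) lt il e | yes le with trans (sym (valc-≤ ρ χ r c le)) e
... | ()
valc-range λ' (ρ ∷ χ) r c zero lt il e | no nle with valc χ (r , c) | 1≤valc χ (r , c) | trans (sym (valc-> ρ χ r c (≰⇒> nle))) e
... | zero | () | _
valc-range λ' (ρ ∷ χ) r c (suc i) lt (s≤s il) e | no nle =
  valc-range ρ χ r c i (≰⇒> nle) il (suc-injective (trans (sym (valc-> ρ χ r c (≰⇒> nle))) e))

valc-hit : ∀ λ' χ → Mono λ' χ → ∀ r c i → i < length χ → part (at λ' χ i) r < c → c ≤ part (at λ' χ (suc i)) r →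
  valc χ (r , c) ≡ suc i
valc-hit λ' (ρ ∷ χ) (ab , mo) r c zero    il       lt le = valc-≤ ρ χ r c le
valc-hit λ' (ρ ∷ χ) (ab , mo) r c (suc i) (s≤s il) lt le =
  trans (valc-> ρ χ r c (≤-<-trans (mono-at ρ χ mo i r) lt)) (cong suc (valc-hit ρ χ mo r c i il lt le))

valc-bound : ∀ λ' χ r c → part λ' r < c → c ≤ part (top λ' χ) r → valc χ (r , c) ≤ length χ
valc-bound λ' []      r c lt le = ⊥-elim (<⇒≱ lt le)
valc-bound λ' (ρ ∷ χ) r c lt le with c ≤? part ρ r
... | yes q rewrite valc-≤ ρ χ r c q = s≤s z≤n
... | no q rewrite valc-> ρ χ r c (≰⇒> q) = s≤s (valc-bound ρ χ r c (≰⇒> q) le)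

valc-row : ∀ χ r {c c'} → c ≤ c' → valc χ (r , c) ≤ valc χ (r , c')
valc-row []      r le = ≤-refl
valc-row (ρ ∷ χ) r {c} {c'} le with c' ≤? part ρ r
... | yes q rewrite valc-≤ ρ χ r c' q | valc-≤ ρ χ r c (≤-trans le q) = ≤-refl
... | no q rewrite valc-> ρ χ r c' (≰⇒> q) with c ≤? part ρ r
...   | yes p rewrite valc-≤ ρ χ r c p = s≤s z≤n
...   | no p rewrite valc-> ρ χ r c (≰⇒> p) = s≤s (valc-row χ r le)

valc-col : ∀ λ' χ → Mono λ' χ → ∀ c {r r'} → 1 ≤ r → r ≤ r' → valc χ (r , c) ≤ valc χ (r' , c)
valc-col λ' []      mo        c p le = ≤-refl
valc-col λ' (ρ ∷ χ) (ab , mo) c {r} {r'} p le with c ≤? part ρ r'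
... | yes q rewrite valc-≤ ρ χ r' c q
    | valc-≤ ρ χ r c (≤-trans q (antitone (part ρ) (decr-part ρ (above-decr λ' ρ ab)) p le)) = ≤-refl
... | no q rewrite valc-> ρ χ r' c (≰⇒> q) with c ≤? part ρ r
...   | yes s rewrite valc-≤ ρ χ r c s = s≤s z≤n
...   | no s rewrite valc-> ρ χ r c (≰⇒> s) = s≤s (valc-col ρ χ mo c p le)

part-ext : ∀ ρ ρ' → length ρ ≡ length ρ' → (∀ i → part ρ (suc i) ≡ part ρ' (suc i)) → ρ ≡ ρ'
part-ext []      []        e h = refl
part-ext (x ∷ ρ) (y ∷ ρ') e h = cong₂ _∷_ (h 0) (part-ext ρ ρ' (suc-injective e) (λ i → h (suc i)))

-- The cells of value 1 determine the first partition; lowering the other values by 1 leaves the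
-- remaining chain.
chain-injective : ∀ ν λ' χ χ' → Mono λ' χ → Mono λ' χ' → length χ ≡ length χ' → top λ' χ ≡ ν → top λ' χ' ≡ ν →
  (∀ r c → part λ' r < c → c ≤ part ν r → valc χ (r , c) ≡ valc χ' (r , c)) → χ ≡ χ'
chain-injective ν λ' []      []         mo mo' e t t' h = refl
chain-injective ν λ' (ρ ∷ χ) (ρ' ∷ χ') (ab , mo) (ab' , mo') e refl t' h with
  part-ext ρ ρ' (trans (above-length λ' ρ ab) (sym (above-length λ' ρ' ab')))
    (λ i → ≤-antisym
      (le ρ χ ρ' χ' ab' (suc i) (at-top ρ χ mo 0 (suc i)) h)
      (le ρ' χ' ρ χ ab (suc i) (subst (λ z → part ρ' (suc i) ≤ part z (suc i)) t' (at-top ρ' χ' mo' 0 (suc i))) (λ r c p q → sym (h r c p q))))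
  where
  le : ∀ ρ χ ρ' χ' → Above λ' ρ' → ∀ r → part ρ r ≤ part ν r →
    (∀ r c → part λ' r < c → c ≤ part ν r → valc (ρ ∷ χ) (r , c) ≡ valc (ρ' ∷ χ') (r , c)) → part ρ r ≤ part ρ' r
  le ρ χ ρ' χ' ab' r top≤ h with part ρ r ≤? part ρ' r
  ... | yes q = q
  ... | no q with part λ' r <? part ρ r
  ...   | no p = ≤-trans (≮⇒≥ p) (above-part λ' ρ' ab' r)
  ...   | yes p with trans (sym (valc-≤ ρ χ r (part ρ r) ≤-refl)) (trans (h r (part ρ r) p top≤) (valc-> ρ' χ' r (part ρ r) (≰⇒> q)))
  ...     | eq = ⊥-elim (<⇒≱ (1≤valc χ' (r , part ρ r)) (≤-reflexive (sym (suc-injective eq))))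
... | refl = cong (ρ ∷_) (chain-injective ν ρ χ χ' mo mo' (suc-injective e) refl t'
  (λ r c lt q → suc-injective (trans (sym (valc-> ρ χ r c lt))
    (trans (h r c (≤-<-trans (above-part λ' ρ ab r) lt) q) (valc-> ρ χ' r c lt)))))

-- A partition as the exponent vector of a monomial: functionals compare lists of one fixed length,
-- so zeros are kept.
pad : ℕ → List ℕ → List ℕ
pad n p = applyUpTo (λ i → part p (suc i)) n

part-applyUpTo-< : ∀ f n i → i < n → part (applyUpTo f n) (suc i) ≡ f i
part-applyUpTo-< f (suc n) zero    lt       = refl
part-applyUpTo-< f (suc n) (suc i) (s≤s lt) = part-applyUpTo-< (f ∘ suc) n i lt

part-applyUpTo : ∀ (f : ℕ → ℕ) n → (∀ i → n ≤ i → f (suc i) ≡ 0) → f 0 ≡ 0 → ∀ r → part (applyUpTo (f ∘ suc) n) r ≡ f r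
part-applyUpTo f n h z zero    = trans (part-0 (applyUpTo (f ∘ suc) n)) (sym z)
part-applyUpTo f n h z (suc i) with i <? n
... | yes lt = part-applyUpTo-< (f ∘ suc) n i lt
... | no ge  = trans (part-beyond (applyUpTo (f ∘ suc) n) (s≤s (subst (_≤ i) (sym (Lₚ.length-applyUpTo (f ∘ suc) n)) (≮⇒≥ ge))))
                     (sym (h i (≮⇒≥ ge)))

applyUpTo-above : ∀ (f g : ℕ → ℕ) n → (∀ i → f i ≤ g i) → (∀ i → g (suc i) ≤ g i) → Above (applyUpTo f n) (applyUpTo g n)
applyUpTo-above f g zero    h k = tt
applyUpTo-above f g (suc n) h k = ⊔-lub (h 0) (hd n) , applyUpTo-above (f ∘ suc) (g ∘ suc) n (h ∘ suc) (k ∘ suc)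
  where
  hd : ∀ n → head₀ (applyUpTo (g ∘ suc) n) ≤ g 0
  hd zero    = z≤n
  hd (suc n) = k 0

applyUpTo-cong-< : ∀ {A : Set} (f g : ℕ → A) n → (∀ i → i < n → f i ≡ g i) → applyUpTo f n ≡ applyUpTo g n
applyUpTo-cong-< f g zero    h = refl
applyUpTo-cong-< f g (suc n) h = cong₂ _∷_ (h 0 (s≤s z≤n)) (applyUpTo-cong-< (f ∘ suc) (g ∘ suc) n (λ i lt → h (suc i) (s≤s lt)))

partition-antitone : ∀ p → IsPartition p → ∀ i → part p (suc (suc i)) ≤ part p (suc i)
partition-antitone p (l , _) = go p l
  where
  go : ∀ p → Linked (λ a b → b ≤ a) p → ∀ i → part p (suc (suc i)) ≤ part p (suc i)
  go []          l       i       = z≤n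
  go (x ∷ [])    l       zero    = z≤n
  go (x ∷ [])    l       (suc i) = z≤n
  go (x ∷ y ∷ p) (q ∷ l) zero    = q
  go (x ∷ y ∷ p) (q ∷ l) (suc i) = go (y ∷ p) l i

pad-decr : ∀ n p → IsPartition p → Decr (pad n p)
pad-decr n p ip = above-decr (pad n p) (pad n p)
  (applyUpTo-above _ _ n (λ i → ≤-refl) (partition-antitone p ip))

strips-at : ∀ λ' χ → strips λ' χ ≡ applyUpTo (λ i → strip (at λ' χ i) (at λ' χ (suc i))) (length χ)
strips-at λ' []      = refl
strips-at λ' (ρ ∷ χ) = cong (strip λ' ρ ∷_) (strips-at ρ χ)

hit-T : ∀ lo hi c → T (hit lo hi c) → ∃ λ i → part lo (suc i) < c × c ≤ part hi (suc i)
hit-T (l ∷ lo) (h ∷ hi) c t with ∨-T {between l h c} t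
... | inj₁ s = 0 , between-T l h c s
... | inj₂ s with hit-T lo hi c s
...   | i , p = suc i , p

T-hit : ∀ lo hi c → Above lo hi → ∀ i → part lo (suc i) < c → c ≤ part hi (suc i) → T (hit lo hi c)
T-hit []       []       c ab       i       lt le = ⊥-elim (<⇒≱ lt (≤-trans le z≤n))
T-hit (l ∷ lo) (h ∷ hi) c (_ , ab) zero    lt le = T-∨ˡ (T-between lt le)
T-hit (l ∷ lo) (h ∷ hi) c (_ , ab) (suc i) lt le = T-∨ʳ {between l h c} (T-hit lo hi c ab i lt le)

cnt-≤ : ∀ p m → cnt p m ≤ m
cnt-≤ p zero    = z≤n
cnt-≤ p (suc m) with p (suc m)
... | true  = ≤-trans (+-monoˡ-≤ 1 (cnt-≤ p m)) (≤-reflexive (+-comm m 1))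
... | false = ≤-trans (≤-reflexive (+-identityʳ _)) (m≤n⇒m≤1+n (cnt-≤ p m))

cnt-mono : ∀ p q m → (∀ k → T (p k) → T (q k)) → cnt p m ≤ cnt q m
cnt-mono p q zero    h = z≤n
cnt-mono p q (suc m) h = +-mono-≤ (cnt-mono p q m h) le
  where
  le : (if p (suc m) then 1 else 0) ≤ (if q (suc m) then 1 else 0)
  le with p (suc m) | q (suc m) | h (suc m)
  ... | true  | true  | _ = ≤-refl
  ... | true  | false | f = ⊥-elim (f tt)
  ... | false | _     | _ = z≤n

cnt-full : ∀ p m → (∀ k → 1 ≤ k → k ≤ m → T (p k)) → cnt p m ≡ m
cnt-full p zero    h = refl
cnt-full p (suc m) h rewrite T⇒≡ (h (suc m) (s≤s z≤n) ≤-refl) =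
  trans (cong (_+ 1) (cnt-full p m (λ k a b → h k a (m≤n⇒m≤1+n b)))) (+-comm m 1)

cnt-none : ∀ p m → (∀ k → 1 ≤ k → k ≤ m → ¬ T (p k)) → cnt p m ≡ 0
cnt-none p zero    h = refl
cnt-none p (suc m) h rewrite ¬T (h (suc m) (s≤s z≤n) ≤-refl) =
  trans (+-identityʳ _) (cnt-none p m (λ k a b → h k a (m≤n⇒m≤1+n b)))

DownClosed : (ℕ → Bool) → ℕ → Set
DownClosed p m = ∀ j k → 1 ≤ j → j ≤ k → k ≤ m → T (p k) → T (p j)

-- A down-closed set of positions is an initial segment, hence determined by its size. Applied to
-- the entries at most i of a weakly increasing row.
cnt-prefix⇒ : ∀ p m → DownClosed p m → ∀ k → 1 ≤ k → k ≤ cnt p m → T (p k)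
cnt-prefix⇒ p zero    d (suc k) a ()
cnt-prefix⇒ p (suc m) d k a b with p (suc m) in eq
... | true  = d k (suc m) a (≤-trans b (≤-trans (+-monoˡ-≤ 1 (cnt-≤ p m)) (≤-reflexive (+-comm m 1)))) ≤-refl (subst T (sym eq) tt)
... | false = cnt-prefix⇒ p m (λ i j x y z → d i j x y (m≤n⇒m≤1+n z)) k a (subst (k ≤_) (+-identityʳ _) b)

cnt-prefix⇐ : ∀ p m → DownClosed p m → ∀ k → 1 ≤ k → k ≤ m → T (p k) → k ≤ cnt p m
cnt-prefix⇐ p zero    d k       a b t = b
cnt-prefix⇐ p (suc m) d k a b t with k ≟ suc m
... | yes refl = ≤-reflexive (sym (cnt-full p (suc m) (λ j x y → d j (suc m) x y ≤-refl t)))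
... | no ne    = ≤-trans (cnt-prefix⇐ p m (λ i j x y z → d i j x y (m≤n⇒m≤1+n z)) k a (≤-pred (≤∧≢⇒< b ne)) t) (m≤m+n _ _)

-- Coefficients of g as numbers of chains

module GCoeff (n : ℕ) (la nu : List ℕ) (pl : IsPartition la) (pn : IsPartition nu) (sub : la ⊆ᵖ nu) (len : length nu ≤ n) where

  cells : List Cell
  cells = skewCells nu la

  pad-nu : ∀ r → part (pad n nu) r ≡ part nu r
  pad-nu = part-applyUpTo (part nu) n (λ i le → part-beyond nu (≤-<-trans len (s≤s le))) (part-0 nu)

  nu-beyond : ∀ i → n ≤ i → part nu (suc i) ≡ 0
  nu-beyond i le = part-beyond nu (≤-<-trans len (s≤s le))

  ≤nu-beyond : ∀ f → (∀ r → f r ≤ part nu r) → ∀ r → part (applyUpTo (f ∘ suc) n) r ≡ f r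
  ≤nu-beyond f h = part-applyUpTo f n
    (λ i le → n≤0⇒n≡0 (≤-trans (h (suc i)) (≤-reflexive (nu-beyond i le))))
    (n≤0⇒n≡0 (≤-trans (h 0) (≤-reflexive (part-0 nu))))

  pad-la : ∀ r → part (pad n la) r ≡ part la r
  pad-la = ≤nu-beyond (part la) sub

  λ₀ ν₀ : List ℕ
  λ₀ = pad n la
  ν₀ = pad n nu

  fillChain : List (List ℕ) → List (Cell × ℕ)
  fillChain χ = tabulate′ cells (valc χ)

  module _ (χ : List (List ℕ)) (mo : Mono λ₀ χ) (tp : top λ₀ χ ≡ ν₀) where

    cell-bounds : ∀ {r c} → (r , c) ∈ cells → part λ₀ r < c × c ≤ part (top λ₀ χ) r
    cell-bounds {r} {c} m with skewCells-∈⁻ nu la m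
    ... | a , b = subst (_< c) (sym (pad-la r)) a , subst (c ≤_) (sym (trans (cong (λ z → part z r) tp) (pad-nu r))) b

    fill-∈ : fillChain χ ∈ assignments cells (range1 (length χ))
    fill-∈ = assignments-∈⁺ cells (range1 (length χ)) (valc χ)
      (λ { (r , c) m → range1-∈⁺ (1≤valc χ (r , c)) (valc-bound λ₀ χ r c (proj₁ (cell-bounds m)) (proj₂ (cell-bounds m))) })

    row≥1 : ∀ {r c} → (r , c) ∈ cells → 1 ≤ r
    row≥1 {zero} {c} m with skewCells-∈⁻ nu la m
    ... | a , b = ⊥-elim (<⇒≱ (≤-<-trans z≤n a) (≤-trans b (≤-reflexive (part-0 nu))))
    row≥1 {suc r} m = s≤s z≤n

    fill-RPP : T (isRPP (fillChain χ))
    fill-RPP = T-all _ (fillChain χ) (λ p p∈ → T-all _ (fillChain χ) (λ q q∈ → ok p q p∈ q∈))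
      where
      ok : ∀ p q → p ∈ fillChain χ → q ∈ fillChain χ → _
      ok p q p∈ q∈ with ∈ₚ.∈-map⁻ _ p∈ | ∈ₚ.∈-map⁻ _ q∈
      ... | (r , c) , m , refl | (r' , c') , m' , refl = T-∧
        (T-imp {(r ≡ᵇ r') ∧ (c ≤ᵇ c')} (λ t → ≤⇒≤ᵇ (rowOK (≡ᵇ⇒≡ r r' (proj₁ (∧-T {r ≡ᵇ r'} t))) (≤ᵇ⇒≤ c c' (proj₂ (∧-T {r ≡ᵇ r'} t))))))
        (T-imp {(c ≡ᵇ c') ∧ (r ≤ᵇ r')} (λ t → ≤⇒≤ᵇ (colOK (≡ᵇ⇒≡ c c' (proj₁ (∧-T {c ≡ᵇ c'} t))) (≤ᵇ⇒≤ r r' (proj₂ (∧-T {c ≡ᵇ c'} t))))))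
        where
        rowOK : r ≡ r' → c ≤ c' → valc χ (r , c) ≤ valc χ (r' , c')
        rowOK refl le = valc-row χ r le
        colOK : c ≡ c' → r ≤ r' → valc χ (r , c) ≤ valc χ (r' , c')
        colOK refl le = valc-col λ₀ χ mo c (row≥1 m) le

    maxcol : ℕ
    maxcol = foldr (λ e m → proj₂ (proj₁ e) ⊔ m) 0 (fillChain χ)

    col≤ : ∀ (F : List (Cell × ℕ)) {e} → e ∈ F → proj₂ (proj₁ e) ≤ foldr (λ e m → proj₂ (proj₁ e) ⊔ m) 0 F
    col≤ (e ∷ F) (here refl) = m≤m⊔n _ _
    col≤ (e ∷ F) (there m)   = ≤-trans (col≤ F m) (m≤n⊔m (proj₂ (proj₁ e)) _)

    fill-wt : rppWt (length χ) (fillChain χ) ≡ strips λ₀ χ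
    fill-wt = trans (sym (Lₚ.map-∘ (upTo (length χ)))) (trans (Lₚ.map-upTo _ (length χ))
      (trans (applyUpTo-cong-< _ _ (length χ) letter) (sym (strips-at λ₀ χ))))
      where
      has : ℕ → ℕ → Bool
      has i c = any (λ e → (proj₂ (proj₁ e) ≡ᵇ c) ∧ (proj₂ e ≡ᵇ i)) (fillChain χ)
      letter : ∀ i → i < length χ → countᵇ (has (suc i)) (range1 maxcol) ≡ strip (at λ₀ χ i) (at λ₀ χ (suc i))
      letter i lt = trans (countᵇ-range1 (has (suc i)) maxcol)
        (trans (cnt-cong maxcol (λ c → T-≡ {has (suc i) c} {hit lo hi c} (to c) (λ t → proj₁ (from c t))))
        -- `rppWt` scans up to the last column of the filling, whereas `strip-count` wants a range
        -- that includes the first part of `hi`. Enlarging the range changes nothing, as every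
        -- column met contains a cell of the filling.
        (trans (sym (cnt-beyond (hit lo hi) maxcol (maxcol ⊔ head₀ hi) (m≤m⊔n _ _) (λ c q t → <⇒≱ q (proj₂ (from c t)))))
          (strip-count lo hi (maxcol ⊔ head₀ hi) (at-decr λ₀ χ (pad-decr n la pl) mo i) ab (m≤n⊔m maxcol (head₀ hi)))))
        where
        lo = at λ₀ χ i
        hi = at λ₀ χ (suc i)
        ab = at-above λ₀ χ mo i lt
        to : ∀ c → T (has (suc i) c) → T (hit lo hi c)
        to c t with any-T _ (fillChain χ) t
        ... | e , m , s with ∈ₚ.∈-map⁻ _ m
        ...   | (zero , c') , m' , refl = ⊥-elim (1+n≰n (row≥1 m'))
        ...   | (suc r , c') , m' , refl with ∧-T {c' ≡ᵇ c} s
        ...     | s₁ , s₂ with ≡ᵇ⇒≡ c' c s₁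
        ...       | refl with valc-range λ₀ χ (suc r) c i (proj₁ (cell-bounds m')) lt (≡ᵇ⇒≡ _ (suc i) s₂)
        ...         | a , b = T-hit lo hi c ab r a b
        from : ∀ c → T (hit lo hi c) → T (has (suc i) c) × c ≤ maxcol
        from c t with hit-T lo hi c t
        ... | r , a , b = T-any _ e∈ (T-∧ (≡⇒≡ᵇ c c refl) (≡⇒≡ᵇ _ (suc i) (valc-hit λ₀ χ mo (suc r) c i lt a b))) , col≤ (fillChain χ) e∈
          where
          cell : (suc r , c) ∈ cells
          cell = skewCells-∈⁺ nu la
            (≤-<-trans (≤-trans (≤-reflexive (sym (pad-la (suc r)))) (mono-at λ₀ χ mo i (suc r))) a)
            (≤-trans b (≤-trans (at-top λ₀ χ mo (suc i) (suc r))
              (≤-reflexive (trans (cong (λ z → part z (suc r)) tp) (pad-nu (suc r))))))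
          e∈ = ∈ₚ.∈-map⁺ (λ x → (x , valc χ x)) cell

  -- Conversely, the i-th partition of the chain of φ consists of the cells of λ and those with φ ≤ i.
  module _ (m : ℕ) (φ : Cell → ℕ) (rng : ∀ x → x ∈ cells → 1 ≤ φ x × φ x ≤ m)
           (rpp : ∀ {r c r' c'} → (r , c) ∈ cells → (r' , c') ∈ cells →
             (r ≡ r' → c ≤ c' → φ (r , c) ≤ φ (r' , c')) × (c ≡ c' → r ≤ r' → φ (r , c) ≤ φ (r' , c'))) where

    low : ℕ → ℕ → ℕ → Bool
    low i r k = φ (r , part la r + k) ≤ᵇ i

    thr : ℕ → ℕ → ℕ
    thr i r = part la r + cnt (low i r) (part nu r ∸ part la r)

    cell+ : ∀ {r k} → 1 ≤ k → k ≤ part nu r ∸ part la r → (r , part la r + k) ∈ cells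
    cell+ {r} {k} a b = skewCells-∈⁺ nu la
      (≤-trans (≤-reflexive (+-comm 1 (part la r))) (+-monoʳ-≤ (part la r) a))
      (≤-trans (+-monoʳ-≤ (part la r) b) (≤-reflexive (m+[n∸m]≡n (sub r))))

    low-down : ∀ i r → DownClosed (low i r) (part nu r ∸ part la r)
    low-down i r j k a b c t = ≤⇒≤ᵇ (≤-trans
      (proj₁ (rpp (cell+ a (≤-trans b c)) (cell+ (≤-trans a b) c)) refl (+-monoʳ-≤ (part la r) b))
      (≤ᵇ⇒≤ _ i t))

    thr-nu : ∀ i r → thr i r ≤ part nu r
    thr-nu i r = ≤-trans (+-monoʳ-≤ (part la r) (cnt-≤ (low i r) _)) (≤-reflexive (m+[n∸m]≡n (sub r)))

    private
      offset : ∀ {r c} → part la r < c → c ≤ part nu r →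
        part la r + (c ∸ part la r) ≡ c × 1 ≤ c ∸ part la r × c ∸ part la r ≤ part nu r ∸ part la r
      offset {r} lt le = m+[n∸m]≡n (<⇒≤ lt) , m<n⇒0<n∸m lt , ∸-monoˡ-≤ (part la r) le

    thr-cell⇒ : ∀ i {r c} → (r , c) ∈ cells → c ≤ thr i r → φ (r , c) ≤ i
    thr-cell⇒ i {r} {c} m le with skewCells-∈⁻ nu la m
    ... | a , b with offset {r} a b
    ...   | e , p , q = subst (λ z → φ (r , z) ≤ i) e (≤ᵇ⇒≤ _ i (cnt-prefix⇒ (low i r) _ (low-down i r) (c ∸ part la r) p
              (+-cancelˡ-≤ (part la r) _ _ (≤-trans (≤-reflexive e) le))))

    thr-cell⇐ : ∀ i {r c} → (r , c) ∈ cells → φ (r , c) ≤ i → c ≤ thr i r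
    thr-cell⇐ i {r} {c} m le with skewCells-∈⁻ nu la m
    ... | a , b with offset {r} a b
    ...   | e , p , q = ≤-trans (≤-reflexive (sym e)) (+-monoʳ-≤ (part la r)
              (cnt-prefix⇐ (low i r) _ (low-down i r) (c ∸ part la r) p q (≤⇒≤ᵇ (subst (λ z → φ (r , z) ≤ i) (sym e) le))))

    thr-suc : ∀ i r → thr i r ≤ thr (suc i) r
    thr-suc i r = +-monoʳ-≤ (part la r) (cnt-mono (low i r) (low (suc i) r) (part nu r ∸ part la r)
      (λ k t → ≤⇒≤ᵇ (m≤n⇒m≤1+n (≤ᵇ⇒≤ (φ (r , part la r + k)) i t))))

    -- If the cell below the end of the upper row lies outside λ, its entry is at most the entry
    -- above it, so it belongs to the same level.
    thr-antitone : ∀ i r → thr i (suc (suc r)) ≤ thr i (suc r)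
    thr-antitone i r with part la (suc r) <? thr i (suc (suc r))
    ... | no q  = ≤-trans (≮⇒≥ q) (m≤m+n _ _)
    ... | yes q = thr-cell⇐ i cell (≤-trans (proj₂ (rpp cell cell') refl (n≤1+n (suc r))) (thr-cell⇒ i cell' ≤-refl))
      where
      c = thr i (suc (suc r))
      cell : (suc r , c) ∈ cells
      cell = skewCells-∈⁺ nu la q (≤-trans (thr-nu i (suc (suc r))) (partition-antitone nu pn r))
      cell' : (suc (suc r) , c) ∈ cells
      cell' = skewCells-∈⁺ nu la (≤-<-trans (partition-antitone la pl r) q) (thr-nu i (suc (suc r)))

    level : ℕ → List ℕ
    level i = applyUpTo (thr i ∘ suc) n

    part-level : ∀ i r → part (level i) r ≡ thr i r
    part-level i = ≤nu-beyond (thr i) (thr-nu i)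

    chainOf : List (List ℕ)
    chainOf = applyUpTo (level ∘ suc) m

    mono-levels : ∀ (f : ℕ → List ℕ) m → (∀ i → Above (f i) (f (suc i))) → Mono (f 0) (applyUpTo (f ∘ suc) m)
    mono-levels f zero    h = tt
    mono-levels f (suc m) h = h 0 , mono-levels (f ∘ suc) m (h ∘ suc)

    top-levels : ∀ (f : ℕ → List ℕ) m → top (f 0) (applyUpTo (f ∘ suc) m) ≡ f m
    top-levels f zero    = refl
    top-levels f (suc m) = top-levels (f ∘ suc) m

    level-0 : level 0 ≡ λ₀
    level-0 = applyUpTo-cong-< _ _ n (λ i _ → trans (cong (λ z → part la (suc i) + z)
      (cnt-none (low 0 (suc i)) _ (λ k a b t → <⇒≱ (proj₁ (rng _ (cell+ a b))) (≤ᵇ⇒≤ _ 0 t)))) (+-identityʳ _))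

    level-m : level m ≡ ν₀
    level-m = applyUpTo-cong-< _ _ n (λ i _ → trans (cong (λ z → part la (suc i) + z)
      (cnt-full (low m (suc i)) _ (λ k a b → ≤⇒≤ᵇ (proj₂ (rng _ (cell+ a b)))))) (m+[n∸m]≡n (sub (suc i))))

    chainOf-mono : Mono λ₀ chainOf
    chainOf-mono = subst (λ z → Mono z chainOf) level-0 (mono-levels level m
      (λ i → applyUpTo-above _ _ n (λ r → thr-suc i (suc r)) (thr-antitone (suc i))))

    chainOf-top : top λ₀ chainOf ≡ ν₀
    chainOf-top = trans (cong (λ z → top z chainOf) (sym level-0)) (trans (top-levels level m) level-m)

    valc-levels : ∀ m (f : ℕ → List ℕ) r c x → 1 ≤ x → x ≤ m →
      (∀ i → c ≤ part (f i) r → x ≤ suc i) → (∀ i → x ≤ suc i → c ≤ part (f i) r) → valc (applyUpTo f m) (r , c) ≡ x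
    valc-levels zero f r c x a b to from = ⊥-elim (<⇒≱ a b)
    valc-levels (suc m) f r c x a b to from with c ≤? part (f 0) r
    ... | yes q = trans (valc-≤ (f 0) (applyUpTo (f ∘ suc) m) r c q) (≤-antisym a (to 0 q))
    valc-levels (suc m) f r c (suc zero)    a b       to from | no q = ⊥-elim (q (from 0 ≤-refl))
    valc-levels (suc m) f r c (suc (suc x)) a (s≤s b) to from | no q = trans (valc-> (f 0) (applyUpTo (f ∘ suc) m) r c (≰⇒> q))
      (cong suc (valc-levels m (f ∘ suc) r c (suc x) (s≤s z≤n) b (λ i le → ≤-pred (to (suc i) le)) (λ i le → from (suc i) (s≤s le))))

    fill-chainOf : fillChain chainOf ≡ tabulate′ cells φ
    fill-chainOf = tabulate′-cong cells (λ { (r , c) x∈ → valc-levels m (level ∘ suc) r c (φ (r , c))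
      (proj₁ (rng _ x∈)) (proj₂ (rng _ x∈))
      (λ i le → thr-cell⇒ (suc i) x∈ (subst (c ≤_) (part-level (suc i) r) le))
      (λ i le → subst (c ≤_) (sym (part-level (suc i) r)) (thr-cell⇐ (suc i) x∈ le)) })

  strips-length : ∀ λ' χ → length (strips λ' χ) ≡ length χ
  strips-length λ' []      = refl
  strips-length λ' (ρ ∷ χ) = cong suc (strips-length ρ χ)

  gCoeff-chains : ∀ α → gCoeff nu la α ≡ countᵇ (λ χ → eqListᵇ (top λ₀ χ) ν₀) (chains α λ₀)
  gCoeff-chains α = count-bijection _ _ (assignments cells (range1 (length α))) (chains α λ₀) fillChain
    (assignments-unique cells (range1 (length α)) (range1-unique (length α))) (chains-unique α λ₀) to from inj
    where
    to : ∀ χ → χ ∈ chains α λ₀ → T (eqListᵇ (top λ₀ χ) ν₀) →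
      fillChain χ ∈ assignments cells (range1 (length α)) × T (isRPP (fillChain χ) ∧ eqListᵇ (rppWt (length α) (fillChain χ)) α)
    to χ χ∈ t with chains-∈⁻ α λ₀ χ∈ | eqListᵇ-T (top λ₀ χ) ν₀ t
    ... | mo , refl | tp rewrite strips-length λ₀ χ = fill-∈ χ mo tp , T-∧ (fill-RPP χ mo tp) (T-eqListᵇ (fill-wt χ mo tp))
    from : ∀ F → F ∈ assignments cells (range1 (length α)) → T (isRPP F ∧ eqListᵇ (rppWt (length α) F) α) →
      ∃ λ χ → χ ∈ chains α λ₀ × T (eqListᵇ (top λ₀ χ) ν₀) × fillChain χ ≡ F
    from F F∈ t with ∧-T {isRPP F} t | assignments-∈⁻ 0 cells (range1 (length α)) (skewCells-unique nu la) F∈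
    ... | t₁ , t₂ | eF , h = χ , subst (λ z → χ ∈ chains z λ₀) str (chains-∈⁺ λ₀ χ mo) , T-eqListᵇ tp , eq
      where
      φ = look 0 F
      m = length α
      rng : ∀ x → x ∈ cells → 1 ≤ φ x × φ x ≤ m
      rng x x∈ = range1-∈⁻ (h x x∈)
      rpp : ∀ {r c r' c'} → (r , c) ∈ cells → (r' , c') ∈ cells →
             (r ≡ r' → c ≤ c' → φ (r , c) ≤ φ (r' , c')) × (c ≡ c' → r ≤ r' → φ (r , c) ≤ φ (r' , c'))
      rpp {r} {c} {r'} {c'} x∈ y∈ = (λ e le → ≤ᵇ⇒≤ _ _ (imp-T (proj₁ ok) (T-∧ (≡⇒≡ᵇ r r' e) (≤⇒≤ᵇ le))))
                                  , (λ e le → ≤ᵇ⇒≤ _ _ (imp-T (proj₂ ok) (T-∧ (≡⇒≡ᵇ c c' e) (≤⇒≤ᵇ le))))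
        where
        in-F : ∀ {x} → x ∈ cells → (x , φ x) ∈ F
        in-F {x} x∈ = subst ((x , φ x) ∈_) (sym eF) (∈ₚ.∈-map⁺ (λ c → (c , φ c)) x∈)
        ok : T (not ((r ≡ᵇ r') ∧ (c ≤ᵇ c')) ∨ (φ (r , c) ≤ᵇ φ (r' , c'))) × T (not ((c ≡ᵇ c') ∧ (r ≤ᵇ r')) ∨ (φ (r , c) ≤ᵇ φ (r' , c')))
        ok = ∧-T {not ((r ≡ᵇ r') ∧ (c ≤ᵇ c')) ∨ (φ (r , c) ≤ᵇ φ (r' , c'))} (all-T _ (all-T _ t₁ (in-F x∈)) (in-F y∈))
      χ = chainOf m φ rng rpp
      mo = chainOf-mono m φ rng rpp
      tp = chainOf-top m φ rng rpp
      eq : fillChain χ ≡ F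
      eq = trans (fill-chainOf m φ rng rpp) (sym eF)
      lenχ : length χ ≡ m
      lenχ = Lₚ.length-applyUpTo _ m
      str : strips λ₀ χ ≡ α
      str = trans (sym (fill-wt χ mo tp)) (trans (cong₂ rppWt lenχ eq) (eqListᵇ-T _ α t₂))
    inj : ∀ χ χ' → χ ∈ chains α λ₀ → χ' ∈ chains α λ₀ → T (eqListᵇ (top λ₀ χ) ν₀) → T (eqListᵇ (top λ₀ χ') ν₀) →
      fillChain χ ≡ fillChain χ' → χ ≡ χ'
    inj χ χ' χ∈ χ'∈ t t' e with chains-∈⁻ α λ₀ χ∈ | chains-∈⁻ α λ₀ χ'∈
    ... | mo , s | mo' , s' = chain-injective ν₀ λ₀ χ χ' mo mo'
      (trans (sym (strips-length λ₀ χ)) (trans (cong length (trans s (sym s'))) (strips-length λ₀ χ')))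
      (eqListᵇ-T (top λ₀ χ) ν₀ t) (eqListᵇ-T (top λ₀ χ') ν₀ t')
      (λ r c lt le → tabulate′-≡ cells e (r , c)
        (skewCells-∈⁺ nu la (subst (_< c) (pad-la r) lt) (subst (c ≤_) (pad-nu r) le)))

  -- All chains end at partitions, on which the dual functional selects those ending at ν.
  Hs-gCoeff : ∀ α → Hs α (dual ν₀) λ₀ ≡ + gCoeff nu la α
  Hs-gCoeff α = trans (Hs-chains α (dual ν₀) λ₀ dλ (λ p _ → dual-anti ν₀ p))
    (trans (∑-ext-∈ (chains α λ₀) (λ χ χ∈ → value χ (proj₁ (chains-∈⁻ α λ₀ χ∈))))
      (trans (sym (∑-count (λ χ → eqListᵇ (top λ₀ χ) ν₀) (chains α λ₀))) (cong +_ (sym (gCoeff-chains α)))))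
    where
    dλ = pad-decr n la pl
    dν = pad-decr n nu pn
    top-decr : ∀ λ' χ → Decr λ' → Mono λ' χ → Decr (top λ' χ)
    top-decr λ' []      d mo        = d
    top-decr λ' (ρ ∷ χ) d (ab , mo) = top-decr ρ χ (above-decr λ' ρ ab) mo
    value : ∀ χ → Mono λ₀ χ → dual ν₀ (top λ₀ χ) ≡ (if eqListᵇ (top λ₀ χ) ν₀ then 1ℤ else 0ℤ)
    value χ mo with eqListᵇ (top λ₀ χ) ν₀ in eq
    ... | true  = trans (cong (dual ν₀) (eqListᵇ-T (top λ₀ χ) ν₀ (subst T (sym eq) tt))) (dual-same ν₀ dν)
    ... | false = dual-other ν₀ (top λ₀ χ) dν (top-decr λ₀ χ dλ mo)
                    (λ e → subst T eq (T-eqListᵇ (sym e)))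

-- Columns of sets

Sorted : List ℕ → Set
Sorted = AllPairs _<_

sorted-++ʳ : ∀ u {v} → Sorted (u ++ v) → Sorted v
sorted-++ʳ []      p       = p
sorted-++ʳ (x ∷ u) (_ ∷ p) = sorted-++ʳ u p

sorted-++ˡ : ∀ u {v} → Sorted (u ++ v) → Sorted u
sorted-++ˡ []      p       = []
sorted-++ˡ (x ∷ u) (q ∷ p) = Allₚ.++⁻ˡ u q ∷ sorted-++ˡ u p

-- The letters joining the current cell, and the cells started afterwards.
blocks : ℕ → List Status → List ℕ × List (List ℕ)
blocks ℓ []           = [] , []
blocks ℓ (absent ∷ s) = blocks (suc ℓ) s
blocks ℓ (join ∷ s)   = ℓ ∷ proj₁ (blocks (suc ℓ) s) , proj₂ (blocks (suc ℓ) s)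
blocks ℓ (start ∷ s)  = [] , (ℓ ∷ proj₁ (blocks (suc ℓ) s)) ∷ proj₂ (blocks (suc ℓ) s)

cellsOf : List Status → List (List ℕ)
cellsOf s = proj₂ (blocks 1 s)

letters : ℕ → List Status → List ℕ
letters ℓ s = proj₁ (blocks ℓ s) ++ concat (proj₂ (blocks ℓ s))

private
  raise : ∀ {ℓ n xs} → All (λ x → suc ℓ ≤ x × x < suc ℓ + n) xs → All (λ x → ℓ ≤ x × x < ℓ + suc n) xs
  raise {ℓ} {n} = All.map (λ { (a , b) → <⇒≤ a , ≤-trans b (≤-reflexive (sym (+-suc ℓ n))) })

  now : ∀ ℓ n → ℓ ≤ ℓ × ℓ < ℓ + suc n
  now ℓ n = ≤-refl , ≤-trans (s≤s (m≤m+n ℓ n)) (≤-reflexive (sym (+-suc ℓ n)))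

letters-range : ∀ ℓ s → All (λ x → ℓ ≤ x × x < ℓ + length s) (letters ℓ s)
letters-range ℓ []           = []
letters-range ℓ (absent ∷ s) = raise (letters-range (suc ℓ) s)
letters-range ℓ (join ∷ s)   = now ℓ (length s) ∷ raise (letters-range (suc ℓ) s)
letters-range ℓ (start ∷ s)  = now ℓ (length s) ∷ raise (letters-range (suc ℓ) s)

letters-sorted : ∀ ℓ s → Sorted (letters ℓ s)
letters-sorted ℓ []           = []
letters-sorted ℓ (absent ∷ s) = letters-sorted (suc ℓ) s
letters-sorted ℓ (join ∷ s)   = All.map proj₁ (letters-range (suc ℓ) s) ∷ letters-sorted (suc ℓ) s
letters-sorted ℓ (start ∷ s)  = All.map proj₁ (letters-range (suc ℓ) s) ∷ letters-sorted (suc ℓ) s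

NonEmpty : List ℕ → Set
NonEmpty []      = ⊥
NonEmpty (_ ∷ _) = ⊤

blocks-nonEmpty : ∀ ℓ s → All NonEmpty (proj₂ (blocks ℓ s))
blocks-nonEmpty ℓ []           = []
blocks-nonEmpty ℓ (absent ∷ s) = blocks-nonEmpty (suc ℓ) s
blocks-nonEmpty ℓ (join ∷ s)   = blocks-nonEmpty (suc ℓ) s
blocks-nonEmpty ℓ (start ∷ s)  = tt ∷ blocks-nonEmpty (suc ℓ) s

mins-heads : ∀ ℓ s → mins ℓ s ≡ map head₀ (proj₂ (blocks ℓ s))
mins-heads ℓ []           = refl
mins-heads ℓ (absent ∷ s) = mins-heads (suc ℓ) s
mins-heads ℓ (join ∷ s)   = mins-heads (suc ℓ) s
mins-heads ℓ (start ∷ s)  = cong (ℓ ∷_) (mins-heads (suc ℓ) s)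

Within : List ℕ → List (List ℕ) → Set
Within []       []       = ⊤
Within []       (_ ∷ _)  = ⊥
Within (_ ∷ _)  []       = ⊥
Within (t ∷ bs) (B ∷ Bs) = All (_≤ t) B × Within bs Bs

okCol⇒within : ∀ ℓ c bs β s → T (okCol false ℓ free c bs β s) →
  All (_≤ c) (proj₁ (blocks ℓ s)) × Within bs (proj₂ (blocks ℓ s))
okCol⇒within ℓ c []       []      []           t = [] , tt
okCol⇒within ℓ c (_ ∷ _)  []      []           ()
okCol⇒within ℓ c (_ ∷ _)  (_ ∷ _) []           ()
okCol⇒within ℓ c bs       (b ∷ β) (absent ∷ s) t = okCol⇒within (suc ℓ) c bs β s t
okCol⇒within ℓ c bs       (b ∷ β) (join ∷ s)   t with ∧-T {ℓ ≤ᵇ c} t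
... | t₁ , t₂ with okCol⇒within (suc ℓ) c bs β s t₂
...   | a , w = ≤ᵇ⇒≤ ℓ c t₁ ∷ a , w
okCol⇒within ℓ c (u ∷ bs) (b ∷ β) (start ∷ s)  t with ∧-T {ℓ ≤ᵇ u} t
... | t₁ , t₂ with okCol⇒within (suc ℓ) u bs β s t₂
...   | a , w = [] , (≤ᵇ⇒≤ ℓ u t₁ ∷ a) , w

within⇒okCol : ∀ ℓ c bs β s → length s ≡ length β →
  All (_≤ c) (proj₁ (blocks ℓ s)) → Within bs (proj₂ (blocks ℓ s)) → T (okCol false ℓ free c bs β s)
within⇒okCol ℓ c []       []      []           e a       w       = tt
within⇒okCol ℓ c bs       (b ∷ β) (absent ∷ s) e a       w       = within⇒okCol (suc ℓ) c bs β s (suc-injective e) a w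
within⇒okCol ℓ c bs       (b ∷ β) (join ∷ s)   e (p ∷ a) w       = T-∧ (≤⇒≤ᵇ p) (within⇒okCol (suc ℓ) c bs β s (suc-injective e) a w)
within⇒okCol ℓ c (u ∷ bs) (b ∷ β) (start ∷ s)  e a (p ∷ q , w)   = T-∧ (≤⇒≤ᵇ p) (within⇒okCol (suc ℓ) u bs β s (suc-injective e) q w)

yamCol : Prev → List ℕ → List Status → Bool
yamCol pv (b ∷ β) (absent ∷ s) = yamCol (prev b false) β s
yamCol pv (b ∷ β) (join ∷ s)   = okJ pv b ∧ yamCol (prev b true) β s
yamCol pv (b ∷ β) (start ∷ s)  = okS pv b ∧ yamCol (prev b true) β s
yamCol pv _       _            = true

-- The bounds only see the cells and the Yamanouchi tests only the weights, so admissibility is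
-- their conjunction.
okCol-split : ∀ ℓ pv c bs β s → T (okCol true ℓ pv c bs β s) → T (okCol false ℓ free c bs β s) × T (yamCol pv β s)
okCol-split ℓ pv c []       []      []           t = tt , tt
okCol-split ℓ pv c (_ ∷ _)  []      []           ()
okCol-split ℓ pv c (_ ∷ _)  (_ ∷ _) []           ()
okCol-split ℓ pv c bs       (b ∷ β) (absent ∷ s) t = okCol-split (suc ℓ) (prev b false) c bs β s t
okCol-split ℓ pv c bs       (b ∷ β) (join ∷ s)   t with ∧-T {okJ pv b ∧ (ℓ ≤ᵇ c)} t
... | t₁ , t₂ with ∧-T {okJ pv b} t₁ | okCol-split (suc ℓ) (prev b true) c bs β s t₂
...   | u , v | x , y = T-∧ v x , T-∧ u y
okCol-split ℓ pv c (w ∷ bs) (b ∷ β) (start ∷ s)  t with ∧-T {okS pv b ∧ (ℓ ≤ᵇ w)} t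
... | t₁ , t₂ with ∧-T {okS pv b} t₁ | okCol-split (suc ℓ) (prev b true) w bs β s t₂
...   | u , v | x , y = T-∧ v x , T-∧ u y

okCol-join : ∀ ℓ pv c bs β s → T (okCol false ℓ free c bs β s) → T (yamCol pv β s) → T (okCol true ℓ pv c bs β s)
okCol-join ℓ pv c []       []      []           t y = tt
okCol-join ℓ pv c (_ ∷ _)  []      []           () y
okCol-join ℓ pv c (_ ∷ _)  (_ ∷ _) []           () y
okCol-join ℓ pv c bs       (b ∷ β) (absent ∷ s) t y = okCol-join (suc ℓ) (prev b false) c bs β s t y
okCol-join ℓ pv c bs       (b ∷ β) (join ∷ s)   t y with ∧-T {ℓ ≤ᵇ c} t | ∧-T {okJ pv b} y
... | v , x | u , z = T-∧ (T-∧ u v) (okCol-join (suc ℓ) (prev b true) c bs β s x z)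
okCol-join ℓ pv c (w ∷ bs) (b ∷ β) (start ∷ s)  t y with ∧-T {ℓ ≤ᵇ w} t | ∧-T {okS pv b} y
... | v , x | u , z = T-∧ (T-∧ u v) (okCol-join (suc ℓ) (prev b true) w bs β s x z)

-- Yamanouchi words

decᶠ : (ℕ → ℕ) → Set
decᶠ γ = ∀ i → γ (suc (suc i)) ≤ γ (suc i)

addWord : (ℕ → ℕ) → List ℕ → ℕ → ℕ
addWord γ w i = occ i w + γ i

Yam : (ℕ → ℕ) → List ℕ → Set
Yam γ w = ∀ u v → u ++ v ≡ w → decᶠ (addWord γ v)

occ-++ : ∀ i u v → occ i (u ++ v) ≡ occ i u + occ i v
occ-++ i u v = trans (cong length (Lₚ.filter-++ _ u v)) (Lₚ.length-++ (filterᵇ (λ x → x ≡ᵇ i) u))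

addWord-++ : ∀ γ u v i → addWord γ (u ++ v) i ≡ addWord (addWord γ v) u i
addWord-++ γ u v i = trans (cong (_+ γ i) (occ-++ i u v)) (+-assoc (occ i u) (occ i v) (γ i))

decᶠ-cong : ∀ {γ δ} → (∀ i → γ i ≡ δ i) → decᶠ γ → decᶠ δ
decᶠ-cong e d i = subst₂ _≤_ (e _) (e _) (d i)

Yam-cong : ∀ {γ δ} w → (∀ i → γ i ≡ δ i) → Yam γ w → Yam δ w
Yam-cong w e y u v q = decᶠ-cong (λ i → cong (λ z → occ i v + z) (e i)) (y u v q)

-- A suffix that reaches into `u` contains all of `w`, which then acts as a change of the starting
-- weight.
Yam-split : ∀ γ u w → Yam γ (u ++ w) → Yam γ w × Yam (addWord γ w) u
Yam-split γ u w y = (λ a b e → y (u ++ a) b (trans (Lₚ.++-assoc u a b) (cong (u ++_) e)))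
  , (λ a b e → decᶠ-cong (addWord-++ γ b w) (y a (b ++ w) (trans (sym (Lₚ.++-assoc a b w)) (cong (_++ w) e))))

Yam-join : ∀ γ u w → Yam γ w → Yam (addWord γ w) u → Yam γ (u ++ w)
Yam-join γ u w y z a b e with cut a u b w e
  where
  cut : ∀ a u b (w : List ℕ) → a ++ b ≡ u ++ w → (∃ λ c → a ++ c ≡ u × b ≡ c ++ w) ⊎ (∃ λ c → c ++ b ≡ w)
  cut []      u       b w e = inj₁ (u , refl , e)
  cut (x ∷ a) []      b w e = inj₂ (x ∷ a , e)
  cut (x ∷ a) (y ∷ u) b w e with Lₚ.∷-injective e
  ... | refl , e' with cut a u b w e'
  ...   | inj₁ (c , p , q) = inj₁ (c , cong (x ∷_) p , q)
  ...   | inj₂ r           = inj₂ r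
... | inj₁ (c , p , refl) = decᶠ-cong (λ i → sym (addWord-++ γ c w i)) (z a c p)
... | inj₂ (c , p)        = y c b p

occ-∉ : ∀ i w → All (_≢ i) w → occ i w ≡ 0
occ-∉ i []      []       = refl
occ-∉ i (x ∷ w) (n ∷ ns) rewrite ≡ᵇ-≢ n = occ-∉ i w ns

occ-head : ∀ i w → occ i (i ∷ w) ≡ suc (occ i w)
occ-head i w rewrite ≡ᵇ-≡ i = refl

occ-other : ∀ {i x} w → x ≢ i → occ i (x ∷ w) ≡ occ i w
occ-other w ne rewrite ≡ᵇ-≢ ne = refl

-- The room that a letter needs below its predecessor; writing it as j+2 exempts the letter 1.
Descents : (ℕ → ℕ) → List ℕ → Set
Descents γ B = All (λ x → ∀ j → x ≡ suc (suc j) → γ x < γ (suc j)) B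

-- Reading an increasing cell from its largest letter, each letter x meets no x - 1 before it.
Yam⇒descents : ∀ γ B → Sorted B → Yam γ B → Descents γ B
Yam⇒descents γ []      s       y = []
Yam⇒descents γ (x ∷ B) (p ∷ s) y = head′ ∷ Yam⇒descents γ B s (λ u v e → y (x ∷ u) v (cong (x ∷_) e))
  where
  head′ : ∀ j → x ≡ suc (suc j) → γ x < γ (suc j)
  head′ j refl = ≤-trans (≤-reflexive (sym (cong (_+ γ x) e₁))) (≤-trans (y [] (x ∷ B) refl j) (≤-reflexive (cong (_+ γ (suc j)) e₂)))
    where
    e₁ : occ x (x ∷ B) ≡ 1
    e₁ = trans (occ-head x B) (cong suc (occ-∉ x B (All.map (λ lt e → <⇒≢ lt (sym e)) p)))
    e₂ : occ (suc j) (x ∷ B) ≡ 0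
    e₂ = occ-∉ (suc j) (x ∷ B) ((λ e → <⇒≢ (n<1+n (suc j)) (sym e)) ∷ All.map (λ lt e → <⇒≢ (<-trans (n<1+n (suc j)) lt) (sym e)) p)

occ-≤1 : ∀ i B → Sorted B → occ i B ≤ 1
occ-≤1 i []      s       = z≤n
occ-≤1 i (x ∷ B) (p ∷ s) with x ≟ i
... | yes refl = ≤-reflexive (trans (occ-head x B) (cong suc (occ-∉ x B (All.map (λ lt e → <⇒≢ lt (sym e)) p))))
... | no ne    = ≤-trans (≤-reflexive (occ-other B ne)) (occ-≤1 i B s)

occ-∈ : ∀ i B → 0 < occ i B → i ∈ B
occ-∈ i (x ∷ B) lt with x ≟ i
... | yes refl = here refl
... | no ne    = there (occ-∈ i B (subst (0 <_) (occ-other B ne) lt))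

-- A letter occurs at most once in a cell, so one unit of room suffices.
descents⇒Yam : ∀ γ B → Sorted B → decᶠ γ → Descents γ B → Yam γ B
descents⇒Yam γ B s d ds u v refl i with 0 <? occ (suc (suc i)) v
... | yes lt = ≤-trans (+-monoˡ-≤ (γ (suc (suc i))) (occ-≤1 (suc (suc i)) v (sorted-++ʳ u s)))
      (≤-trans (All.lookup ds (∈ₚ.∈-++⁺ʳ u (occ-∈ (suc (suc i)) v lt)) i refl) (m≤n+m _ _))
... | no nlt = ≤-trans (≤-reflexive (cong (_+ γ (suc (suc i))) (n≤0⇒n≡0 (≮⇒≥ nlt)))) (≤-trans (d i) (m≤n+m _ _))

CellDescents : (ℕ → ℕ) → List (List ℕ) → Set
CellDescents γ []       = ⊤
CellDescents γ (B ∷ Bs) = Descents γ B × CellDescents (addWord γ B) Bs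

word : List (List ℕ) → List ℕ
word Bs = concat (reverse Bs)

word-∷ : ∀ B Bs → word (B ∷ Bs) ≡ word Bs ++ B
word-∷ B Bs = trans (cong concat (Lₚ.unfold-reverse B Bs))
  (trans (sym (Lₚ.concat-++ (reverse Bs) (B ∷ []))) (cong (word Bs ++_) (Lₚ.++-identityʳ B)))

Yam⇒cells : ∀ γ Bs → All Sorted Bs → Yam γ (word Bs) → CellDescents γ Bs
Yam⇒cells γ []       s       y = tt
Yam⇒cells γ (B ∷ Bs) (s ∷ ss) y with Yam-split γ (word Bs) B (subst (Yam γ) (word-∷ B Bs) y)
... | y₁ , y₂ = Yam⇒descents γ B s y₁ , Yam⇒cells (addWord γ B) Bs ss y₂

cells⇒Yam : ∀ γ Bs → All Sorted Bs → decᶠ γ → CellDescents γ Bs → Yam γ (word Bs)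
cells⇒Yam γ []       s        d c [] [] e = d
cells⇒Yam γ (B ∷ Bs) (s ∷ ss) d (ds , c) = subst (Yam γ) (sym (word-∷ B Bs))
  (Yam-join γ (word Bs) B yB (cells⇒Yam (addWord γ B) Bs ss (yB [] B refl) c))
  where yB = descents⇒Yam γ B s d ds

-- Yamanouchi columns

Iff : Set → Set → Set
Iff A B = (A → B) × (B → A)

cellDescents-cong : ∀ {γ δ} Bs → (∀ i → γ i ≡ δ i) → CellDescents γ Bs → CellDescents δ Bs
cellDescents-cong []       e c        = tt
cellDescents-cong {γ} {δ} (B ∷ Bs) e (ds , c) =
  All.map (λ {x} f j q → subst₂ _<_ (e x) (e (suc j)) (f j q)) ds , cellDescents-cong Bs (λ i → cong (λ z → occ i B + z) (e i)) c

private
  bit : Bool → ℕ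
  bit p = if p then 1 else 0

  -- Invariant of the scan: a previous letter that is present lies in the current cell, counted by
  -- `ε`. The inequality b ≤ a turns the equality tests of `okJ` and `okS` into strict inequalities.
  PrevOK : Prev → ℕ → (ℕ → ℕ) → (ℕ → ℕ) → ℕ → Set
  PrevOK free       ℓ γ ε b = ℓ ≡ 1
  PrevOK (prev a p) ℓ γ ε b = ∃ λ j → ℓ ≡ suc (suc j) × γ (suc j) ≡ a × ε (suc j) ≡ bit p × b ≤ a

  Descent : (ℕ → ℕ) → ℕ → Set
  Descent γ x = ∀ j → x ≡ suc (suc j) → γ x < γ (suc j)

  not-≡ᵇ : ∀ {a b} → b < a → T (not (a ≡ᵇ b))
  not-≡ᵇ lt rewrite ≡ᵇ-≢ (λ e → <⇒≢ lt (sym e)) = tt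

  ≡ᵇ-not : ∀ a b → b ≤ a → T (not (a ≡ᵇ b)) → b < a
  ≡ᵇ-not a b le t = ≤∧≢⇒< le λ { refl → subst (λ z → T (not z)) (≡ᵇ-≡ a) t }

  okJ-iff : ∀ pv ℓ γ ε b → PrevOK pv ℓ γ ε b → γ ℓ ≡ b → Iff (T (okJ pv b)) (Descent γ ℓ)
  okJ-iff free       .1 γ ε b refl g = (λ _ j ()) , λ _ → tt
  okJ-iff (prev a p) ℓ γ ε b (j , refl , ga , _ , le) g =
    (λ { t i refl → subst₂ _<_ (sym g) (sym ga) (≡ᵇ-not a b le t) }) ,
    (λ d → not-≡ᵇ (subst₂ _<_ g ga (d j refl)))

  okS-iff : ∀ pv ℓ γ ε b → PrevOK pv ℓ γ ε b → γ ℓ ≡ b → ε ℓ ≡ 0 → Iff (T (okS pv b)) (Descent (λ i → ε i + γ i) ℓ)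
  okS-iff free       .1 γ ε b refl g e0 = (λ _ j ()) , λ _ → tt
  okS-iff (prev a true) ℓ γ ε b (j , refl , ga , ep , le) g e0 =
    (λ { t i refl → subst₂ _<_ (sym (cong₂ _+_ e0 g)) (sym (cong₂ _+_ ep ga)) (s≤s le) }) ,
    (λ d → subst T (sym (or-true (not (a ≡ᵇ b)))) tt)
    where
    or-true : ∀ x → (x ∨ true) ≡ true
    or-true true  = refl
    or-true false = refl
  okS-iff (prev a false) ℓ γ ε b (j , refl , ga , ep , le) g e0 =
    (λ { t i refl → subst₂ _<_ (sym (cong₂ _+_ e0 g)) (sym (cong₂ _+_ ep ga)) (≡ᵇ-not a b le (subst T (or-false (not (a ≡ᵇ b))) t)) }) ,
    (λ d → subst T (sym (or-false (not (a ≡ᵇ b)))) (not-≡ᵇ (subst₂ _<_ (cong₂ _+_ e0 g) (cong₂ _+_ ep ga) (d j refl))))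
    where
    or-false : ∀ x → (x ∨ false) ≡ x
    or-false true  = refl
    or-false false = refl

  occ-∷ : ∀ i x w → occ i (x ∷ w) ≡ occ i w + occ i (x ∷ [])
  occ-∷ i x w = trans (occ-++ i (x ∷ []) w) (+-comm (occ i (x ∷ [])) (occ i w))

  occ-one : ∀ x → occ x (x ∷ []) ≡ 1
  occ-one x = occ-head x []

  occ-later : ∀ ℓ k → occ (suc (ℓ + k)) (ℓ ∷ []) ≡ 0
  occ-later ℓ k = occ-other [] (λ e → <⇒≢ (s≤s (m≤m+n ℓ k)) e)

  Agree : ℕ → List ℕ → (ℕ → ℕ) → Set
  Agree ℓ β γ = ∀ k → γ (ℓ + k) ≡ part β (suc k)

  agree-tail : ∀ ℓ b β γ → Agree ℓ (b ∷ β) γ → Agree (suc ℓ) β γ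
  agree-tail ℓ b β γ g k = trans (cong γ (sym (+-suc ℓ k))) (g (suc k))

  agree-head : ∀ ℓ b β γ → Agree ℓ (b ∷ β) γ → γ ℓ ≡ b
  agree-head ℓ b β γ g = trans (cong γ (sym (+-identityʳ ℓ))) (g 0)

  nextOK : ∀ {ℓ p b b'} γ ε → 1 ≤ ℓ → γ ℓ ≡ b → ε ℓ ≡ bit p → b' ≤ b → PrevOK (prev b p) (suc ℓ) γ ε b'
  nextOK {suc j} γ ε _ g e le = j , refl , g , e , le

-- γ is the weight after the lower cells, and ε counts the letters of the current cell.
yamCol-iff : ∀ ℓ pv β s γ ε → 1 ≤ ℓ → length s ≡ length β → Decr β → Agree ℓ β γ → (∀ k → ε (ℓ + k) ≡ 0) →
  PrevOK pv ℓ γ ε (head₀ β) →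
  Iff (T (yamCol pv β s))
      (Descents γ (proj₁ (blocks ℓ s)) × CellDescents (addWord (λ i → ε i + γ i) (proj₁ (blocks ℓ s))) (proj₂ (blocks ℓ s)))
yamCol-iff ℓ pv []      []           γ ε l e d g z p = (λ _ → [] , tt) , (λ _ → tt)
yamCol-iff ℓ pv (b ∷ β) (absent ∷ s) γ ε l e (h≤b , d) g z p =
  yamCol-iff (suc ℓ) (prev b false) β s γ ε (s≤s z≤n) (suc-injective e) d (agree-tail ℓ b β γ g)
    (λ k → trans (cong ε (sym (+-suc ℓ k))) (z (suc k)))
    (nextOK γ ε l (agree-head ℓ b β γ g) (trans (cong ε (sym (+-identityʳ ℓ))) (z 0)) h≤b)
yamCol-iff ℓ pv (b ∷ β) (join ∷ s)   γ ε l e (h≤b , d) g z p =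
  (λ t → let t₁ , t₂ = ∧-T {okJ pv b} t ; D , c = proj₁ ih t₂ in proj₁ ok t₁ ∷ D , cellDescents-cong Bs (λ i → sym (same′ i)) c) ,
  (λ { (x ∷ D , c) → T-∧ (proj₂ ok x) (proj₂ ih (D , cellDescents-cong Bs same′ c)) })
  where
  js = proj₁ (blocks (suc ℓ) s)
  Bs = proj₂ (blocks (suc ℓ) s)
  ε′ : ℕ → ℕ
  ε′ = addWord ε (ℓ ∷ [])
  ok = okJ-iff pv ℓ γ ε b p (agree-head ℓ b β γ g)
  ih = yamCol-iff (suc ℓ) (prev b true) β s γ ε′ (s≤s z≤n) (suc-injective e) d (agree-tail ℓ b β γ g)
    (λ k → cong₂ _+_ (occ-later ℓ k) (trans (cong ε (sym (+-suc ℓ k))) (z (suc k))))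
    (nextOK γ ε′ l (agree-head ℓ b β γ g) (cong₂ _+_ (occ-one ℓ) (trans (cong ε (sym (+-identityʳ ℓ))) (z 0))) h≤b)
  same′ : ∀ i → occ i (ℓ ∷ js) + (ε i + γ i) ≡ occ i js + (ε′ i + γ i)
  same′ i = trans (cong (_+ (ε i + γ i)) (occ-∷ i ℓ js)) (trans (+-assoc (occ i js) (occ i (ℓ ∷ [])) (ε i + γ i))
    (cong (λ x → occ i js + x) (sym (+-assoc (occ i (ℓ ∷ [])) (ε i) (γ i)))))
yamCol-iff ℓ pv (b ∷ β) (start ∷ s)  γ ε l e (h≤b , d) g z p =
  (λ t → let t₁ , t₂ = ∧-T {okS pv b} t ; D , c = proj₁ ih t₂ in
     [] , (proj₁ ok t₁ ∷ D , cellDescents-cong Bs (λ i → sym (same′ i)) c)) ,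
  (λ { (_ , (x ∷ D , c)) → T-∧ (proj₂ ok x) (proj₂ ih (D , cellDescents-cong Bs same′ c)) })
  where
  js = proj₁ (blocks (suc ℓ) s)
  Bs = proj₂ (blocks (suc ℓ) s)
  γ′ ε′ : ℕ → ℕ
  γ′ i = ε i + γ i
  ε′ = addWord (λ _ → 0) (ℓ ∷ [])
  ε0 : ε ℓ ≡ 0
  ε0 = trans (cong ε (sym (+-identityʳ ℓ))) (z 0)
  ok = okS-iff pv ℓ γ ε b p (agree-head ℓ b β γ g) ε0
  ih = yamCol-iff (suc ℓ) (prev b true) β s γ′ ε′ (s≤s z≤n) (suc-injective e) d
    (λ k → cong₂ _+_ (trans (cong ε (sym (+-suc ℓ k))) (z (suc k))) (agree-tail ℓ b β γ g k))
    (λ k → cong₂ _+_ (occ-later ℓ k) refl)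
    (nextOK γ′ ε′ l (cong₂ _+_ ε0 (agree-head ℓ b β γ g)) (cong₂ _+_ (occ-one ℓ) refl) h≤b)
  same′ : ∀ i → occ i (ℓ ∷ js) + γ′ i ≡ occ i js + (ε′ i + γ′ i)
  same′ i = trans (cong (_+ γ′ i) (occ-∷ i ℓ js)) (trans (+-assoc (occ i js) (occ i (ℓ ∷ [])) (γ′ i))
    (cong (λ x → occ i js + (x + γ′ i)) (sym (+-identityʳ (occ i (ℓ ∷ []))))))

decr⇒decᶠ : ∀ β → Decr β → decᶠ (part β)
decr⇒decᶠ = decr-part

decᶠ⇒decr : ∀ β → decᶠ (part β) → Decr β
decᶠ⇒decr []          d = tt
decᶠ⇒decr (x ∷ [])    d = z≤n , tt
decᶠ⇒decr (x ∷ y ∷ β) d = d 0 , decᶠ⇒decr (y ∷ β) (λ i → d (suc i))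

cellsOf-sorted : ∀ s → All Sorted (cellsOf s)
cellsOf-sorted s = go (cellsOf s) (sorted-++ʳ (proj₁ (blocks 1 s)) (letters-sorted 1 s))
  where
  go : ∀ Bs → Sorted (concat Bs) → All Sorted Bs
  go []       p = []
  go (B ∷ Bs) p = sorted-++ˡ B p ∷ go Bs (sorted-++ʳ B p)

Column : List Status → Set
Column s = proj₁ (blocks 1 s) ≡ []

yamCol-word : ∀ β s → length s ≡ length β → Decr β → Column s → Iff (T (yamCol free β s)) (Yam (part β) (word (cellsOf s)))
yamCol-word β s e d col with yamCol-iff 1 free β s (part β) (λ _ → 0) (s≤s z≤n) e d (λ k → refl) (λ k → refl) refl
... | f , g rewrite col = (λ t → cells⇒Yam (part β) (cellsOf s) (cellsOf-sorted s) (decr⇒decᶠ β d) (proj₂ (f t))) ,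
    (λ y → g ([] , Yam⇒cells (part β) (cellsOf s) (cellsOf-sorted s) y))

occ-word : ∀ i Bs → occ i (word Bs) ≡ occ i (concat Bs)
occ-word i []       = refl
occ-word i (B ∷ Bs) = trans (cong (occ i) (word-∷ B Bs)) (trans (occ-++ i (word Bs) B)
  (trans (+-comm (occ i (word Bs)) (occ i B)) (trans (cong (λ x → occ i B + x) (occ-word i Bs)) (sym (occ-++ i B (concat Bs))))))

occ-below : ∀ {x} w i → All (x ≤_) w → i < x → occ i w ≡ 0
occ-below w i a lt = occ-∉ i w (All.map (λ q e → <⇒≢ (<-≤-trans lt q) (sym e)) a)

part-⊕ : ∀ ℓ β s → length s ≡ length β → ∀ i → part (β ⊕ wtCol s) (suc i) ≡ occ (ℓ + i) (letters ℓ s) + part β (suc i)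
part-⊕ ℓ []      []           e i       = refl
part-⊕ ℓ (b ∷ β) (x ∷ s)      e (suc i) = trans (part-⊕ (suc ℓ) β s (suc-injective e) i) (cong (_+ part β (suc i)) (shift x))
  where
  shift : ∀ x → occ (suc ℓ + i) (letters (suc ℓ) s) ≡ occ (ℓ + suc i) (letters ℓ (x ∷ s))
  shift x rewrite +-suc ℓ i = go x
    where
    ne : ℓ ≢ suc (ℓ + i)
    ne e = <⇒≢ (s≤s (m≤m+n ℓ i)) e
    go : ∀ x → occ (suc ℓ + i) (letters (suc ℓ) s) ≡ occ (suc (ℓ + i)) (letters ℓ (x ∷ s))
    go absent = refl
    go join   = sym (occ-other _ ne)
    go start  = sym (occ-other _ ne)
part-⊕ ℓ (b ∷ β) (x ∷ s)      e zero = cong (_+ b) (trans (w x) (cong (λ z → occ z (letters ℓ (x ∷ s))) (sym (+-identityʳ ℓ))))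
  where
  none : occ ℓ (letters (suc ℓ) s) ≡ 0
  none = occ-below _ ℓ (All.map proj₁ (letters-range (suc ℓ) s)) ≤-refl
  w : ∀ x → weight x ≡ occ ℓ (letters ℓ (x ∷ s))
  w absent = sym none
  w join   = sym (trans (occ-head ℓ (letters (suc ℓ) s)) (cong suc none))
  w start  = sym (trans (occ-head ℓ (letters (suc ℓ) s)) (cong suc none))

-- part _ 0 is a junk value; only the letters ≥ 1 matter.
part-column : ∀ β s → length s ≡ length β → Column s → ∀ i → part (β ⊕ wtCol s) i ≡ addWord (part β) (word (cellsOf s)) i
part-column β s e col zero = trans (part-0 (β ⊕ wtCol s)) (sym (cong₂ _+_
  (trans (occ-word 0 (cellsOf s)) (trans (cong (λ z → occ 0 (z ++ concat (cellsOf s))) (sym col)) (occ-below _ 0 (All.map proj₁ (letters-range 1 s)) (s≤s z≤n))))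
  (part-0 β)))
part-column β s e col (suc i) = trans (part-⊕ 1 β s e i) (cong (_+ part β (suc i))
  (trans (cong (λ z → occ (suc i) (z ++ concat (cellsOf s))) col) (sym (occ-word (suc i) (cellsOf s)))))

-- Yamanouchi tableaux

tabWord : List (List Status) → List ℕ
tabWord []      = []
tabWord (s ∷ T) = tabWord T ++ word (cellsOf s)

yamTab : List ℕ → List (List Status) → Bool
yamTab β []      = true
yamTab β (s ∷ T) = yamCol free β s ∧ yamTab (β ⊕ wtCol s) T

okTab-split : ∀ N hs b β T′ → T (okTab true N hs b β T′) → T (okTab false N hs b β T′) × T (yamTab β T′)
okTab-split N []       b β []      t = tt , tt
okTab-split N (h ∷ hs) b β (s ∷ T′) t with ∧-T {okCol true 1 free 0 (extend N h b) β s} t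
... | t₁ , t₂ with okCol-split 1 free 0 (extend N h b) β s t₁ | okTab-split N hs (mins 1 s) (β ⊕ wtCol s) T′ t₂
...   | u , v | x , y = T-∧ u x , T-∧ v y

okTab-join : ∀ N hs b β T′ → T (okTab false N hs b β T′) → T (yamTab β T′) → T (okTab true N hs b β T′)
okTab-join N []       b β []      t y = tt
okTab-join N (h ∷ hs) b β (s ∷ T′) t y with ∧-T {okCol false 1 free 0 (extend N h b) β s} t | ∧-T {yamCol free β s} y
... | u , x | v , w = T-∧ (okCol-join 1 free 0 (extend N h b) β s u v) (okTab-join N hs (mins 1 s) (β ⊕ wtCol s) T′ x w)

-- The equivalence for the columns further left needs a decreasing weight, and this is guaranteed by
-- the condition on the current column; hence `ih` takes that condition as an argument.
yamTab-iff : ∀ β T′ → All (λ s → length s ≡ length β) T′ → All Column T′ → Decr β →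
  Iff (T (yamTab β T′)) (Yam (part β) (tabWord T′))
yamTab-iff β []       es       cs       d = (λ { _ [] [] e → decr⇒decᶠ β d }) , λ _ → tt
yamTab-iff β (s ∷ T′) (e ∷ es) (c ∷ cs) d =
  (λ t → let t₁ , t₂ = ∧-T {yamCol free β s} t ; y = proj₁ col t₁ in
     Yam-join (part β) (tabWord T′) (word (cellsOf s)) y (Yam-cong (tabWord T′) pc (proj₁ (ih y) t₂))) ,
  (λ y → let y₁ , y₂ = Yam-split (part β) (tabWord T′) (word (cellsOf s)) y in
     T-∧ (proj₂ col y₁) (proj₂ (ih y₁) (Yam-cong (tabWord T′) (λ i → sym (pc i)) y₂)))
  where
  col = yamCol-word β s e d c
  pc = part-column β s e c
  ih : Yam (part β) (word (cellsOf s)) → _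
  ih y = yamTab-iff (β ⊕ wtCol s) T′ (All.map (λ q → trans q (sym (⊕-length β (wtCol s) (wtCol-length s e)))) es) cs
    (decᶠ⇒decr (β ⊕ wtCol s) (decᶠ-cong (λ i → sym (pc i)) (y [] (word (cellsOf s)) refl)))

yamTab-decr : ∀ β T′ → All (λ s → length s ≡ length β) T′ → All Column T′ → Decr β → T (yamTab β T′) → Decr (addTab β T′)
yamTab-decr β []       es       cs       d t = d
yamTab-decr β (s ∷ T′) (e ∷ es) (c ∷ cs) d t with ∧-T {yamCol free β s} t
... | t₁ , t₂ = yamTab-decr (β ⊕ wtCol s) T′ (All.map (λ q → trans q (sym (⊕-length β (wtCol s) (wtCol-length s e)))) es) cs
  (decᶠ⇒decr (β ⊕ wtCol s) (decᶠ-cong (λ i → sym (part-column β s e c i)) (proj₁ (yamCol-word β s e d c) t₁ [] (word (cellsOf s)) refl))) t₂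

part-addTab : ∀ β T′ → All (λ s → length s ≡ length β) T′ → All Column T′ → ∀ i → part (addTab β T′) i ≡ addWord (part β) (tabWord T′) i
part-addTab β []       es       cs       i = refl
part-addTab β (s ∷ T′) (e ∷ es) (c ∷ cs) i = trans
  (part-addTab (β ⊕ wtCol s) T′ (All.map (λ q → trans q (sym (⊕-length β (wtCol s) (wtCol-length s e)))) es) cs i)
  (trans (cong (λ z → occ i (tabWord T′) + z) (part-column β s e c i)) (sym (addWord-++ (part β) (tabWord T′) (word (cellsOf s)) i)))

tails-∈⁺ : ∀ u (v : List ℕ) → v ∈ tails (u ++ v)
tails-∈⁺ []      []      = here refl
tails-∈⁺ []      (x ∷ v) = here refl
tails-∈⁺ (x ∷ u) v       = there (tails-∈⁺ u v)

tails-∈⁻ : ∀ w {v : List ℕ} → v ∈ tails w → ∃ λ u → u ++ v ≡ w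
tails-∈⁻ []      (here refl) = [] , refl
tails-∈⁻ (x ∷ w) (here refl) = [] , refl
tails-∈⁻ (x ∷ w) (there m) with tails-∈⁻ w m
... | u , refl = x ∷ u , refl

isYam⇒Yam : ∀ la w → T (isYamanouchi la w) → Yam (part la) w
isYam⇒Yam la w t u v refl i with suc i ≤? foldr _⊔_ 0 w + length la
... | yes le = ≤ᵇ⇒≤ _ _ (all-T (λ j → (occ (suc j) v + part la (suc j)) ≤ᵇ (occ j v + part la j))
       (all-T (λ v → all (λ j → (occ (suc j) v + part la (suc j)) ≤ᵇ (occ j v + part la j)) (range1 (foldr _⊔_ 0 w + length la))) {x = v} t (tails-∈⁺ u v))
       (range1-∈⁺ (s≤s z≤n) le))
... | no gt = ≤-trans (≤-reflexive (cong₂ _+_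
    (occ-∉ (suc (suc i)) v (Allₚ.++⁻ʳ u (All.map (λ q e → <⇒≢ (≤-<-trans q big) e) (max≤ (u ++ v)))))
    (part-beyond la (≤-<-trans (m≤n+m (length la) _) (<-trans (≰⇒> gt) (n<1+n _)))))) z≤n
  where
  max≤ : ∀ w → All (_≤ foldr _⊔_ 0 w) w
  max≤ []      = []
  max≤ (x ∷ w) = m≤m⊔n x _ ∷ All.map (λ q → ≤-trans q (m≤n⊔m x _)) (max≤ w)
  big : foldr _⊔_ 0 (u ++ v) < suc (suc i)
  big = <-trans (≤-<-trans (m≤m+n _ (length la)) (≰⇒> gt)) (n<1+n _)

Yam⇒isYam : ∀ la w → Yam (part la) w → T (isYamanouchi la w)
Yam⇒isYam la w y = T-all _ (tails w) (λ v m → T-all _ (range1 (foldr _⊔_ 0 w + length la)) (λ { zero j∈ → ⊥-elim (1+n≰n (proj₁ (range1-∈⁻ j∈)))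
  ; (suc i) j∈ → ≤⇒≤ᵇ (y (proj₁ (tails-∈⁻ w m)) v (proj₂ (tails-∈⁻ w m)) i) }))

-- Status tableaux as fillings

-- The list runs from the rightmost column, so the number of a column is one more than the number of
-- columns after it in the list.
colAt : List (List Status) → ℕ → List Status
colAt []       c = []
colAt (s ∷ T′) c = if c ≡ᵇ suc (length T′) then s else colAt T′ c

htAt : List ℕ → ℕ → ℕ
htAt []       c = 0
htAt (h ∷ hs) c = if c ≡ᵇ suc (length hs) then h else htAt hs c

nth : List (List ℕ) → ℕ → List ℕ
nth Bs       zero          = []
nth []       (suc r)       = []
nth (B ∷ Bs) (suc zero)    = B
nth (B ∷ Bs) (suc (suc r)) = nth Bs (suc r)

cellOf : List (List Status) → Cell → List ℕ
cellOf T′ (r , c) = nth (cellsOf (colAt T′ c)) r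

colAt-top : ∀ s T′ → colAt (s ∷ T′) (suc (length T′)) ≡ s
colAt-top s T′ rewrite ≡ᵇ-≡ (length T′) = refl

colAt-< : ∀ s T′ {c} → c ≤ length T′ → colAt (s ∷ T′) c ≡ colAt T′ c
colAt-< s T′ le rewrite ≡ᵇ-≢ (<⇒≢ (s≤s le)) = refl

htAt-top : ∀ h hs {c} → c ≡ suc (length hs) → htAt (h ∷ hs) c ≡ h
htAt-top h hs refl rewrite ≡ᵇ-≡ (length hs) = refl

htAt-< : ∀ h hs {c} → c ≤ length hs → htAt (h ∷ hs) c ≡ htAt hs c
htAt-< h hs le rewrite ≡ᵇ-≢ (<⇒≢ (s≤s le)) = refl

colAt-> : ∀ T′ {c} → length T′ < c → colAt T′ c ≡ []
colAt-> []       lt = refl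
colAt-> (s ∷ T′) {c} lt rewrite ≡ᵇ-≢ {c} (λ e → <⇒≢ lt (sym e)) = colAt-> T′ (<-trans (n<1+n _) lt)

htAt-map : ∀ hs {c} → 1 ≤ c → c ≤ length hs → htAt (map suc hs) c ≡ suc (htAt hs c)
htAt-map [] a b = ⊥-elim (<⇒≱ a b)
htAt-map (h ∷ hs) {c} a b with c ≟ suc (length hs)
... | yes refl = trans (htAt-top (suc h) (map suc hs) (cong suc (sym (Lₚ.length-map suc hs)))) (cong suc (sym (htAt-top h hs refl)))
... | no ne = trans (htAt-< (suc h) (map suc hs) (subst (c ≤_) (sym (Lₚ.length-map suc hs)) le))
    (trans (htAt-map hs a le) (cong suc (sym (htAt-< h hs le))))
  where le = ≤-pred (≤∧≢⇒< b ne)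

length-ones : ∀ j hs → length (replicate j 1 ++ map suc hs) ≡ j + length hs
length-ones j hs = trans (Lₚ.length-++ (replicate j 1)) (cong₂ _+_ (Lₚ.length-replicate j) (Lₚ.length-map suc hs))

htAt-ones : ∀ j hs {c} → c ≤ length hs → htAt (replicate j 1 ++ map suc hs) c ≡ htAt (map suc hs) c
htAt-ones zero    hs le = refl
htAt-ones (suc j) hs {c} le = trans (htAt-< 1 (replicate j 1 ++ map suc hs)
  (≤-trans le (≤-trans (m≤n+m _ j) (≤-reflexive (sym (length-ones j hs)))))) (htAt-ones j hs le)

htAt-ones> : ∀ j hs {c} → length hs < c → c ≤ j + length hs → htAt (replicate j 1 ++ map suc hs) c ≡ 1
htAt-ones> zero    hs lt le = ⊥-elim (<⇒≱ lt le)
htAt-ones> (suc j) hs {c} lt le with c ≟ suc (j + length hs)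
... | yes e = htAt-top 1 (replicate j 1 ++ map suc hs) (trans e (cong suc (sym (length-ones j hs))))
... | no ne = trans (htAt-< 1 (replicate j 1 ++ map suc hs) (subst (c ≤_) (sym (length-ones j hs)) le′)) (htAt-ones> j hs lt le′)
  where le′ = ≤-pred (≤∧≢⇒< le ne)

part-≤head : ∀ λ' → Decr λ' → ∀ r → part λ' r ≤ head₀ λ'
part-≤head []       d        r             = z≤n
part-≤head (a ∷ λ') d        zero          = z≤n
part-≤head (a ∷ λ') d        (suc zero)    = ≤-refl
part-≤head (a ∷ λ') (le , d) (suc (suc r)) = ≤-trans (part-≤head λ' d (suc r)) le

heights-shape : ∀ λ' → Decr λ' → ∀ c → 1 ≤ c → c ≤ length (heights λ') → ∀ i →
  Iff (suc i ≤ htAt (heights λ') c) (c ≤ part λ' (suc i))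
heights-shape [] d c 1≤c c≤ i = ⊥-elim (<⇒≱ 1≤c c≤)
heights-shape (a ∷ λ') (h≤a , d) c 1≤c c≤ i with c ≤? length (heights λ')
... | yes le rewrite htAt-ones (a ∸ head₀ λ') (heights λ') le | htAt-map (heights λ') 1≤c le = go i
  where
  go : ∀ i → Iff (suc i ≤ suc (htAt (heights λ') c)) (c ≤ part (a ∷ λ') (suc i))
  go zero    = (λ _ → ≤-trans le (≤-trans (≤-reflexive (heights-length λ' d)) h≤a)) , (λ _ → s≤s z≤n)
  go (suc i) = (λ { (s≤s p) → proj₁ (heights-shape λ' d c 1≤c le i) p }) , (λ p → s≤s (proj₂ (heights-shape λ' d c 1≤c le i) p))
... | no gt rewrite htAt-ones> (a ∸ head₀ λ') (heights λ') (≰⇒> gt) (subst (c ≤_) (length-ones (a ∸ head₀ λ') (heights λ')) c≤) = go i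
  where
  c≤a : c ≤ a
  c≤a = ≤-trans c≤ (≤-reflexive (heights-length (a ∷ λ') (h≤a , d)))
  go : ∀ i → Iff (suc i ≤ 1) (c ≤ part (a ∷ λ') (suc i))
  go zero    = (λ _ → c≤a) , (λ _ → s≤s z≤n)
  go (suc i) = (λ { (s≤s ()) }) , (λ p → ⊥-elim (gt (≤-trans p (≤-trans (part-≤head λ' d (suc i)) (≤-reflexive (sym (heights-length λ' d)))))))

ShapeT : List ℕ → List (List Status) → Set
ShapeT []       []       = ⊤
ShapeT []       (_ ∷ _)  = ⊥
ShapeT (_ ∷ _)  []       = ⊥
ShapeT (h ∷ hs) (s ∷ T′) = Column s × length (cellsOf s) ≡ h × ShapeT hs T′

Bounded : List ℕ → List (List ℕ) → Set
Bounded []      Bs       = ⊤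
Bounded (t ∷ b) []       = ⊥
Bounded (t ∷ b) (B ∷ Bs) = All (_≤ t) B × Bounded b Bs

RowsT : List ℕ → List (List Status) → Set
RowsT b []       = ⊤
RowsT b (s ∷ T′) = Bounded b (cellsOf s) × RowsT (map head₀ (cellsOf s)) T′

within⇒bounded : ∀ b k N Bs → Within (b ++ replicate k N) Bs → Bounded b Bs × length Bs ≡ length b + k
within⇒bounded []      zero    N []       w       = tt , refl
within⇒bounded []      (suc k) N (B ∷ Bs) (_ , w) = tt , cong suc (proj₂ (within⇒bounded [] k N Bs w))
within⇒bounded (t ∷ b) k       N (B ∷ Bs) (a , w) with within⇒bounded b k N Bs w
... | x , y = (a , x) , cong suc y

bounded⇒within : ∀ b k N Bs → All (All (_≤ N)) Bs → Bounded b Bs → length Bs ≡ length b + k → Within (b ++ replicate k N) Bs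
bounded⇒within []      zero    N []       a        x       e = tt
bounded⇒within []      (suc k) N (B ∷ Bs) (p ∷ ps) x       e = p , bounded⇒within [] k N Bs ps tt (suc-injective e)
bounded⇒within (t ∷ b) k       N (B ∷ Bs) (p ∷ ps) (q , x) e = q , bounded⇒within b k N Bs ps x (suc-injective e)

cellsOf-letters : ∀ s → Column s → All (All (λ x → 1 ≤ x × x ≤ length s)) (cellsOf s)
cellsOf-letters s col = Allₚ.concat⁻ (subst (λ z → All (λ x → 1 ≤ x × x ≤ length s) (z ++ concat (cellsOf s))) col (All.map (λ { (a , b) → a , ≤-pred b }) (letters-range 1 s)))

-- Letters are positive, so the initial bound 0 prevents any of them from joining before a cell has
-- been started.
low-column : ∀ s → All (_≤ 0) (proj₁ (blocks 1 s)) → Column s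
low-column s a = go (proj₁ (blocks 1 s)) a (Allₚ.++⁻ˡ (proj₁ (blocks 1 s)) (letters-range 1 s))
  where
  go : ∀ js → All (_≤ 0) js → All (λ x → 1 ≤ x × x < suc (length s)) js → js ≡ []
  go []       a        b        = refl
  go (x ∷ js) (p ∷ ps) (q ∷ qs) = ⊥-elim (<⇒≱ (proj₁ q) p)

okTab⇒shape : ∀ N hs b β T′ → Heights N (length b) hs → T (okTab false N hs b β T′) → ShapeT hs T′ × RowsT b T′
okTab⇒shape N []       b β []       H t = tt , tt
okTab⇒shape N (h ∷ hs) b β (s ∷ T′) ((b≤h , _) ∷ H) t with ∧-T {okCol false 1 free 0 (extend N h b) β s} t
... | t₁ , t₂ with okCol⇒within 1 0 (extend N h b) β s t₁
...   | a , w with within⇒bounded b (h ∸ length b) N (cellsOf s) w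
...     | bd , e = (low-column s a , len , proj₁ ih) , (bd , subst (λ z → RowsT z T′) (mins-heads 1 s) (proj₂ ih))
  where
  len : length (cellsOf s) ≡ h
  len = trans e (m+[n∸m]≡n b≤h)
  lm : length (mins 1 s) ≡ h
  lm = trans (cong length (mins-heads 1 s)) (trans (Lₚ.length-map head₀ (cellsOf s)) len)
  ih = okTab⇒shape N hs (mins 1 s) (β ⊕ wtCol s) T′ (subst (λ z → Heights N z hs) (sym lm) H) t₂

shape⇒okTab : ∀ N hs b β T′ → Heights N (length b) hs → length β ≡ N → All (λ s → length s ≡ N) T′ →
  ShapeT hs T′ → RowsT b T′ → T (okTab false N hs b β T′)
shape⇒okTab N []       b β []       H e es sh rw = tt
shape⇒okTab N (h ∷ hs) b β (s ∷ T′) ((b≤h , _) ∷ H) refl (q ∷ es) (col , len , sh) (bd , rw) = T-∧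
  (within⇒okCol 1 0 (extend N h b) β s q (subst (All (_≤ 0)) (sym col) [])
    (bounded⇒within b (h ∸ length b) N (cellsOf s)
      (All.map (All.map (λ z → ≤-trans (proj₂ z) (≤-reflexive q))) (cellsOf-letters s col)) bd (trans len (sym (m+[n∸m]≡n b≤h)))))
  (shape⇒okTab N hs (mins 1 s) (β ⊕ wtCol s) T′ (subst (λ z → Heights N z hs) (sym lm) H) (⊕-length β (wtCol s) (wtCol-length s q)) es sh
    (subst (λ z → RowsT z T′) (sym (mins-heads 1 s)) rw))
  where
  lm : length (mins 1 s) ≡ h
  lm = trans (cong length (mins-heads 1 s)) (trans (Lₚ.length-map head₀ (cellsOf s)) len)

shape-length : ∀ hs T′ → ShapeT hs T′ → length T′ ≡ length hs
shape-length []       []       sh           = refl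
shape-length (h ∷ hs) (s ∷ T′) (_ , _ , sh) = cong suc (shape-length hs T′ sh)

shape-columns : ∀ hs T′ → ShapeT hs T′ → All Column T′
shape-columns []       []       sh           = []
shape-columns (h ∷ hs) (s ∷ T′) (c , _ , sh) = c ∷ shape-columns hs T′ sh

shape-column : ∀ hs T′ → ShapeT hs T′ → ∀ c → length (cellsOf (colAt T′ c)) ≡ htAt hs c
shape-column []       []       sh           c = refl
shape-column (h ∷ hs) (s ∷ T′) (_ , e , sh) c rewrite shape-length hs T′ sh with c ≡ᵇ suc (length hs)
... | true  = e
... | false = shape-column hs T′ sh c

nth-All : ∀ {P : List ℕ → Set} Bs → All P Bs → ∀ {i} → i < length Bs → P (nth Bs (suc i))
nth-All (B ∷ Bs) (p ∷ ps) {zero}  lt       = p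
nth-All (B ∷ Bs) (p ∷ ps) {suc i} (s≤s lt) = nth-All Bs ps lt

nth-beyond : ∀ Bs {r} → length Bs < r → nth Bs r ≡ []
nth-beyond []       {suc r}       lt       = refl
nth-beyond (B ∷ Bs) {suc (suc r)} (s≤s lt) = nth-beyond Bs lt
nth-beyond (B ∷ Bs) {suc zero}    (s≤s ())

nth-heads : ∀ Bs i → part (map head₀ Bs) (suc i) ≡ head₀ (nth Bs (suc i))
nth-heads []       i       = refl
nth-heads (B ∷ Bs) zero    = refl
nth-heads (B ∷ Bs) (suc i) = nth-heads Bs i

head-∈ : ∀ B → NonEmpty B → head₀ B ∈ B
head-∈ (x ∷ B) _ = here refl

head-≤ : ∀ B → Sorted B → ∀ {y} → y ∈ B → head₀ B ≤ y
head-≤ (x ∷ B) (p ∷ s) (here refl) = ≤-refl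
head-≤ (x ∷ B) (p ∷ s) (there m)   = <⇒≤ (All.lookup p m)

bounded-nth : ∀ b Bs → Bounded b Bs → ∀ i → i < length b → i < length Bs × All (_≤ part b (suc i)) (nth Bs (suc i))
bounded-nth (t ∷ b) (B ∷ Bs) (a , bd) zero    lt       = s≤s z≤n , a
bounded-nth (t ∷ b) (B ∷ Bs) (a , bd) (suc i) (s≤s lt) with bounded-nth b Bs bd i lt
... | x , y = s≤s x , y

-- A minimum is an element of its cell, so it is bounded by the next minimum to the right. Comparing
-- neighbouring columns therefore controls distant ones.
rows-bound : ∀ b T′ → RowsT b T′ → ∀ c → 1 ≤ c → c ≤ length T′ → ∀ i → i < length b → ∀ x → x ∈ cellOf T′ (suc i , c) → x ≤ part b (suc i)
rows-bound b []       rw c 1≤c c≤ i lt x m = ⊥-elim (<⇒≱ 1≤c c≤)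
rows-bound b (s ∷ T′) (bd , rw) c 1≤c c≤ i lt x m with bounded-nth b (cellsOf s) bd i lt
... | i< , al with c ≟ suc (length T′)
...   | yes refl = All.lookup al (subst (λ z → x ∈ nth (cellsOf z) (suc i)) (colAt-top s T′) m)
...   | no ne = ≤-trans
        (rows-bound (map head₀ (cellsOf s)) T′ rw c 1≤c le i (subst (i <_) (sym (Lₚ.length-map head₀ (cellsOf s))) i<) x
          (subst (λ z → x ∈ nth (cellsOf z) (suc i)) (colAt-< s T′ le) m))
        (≤-trans (≤-reflexive (nth-heads (cellsOf s) i))
          (All.lookup al (head-∈ _ (nth-All (cellsOf s) (blocks-nonEmpty 1 s) i<))))
  where le = ≤-pred (≤∧≢⇒< c≤ ne)

rows-pair : ∀ b T′ → RowsT b T′ → ∀ c c' → 1 ≤ c → c < c' → c' ≤ length T′ → ∀ i x y →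
  x ∈ cellOf T′ (suc i , c) → y ∈ cellOf T′ (suc i , c') → x ≤ y
rows-pair b []       rw c c' 1≤c c<c' c'≤ i x y mx my = ⊥-elim (<⇒≱ (<-trans 1≤c c<c') c'≤)
rows-pair b (s ∷ T′) (bd , rw) c c' 1≤c c<c' c'≤ i x y mx my with c' ≟ suc (length T′)
... | yes refl = ≤-trans (rows-bound (map head₀ (cellsOf s)) T′ rw c 1≤c (≤-pred c<c') i
        (subst (i <_) (sym (Lₚ.length-map head₀ (cellsOf s))) i<) x (subst (λ z → x ∈ nth (cellsOf z) (suc i)) (colAt-< s T′ (≤-pred c<c')) mx))
      (≤-trans (≤-reflexive (nth-heads (cellsOf s) i)) (head-≤ _ (nth-All (cellsOf s) (cellsOf-sorted s) i<) my′))
  where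
  my′ : y ∈ nth (cellsOf s) (suc i)
  my′ = subst (λ z → y ∈ nth (cellsOf z) (suc i)) (colAt-top s T′) my
  i< : i < length (cellsOf s)
  i< with suc i ≤? length (cellsOf s)
  ... | yes q = q
  ... | no q with subst (y ∈_) (nth-beyond (cellsOf s) (≰⇒> q)) my′
  ...   | ()
... | no ne = rows-pair (map head₀ (cellsOf s)) T′ rw c c' 1≤c c<c' le i x y
    (subst (λ z → x ∈ nth (cellsOf z) (suc i)) (colAt-< s T′ (<⇒≤ (<-≤-trans c<c' le))) mx)
    (subst (λ z → y ∈ nth (cellsOf z) (suc i)) (colAt-< s T′ le) my)
  where le = ≤-pred (≤∧≢⇒< c'≤ ne)

sorted-nth : ∀ Bs → Sorted (concat Bs) → ∀ i j → i < j → ∀ x y → x ∈ nth Bs (suc i) → y ∈ nth Bs (suc j) → x < y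
sorted-nth (B ∷ Bs) s zero    (suc j) lt       x y mx my = go B s mx
  where
  in-concat : ∀ Bs j → y ∈ nth Bs (suc j) → y ∈ concat Bs
  in-concat (B ∷ Bs) zero    m = ∈ₚ.∈-++⁺ˡ m
  in-concat (B ∷ Bs) (suc j) m = ∈ₚ.∈-++⁺ʳ B (in-concat Bs j m)
  go : ∀ B → Sorted (B ++ concat Bs) → x ∈ B → x < y
  go (z ∷ B) (p ∷ s) (here refl) = All.lookup p (∈ₚ.∈-++⁺ʳ B (in-concat Bs j my))
  go (z ∷ B) (p ∷ s) (there m)   = go B s m
sorted-nth (B ∷ Bs) s (suc i) (suc j) (s≤s lt) x y mx my = sorted-nth Bs (sorted-++ʳ B s) i j lt x y mx my

cellsOf-concat-sorted : ∀ s → Sorted (concat (cellsOf s))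
cellsOf-concat-sorted s = sorted-++ʳ (proj₁ (blocks 1 s)) (letters-sorted 1 s)

-- Status words of columns

-- Sortedness leaves three cases for the letter ℓ: it is the next letter of the current cell, the
-- least letter of the next one, or absent.
statuses : ∀ k ℓ js Bs → Sorted (js ++ concat Bs) → All NonEmpty Bs → All (λ x → ℓ ≤ x × x < ℓ + k) (js ++ concat Bs) →
  ∃ λ s → length s ≡ k × blocks ℓ s ≡ (js , Bs)
statuses zero ℓ []       []             so ne rg = [] , refl , refl
statuses zero ℓ []       ((x ∷ B) ∷ Bs) so ne ((a , b) ∷ rg) = ⊥-elim (<⇒≱ b (≤-trans (≤-reflexive (+-identityʳ ℓ)) a))
statuses zero ℓ []       ([] ∷ Bs)      so (() ∷ _) rg
statuses zero ℓ (x ∷ js) Bs             so ne ((a , b) ∷ rg) = ⊥-elim (<⇒≱ b (≤-trans (≤-reflexive (+-identityʳ ℓ)) a))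
statuses (suc k) ℓ js Bs so ne rg = first js Bs so ne rg
  where
  later : ∀ {xs} → All (λ x → ℓ ≤ x × x < ℓ + suc k) xs → All (ℓ <_) xs → All (λ x → suc ℓ ≤ x × x < suc ℓ + k) xs
  later rg gt = All.zipWith (λ { ((a , b) , c) → c , ≤-trans b (≤-reflexive (+-suc ℓ k)) }) (rg , gt)
  skip : ∀ js Bs → Sorted (js ++ concat Bs) → All NonEmpty Bs → All (λ x → ℓ ≤ x × x < ℓ + suc k) (js ++ concat Bs) →
    All (ℓ <_) (js ++ concat Bs) → ∃ λ s → length s ≡ suc k × blocks ℓ s ≡ (js , Bs)
  skip js Bs so ne rg gt with statuses k (suc ℓ) js Bs so ne (later rg gt)
  ... | s , e , q = absent ∷ s , cong suc e , q
  first : ∀ js Bs → Sorted (js ++ concat Bs) → All NonEmpty Bs → All (λ x → ℓ ≤ x × x < ℓ + suc k) (js ++ concat Bs) →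
    ∃ λ s → length s ≡ suc k × blocks ℓ s ≡ (js , Bs)
  first (x ∷ js) Bs (p ∷ so) ne (r ∷ rg) with x ≟ ℓ
  ... | no x≢ = skip (x ∷ js) Bs (p ∷ so) ne (r ∷ rg) (ℓ<x ∷ All.map (<-trans ℓ<x) p)
    where ℓ<x = ≤∧≢⇒< (proj₁ r) (λ e → x≢ (sym e))
  ... | yes refl with statuses k (suc ℓ) js Bs so ne (later rg p)
  ...   | s , e , q = join ∷ s , cong suc e , cong (λ z → ℓ ∷ proj₁ z , proj₂ z) q
  first [] [] so ne rg = skip [] [] so ne rg []
  first [] ([] ∷ Bs) so (() ∷ _) rg
  first [] ((x ∷ B) ∷ Bs) (p ∷ so) (n ∷ ne) (r ∷ rg) with x ≟ ℓ
  ... | no x≢ = skip [] ((x ∷ B) ∷ Bs) (p ∷ so) (n ∷ ne) (r ∷ rg) (ℓ<x ∷ All.map (<-trans ℓ<x) p)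
    where ℓ<x = ≤∧≢⇒< (proj₁ r) (λ e → x≢ (sym e))
  ... | yes refl with statuses k (suc ℓ) B Bs so ne (later rg p)
  ...   | s , e , q = start ∷ s , cong suc e , cong (λ z → [] , (ℓ ∷ proj₁ z) ∷ proj₂ z) q

letters-≢ : ∀ ℓ s {xs} → letters (suc ℓ) s ≢ ℓ ∷ xs
letters-≢ ℓ s e with subst (All (λ x → suc ℓ ≤ x × x < suc ℓ + length s)) e (letters-range (suc ℓ) s)
... | (a , _) ∷ _ = 1+n≰n a

statuses-injective : ∀ ℓ s s' → length s ≡ length s' → blocks ℓ s ≡ blocks ℓ s' → s ≡ s'
statuses-injective ℓ []           []             e q = refl
statuses-injective ℓ (absent ∷ s) (absent ∷ s')  e q = cong (absent ∷_) (statuses-injective (suc ℓ) s s' (suc-injective e) q)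
statuses-injective ℓ (join ∷ s)   (join ∷ s')    e q = cong (join ∷_) (statuses-injective (suc ℓ) s s' (suc-injective e)
  (cong₂ _,_ (Lₚ.∷-injectiveʳ (cong proj₁ q)) (cong proj₂ q)))
statuses-injective ℓ (start ∷ s)  (start ∷ s')   e q = cong (start ∷_) (statuses-injective (suc ℓ) s s' (suc-injective e)
  (cong₂ _,_ (Lₚ.∷-injectiveʳ (Lₚ.∷-injectiveˡ (cong proj₂ q))) (Lₚ.∷-injectiveʳ (cong proj₂ q))))
statuses-injective ℓ (join ∷ s)   (start ∷ s')   e q with cong proj₁ q
... | ()
statuses-injective ℓ (start ∷ s)  (join ∷ s')    e q with cong proj₁ q
... | ()
statuses-injective ℓ (absent ∷ s) (join ∷ s')    e q = ⊥-elim (letters-≢ ℓ s (cong (λ z → proj₁ z ++ concat (proj₂ z)) q))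
statuses-injective ℓ (absent ∷ s) (start ∷ s')   e q = ⊥-elim (letters-≢ ℓ s (cong (λ z → proj₁ z ++ concat (proj₂ z)) q))
statuses-injective ℓ (join ∷ s)   (absent ∷ s')  e q = sym (statuses-injective ℓ (absent ∷ s') (join ∷ s) (sym e) (sym q))
statuses-injective ℓ (start ∷ s)  (absent ∷ s')  e q = sym (statuses-injective ℓ (absent ∷ s') (start ∷ s) (sym e) (sym q))

words-∈⁺ : ∀ s → s ∈ words (length s)
words-∈⁺ []           = here refl
words-∈⁺ (absent ∷ s) = ∈ₚ.∈-++⁺ˡ (∈ₚ.∈-map⁺ (absent ∷_) (words-∈⁺ s))
words-∈⁺ (join ∷ s)   = ∈ₚ.∈-++⁺ʳ (map (absent ∷_) (words (length s))) (∈ₚ.∈-++⁺ˡ (∈ₚ.∈-map⁺ (join ∷_) (words-∈⁺ s)))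
words-∈⁺ (start ∷ s)  = ∈ₚ.∈-++⁺ʳ (map (absent ∷_) (words (length s))) (∈ₚ.∈-++⁺ʳ (map (join ∷_) (words (length s))) (∈ₚ.∈-map⁺ (start ∷_) (words-∈⁺ s)))

words-unique : ∀ n → Unique (words n)
words-unique zero    = [] ∷ []
words-unique (suc n) = Uₚ.++⁺ (u absent) (Uₚ.++⁺ (u join) (u start) (disj λ ())) dj
  where
  u : ∀ x → Unique (map (x ∷_) (words n))
  u x = Uₚ.map⁺ Lₚ.∷-injectiveʳ (words-unique n)
  disj : ∀ {x y : Status} → x ≢ y → ∀ {s} → s ∈ map (x ∷_) (words n) × s ∈ map (y ∷_) (words n) → ⊥
  disj ne (p , q) with ∈ₚ.∈-map⁻ _ p | ∈ₚ.∈-map⁻ _ q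
  ... | _ , _ , refl | _ , _ , e = ne (Lₚ.∷-injectiveˡ e)
  dj : ∀ {s} → s ∈ map (absent ∷_) (words n) × s ∈ map (join ∷_) (words n) ++ map (start ∷_) (words n) → ⊥
  dj (p , q) with ∈ₚ.∈-++⁻ (map (join ∷_) (words n)) q
  ... | inj₁ r = disj (λ ()) (p , r)
  ... | inj₂ r = disj (λ ()) (p , r)

tabs-∈⁺ : ∀ hs n T′ → length T′ ≡ length hs → All (λ s → length s ≡ n) T′ → T′ ∈ tabs hs n
tabs-∈⁺ []       n []       e es          = here refl
tabs-∈⁺ (h ∷ hs) n (s ∷ T′) e (refl ∷ es) = ∈-concatMap⁺ _ (words-∈⁺ s) (∈ₚ.∈-map⁺ (s ∷_) (tabs-∈⁺ hs n T′ (suc-injective e) es))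

tabs-unique : ∀ hs n → Unique (tabs hs n)
tabs-unique []       n = [] ∷ []
tabs-unique (h ∷ hs) n = unique-concatMap _ back ok (λ s → Uₚ.map⁺ Lₚ.∷-injectiveʳ (tabs-unique hs n)) (words-unique n)
  where
  back : List (List Status) → List Status
  back []      = []
  back (s ∷ _) = s
  ok : ∀ s T′ → T′ ∈ map (s ∷_) (tabs hs n) → back T′ ≡ s
  ok s T′ m with ∈ₚ.∈-map⁻ _ m
  ... | _ , _ , refl = refl

sublists-∈⁺ : ∀ ys → Sorted ys → ∀ xs → Sorted xs → All (_∈ ys) xs → xs ∈ sublists ys
sublists-∈⁺ []       so []       sx a        = here refl
sublists-∈⁺ []       so (x ∷ xs) sx (() ∷ _)
sublists-∈⁺ (y ∷ ys) so []       sx a        = ∈ₚ.∈-++⁺ʳ (map (y ∷_) (sublists ys)) (sublists-∈⁺ ys (AP-tail so) [] [] [])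
  where
  AP-tail : Sorted (y ∷ ys) → Sorted ys
  AP-tail (_ ∷ s) = s
sublists-∈⁺ (y ∷ ys) (p ∷ so) (x ∷ xs) (q ∷ sx) (m ∷ ms) with x ≟ y
... | yes refl = ∈ₚ.∈-++⁺ˡ (∈ₚ.∈-map⁺ (x ∷_) (sublists-∈⁺ ys so xs sx (All.zipWith (λ { (lt , z) → tail-∈ lt z }) (q , ms))))
  where
  tail-∈ : ∀ {z} → x < z → z ∈ x ∷ ys → z ∈ ys
  tail-∈ lt (here refl) = ⊥-elim (<-irrefl refl lt)
  tail-∈ lt (there m)   = m
... | no ne = ∈ₚ.∈-++⁺ʳ (map (y ∷_) (sublists ys)) (sublists-∈⁺ ys so (x ∷ xs) (q ∷ sx) (skip m ∷ All.zipWith (λ { (lt , z) → skip′ lt z }) (q , ms)))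
  where
  skip : x ∈ y ∷ ys → x ∈ ys
  skip (here e)  = ⊥-elim (ne e)
  skip (there m) = m
  skip′ : ∀ {z} → x < z → z ∈ y ∷ ys → z ∈ ys
  skip′ lt (here refl) = ⊥-elim (<-asym lt (All.lookup p (skip m)))
  skip′ lt (there m)   = m

sublists-∈⁻ : ∀ ys → Sorted ys → ∀ {xs} → xs ∈ sublists ys → Sorted xs × All (_∈ ys) xs
sublists-∈⁻ []       so (here refl) = [] , []
sublists-∈⁻ (y ∷ ys) (p ∷ so) m with ∈ₚ.∈-++⁻ (map (y ∷_) (sublists ys)) m
... | inj₂ r with sublists-∈⁻ ys so r
...   | a , b = a , All.map there b
sublists-∈⁻ (y ∷ ys) (p ∷ so) m | inj₁ r with ∈ₚ.∈-map⁻ _ r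
... | xs , q , refl with sublists-∈⁻ ys so q
...   | a , b = All.map (All.lookup p) b ∷ a , here refl ∷ All.map there b

sublists-unique : ∀ ys → Sorted ys → Unique (sublists ys)
sublists-unique []       so       = [] ∷ []
sublists-unique (y ∷ ys) (p ∷ so) = Uₚ.++⁺ (Uₚ.map⁺ Lₚ.∷-injectiveʳ (sublists-unique ys so)) (sublists-unique ys so) dj
  where
  dj : ∀ {xs} → xs ∈ map (y ∷_) (sublists ys) × xs ∈ sublists ys → ⊥
  dj (a , b) with ∈ₚ.∈-map⁻ _ a
  ... | xs , q , refl with sublists-∈⁻ ys so b
  ...   | _ , m ∷ _ = <-irrefl refl (All.lookup p m)

range1-sorted : ∀ n → Sorted (range1 n)
range1-sorted n = subst Sorted (sym (Lₚ.map-upTo suc n)) (APₚ.applyUpTo⁺₁ suc n (λ lt _ → s≤s lt))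

nonemptySubsets-∈⁺ : ∀ n B → NonEmpty B → Sorted B → All (λ x → 1 ≤ x × x ≤ n) B → B ∈ nonemptySubsets n
nonemptySubsets-∈⁺ n (x ∷ B) ne so a = ∈ₚ.∈-filter⁺ _ (sublists-∈⁺ (range1 n) (range1-sorted n) (x ∷ B) so (All.map (λ { (p , q) → range1-∈⁺ p q }) a)) tt

nonemptySubsets-∈⁻ : ∀ n B → B ∈ nonemptySubsets n → NonEmpty B × Sorted B × All (λ x → 1 ≤ x × x ≤ n) B
nonemptySubsets-∈⁻ n B m with ∈ₚ.∈-filter⁻ _ {xs = sublists (range1 n)} m
... | q , t with sublists-∈⁻ (range1 n) (range1-sorted n) q
...   | a , b = ne B t , a , All.map range1-∈⁻ b
  where
  ne : ∀ B → T (nonEmpty B) → NonEmpty B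
  ne (x ∷ B) t = tt

nonemptySubsets-unique : ∀ n → Unique (nonemptySubsets n)
nonemptySubsets-unique n = Uₚ.filter⁺ _ (sublists-unique (range1 n) (range1-sorted n))

-- Set-valued fillings

entry-look : ∀ S x → entry S x ≡ look [] S x
entry-look []                  x         = refl
entry-look (((r , c) , s) ∷ S) (r' , c') with (r ≡ᵇ r') ∧ (c ≡ᵇ c')
... | true  = refl
... | false = entry-look S (r' , c')

choices-∈⁺ : ∀ cs φ (ψ : Cell → ℕ) → (∀ x → x ∈ cs → ψ x ∈ φ x) → tabulate′ cs ψ ∈ choices (tabulate′ cs φ)
choices-∈⁺ []       φ ψ h = here refl
choices-∈⁺ (c ∷ cs) φ ψ h = ∈-concatMap⁺ _ (h c (here refl)) (∈ₚ.∈-map⁺ _ (choices-∈⁺ cs φ ψ (λ x m → h x (there m))))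

choices-∈⁻ : ∀ cs φ → Unique cs → ∀ {X} → X ∈ choices (tabulate′ cs φ) →
  X ≡ tabulate′ cs (look 0 X) × (∀ x → x ∈ cs → look 0 X x ∈ φ x)
choices-∈⁻ []       φ u (here refl) = refl , λ _ ()
choices-∈⁻ (c ∷ cs) φ (n ∷ u) m with ∈-concatMap⁻ _ (φ c) m
... | v , v∈ , m' with ∈ₚ.∈-map⁻ _ m'
...   | X , X∈ , refl with choices-∈⁻ cs φ u X∈
...     | e , h = cong₂ _∷_ (cong (c ,_) (sym (look-head 0 c v X)))
                    (trans e (tabulate′-cong cs (λ x m → sym (look-tail 0 {c} {v} {X} {x} (All.lookup n m))))) , h'
    where
    h' : ∀ x → x ∈ c ∷ cs → look 0 ((c , v) ∷ X) x ∈ φ x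
    h' x (here refl) = subst (_∈ φ x) (sym (look-head 0 c v X)) v∈
    h' x (there m)   = subst (_∈ φ x) (sym (look-tail 0 {c} {v} {X} {x} (All.lookup n m))) (h x m)

SetValued : List Cell → (Cell → List ℕ) → Set
SetValued cs φ = ∀ {r c r' c'} → (r , c) ∈ cs → (r' , c') ∈ cs → ∀ a b → a ∈ φ (r , c) → b ∈ φ (r' , c') →
  (r ≡ r' → c < c' → a ≤ b) × (c ≡ c' → r < r' → a < b)

setValued⇒ : ∀ cs φ → Unique cs → SetValued cs φ → T (isSetValued (tabulate′ cs φ))
setValued⇒ cs φ u sv = T-all _ (choices (tabulate′ cs φ)) one-choice
  where
  one-choice : ∀ X → X ∈ choices (tabulate′ cs φ) → T (isSSYT X)
  one-choice X X∈ with choices-∈⁻ cs φ u X∈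
  ... | eX , h = T-all _ X (λ p p∈ → T-all _ X (λ q q∈ → ok p q p∈ q∈))
    where
    ψ = look 0 X
    ok : ∀ p q → p ∈ X → q ∈ X → _
    ok p q p∈ q∈ with ∈ₚ.∈-map⁻ _ (subst (p ∈_) eX p∈) | ∈ₚ.∈-map⁻ _ (subst (q ∈_) eX q∈)
    ... | (r , c) , m , refl | (r' , c') , m' , refl = T-∧
      (T-imp {(r ≡ᵇ r') ∧ (c ≤ᵇ c')} (λ t → ≤⇒≤ᵇ (rowOK (≡ᵇ⇒≡ r r' (proj₁ (∧-T {r ≡ᵇ r'} t))) (≤ᵇ⇒≤ c c' (proj₂ (∧-T {r ≡ᵇ r'} t))))))
      (T-imp {(c ≡ᵇ c') ∧ (r <ᵇ r')} (λ t → <⇒<ᵇ (proj₂ (sv m m' _ _ (h _ m) (h _ m')) (≡ᵇ⇒≡ c c' (proj₁ (∧-T {c ≡ᵇ c'} t))) (<ᵇ⇒< r r' (proj₂ (∧-T {c ≡ᵇ c'} t))))))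
      where
      rowOK : r ≡ r' → c ≤ c' → ψ (r , c) ≤ ψ (r' , c')
      rowOK refl le with c ≟ c'
      ... | yes refl = ≤-refl
      ... | no ne    = proj₁ (sv m m' _ _ (h _ m) (h _ m')) refl (≤∧≢⇒< le ne)

setValued⇐ : ∀ cs φ → (∀ x → x ∈ cs → NonEmpty (φ x)) → T (isSetValued (tabulate′ cs φ)) → SetValued cs φ
setValued⇐ cs φ ne t {r} {c} {r'} {c'} m m' a b a∈ b∈ =
  (λ { refl lt → ≤ᵇ⇒≤ _ _ (imp-T (proj₁ (ok (λ e → <⇒≢ lt (cong proj₂ e)))) (T-∧ (≡⇒≡ᵇ r r' refl) (≤⇒≤ᵇ (<⇒≤ lt)))) }) ,
  (λ { refl lt → <ᵇ⇒< _ _ (imp-T (proj₂ (ok (λ e → <⇒≢ lt (cong proj₁ e)))) (T-∧ (≡⇒≡ᵇ c c' refl) (<⇒<ᵇ lt))) })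
  where
  p q : Cell
  p = (r , c)
  q = (r' , c')
  -- A choice that takes the values `a` and `b` at the two cells to be compared, which are distinct,
  -- and the least element elsewhere.
  ψ : Cell → ℕ
  ψ x = if eqCell p x then a else (if eqCell q x then b else head₀ (φ x))
  ψ-∈ : ∀ x → x ∈ cs → ψ x ∈ φ x
  ψ-∈ x x∈ with eqCell p x in e₁
  ... | true = subst (λ z → a ∈ φ z) (eqCell-T p x (subst T (sym e₁) tt)) a∈
  ... | false with eqCell q x in e₂
  ...   | true  = subst (λ z → b ∈ φ z) (eqCell-T q x (subst T (sym e₂) tt)) b∈
  ...   | false = head-∈ (φ x) (ne x x∈)
  ok : p ≢ q → T (not ((r ≡ᵇ r') ∧ (c ≤ᵇ c')) ∨ (a ≤ᵇ b)) × T (not ((c ≡ᵇ c') ∧ (r <ᵇ r')) ∨ (a <ᵇ b))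
  ok ne = ∧-T {not ((r ≡ᵇ r') ∧ (c ≤ᵇ c')) ∨ (a ≤ᵇ b)} (all-T _ (all-T _ (all-T isSSYT t (choices-∈⁺ cs φ ψ ψ-∈)) (in-X a p m ψp)) (in-X b q m' ψq))
    where
    in-X : ∀ v x → x ∈ cs → ψ x ≡ v → (x , v) ∈ tabulate′ cs ψ
    in-X v x x∈ refl = ∈ₚ.∈-map⁺ (λ c → (c , ψ c)) x∈
    ψp : ψ p ≡ a
    ψp rewrite eqCell-refl p = refl
    ψq : ψ q ≡ b
    ψq rewrite eqCell-≢ ne | eqCell-refl q = refl

-- Sums over the cells of a filling

sumTo : (ℕ → ℕ) → ℕ → ℕ
sumTo f zero    = 0
sumTo f (suc n) = sumTo f n + f (suc n)

range1-suc : ∀ n → range1 (suc n) ≡ range1 n ++ suc n ∷ []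
range1-suc n = trans (cong (map suc) (sym (Lₚ.upTo-∷ʳ n))) (Lₚ.map-++ suc (upTo n) (n ∷ []))

sum-range1 : ∀ f n → sum (map f (range1 n)) ≡ sumTo f n
sum-range1 f zero    = refl
sum-range1 f (suc n) = trans (cong (sum ∘ map f) (range1-suc n)) (trans (cong sum (Lₚ.map-++ f (range1 n) (suc n ∷ [])))
  (trans (sum-++ (map f (range1 n)) (f (suc n) ∷ [])) (cong₂ _+_ (sum-range1 f n) (+-identityʳ (f (suc n))))))

sumTo-cong : ∀ {f g} n → (∀ k → 1 ≤ k → k ≤ n → f k ≡ g k) → sumTo f n ≡ sumTo g n
sumTo-cong zero    h = refl
sumTo-cong (suc n) h = cong₂ _+_ (sumTo-cong n (λ k a b → h k a (m≤n⇒m≤1+n b))) (h (suc n) (s≤s z≤n) ≤-refl)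

sumTo-extend : ∀ f m n → m ≤ n → (∀ k → m < k → f k ≡ 0) → sumTo f m ≡ sumTo f n
sumTo-extend f m n le h with m ≟ n
... | yes refl = refl
sumTo-extend f m zero    z≤n h | no ne = ⊥-elim (ne refl)
sumTo-extend f m (suc n) le h | no ne = trans (sumTo-extend f m n (≤-pred lt) h)
  (trans (sym (+-identityʳ _)) (cong (λ z → sumTo f n + z) (sym (h (suc n) lt))))
  where lt = ≤∧≢⇒< le ne

sumTo-+ : ∀ f g n → sumTo (λ k → f k + g k) n ≡ sumTo f n + sumTo g n
sumTo-+ f g zero    = refl
sumTo-+ f g (suc n) = trans (cong (_+ (f (suc n) + g (suc n))) (sumTo-+ f g n)) (interchange (sumTo f n) (sumTo g n) (f (suc n)) (g (suc n)))

sumTo-swap : ∀ (f : ℕ → ℕ → ℕ) m n → sumTo (λ i → sumTo (f i) n) m ≡ sumTo (λ j → sumTo (λ i → f i j) m) n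
sumTo-swap f zero    n = sym (zero′ n)
  where
  zero′ : ∀ n → sumTo (λ _ → 0) n ≡ 0
  zero′ zero    = refl
  zero′ (suc n) = trans (+-identityʳ _) (zero′ n)
sumTo-swap f (suc m) n = trans (cong (_+ sumTo (f (suc m)) n) (sumTo-swap f m n)) (sym (sumTo-+ _ (f (suc m)) n))

sum-concatMap : ∀ {A B : Set} (g : B → ℕ) (h : A → List B) xs → sum (map g (concatMap h xs)) ≡ sum (map (λ x → sum (map g (h x))) xs)
sum-concatMap g h []       = refl
sum-concatMap g h (x ∷ xs) = trans (cong sum (Lₚ.map-++ g (h x) (concatMap h xs)))
  (trans (sum-++ (map g (h x)) (map g (concatMap h xs))) (cong (λ z → sum (map g (h x)) + z) (sum-concatMap g h xs)))

occ-concatMap : ∀ {A : Set} i (g : A → List ℕ) xs → occ i (concatMap g xs) ≡ sum (map (λ x → occ i (g x)) xs)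
occ-concatMap i g []       = refl
occ-concatMap i g (x ∷ xs) = trans (occ-++ i (g x) (concatMap g xs)) (cong (λ z → occ i (g x) + z) (occ-concatMap i g xs))

sum-reverse : ∀ {A : Set} (f : A → ℕ) xs → sum (map f (reverse xs)) ≡ sum (map f xs)
sum-reverse f []       = refl
sum-reverse f (x ∷ xs) = trans (cong (sum ∘ map f) (Lₚ.unfold-reverse x xs)) (trans (cong sum (Lₚ.map-++ f (reverse xs) (x ∷ [])))
  (trans (sum-++ (map f (reverse xs)) (f x ∷ [])) (trans (cong₂ _+_ (sum-reverse f xs) (+-identityʳ (f x))) (+-comm _ (f x)))))

sum-cells : ∀ mu (g : Cell → ℕ) → sum (map g (skewCells mu [])) ≡ sumTo (λ r → sumTo (λ c → g (r , c)) (part mu r)) (length mu)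
sum-cells mu g = trans (sum-concatMap g (λ r → map (λ k → (r , k)) (range1 (part mu r))) (range1 (length mu)))
  (trans (sum-range1 _ (length mu)) (sumTo-cong (length mu) (λ r _ _ →
    trans (cong sum (sym (Lₚ.map-∘ (range1 (part mu r))))) (sum-range1 (λ c → g (r , c)) (part mu r)))))

-- `colWord` visits every row of μ in each column; the rows above the column contribute empty words.
word-nth : ∀ Bs R → length Bs ≤ R → concatMap (nth Bs) (reverse (range1 R)) ≡ word Bs
word-nth Bs R le = trans (cong concat (Lₚ.reverse-map (nth Bs) (range1 R)))
  (trans (cong word (sym (Lₚ.map-∘ (upTo R)))) (trans (cong word (Lₚ.map-upTo (λ i → nth Bs (suc i)) R)) (go Bs R le)))
  where
  go : ∀ Bs R → length Bs ≤ R → word (applyUpTo (λ i → nth Bs (suc i)) R) ≡ word Bs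
  go []       zero    le       = refl
  go []       (suc R) le       = trans (word-∷ [] (applyUpTo (λ i → []) R)) (trans (Lₚ.++-identityʳ _) (go [] R z≤n))
  go (B ∷ Bs) (suc R) (s≤s le) = trans (word-∷ B (applyUpTo (λ i → nth Bs (suc i)) R)) (trans (cong (_++ B) (go Bs R le)) (sym (word-∷ B Bs)))

concatMap-cong-∈ : ∀ {A B : Set} {f g : A → List B} xs → (∀ x → x ∈ xs → f x ≡ g x) → concatMap f xs ≡ concatMap g xs
concatMap-cong-∈ []       h = refl
concatMap-cong-∈ (x ∷ xs) h = cong₂ _++_ (h x (here refl)) (concatMap-cong-∈ xs (λ y m → h y (there m)))

tabWord-columns : ∀ T′ → concatMap (λ c → word (cellsOf (colAt T′ c))) (range1 (length T′)) ≡ tabWord T′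
tabWord-columns []       = refl
tabWord-columns (s ∷ T′) = trans (cong (concatMap W) (range1-suc (length T′)))
  (trans (Lₚ.concatMap-++ W (range1 (length T′)) (suc (length T′) ∷ []))
    (cong₂ _++_ (trans (concatMap-cong-∈ (range1 (length T′)) (λ c m → cong (word ∘ cellsOf) (colAt-< s T′ (proj₂ (range1-∈⁻ m))))) (tabWord-columns T′))
      (trans (Lₚ.++-identityʳ _) (cong (word ∘ cellsOf) (colAt-top s T′)))))
  where
  W : ℕ → List ℕ
  W c = word (cellsOf (colAt (s ∷ T′) c))

word-∈ : ∀ Bs {r x} → x ∈ nth Bs r → x ∈ word Bs
word-∈ (B ∷ Bs) {suc zero}    {x} m = subst (x ∈_) (sym (word-∷ B Bs)) (∈ₚ.∈-++⁺ʳ (word Bs) m)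
word-∈ (B ∷ Bs) {suc (suc r)} {x} m = subst (x ∈_) (sym (word-∷ B Bs)) (∈ₚ.∈-++⁺ˡ (word-∈ Bs {suc r} m))
word-∈ Bs       {zero}        ()
word-∈ []       {suc r}       ()

tabWord-∈ : ∀ T′ r c {x} → x ∈ cellOf T′ (r , c) → x ∈ tabWord T′
tabWord-∈ []       zero    c ()
tabWord-∈ []       (suc r) c ()
tabWord-∈ (s ∷ T′) r c m with c ≡ᵇ suc (length T′)
... | true  = ∈ₚ.∈-++⁺ʳ (tabWord T′) (word-∈ (cellsOf s) {r} m)
... | false = ∈ₚ.∈-++⁺ˡ (tabWord-∈ T′ r c m)

occ-pos : ∀ {x} w → x ∈ w → 0 < occ x w
occ-pos (x ∷ w) (here refl) = ≤-trans (s≤s z≤n) (≤-reflexive (sym (occ-head x w)))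
occ-pos {x} (y ∷ w) (there m) = ≤-trans (occ-pos w m) (≤-trans (m≤n+m (occ x w) (occ x (y ∷ []))) (≤-reflexive (sym (occ-++ x (y ∷ []) w))))

-- Counting set-valued tableaux by status tableaux

head₀-part : ∀ p → head₀ p ≡ part p 1
head₀-part []      = refl
head₀-part (_ ∷ _) = refl

htAt-> : ∀ hs {c} → length hs < c → htAt hs c ≡ 0
htAt-> []       lt = refl
htAt-> (h ∷ hs) {c} lt rewrite ≡ᵇ-≢ {c} (λ e → <⇒≢ lt (sym e)) = htAt-> hs (<-trans (n<1+n _) lt)

nth-map : ∀ (f : ℕ → List ℕ) h i → i < h → nth (map f (range1 h)) (suc i) ≡ f (suc i)
nth-map f h i lt = trans (cong (λ z → nth z (suc i)) (trans (sym (Lₚ.map-∘ (upTo h))) (Lₚ.map-upTo (f ∘ suc) h))) (go (f ∘ suc) h i lt)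
  where
  go : ∀ g h i → i < h → nth (applyUpTo g h) (suc i) ≡ g i
  go g (suc h) zero    lt       = refl
  go g (suc h) (suc i) (s≤s lt) = go (g ∘ suc) h i lt

nth-ext : ∀ Bs Bs' → length Bs ≡ length Bs' → (∀ i → i < length Bs → nth Bs (suc i) ≡ nth Bs' (suc i)) → Bs ≡ Bs'
nth-ext []       []         e h = refl
nth-ext (B ∷ Bs) (B' ∷ Bs') e h = cong₂ _∷_ (h 0 (s≤s z≤n)) (nth-ext Bs Bs' (suc-injective e) (λ i lt → h (suc i) (s≤s lt)))

length-range1 : ∀ n → length (range1 n) ≡ n
length-range1 n = trans (Lₚ.length-map suc (upTo n)) (Lₚ.length-upTo n)

concat-sorted : ∀ Bs → All Sorted Bs → (∀ i j → i < j → ∀ x y → x ∈ nth Bs (suc i) → y ∈ nth Bs (suc j) → x < y) → Sorted (concat Bs)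
concat-sorted []       ss       h = []
concat-sorted (B ∷ Bs) (s ∷ ss) h = APₚ.++⁺ s (concat-sorted Bs ss (λ i j lt → h (suc i) (suc j) (s≤s lt)))
  (All.tabulate (λ {x} mx → All.tabulate (λ {y} my → let j , my′ = find Bs my in h 0 (suc j) (s≤s z≤n) x y mx my′)))
  where
  find : ∀ Bs {y} → y ∈ concat Bs → ∃ λ j → y ∈ nth Bs (suc j)
  find (B ∷ Bs) m with ∈ₚ.∈-++⁻ B m
  ... | inj₁ q = 0 , q
  ... | inj₂ q with find Bs q
  ...   | j , r = suc j , r

map-range1-≡ : ∀ {A : Set} {f g : ℕ → A} n → map f (range1 n) ≡ map g (range1 n) → ∀ i → 1 ≤ i → i ≤ n → f i ≡ g i
map-range1-≡ {f = f} {g} n e i a b = go (range1 n) e (range1-∈⁺ a b)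
  where
  go : ∀ xs → map f xs ≡ map g xs → ∀ {i} → i ∈ xs → f i ≡ g i
  go (x ∷ xs) e (here refl) = Lₚ.∷-injectiveˡ e
  go (x ∷ xs) e (there m)   = go xs (Lₚ.∷-injectiveʳ e) m

module SVT (N : ℕ) (la nu mu : List ℕ) (pl : IsPartition la) (pn : IsPartition nu) (pm : IsPartition mu)
           (sub : la ⊆ᵖ nu) (ln : length nu ≤ N) (lm : length mu ≤ N) where

  open GCoeff N la nu pl pn sub ln using (λ₀; ν₀; pad-nu; pad-la)

  n : ℕ
  n = length nu

  μ₀ hs : List ℕ
  μ₀ = pad N mu
  hs = heights μ₀

  cells : List Cell
  cells = skewCells mu []

  dμ : Decr μ₀
  dμ = pad-decr N mu pm

  len-λ₀ : length λ₀ ≡ N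
  len-λ₀ = Lₚ.length-applyUpTo _ N

  pad-mu : ∀ r → part μ₀ r ≡ part mu r
  pad-mu = part-applyUpTo (part mu) N (λ i le → part-beyond mu (≤-<-trans lm (s≤s le))) (part-0 mu)

  hs-length : length hs ≡ part mu 1
  hs-length = trans (heights-length μ₀ dμ) (trans (head₀-part μ₀) (pad-mu 1))

  H₀ : Heights N 0 hs
  H₀ = subst (λ z → Heights z 0 hs) (Lₚ.length-applyUpTo _ N) (heights-heights μ₀)

  part-≤ : ∀ r → part mu r ≤ length hs
  part-≤ r = ≤-trans (≤-reflexive (sym (pad-mu r))) (≤-trans (part-≤head μ₀ dμ r) (≤-reflexive (sym (heights-length μ₀ dμ))))

  shape⇒ : ∀ c i → suc i ≤ htAt hs c → 1 ≤ c → c ≤ part mu (suc i)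
  shape⇒ c i le 1≤c with c ≤? length hs
  ... | yes q = subst (c ≤_) (pad-mu (suc i)) (proj₁ (heights-shape μ₀ dμ c 1≤c q i) le)
  ... | no q = ⊥-elim (<⇒≱ (s≤s z≤n) (≤-trans le (≤-reflexive (htAt-> hs (≰⇒> q)))))

  shape⇐ : ∀ c i → 1 ≤ c → c ≤ part mu (suc i) → suc i ≤ htAt hs c
  shape⇐ c i 1≤c le = proj₂ (heights-shape μ₀ dμ c 1≤c (≤-trans le (part-≤ (suc i))) i) (subst (c ≤_) (sym (pad-mu (suc i))) le)

  cell⁻ : ∀ {r c} → (r , c) ∈ cells → 1 ≤ c × c ≤ part mu r
  cell⁻ m = skewCells-∈⁻ mu [] m

  cell⁺ : ∀ {r c} → 1 ≤ c → c ≤ part mu r → (r , c) ∈ cells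
  cell⁺ = skewCells-∈⁺ mu []

  cells-unique : Unique cells
  cells-unique = skewCells-unique mu []

  fillTab : List (List Status) → List (Cell × List ℕ)
  fillTab T′ = tabulate′ cells (cellOf T′)

  module FromTab (T′ : List (List Status)) (shp : ShapeT hs T′) where

    lenT : length T′ ≡ part mu 1
    lenT = trans (shape-length hs T′ shp) hs-length

    outside : ∀ r c → 1 ≤ c → part mu r < c → cellOf T′ (r , c) ≡ []
    outside zero    c 1≤c lt = refl
    outside (suc i) c 1≤c lt = nth-beyond (cellsOf (colAt T′ c)) (≰⇒> (λ le →
      <⇒≱ lt (shape⇒ c i (subst (suc i ≤_) (shape-column hs T′ shp c) le) 1≤c)))

    inside : ∀ {i c} → (suc i , c) ∈ cells → i < length (cellsOf (colAt T′ c))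
    inside {i} {c} m = subst (suc i ≤_) (sym (shape-column hs T′ shp c)) (shape⇐ c i (proj₁ (cell⁻ m)) (proj₂ (cell⁻ m)))

    entry-cell : ∀ r c → 1 ≤ c → entry (fillTab T′) (r , c) ≡ cellOf T′ (r , c)
    entry-cell r c 1≤c = trans (entry-look (fillTab T′) (r , c)) go
      where
      go : look [] (fillTab T′) (r , c) ≡ cellOf T′ (r , c)
      go with c ≤? part mu r
      ... | yes le = look-tabulate [] cells (cellOf T′) (r , c) (cell⁺ 1≤c le)
      ... | no gt  = trans (look-∉ [] cells (cellOf T′) (r , c) (λ m → gt (proj₂ (cell⁻ m)))) (sym (outside r c 1≤c (≰⇒> gt)))

    col-height : ∀ c → length (cellsOf (colAt T′ c)) ≤ length mu
    col-height c with c ≤? length hs | 1 ≤? c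
    ... | no q | _ = ≤-trans (≤-reflexive (trans (shape-column hs T′ shp c) (htAt-> hs (≰⇒> q)))) z≤n
    ... | yes q | yes 1≤c = ≮⇒≥ (λ lt → <⇒≱ 1≤c (≤-trans
          (shape⇒ c (length mu) (subst (suc (length mu) ≤_) (shape-column hs T′ shp c) lt) 1≤c)
          (≤-reflexive (part-beyond mu (n<1+n _)))))
    ... | yes q | no 1≰c = ≤-trans (≤-reflexive (cong (length ∘ cellsOf) (col0 c T′ (≰⇒> 1≰c)))) z≤n
      where
      col0 : ∀ c T′ → c < 1 → colAt T′ c ≡ []
      col0 zero []       lt = refl
      col0 zero (s ∷ T′) lt = col0 zero T′ lt
      col0 (suc c) T′ (s≤s ())

    colWord-tab : colWord mu (fillTab T′) ≡ tabWord T′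
    colWord-tab = trans (concatMap-cong-∈ (range1 (part mu 1)) (λ c m → trans
        (concatMap-cong-∈ (reverse (range1 (length mu))) (λ r _ → entry-cell r c (proj₁ (range1-∈⁻ m))))
        (word-nth (cellsOf (colAt T′ c)) (length mu) (col-height c))))
      (trans (cong (λ z → concatMap (λ c → word (cellsOf (colAt T′ c))) (range1 z)) (sym lenT)) (tabWord-columns T′))

    svt-occ : ∀ i → sum (map (λ e → countᵇ (λ x → x ≡ᵇ i) (proj₂ e)) (fillTab T′)) ≡ occ i (tabWord T′)
    svt-occ i = trans (cong sum (sym (Lₚ.map-∘ cells)))
      (trans (sum-cells mu g)
      -- The weight is summed by rows and the column word by columns. Empty cells complete the shape
      -- to a rectangle before the sums are exchanged.
      (trans (sumTo-cong (length mu) (λ r 1≤r _ → sumTo-extend (λ c → g (r , c)) (part mu r) (part mu 1)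
          (antitone (part mu) (partition-antitone mu pm) (s≤s z≤n) 1≤r)
          (λ c lt → cong (occ i) (outside r c (≤-trans (s≤s z≤n) lt) lt))))
      (trans (sumTo-swap (λ r c → g (r , c)) (length mu) (part mu 1))
      (trans (sym (sum-range1 _ (part mu 1)))
      (trans (cong sum (Lₚ.map-cong (λ c → trans (sym (sum-range1 (λ r → g (r , c)) (length mu)))
          (trans (sym (sum-reverse (λ r → g (r , c)) (range1 (length mu))))
            (trans (sym (occ-concatMap i (nth (cellsOf (colAt T′ c))) (reverse (range1 (length mu)))))
              (cong (occ i) (word-nth (cellsOf (colAt T′ c)) (length mu) (col-height c)))))) (range1 (part mu 1))))
      (trans (sym (occ-concatMap i (λ c → word (cellsOf (colAt T′ c))) (range1 (part mu 1))))
        (cong (occ i) (trans (cong (λ z → concatMap (λ c → word (cellsOf (colAt T′ c))) (range1 z)) (sym lenT)) (tabWord-columns T′)))))))))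
      where
      g : Cell → ℕ
      g x = occ i (cellOf T′ x)

  validTab : List (List Status) → Bool
  validTab T′ = okTab true N hs [] λ₀ T′ ∧ eqListᵇ (addTab λ₀ T′) ν₀

  validSVT : List (Cell × List ℕ) → Bool
  validSVT S = isSetValued S ∧ eqListᵇ (svtWt n S) (map (λ i → part nu i ∸ part la i) (range1 n)) ∧ isYamanouchi la (colWord mu S)

  row≥1 : ∀ {r c} → (r , c) ∈ cells → 1 ≤ r
  row≥1 {zero} m = ⊥-elim (<⇒≱ (proj₁ (cell⁻ m)) (≤-trans (proj₂ (cell⁻ m)) (≤-reflexive (part-0 mu))))
  row≥1 {suc r} m = s≤s z≤n

  same-λ₀ : ∀ {T′ : List (List Status)} → All (λ s → length s ≡ N) T′ → All (λ s → length s ≡ length λ₀) T′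
  same-λ₀ = All.map (λ e → trans e (sym len-λ₀))

  module Forward (T′ : List (List Status)) (T∈ : T′ ∈ tabs hs N) (t : T (validTab T′)) where

    lens : All (λ s → length s ≡ N) T′
    lens = All.lookup (tabs-length hs N) T∈

    private
      t₁ = proj₁ (∧-T {okTab true N hs [] λ₀ T′} t)
      sp = okTab-split N hs [] λ₀ T′ t₁
      sr = okTab⇒shape N hs [] λ₀ T′ H₀ (proj₁ sp)

    shp : ShapeT hs T′
    shp = proj₁ sr

    rowsOK : RowsT [] T′
    rowsOK = proj₂ sr

    yam : T (yamTab λ₀ T′)
    yam = proj₂ sp

    weight-eq : addTab λ₀ T′ ≡ ν₀
    weight-eq = eqListᵇ-T _ _ (proj₂ (∧-T {okTab true N hs [] λ₀ T′} t))

    columns : All Column T′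
    columns = shape-columns hs T′ shp

    open FromTab T′ shp public

    occ-eq : ∀ i → occ i (tabWord T′) + part la i ≡ part nu i
    occ-eq i = trans (cong (λ z → occ i (tabWord T′) + z) (sym (pad-la i)))
      (trans (sym (part-addTab λ₀ T′ (same-λ₀ lens) columns i)) (trans (cong (λ z → part z i) weight-eq) (pad-nu i)))

    column∈ : ∀ c → All (All (λ x → 1 ≤ x)) (cellsOf (colAt T′ c))
    column∈ c = All.map (All.map proj₁) (cellsOf-letters (colAt T′ c) (col-col T′ columns))
      where
      col-col : ∀ T′ → All Column T′ → Column (colAt T′ c)
      col-col []       []       = refl
      col-col (s ∷ T′) (p ∷ ps) with c ≡ᵇ suc (length T′)
      ... | true  = p
      ... | false = col-col T′ ps

    cell-subset : ∀ x → x ∈ cells → cellOf T′ x ∈ nonemptySubsets n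
    cell-subset (zero , c)  m = ⊥-elim (1+n≰n (row≥1 m))
    cell-subset (suc i , c) m = nonemptySubsets-∈⁺ n _ (nth-All _ (blocks-nonEmpty 1 (colAt T′ c)) (inside m))
      (nth-All _ (cellsOf-sorted (colAt T′ c)) (inside m))
      (All.tabulate (λ {x} x∈ → All.lookup (nth-All _ (column∈ c) (inside m)) x∈ , small x x∈))
      where
      -- Status words use letters up to `N`, but a letter beyond the length of ν would give ν a
      -- further part.
      small : ∀ x → x ∈ cellOf T′ (suc i , c) → x ≤ n
      small x x∈ with x ≤? n
      ... | yes q = q
      ... | no q = ⊥-elim (<⇒≱ (occ-pos (tabWord T′) (tabWord-∈ T′ (suc i) c x∈))
          (≤-trans (m≤m+n _ (part la x)) (≤-trans (≤-reflexive (occ-eq x)) (≤-reflexive (part-beyond nu (≰⇒> q))))))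

    set-valued : SetValued cells (cellOf T′)
    set-valued {zero}  {c} {r'}     {c'} m m' a b a∈ b∈ = ⊥-elim (1+n≰n (row≥1 m))
    set-valued {suc i} {c} {zero}   {c'} m m' a b a∈ b∈ = ⊥-elim (1+n≰n (row≥1 m'))
    set-valued {suc i} {c} {suc i'} {c'} m m' a b a∈ b∈ =
      (λ { refl lt → rows-pair [] T′ rowsOK c c' (proj₁ (cell⁻ m)) lt
           (≤-trans (proj₂ (cell⁻ m')) (≤-trans (part-≤ (suc i)) (≤-reflexive (sym (shape-length hs T′ shp))))) i a b a∈ b∈ }) ,
      (λ { refl lt → sorted-nth (cellsOf (colAt T′ c)) (cellsOf-concat-sorted (colAt T′ c)) i i' (≤-pred lt) a b a∈ b∈ })

    fill-∈ : fillTab T′ ∈ assignments cells (nonemptySubsets n)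
    fill-∈ = assignments-∈⁺ cells (nonemptySubsets n) (cellOf T′) cell-subset

    fill-valid : T (validSVT (fillTab T′))
    fill-valid = T-∧ (setValued⇒ cells (cellOf T′) cells-unique set-valued) (T-∧ (T-eqListᵇ wt)
      (Yam⇒isYam la (colWord mu (fillTab T′)) (subst (Yam (part la)) (sym colWord-tab)
        (Yam-cong (tabWord T′) pad-la (proj₁ (yamTab-iff λ₀ T′ (same-λ₀ lens) columns (pad-decr N la pl)) yam)))))
      where
      wt : svtWt n (fillTab T′) ≡ map (λ i → part nu i ∸ part la i) (range1 n)
      wt = Lₚ.map-cong (λ i → trans (svt-occ i) (sym (trans (cong (_∸ part la i) (sym (occ-eq i))) (m+n∸n≡m _ (part la i))))) (range1 n)

  module Backward (S : List (Cell × List ℕ)) (S∈ : S ∈ assignments cells (nonemptySubsets n)) (t : T (validSVT S)) where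

    φ : Cell → List ℕ
    φ = look [] S

    eS : S ≡ tabulate′ cells φ
    eS = proj₁ (assignments-∈⁻ [] cells (nonemptySubsets n) cells-unique S∈)

    φ-sub : ∀ x → x ∈ cells → NonEmpty (φ x) × Sorted (φ x) × All (λ z → 1 ≤ z × z ≤ n) (φ x)
    φ-sub x x∈ = nonemptySubsets-∈⁻ n (φ x) (proj₂ (assignments-∈⁻ [] cells (nonemptySubsets n) cells-unique S∈) x x∈)

    private
      ts = ∧-T {isSetValued S} t
      ts₂ = ∧-T {eqListᵇ (svtWt n S) (map (λ i → part nu i ∸ part la i) (range1 n))} (proj₂ ts)

    sv : SetValued cells φ
    sv = setValued⇐ cells φ (λ x x∈ → proj₁ (φ-sub x x∈)) (subst (T ∘ isSetValued) eS (proj₁ ts))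

    column : ℕ → List (List ℕ)
    column c = map (λ r → φ (r , c)) (range1 (htAt hs c))

    column-length : ∀ c → length (column c) ≡ htAt hs c
    column-length c = trans (Lₚ.length-map _ (range1 (htAt hs c))) (length-range1 (htAt hs c))

    column-cell : ∀ c → 1 ≤ c → ∀ {r} → r ∈ range1 (htAt hs c) → (r , c) ∈ cells
    column-cell c 1≤c {zero}  m = ⊥-elim (1+n≰n (proj₁ (range1-∈⁻ m)))
    column-cell c 1≤c {suc i} m = cell⁺ 1≤c (shape⇒ c i (proj₂ (range1-∈⁻ m)) 1≤c)

    column-All : ∀ {P : List ℕ → Set} c → 1 ≤ c → (∀ x → x ∈ cells → P (φ x)) → All P (column c)
    column-All c 1≤c h = Allₚ.map⁺ (All.tabulate (λ m → h _ (column-cell c 1≤c m)))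

    column-nth : ∀ c i → i < htAt hs c → nth (column c) (suc i) ≡ φ (suc i , c)
    column-nth c i lt = nth-map (λ r → φ (r , c)) (htAt hs c) i lt

    nth-inside : ∀ c i {x} → x ∈ nth (column c) (suc i) → i < htAt hs c
    nth-inside c i {x} m with i <? htAt hs c
    ... | yes q = q
    ... | no q with subst (x ∈_) (nth-beyond (column c) (s≤s (subst (_≤ i) (sym (column-length c)) (≮⇒≥ q)))) m
    ...   | ()

    column-sorted′ : ∀ c → 1 ≤ c → Sorted (concat (column c))
    column-sorted′ c 1≤c = concat-sorted (column c) (column-All c 1≤c (λ x x∈ → proj₁ (proj₂ (φ-sub x x∈))))
      (λ i j lt x y mx my → let i< = nth-inside c i mx ; j< = nth-inside c j my in
        proj₂ (sv (cell⁺ 1≤c (shape⇒ c i i< 1≤c)) (cell⁺ 1≤c (shape⇒ c j j< 1≤c)) x y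
          (subst (x ∈_) (column-nth c i i<) mx) (subst (y ∈_) (column-nth c j j<) my)) refl (s≤s lt))

    stat : ∀ c → 1 ≤ c → ∃ λ s → length s ≡ N × blocks 1 s ≡ ([] , column c)
    stat c 1≤c = statuses N 1 [] (column c) (column-sorted′ c 1≤c) (column-All c 1≤c (λ x x∈ → proj₁ (φ-sub x x∈)))
      (Allₚ.concat⁺ (column-All c 1≤c (λ x x∈ → All.map (λ { (a , b) → a , s≤s (≤-trans b ln) }) (proj₂ (proj₂ (φ-sub x x∈))))))

    build : ℕ → List (List Status)
    build zero    = []
    build (suc m) = proj₁ (stat (suc m) (s≤s z≤n)) ∷ build m

    build-length : ∀ m → length (build m) ≡ m
    build-length zero    = refl
    build-length (suc m) = cong suc (build-length m)

    build-N : ∀ m → All (λ s → length s ≡ N) (build m)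
    build-N zero    = []
    build-N (suc m) = proj₁ (proj₂ (stat (suc m) (s≤s z≤n))) ∷ build-N m

    build-blocks : ∀ m → cellsOf (proj₁ (stat (suc m) (s≤s z≤n))) ≡ column (suc m)
    build-blocks m = cong proj₂ (proj₂ (proj₂ (stat (suc m) (s≤s z≤n))))

    build-col : ∀ m c → 1 ≤ c → c ≤ m → cellsOf (colAt (build m) c) ≡ column c
    build-col zero    c 1≤c le = ⊥-elim (<⇒≱ 1≤c le)
    build-col (suc m) c 1≤c le with c ≟ suc m
    ... | yes refl = trans (cong cellsOf (trans (cong (λ z → colAt (build (suc m)) (suc z)) (sym (build-length m)))
            (colAt-top (proj₁ (stat (suc m) (s≤s z≤n))) (build m)))) (build-blocks m)
    ... | no ne = trans (cong cellsOf (colAt-< (proj₁ (stat (suc m) (s≤s z≤n))) (build m)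
            (subst (c ≤_) (sym (build-length m)) le′))) (build-col m c 1≤c le′)
      where le′ = ≤-pred (≤∧≢⇒< le ne)

    build-shape : ∀ hs′ → (∀ c → 1 ≤ c → c ≤ length hs′ → htAt hs c ≡ htAt hs′ c) → ShapeT hs′ (build (length hs′))
    build-shape []        h = tt
    build-shape (x ∷ hs′) h = cong proj₁ (proj₂ (proj₂ (stat (suc (length hs′)) (s≤s z≤n)))) ,
      trans (cong length (build-blocks (length hs′))) (trans (column-length (suc (length hs′)))
        (trans (h (suc (length hs′)) (s≤s z≤n) ≤-refl) (htAt-top x hs′ refl))) ,
      build-shape hs′ (λ c 1≤c le → trans (h c 1≤c (m≤n⇒m≤1+n le)) (htAt-< x hs′ le))

    bounded-build : ∀ b Bs → length b ≤ length Bs → (∀ i → i < length b → All (_≤ part b (suc i)) (nth Bs (suc i))) → Bounded b Bs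
    bounded-build []      Bs       le h = tt
    bounded-build (t ∷ b) (B ∷ Bs) (s≤s le) h = h 0 (s≤s z≤n) , bounded-build b Bs le (λ i lt → h (suc i) (s≤s lt))

    build-rowsOK : ∀ m → RowsT (map head₀ (column (suc m))) (build m)
    build-rowsOK zero    = tt
    build-rowsOK (suc m) = subst (Bounded (map head₀ (column (suc (suc m))))) (sym (build-blocks m))
        (bounded-build _ (column (suc m)) len-le (λ i lt → bd i (subst (i <_) len-b lt)))
      , subst (λ z → RowsT (map head₀ z) (build m)) (sym (build-blocks m)) (build-rowsOK m)
      where
      c = suc m
      c' = suc (suc m)
      len-b : length (map head₀ (column c')) ≡ htAt hs c'
      len-b = trans (Lₚ.length-map head₀ (column c')) (column-length c')
      ht≤ : htAt hs c' ≤ htAt hs c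
      ht≤ with htAt hs c' in eq
      ... | zero  = z≤n
      ... | suc h = shape⇐ c h (s≤s z≤n) (≤-trans (n≤1+n c) (shape⇒ c' h (≤-reflexive (sym eq)) (s≤s z≤n)))
      len-le : length (map head₀ (column c')) ≤ length (column c)
      len-le = ≤-trans (≤-reflexive len-b) (≤-trans ht≤ (≤-reflexive (sym (column-length c))))
      bd : ∀ i → i < htAt hs c' → All (_≤ part (map head₀ (column c')) (suc i)) (nth (column c) (suc i))
      bd i lt = All.tabulate (λ {x} x∈ → ≤-trans
          (proj₁ (sv (cell⁺ (s≤s z≤n) (shape⇒ c i (≤-trans lt ht≤) (s≤s z≤n))) in-c' x (head₀ (φ (suc i , c')))
            (subst (x ∈_) (column-nth c i (≤-trans lt ht≤)) x∈) (head-∈ _ (proj₁ (φ-sub _ in-c')))) refl (n<1+n c))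
          (≤-reflexive (sym (trans (nth-heads (column c') i) (cong head₀ (column-nth c' i lt))))))
        where
        in-c' : (suc i , c') ∈ cells
        in-c' = cell⁺ (s≤s z≤n) (shape⇒ c' i lt (s≤s z≤n))

    T₀ : List (List Status)
    T₀ = build (length hs)

    shp : ShapeT hs T₀
    shp = build-shape hs (λ _ _ _ → refl)

    rowsOK : RowsT [] T₀
    rowsOK = go (length hs)
      where
      go : ∀ m → RowsT [] (build m)
      go zero    = tt
      go (suc m) = tt , subst (λ z → RowsT (map head₀ z) (build m)) (sym (build-blocks m)) (build-rowsOK m)

    open FromTab T₀ shp

    lens : All (λ s → length s ≡ N) T₀
    lens = build-N (length hs)

    columns : All Column T₀
    columns = shape-columns hs T₀ shp

    fill-T₀ : fillTab T₀ ≡ S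
    fill-T₀ = trans (tabulate′-cong cells cell-eq) (sym eS)
      where
      cell-eq : ∀ x → x ∈ cells → cellOf T₀ x ≡ φ x
      cell-eq (zero , c)  m = ⊥-elim (1+n≰n (row≥1 m))
      cell-eq (suc i , c) m = trans
        (cong (λ z → nth z (suc i)) (build-col (length hs) c (proj₁ (cell⁻ m)) (≤-trans (proj₂ (cell⁻ m)) (part-≤ (suc i)))))
        (column-nth c i (shape⇐ c i (proj₁ (cell⁻ m)) (proj₂ (cell⁻ m))))

    occ-small : ∀ i → n < i → occ i (tabWord T₀) ≡ 0
    occ-small i lt = trans (sym (svt-occ i)) (trans (cong (λ z → sum (map (λ e → countᵇ (λ x → x ≡ᵇ i) (proj₂ e)) z)) (trans fill-T₀ eS))
      (trans (cong sum (sym (Lₚ.map-∘ cells))) (zeros cells (λ x m → occ-∉ i (φ x) (All.map (λ q e → <⇒≢ (≤-<-trans (proj₂ q) lt) e) (proj₂ (proj₂ (φ-sub x m))))))))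
      where
      zeros : ∀ cs → (∀ x → x ∈ cs → occ i (φ x) ≡ 0) → sum (map (λ x → occ i (φ x)) cs) ≡ 0
      zeros []       h = refl
      zeros (c ∷ cs) h = cong₂ _+_ (h c (here refl)) (zeros cs (λ x m → h x (there m)))

    occ-eq : ∀ i → 1 ≤ i → occ i (tabWord T₀) + part la i ≡ part nu i
    occ-eq i 1≤i with i ≤? n
    ... | yes le = trans (cong (_+ part la i) (trans (sym (svt-occ i)) (trans (cong (λ z → sum (map (λ e → countᵇ (λ x → x ≡ᵇ i) (proj₂ e)) z)) fill-T₀)
            (map-range1-≡ n (eqListᵇ-T (svtWt n S) _ (proj₁ ts₂)) i 1≤i le)))) (m∸n+n≡m (sub i))
    ... | no gt = trans (cong (_+ part la i) (occ-small i (≰⇒> gt))) (trans (n≤0⇒n≡0 (≤-trans (sub i) (≤-reflexive z))) (sym z))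
      where z = part-beyond nu (≰⇒> gt)

    weight-eq : addTab λ₀ T₀ ≡ ν₀
    weight-eq = part-ext _ _ (trans (addTab-length λ₀ T₀ (same-λ₀ lens)) (trans len-λ₀ (sym (Lₚ.length-applyUpTo _ N))))
      (λ i → trans (part-addTab λ₀ T₀ (same-λ₀ lens) columns (suc i))
        (trans (cong (λ z → occ (suc i) (tabWord T₀) + z) (pad-la (suc i))) (trans (occ-eq (suc i) (s≤s z≤n)) (sym (pad-nu (suc i))))))

    valid : T (validTab T₀)
    valid = T-∧ (okTab-join N hs [] λ₀ T₀ (shape⇒okTab N hs [] λ₀ T₀ H₀ len-λ₀ lens shp rowsOK)
        (proj₂ (yamTab-iff λ₀ T₀ (same-λ₀ lens) columns (pad-decr N la pl))
          (Yam-cong (tabWord T₀) (λ i → sym (pad-la i)) (subst (Yam (part la)) (trans (cong (colWord mu) (sym fill-T₀)) colWord-tab)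
            (isYam⇒Yam la (colWord mu S) (proj₂ ts₂))))))
      (T-eqListᵇ weight-eq)

    in-tabs : T₀ ∈ tabs hs N
    in-tabs = tabs-∈⁺ hs N T₀ (build-length (length hs)) lens

  fillTab-injective : ∀ T′ T″ → T′ ∈ tabs hs N → T″ ∈ tabs hs N → T (validTab T′) → T (validTab T″) →
    fillTab T′ ≡ fillTab T″ → T′ ≡ T″
  fillTab-injective T′ T″ m m' t t' e = ext T′ T″ (trans F.lenT (sym F'.lenT)) F.lens F'.lens F.columns F'.columns cols-eq
    where
    module F = Forward T′ m t
    module F' = Forward T″ m' t'
    cols-eq : ∀ c → 1 ≤ c → cellsOf (colAt T′ c) ≡ cellsOf (colAt T″ c)
    cols-eq c 1≤c = nth-ext _ _ (trans (shape-column hs T′ F.shp c) (sym (shape-column hs T″ F'.shp c)))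
      (λ i lt → tabulate′-≡ cells e (suc i , c) (cell⁺ 1≤c (shape⇒ c i (subst (suc i ≤_) (shape-column hs T′ F.shp c) lt) 1≤c)))
    ext : ∀ T′ T″ → length T′ ≡ length T″ → All (λ s → length s ≡ N) T′ → All (λ s → length s ≡ N) T″ → All Column T′ → All Column T″ →
      (∀ c → 1 ≤ c → cellsOf (colAt T′ c) ≡ cellsOf (colAt T″ c)) → T′ ≡ T″
    ext []       []        e es es' cs cs' h = refl
    ext (s ∷ T′) (s' ∷ T″) e (p ∷ es) (p' ∷ es') (q ∷ cs) (q' ∷ cs') h = cong₂ _∷_
      (statuses-injective 1 s s' (trans p (sym p')) (cong₂ _,_ (trans q (sym q'))
        (trans (cong cellsOf (sym (colAt-top s T′))) (trans (h (suc (length T′)) (s≤s z≤n))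
          (cong cellsOf (trans (cong (λ z → colAt (s' ∷ T″) (suc z)) (suc-injective e)) (colAt-top s' T″)))))))
      (ext T′ T″ (suc-injective e) es es' cs cs' tails-eq)
      where
      tails-eq : ∀ c → 1 ≤ c → cellsOf (colAt T′ c) ≡ cellsOf (colAt T″ c)
      tails-eq c 1≤c with c ≤? length T′
      ... | yes le = trans (cong cellsOf (sym (colAt-< s T′ le))) (trans (h c 1≤c)
              (cong cellsOf (colAt-< s' T″ (≤-trans le (≤-reflexive (suc-injective e))))))
      ... | no gt = trans (cong cellsOf (colAt-> T′ (≰⇒> gt))) (sym (cong cellsOf (colAt-> T″ (subst (_< c) (suc-injective e) (≰⇒> gt)))))

  countSVT-tabs : countSVT la nu mu ≡ countᵇ validTab (tabs hs N)
  countSVT-tabs = count-bijection validSVT validTab (assignments cells (nonemptySubsets n)) (tabs hs N) fillTab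
    (assignments-unique cells (nonemptySubsets n) (nonemptySubsets-unique n)) (tabs-unique hs N)
    (λ T′ m t → Forward.fill-∈ T′ m t , Forward.fill-valid T′ m t)
    (λ S m t → Backward.T₀ S m t , Backward.in-tabs S m t , Backward.valid S m t , Backward.fill-T₀ S m t)
    fillTab-injective

-- Signs

-- The number of letters in excess of the number of cells.
joinCount : List Status → ℕ
joinCount []           = 0
joinCount (absent ∷ s) = joinCount s
joinCount (join ∷ s)   = suc (joinCount s)
joinCount (start ∷ s)  = joinCount s

joinCountTab : List (List Status) → ℕ
joinCountTab []       = 0
joinCountTab (s ∷ T′) = joinCount s + joinCountTab T′

sgCol-joins : ∀ s → sgCol s ≡ -[1+ 0 ] ℤ.^ joinCount s
sgCol-joins []           = refl
sgCol-joins (absent ∷ s) = trans (ℤₚ.*-identityˡ _) (sgCol-joins s)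
sgCol-joins (join ∷ s)   = cong (-[1+ 0 ] *_) (sgCol-joins s)
sgCol-joins (start ∷ s)  = trans (ℤₚ.*-identityˡ _) (sgCol-joins s)

sgTab-joins : ∀ T′ → sgTab T′ ≡ -[1+ 0 ] ℤ.^ joinCountTab T′
sgTab-joins []       = refl
sgTab-joins (s ∷ T′) = trans (cong₂ _*_ (sgCol-joins s) (sgTab-joins T′)) (sym (ℤₚ.^-distribˡ-+-* -[1+ 0 ] (joinCount s) (joinCountTab T′)))

sum-⊕ : ∀ ℓ β s → length s ≡ length β → sum (β ⊕ wtCol s) ≡ (length (mins ℓ s) + joinCount s) + sum β
sum-⊕ ℓ []      []           e = refl
sum-⊕ ℓ (b ∷ β) (absent ∷ s) e = trans (cong (λ z → b + z) (sum-⊕ (suc ℓ) β s (suc-injective e))) (x∙yz≈y∙xz b _ (sum β))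
sum-⊕ ℓ (b ∷ β) (join ∷ s)   e = trans (cong (λ z → suc (b + z)) (sum-⊕ (suc ℓ) β s (suc-injective e)))
  (trans (cong suc (x∙yz≈y∙xz b _ (sum β))) (cong (_+ (b + sum β)) (sym (+-suc (length (mins (suc ℓ) s)) (joinCount s)))))
sum-⊕ ℓ (b ∷ β) (start ∷ s)  e = trans (cong (λ z → suc (b + z)) (sum-⊕ (suc ℓ) β s (suc-injective e))) (cong suc (x∙yz≈y∙xz b _ (sum β)))

sum-addTab : ∀ hs β T′ → ShapeT hs T′ → All (λ s → length s ≡ length β) T′ → sum (addTab β T′) ≡ (sum hs + joinCountTab T′) + sum β
sum-addTab []       β []       sh           es       = refl
sum-addTab (h ∷ hs) β (s ∷ T′) (c , e , sh) (q ∷ es) = trans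
  (sum-addTab hs (β ⊕ wtCol s) T′ sh (All.map (λ z → trans z (sym (⊕-length β (wtCol s) (wtCol-length s q)))) es))
  (trans (cong (λ z → (sum hs + joinCountTab T′) + z) (trans (sum-⊕ 1 β s q) (cong (λ z → (z + joinCount s) + sum β) len)))
  (trans (sym (+-assoc (sum hs + joinCountTab T′) (h + joinCount s) (sum β)))
    (cong (_+ sum β) (trans (+-comm (sum hs + joinCountTab T′) (h + joinCount s)) (interchange h (joinCount s) (sum hs) (joinCountTab T′))))))
  where
  len : length (mins 1 s) ≡ h
  len = trans (cong length (mins-heads 1 s)) (trans (Lₚ.length-map head₀ (cellsOf s)) e)

sum-heights : ∀ λ' → Decr λ' → sum (heights λ') ≡ sum λ'
sum-heights []       d = refl
sum-heights (a ∷ λ') (h≤a , d) = trans (sum-++ (replicate (a ∸ head₀ λ') 1) (map suc (heights λ')))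
  (trans (cong₂ _+_ (ones (a ∸ head₀ λ')) (trans (sucs (heights λ')) (cong₂ _+_ (heights-length λ' d) (sum-heights λ' d))))
  (trans (sym (+-assoc (a ∸ head₀ λ') (head₀ λ') (sum λ'))) (cong (_+ sum λ') (m∸n+n≡m h≤a))))
  where
  ones : ∀ j → sum (replicate j 1) ≡ j
  ones zero    = refl
  ones (suc j) = cong suc (ones j)
  sucs : ∀ hs → sum (map suc hs) ≡ length hs + sum hs
  sucs []       = refl
  sucs (h ∷ hs) = cong suc (trans (cong (λ z → h + z) (sucs hs)) (x∙yz≈y∙xz h (length hs) (sum hs)))

sum-pad : ∀ N p → length p ≤ N → sum (pad N p) ≡ sum p
sum-pad N       []      le       = zeros N
  where
  zeros : ∀ N → sum (applyUpTo (λ _ → 0) N) ≡ 0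
  zeros zero    = refl
  zeros (suc N) = zeros N
sum-pad (suc N) (x ∷ p) (s≤s le) = cong (λ z → x + z) (sum-pad N p le)

-- Parts are positive, so the padding zeros can be told apart from them.
pad-injective : ∀ N p q → All (0 <_) p → All (0 <_) q → length p ≤ N → length q ≤ N → pad N p ≡ pad N q → p ≡ q
pad-injective N       []      []      a        b        l        l'       e = refl
pad-injective (suc N) []      (y ∷ q) a        (p ∷ b)  l        l'       e = ⊥-elim (<⇒≢ p (Lₚ.∷-injectiveˡ e))
pad-injective (suc N) (x ∷ p) []      (r ∷ a)  b        l        l'       e = ⊥-elim (<⇒≢ r (sym (Lₚ.∷-injectiveˡ e)))
pad-injective (suc N) (x ∷ p) (y ∷ q) (_ ∷ a)  (_ ∷ b)  (s≤s l)  (s≤s l') e =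
  cong₂ _∷_ (Lₚ.∷-injectiveˡ e) (pad-injective N p q a b l l' (Lₚ.∷-injectiveʳ e))

dual-below : ∀ n ν → AntiBelow n (dual ν)
dual-below n ν p _ = dual-anti ν p

module _ (N : ℕ) (la nu mu : List ℕ) (pl : IsPartition la) (pn : IsPartition nu) (pm : IsPartition mu)
         (sub : la ⊆ᵖ nu) (ln : length nu ≤ N) (lm : length mu ≤ N) where

  open SVT N la nu mu pl pn pm sub ln lm
  open GCoeff N la nu pl pn sub ln using (λ₀; ν₀)

  private
    e : ℤ
    e = + size nu - + size la - + size mu

    la-length : ∀ p → All (0 <_) p → ∀ {m} → m < length p → 0 < part p (suc m)
    la-length (x ∷ p) (q ∷ a) {zero}  lt       = q
    la-length (x ∷ p) (q ∷ a) {suc m} (s≤s lt) = la-length p a lt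

    ll : length la ≤ N
    ll = ≤-trans (≮⇒≥ (λ lt → <⇒≱ (la-length la (proj₂ pl) lt)
      (≤-trans (sub (suc (length nu))) (≤-reflexive (part-beyond nu (n<1+n _)))))) ln

    exponent : ∀ j → size nu ≡ (size mu + j) + size la → e ≡ + j
    exponent j q = trans (cong (λ z → + z - + size la - + size mu) q)
      (trans (cong (λ z → z - + size la - + size mu) (trans (ℤₚ.pos-+ (size mu + j) (size la)) (cong (_+ᶻ + size la) (ℤₚ.pos-+ (size mu) j))))
        (l (+ size mu) (+ j) (+ size la)))
      where
      l : ∀ m j a → (((m +ᶻ j) +ᶻ a) - a) - m ≡ j
      l = solve-∀

    sign-valid : ∀ T′ → T′ ∈ tabs hs N → T (validTab T′) → sgTab T′ ≡ signPow e
    sign-valid T′ m t = trans (sgTab-joins T′) (cong signPow (sym (exponent (joinCountTab T′) (trans (sym (sum-pad N nu ln))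
      (trans (cong sum (sym F.weight-eq)) (trans (sum-addTab hs λ₀ T′ F.shp (same-λ₀ F.lens))
        (cong₂ (λ a b → (a + joinCountTab T′) + b) (trans (sum-heights μ₀ dμ) (sum-pad N mu lm)) (sum-pad N la ll))))))))
      where module F = Forward T′ m t

    -- A Yamanouchi tableau ends at a partition, on which the dual functional is 1 or 0 according to
    -- whether it is ν. In the first case the total weight is fixed, and with it the number of joins
    -- and the sign.
    term : ∀ T′ → T′ ∈ tabs hs N →
      when (okTab true N hs [] λ₀ T′) (sgTab T′) * dual ν₀ (addTab λ₀ T′) ≡ signPow e * (if validTab T′ then 1ℤ else 0ℤ)
    term T′ m with okTab true N hs [] λ₀ T′ in eo
    ... | false = sym (ℤₚ.*-zeroʳ (signPow e))
    ... | true with eqListᵇ (addTab λ₀ T′) ν₀ in eq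
    ...   | true  = cong₂ _*_
            (sign-valid T′ m (T-∧ {okTab true N hs [] λ₀ T′} (subst T (sym eo) tt) (subst T (sym eq) tt)))
            (trans (cong (dual ν₀) (eqListᵇ-T (addTab λ₀ T′) ν₀ (subst T (sym eq) tt))) (dual-same ν₀ (pad-decr N nu pn)))
    ...   | false = trans (cong (sgTab T′ *_) (dual-other ν₀ (addTab λ₀ T′) (pad-decr N nu pn) dec (λ q → subst T eq (T-eqListᵇ (sym q)))))
            (trans (ℤₚ.*-zeroʳ (sgTab T′)) (sym (ℤₚ.*-zeroʳ (signPow e))))
      where
      sp = okTab-split N hs [] λ₀ T′ (subst T (sym eo) tt)
      lens = All.lookup (tabs-length hs N) m
      dec : Decr (addTab λ₀ T′)
      dec = yamTab-decr λ₀ T′ (same-λ₀ lens) (shape-columns hs T′ (proj₁ (okTab⇒shape N hs [] λ₀ T′ H₀ (proj₁ sp)))) (pad-decr N la pl) (proj₂ sp)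

  G-countSVT : G N hs (dual ν₀) λ₀ ≡ signPow e * + countSVT la nu mu
  G-countSVT = trans (Φ-LR (dual ν₀) N (dual-below N ν₀) hs [] λ₀ len-λ₀)
    (trans (Φ-sum true N hs (dual ν₀) [] λ₀)
    (trans (cong (λ m → ∑ (tabs hs m) (λ T′ → when (okTab true N hs [] λ₀ T′) (sgTab T′) * dual ν₀ (addTab λ₀ T′))) len-λ₀)
    (trans (∑-ext-∈ (tabs hs N) term)
    (trans (∑-scale (tabs hs N) (signPow e) (λ T′ → if validTab T′ then 1ℤ else 0ℤ))
      (cong (signPow e *_) (trans (sym (∑-count validTab (tabs hs N))) (cong +_ (sym countSVT-tabs))))))))

-- Expansions

Hs-lift : ∀ {I : Set} {R : (I → ℤ) → Set} → Linear R → ∀ α (L : I → Fun) → (∀ β → R (λ i → L i β)) → ∀ β → R (λ i → Hs α (L i) β)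
Hs-lift lin []      L h β = h β
Hs-lift lin (k ∷ α) L h β = H-lift lin (λ i → Hs α (L i)) β (λ β' _ → Hs-lift lin α L h β') k

anti-scale : ∀ c {M : ℕ → ℕ → ℤ} → Anti M → Anti (λ x y → c * M x y)
anti-scale c {M} a = mkAnti λ x y → trans (l c (M x (suc y)) (M (suc x) (suc y)) (M y (suc x)) (M (suc y) (suc x)))
  (trans (cong (c *_) (anti a x y)) (ℤₚ.*-zeroʳ c))
  where
  l : ∀ c m n p q → (c * m - c * n) +ᶻ (c * p - c * q) ≡ c * ((m - n) +ᶻ (p - q))
  l = solve-∀

anti-∑ : ∀ {A : Set} (xs : List A) (c : A → ℤ) (M : A → ℕ → ℕ → ℤ) → (∀ a → Anti (M a)) → Anti (λ x y → ∑ xs (λ a → c a * M a x y))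
anti-∑ []       c M h = mkAnti λ x y → refl
anti-∑ (a ∷ xs) c M h = anti+ (anti-scale (c a) (h a)) (anti-∑ xs c M h)

addTab-head : ∀ b β T′ → All (λ s → length s ≡ suc (length β)) T′ → ∃ λ b' → ∃ λ β' → addTab (b ∷ β) T′ ≡ b' ∷ β' × b ≤ b'
addTab-head b β []             []       = b , β , refl , ≤-refl
addTab-head b β ((x ∷ s) ∷ T′) (e ∷ es) with addTab-head (weight x + b) (β ⊕ wtCol s) T′
    (All.map (λ q → trans q (cong suc (sym (⊕-length β (wtCol s) (wtCol-length s (suc-injective e)))))) es)
... | b' , β' , q , le = b' , β' , q , ≤-trans (m≤n+m b (weight x)) le

-- Multiplication by a monomial never lowers the first exponent, so the vanishing in `dual-large`
-- persists term by term.
G-large : ∀ N hs ν b β → All (_< b) ν → G N hs (dual ν) (b ∷ β) ≡ 0ℤ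
G-large N hs ν b β lt = trans (G-sum N hs (dual ν) (b ∷ β) (b ∷ β) refl)
  (trans (∑-ext-All (tabs-length hs (length (b ∷ β))) zero′) (∑-zero (tabs hs (length (b ∷ β))) (λ _ → refl)))
  where
  zero′ : ∀ T′ → All (λ s → length s ≡ suc (length β)) T′ → coef N hs (b ∷ β) T′ * dual ν (addTab (b ∷ β) T′) ≡ 0ℤ
  zero′ T′ es with addTab-head b β T′ es
  ... | b' , β' , q , le = trans (cong (λ z → coef N hs (b ∷ β) T′ * dual ν z) q)
    (trans (cong (coef N hs (b ∷ β) T′ *_) (dual-large ν b' β' (All.map (λ p → <-≤-trans p le) lt))) (ℤₚ.*-zeroʳ (coef N hs (b ∷ β) T′)))

pad-< : ∀ N p b → IsPartition p → part p 1 < b → All (_< b) (pad N p)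
pad-< N p b ip lt = Allₚ.applyUpTo⁺₂ _ N (λ i → ≤-<-trans (antitone (part p) (partition-antitone p ip) {1} {suc i} (s≤s z≤n) (s≤s z≤n)) lt)

pad-[] : ∀ N → pad N [] ≡ replicate N 0
pad-[] zero    = refl
pad-[] (suc N) = cong (0 ∷_) (pad-[] N)

module _ (la nu mu : List ℕ) (pl : IsPartition la) (pn : IsPartition nu) (pm : IsPartition mu) (sub : la ⊆ᵖ nu)
         (E : List (List ℕ × ℤ)) (pE : All (λ e → IsPartition (proj₁ e)) E) (ex : IsExpansion nu la E) where

  private
    bound : (List ℕ → ℕ) → List (List ℕ × ℤ) → ℕ
    bound f []      = 0
    bound f (e ∷ E) = f (proj₁ e) + bound f E

    bound-all : ∀ f E → All (λ e → f (proj₁ e) ≤ bound f E) E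
    bound-all f []      = []
    bound-all f (e ∷ E) = m≤m+n _ _ ∷ All.map (λ q → ≤-trans q (m≤n+m _ (f (proj₁ e)))) (bound-all f E)

    -- `N` variables accommodate ν, μ and every index of the expansion at once, so that all
    -- functionals act on the same lists. `B` is at least the first part of ν and of each index,
    -- hence bounds the support of all the dual functionals involved.
    N B : ℕ
    N = (length nu + length mu) + bound length E
    B = part nu 1 + bound (λ p → part p 1) E

    ln : length nu ≤ N
    ln = ≤-trans (m≤m+n _ _) (m≤m+n (length nu + length mu) _)

    lm : length mu ≤ N
    lm = ≤-trans (m≤n+m (length mu) (length nu)) (m≤m+n (length nu + length mu) _)

    lE : All (λ e → IsPartition (proj₁ e) × length (proj₁ e) ≤ N) E
    lE = All.zipWith (λ { (p , q) → p , ≤-trans q (m≤n+m _ (length nu + length mu)) }) (pE , bound-all length E)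

    λ₀ ν₀ μ₀ : List ℕ
    λ₀ = pad N la
    ν₀ = pad N nu
    μ₀ = pad N mu

    dλ = pad-decr N la pl
    dμ = pad-decr N mu pm

    D Θ Σᴱ Ξ : Fun
    D = dual ν₀
    Θ = G N (heights λ₀) D
    Σᴱ β = ∑ E (λ e → proj₂ e * dual (pad N (proj₁ e)) β)
    Ξ β = Σᴱ β - Θ β

    aΘ : AntiBelow N Θ
    aΘ = Φ-anti N D (dual-below N ν₀) (heights λ₀)

    aΞ : AntiBelow N Ξ
    aΞ p lt pre rest e = anti- (anti-∑ E proj₂ _ (λ e' → dual-anti (pad N (proj₁ e')) p pre rest e)) (aΘ p lt pre rest e)

    len-pad : ∀ p → length (pad N p) ≡ N
    len-pad p = Lₚ.length-applyUpTo _ N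

    unit : ∀ p → IsPartition p → ∀ L → AntiBelow N L → G N (heights (pad N p)) L (replicate N 0) ≡ L (pad N p)
    unit p ip L a = subst (λ n → AntiBelow n L → G n (heights (pad N p)) L (replicate n 0) ≡ L (pad N p)) (len-pad p)
      (G-unit L (pad N p) (pad-decr N p ip)) a

    moment-Θ : ∀ α → Hs α Θ (replicate N 0) ≡ + gCoeff nu la α
    moment-Θ α = trans (Hs-G N (heights λ₀) α D (replicate N 0))
      (trans (unit la pl (Hs α D) (Hs-anti α (dual-below N ν₀))) (GCoeff.Hs-gCoeff N la nu pl pn sub ln α))

    moment-E : ∀ α → Hs α Σᴱ (replicate N 0) ≡ ∑ E (λ e → proj₂ e * + gCoeff (proj₁ e) [] α)
    moment-E α = trans (Hs-lift (∑-linear E proj₂) α fam (λ _ → refl) (replicate N 0))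
      (∑-ext-All lE (λ { (η , c) (ip , le) → cong (c *_) (trans (cong (Hs α (dual (pad N η))) (sym (pad-[] N)))
        (GCoeff.Hs-gCoeff N [] η ([] , []) ip (λ i → z≤n) le α)) }))
      where
      fam : Maybe (List ℕ × ℤ) → Fun
      fam nothing  = Σᴱ
      fam (just e) = dual (pad N (proj₁ e))

    no-moments : NoMoments N Ξ
    no-moments α = trans (Hs-lift linear3 α fam (λ _ → refl) (replicate N 0))
      (ℤₚ.i≡j⇒i-j≡0 (trans (moment-E α) (trans (sym (ex α)) (sym (moment-Θ α)))))
      where
      fam : Three → Fun
      fam one   = Ξ
      fam two   = Σᴱ
      fam three = Θ

    large : ∀ ρ → Decr ρ → length ρ ≡ N → B < head₀ ρ → Ξ ρ ≡ 0ℤ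
    large (b ∷ β) d len lt = cong₂ _-_
      (trans (∑-ext-All (All.zipWith id (pE , bound-all (λ p → part p 1) E)) (λ { (η , c) (ip , le) → trans
          (cong (c *_) (dual-large (pad N η) b β (pad-< N η b ip (≤-<-trans (≤-trans le (m≤n+m _ (part nu 1))) lt)))) (ℤₚ.*-zeroʳ c) }))
        (∑-zero E (λ _ → refl)))
      (G-large N (heights λ₀) ν₀ b β (pad-< N nu b pn (≤-<-trans (m≤m+n (part nu 1) _) lt)))

    coeff-Σ : Σᴱ μ₀ ≡ coeffOf E mu
    coeff-Σ = trans (∑-ext-All lE single) (sym (∑-filterᵇ (λ e → eqListᵇ (proj₁ e) mu) E proj₂))
      where
      single : ∀ e → IsPartition (proj₁ e) × length (proj₁ e) ≤ N → proj₂ e * dual (pad N (proj₁ e)) μ₀ ≡ when (eqListᵇ (proj₁ e) mu) (proj₂ e)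
      single (η , c) (ip , le) with eqListᵇ η mu in eq
      ... | true = trans (cong (λ z → c * dual (pad N z) μ₀) (eqListᵇ-T η mu (subst T (sym eq) tt)))
              (trans (cong (c *_) (dual-same μ₀ dμ)) (ℤₚ.*-identityʳ c))
      ... | false = trans (cong (c *_) (dual-other (pad N η) μ₀ (pad-decr N η ip) dμ
              (λ q → subst T eq (T-eqListᵇ (pad-injective N η mu (proj₂ ip) (proj₂ pm) le lm q))))) (ℤₚ.*-zeroʳ c)

    Θ-μ : Θ μ₀ ≡ G N (heights μ₀) D λ₀
    Θ-μ = trans (sym (unit mu pm Θ aΘ)) (trans (G-comm N (heights μ₀) (heights λ₀) D (replicate N 0))
      (unit la pl (G N (heights μ₀) D) (Φ-anti N D (dual-below N ν₀) (heights μ₀))))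

  coefficient : coeffOf E mu ≡ signPow (+ size nu - + size la - + size mu) * + countSVT la nu mu
  coefficient = trans (sym coeff-Σ) (trans (ℤₚ.i-j≡0⇒i≡j _ _ (no-moments⇒zero N B Ξ aΞ no-moments large μ₀ dμ (len-pad mu)))
    (trans Θ-μ (G-countSVT N la nu mu pl pn pm sub ln lm)))

mainTheorem1 : (la nu mu : List ℕ) → IsPartition la → IsPartition nu → IsPartition mu →
    la ⊆ᵖ nu →
    (E : List (List ℕ × ℤ)) → All (λ e → IsPartition (proj₁ e)) E → IsExpansion nu la E →
    coeffOf E mu ≡ signPow (+ size nu - + size la - + size mu) * + countSVT la nu mu
mainTheorem1 = coefficient
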